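{- Let $\boldsymbol{\alpha}=(\alpha_1,\dots,\alpha_r)$ and $\boldsymbol{\beta}=(\beta_1,\dots,\beta_r)$ be tuples of parameters in $\mathbb{Q}\setminus\mathbb{Z}_{\leq0}$ with the same number of elements, such that $\alpha_i\not\equiv\beta_j \bmod \mathbb{Z}$ for all $i,j$ (i.e. $\langle\boldsymbol{\alpha}\rangle$ and $\langle\boldsymbol{\beta}\rangle$ are disjoint), and such that assertion $H_{\boldsymbol{\alpha},\boldsymbol{\beta}}$ holds. Let $p$ be a prime, write $d_{\boldsymbol{\alpha},\boldsymbol{\beta}}=p^\nu D$ with $\nu,D\in\mathbb{N}$ and $D$ coprime to $p$, and let $b\in\{1,\dots,D\}$ be coprime to $D$. Then there exists a sequence $(R_{k,b})_{k\geq0}$ of elements of $\mathcal{A}_b(p^\nu,D)^\ast$ such that, for all $t\in\Omega_b(p^\nu,D)$, $$\frac{G_{\underline{t^{(1)}\boldsymbol{\alpha}},\underline{t^{(1)}\boldsymbol{\beta}}}}{F_{\underline{t^{(1)}\boldsymbol{\alpha}},\underline{t^{(1)}\boldsymbol{\beta}}}}(C'_{\boldsymbol{\alpha},\boldsymbol{\beta}}z^p)-p\,\frac{G_{\underline{t\boldsymbol{\alpha}},\underline{t\boldsymbol{\beta}}}}{F_{\underline{t\boldsymbol{\alpha}},\underline{t\boldsymbol{\beta}}}}(C'_{\boldsymbol{\alpha},\boldsymbol{\beta}}z)=p\sum_{k=0}^\infty R_{k,b}(t)z^k.$$ Furthermore, if $p$ divides $d_{\boldsymbol{\alpha},\boldsymbol{\beta}}$,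 then for all $k\in\mathbb{N}$, writing $\lambda_p=\lambda_p(\boldsymbol{\alpha},\boldsymbol{\beta})$: - if $\boldsymbol{\beta}\in\mathbb{Z}^r$, then $R_{k,b}\in p^{ -1-\lfloor\lambda_p/(p-1)\rfloor}\mathcal{A}_b(p^\nu,D)$; - if $\boldsymbol{\beta}\notin\mathbb{Z}^r$ and $p-1\nmid\lambda_p$, then $R_{k,b}\in\mathcal{A}_b(p^\nu,D)$; - if $\boldsymbol{\beta}\notin\mathbb{Z}^r$, $\mathfrak{m}_{\boldsymbol{\alpha},\boldsymbol{\beta}}$ is odd and $p=2$, then $R_{k,b}\in\mathcal{A}_b(p^\nu,D)$.
   Context: Notation. $(x)_n$ is the Pochhammer symbol ($(x)_0=1$). For tuples $\boldsymbol{\gamma}=(\gamma_1,\dots,\gamma_r)$, $\boldsymbol{\delta}=(\delta_1,\dots,\delta_s)$ in $\mathbb{Q}\setminus\mathbb{Z}_{\le0}$: $F_{\boldsymbol{\gamma},\boldsymbol{\delta}}(z)=\sum_{n\ge0}\frac{\prod_i(\gamma_i)_n}{\prod_j(\delta_j)_n}z^n$ and $G_{\boldsymbol{\gamma},\boldsymbol{\delta}}(z)=\sum_{n\ge1}\frac{\prod_i(\gamma_i)_n}{\prod_j(\delta_j)_n}\Big(\sum_iH_{\gamma_i}(n)-\sum_jH_{\delta_j}(n)\Big)z^n$ with $H_x(n)=\sum_{k=0}^{n-1}\frac1{x+k}$. A series $f$ is $N$-integral if $f(cz)\in\mathbb{Z}[[z]]$ for some $c\in\mathbb{Q}\setminus\{0\}$;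 then $C_{\boldsymbol{\gamma},\boldsymbol{\delta}}$ denotes the positive rational with $\{c\in\mathbb{Q}:F_{\boldsymbol{\gamma},\boldsymbol{\delta}}(cz)\in\mathbb{Z}[[z]]\}=C_{\boldsymbol{\gamma},\boldsymbol{\delta}}\mathbb{Z}$. For $x\in\mathbb{Q}$, $\underline{x}=\langle x\rangle$ is the unique element of $(0,1]$ with $x-\underline{x}\in\mathbb{Z}$; applied to a tuple, componentwise; $\underline{t\boldsymbol{\alpha}}=(\underline{t\alpha_1},\dots,\underline{t\alpha_r})$. Total order $\preceq$ on $\mathbb{R}$: $x\preceq y$ iff $\underline{x}<\underline{y}$, or ($\underline{x}=\underline{y}$ and $x\geq y$); $x\prec y$ means $x\preceq y$, $x\ne y$. $d_{\boldsymbol{\alpha},\boldsymbol{\beta}}$ = lcm of exact denominators of the elements of $\boldsymbol{\alpha},\boldsymbol{\beta}$. For $a\in\{1,\dots,d_{\boldsymbol{\alpha},\boldsymbol{\beta}}\}$ coprime to $d_{\boldsymbol{\alpha},\boldsymbol{\beta}}$ and $x\in\mathbb{R}$: $\xi_{\boldsymbol{\alpha},\boldsymbol{\beta}}(a,x)=\#\{i:a\alpha_i\preceq x\}-\#\{j:a\beta_j\preceq x\}$; $m_{\boldsymbol{\alpha},\boldsymbol{\beta}}(a)$ is the $\preceq$-smallest element of $\{a\alpha_1,\dots,a\alpha_r,a\beta_1,\dots,a\beta_s\}$. $H_{\boldsymbol{\alpha},\boldsymbol{\beta}}$ is the assertion: for all $a\in\{1,\dots,d_{\boldsymbol{\alpha},\boldsymbol{\beta}}\}$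 coprime to $d_{\boldsymbol{\alpha},\boldsymbol{\beta}}$ and all $x\in\mathbb{R}$ with $m_{\boldsymbol{\alpha},\boldsymbol{\beta}}(a)\preceq x\prec a$, $\xi_{\boldsymbol{\alpha},\boldsymbol{\beta}}(a,x)\geq1$. $\lambda_p(\boldsymbol{\alpha},\boldsymbol{\beta})=\#\{i:\alpha_i\in\mathbb{Z}_p\}-\#\{j:\beta_j\in\mathbb{Z}_p\}$. $\mathfrak{m}_{\boldsymbol{\alpha},\boldsymbol{\beta}}$ = number of elements of $\boldsymbol{\alpha}$ and $\boldsymbol{\beta}$ whose exact denominator is divisible by $4$. $C'_{\boldsymbol{\alpha},\boldsymbol{\beta}}=2C_{\langle\boldsymbol{\alpha}\rangle,\langle\boldsymbol{\beta}\rangle}$ if $\boldsymbol{\beta}\notin\mathbb{Z}^r$ and $\mathfrak{m}_{\boldsymbol{\alpha},\boldsymbol{\beta}}$ is odd, and $C'_{\boldsymbol{\alpha},\boldsymbol{\beta}}=C_{\langle\boldsymbol{\alpha}\rangle,\langle\boldsymbol{\beta}\rangle}$ otherwise. Function algebras. For $D$ coprime to $p$, $\nu\in\mathbb{N}$, $b\in\{1,\dots,D\}$ coprime to $D$: $\Omega_b(p^\nu,D)$ is the set of $t\in\{1,\dots,p^\nu D\}$ coprime to $p^\nu D$ with $t\equiv b\bmod D$. $\mathcal{A}_b(p^\nu,D)$ (resp. $\mathcal{A}_b(p^\nu,D)^\ast$) is the $\mathbb{Z}_p$-algebra of functions $f:\Omega_b(p^\nu,D)\to\mathbb{Z}_p$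 such that for all $m\geq1$ and $t_1,t_2\in\Omega_b(p^\nu,D)$ with $t_1\equiv t_2\bmod p^m$, $f(t_1)\equiv f(t_2)\bmod p^m\mathbb{Z}_p$ (resp. $\bmod\ p^{m-1}\mathbb{Z}_p$). For $t\in\Omega_b(p^\nu,D)$ and $r\in\mathbb{N}$, $t^{(r)}$ is the unique element of $\{1,\dots,p^\nu D\}$ with $t^{(r)}\equiv t\bmod p^\nu$ and $p^rt^{(r)}\equiv t\bmod D$. -}

module Defs where

open import Data.Bool using (Bool; true; false; if_then_else_; _∧_; not)
open import Data.Empty using (⊥)
open import Data.Nat as ℕ using (ℕ; zero; suc)
open import Data.Nat.Divisibility using (_∣_; _∣?_)
open import Data.Nat.LCM using (lcm)
open import Data.Nat.Coprimality using (Coprime)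
open import Data.Integer as ℤ using (ℤ; +_; -[1+_])
import Data.Integer.Divisibility as ℤDiv
open import Data.Rational as ℚ using (ℚ; 0ℚ; 1ℚ; _+_; _*_; _-_; -_; _<_; _≤_; floor; ceiling; ↧ₙ_; 1/_; ≢-nonZero)
open import Data.Rational.Properties using (_≟_; _<?_; _≤?_)
open import Data.List as List using (List; []; _∷_; _++_; map; filter; length; foldr)
open import Data.List.Relation.Unary.All using (All; all?)
open import Data.Vec as Vec using (Vec; toList)
open import Data.Product using (Σ; _×_; _,_)
open import Data.Sum using (_⊎_)
open import Relation.Nullary using (¬_; Dec; yes; no; ¬?; does)
open import Relation.Nullary.Decidable using (_×-dec_; _⊎-dec_)
open import Relation.Binary.PropositionalEquality using (_≡_; _≢_)

fromℕ : ℕ → ℚ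
fromℕ n = + n ℚ./ 1

fromℤ : ℤ → ℚ
fromℤ z = z ℚ./ 1

-- total inverse (1/0 := 0); only ever applied to nonzero arguments below
inv : ℚ → ℚ
inv q with q ≟ 0ℚ
... | yes _ = 0ℚ
... | no ne = 1/_ q {{≢-nonZero ne}}

_÷'_ : ℚ → ℚ → ℚ
x ÷' y = x * inv y

powQ : ℚ → ℕ → ℚ
powQ c zero = 1ℚ
powQ c (suc n) = powQ c n * c

powZ : ℕ → ℤ → ℚ
powZ p (+ n) = fromℕ (p ℕ.^ n)
powZ p -[1+ n ] = inv (fromℕ (p ℕ.^ suc n))

IsInt : ℚ → Set
IsInt q = ↧ₙ q ≡ 1

InZp : ℕ → ℚ → Set
InZp p q = ¬ (p ∣ ↧ₙ q)

-- ⟨x⟩ : the unique element of (0,1] with x - ⟨x⟩ ∈ ℤ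
frac : ℚ → ℚ
frac x = x - fromℤ (ceiling x) + 1ℚ

_⪯_ : ℚ → ℚ → Set
x ⪯ y = (frac x < frac y) ⊎ ((frac x ≡ frac y) × (y ≤ x))

_⪯?_ : (x y : ℚ) → Dec (x ⪯ y)
x ⪯? y = (frac x <? frac y) ⊎-dec ((frac x ≟ frac y) ×-dec (y ≤? x))

_≺_ : ℚ → ℚ → Set
x ≺ y = (x ⪯ y) × (x ≢ y)

module _ {r : ℕ} (α β : Vec ℚ r) where

  allParams : List ℚ
  allParams = toList α ++ toList β

  dαβ : ℕ
  dαβ = foldr lcm 1 (map ↧ₙ_ allParams)

  countBelow : List ℚ → ℚ → ℕ
  countBelow l x = length (filter (λ e → e ⪯? x) l)

  scaleList : ℕ → List ℚ → List ℚ
  scaleList a l = map (λ e → fromℕ a * e) l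

  ξ : ℕ → ℚ → ℤ
  ξ a x = + countBelow (scaleList a (toList α)) x ℤ.- + countBelow (scaleList a (toList β)) x

  minFrom : ℚ → List ℚ → ℚ
  minFrom m [] = m
  minFrom m (e ∷ l) = minFrom (if does (e ⪯? m) then e else m) l

  -- m_{α,β}(a)  (for r = 0 the set is empty; we then put m = a, making H vacuous)
  mαβ : ℕ → ℚ
  mαβ a with scaleList a allParams
  ... | [] = fromℕ a
  ... | e ∷ l = minFrom e l

  Hαβ : Set
  Hαβ = ∀ (a : ℕ) → 1 ℕ.≤ a → a ℕ.≤ dαβ → Coprime a dαβ →
        ∀ (x : ℚ) → mαβ a ⪯ x → x ≺ fromℕ a → ℤ.+ 1 ℤ.≤ ξ a x

  λp : ℕ → ℤ
  λp p = + length (filter (λ q → ¬? (p ∣? ↧ₙ q)) (toList α))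
     ℤ.- + length (filter (λ q → ¬? (p ∣? ↧ₙ q)) (toList β))

  𝔪 : ℕ
  𝔪 = length (filter (λ q → 4 ∣? ↧ₙ q) allParams)

  BetaInt : Set
  BetaInt = All IsInt (toList β)

  betaIntᵇ : Bool
  betaIntᵇ = does (all? (λ q → ↧ₙ q ℕ.≟ 1) (toList β))

  -- C'_{α,β}, given the value C = C_{⟨α⟩,⟨β⟩}
  C′ : ℚ → ℚ
  C′ C = if not betaIntᵇ ∧ does (¬? (2 ∣? 𝔪)) then fromℕ 2 * C else C

Series : Set
Series = ℕ → ℚ

poch : ℚ → ℕ → ℚ
poch x zero = 1ℚ
poch x (suc n) = poch x n * (x + fromℕ n)

prodPoch : List ℚ → ℕ → ℚ
prodPoch l n = foldr (λ x acc → poch x n * acc) 1ℚ l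

Hx : ℚ → ℕ → ℚ
Hx x zero = 0ℚ
Hx x (suc n) = Hx x n + inv (x + fromℕ n)

sumH : List ℚ → ℕ → ℚ
sumH l n = foldr (λ x acc → Hx x n + acc) 0ℚ l

Fser : List ℚ → List ℚ → Series
Fser γ δ n = prodPoch γ n ÷' prodPoch δ n

-- coefficients of G_{γ,δ} (the n = 0 coefficient is 0 since H_x(0) = 0)
Gser : List ℚ → List ℚ → Series
Gser γ δ n = Fser γ δ n * (sumH γ n - sumH δ n)

-- formal power series quotient g / f (f(0) ≠ 0)
module SerDiv (f g : Series) where
  sumZip : ℕ → List ℚ → ℚ
  sumZip j [] = 0ℚ
  sumZip j (q ∷ qs) = f (suc j) * q + sumZip (suc j) qs

  -- qs n = [q_n , q_{n-1} , … , q_0]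
  qs : ℕ → List ℚ
  qs zero = (g 0 ÷' f 0) ∷ []
  qs (suc n) = ((g (suc n) - sumZip 0 (qs n)) ÷' f 0) ∷ qs n

  headOr0 : List ℚ → ℚ
  headOr0 [] = 0ℚ
  headOr0 (q ∷ _) = q

  quot : Series
  quot n = headOr0 (qs n)

_/ₛ_ : Series → Series → Series
g /ₛ f = SerDiv.quot f g

scaleSer : ℚ → Series → Series
scaleSer c s n = powQ c n * s n

subPowSer : ℚ → ℕ → Series → Series
subPowSer c p s n = go (suc n)
  where
  go : ℕ → ℚ
  go zero = 0ℚ
  go (suc m) = (if does ((m ℕ.* p) ℕ.≟ n) then powQ c m * s m else 0ℚ) + go m

IntegralSer : Series → Set
IntegralSer s = ∀ n → IsInt (s n)

IsCconst : List ℚ → List ℚ → ℚ → Set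
IsCconst γ δ C = (0ℚ < C) ×
  (∀ (c : ℚ) → (IntegralSer (scaleSer c (Fser γ δ)) → Σ ℤ (λ k → c ≡ fromℤ k * C))
              × (Σ ℤ (λ k → c ≡ fromℤ k * C) → IntegralSer (scaleSer c (Fser γ δ))))

fracMul : ℕ → List ℚ → List ℚ
fracMul t l = map (λ x → frac (fromℕ t * x)) l

ModEq : ℕ → ℕ → ℕ → Set
ModEq n x y = (+ n) ℤDiv.∣ (+ x ℤ.- + y)

module _ (p ν D b : ℕ) where

  InΩ : ℕ → Set
  InΩ t = (1 ℕ.≤ t) × (t ℕ.≤ p ℕ.^ ν ℕ.* D) × Coprime t (p ℕ.^ ν ℕ.* D) × ModEq D t b

  IsShift1 : ℕ → ℕ → Set
  IsShift1 t t1 = (1 ℕ.≤ t1) × (t1 ℕ.≤ p ℕ.^ ν ℕ.* D) × ModEq (p ℕ.^ ν) t1 t × ModEq D (p ℕ.* t1) t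

  CongP : ℕ → ℚ → ℚ → Set
  CongP m x y = InZp p ((x - y) * inv (fromℕ (p ℕ.^ m)))

  -- f ∈ A_b(p^ν,D)   (functions represented on ℕ, only values on Ω matter)
  InA : (ℕ → ℚ) → Set
  InA f = (∀ t → InΩ t → InZp p (f t)) ×
          (∀ m → 1 ℕ.≤ m → ∀ t₁ t₂ → InΩ t₁ → InΩ t₂ → ModEq (p ℕ.^ m) t₁ t₂ → CongP m (f t₁) (f t₂))

  InA* : (ℕ → ℚ) → Set
  InA* f = (∀ t → InΩ t → InZp p (f t)) ×
           (∀ m → 1 ℕ.≤ m → ∀ t₁ t₂ → InΩ t₁ → InΩ t₂ → ModEq (p ℕ.^ m) t₁ t₂ → CongP (m ℕ.∸ 1) (f t₁) (f t₂))

  InPowA : ℤ → (ℕ → ℚ) → Set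
  InPowA e f = InA (λ t → powZ p (ℤ.- e) * f t)

{-# OPTIONS --safe #-}
module Submission where

-- The coefficients of the left-hand side L are read off from the identity
--   F(z) F'(z^p) L = - (p G(z) F'(z^p) - F(z) G'(z^p)),
-- where F', G' belong to the shifted parameters: as F(0) = 1 and F is p-integral, it suffices
-- to bound the right-hand side. Writing the coefficients of F as A_r(n), r counting shifts,
-- the right-hand side is controlled by Dwork's congruences for A_0 and A_1, which follow from
-- Abel summation along base-p digits once the quotients of products over blocks of p^s
-- consecutive factors are known modulo p^(s+1), and once A_r(n) is divisible by p to the number
-- of digit levels at which some p-integral parameter lies below n. The latter bound is hypothesis H
-- averaged over all a prime to p in a residue class modulo D. Write φ ≥ 0 for the normalised gain
-- in p-adic valuation per step n; that φ is nonnegative is the integrality of F(Cz) at n = p^M. If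
-- φ > 0 the gain absorbs the denominators of the harmonic sums directly; if φ = 0 the Dwork
-- congruences are sharp and the block quotients are congruent to 1.

import Defs
open import Data.Nat.Base using (ℕ; zero; suc; z≤n; s≤s; NonZero)
open import Data.Nat.Primality using (Prime; euclidsLemma; prime⇒nonZero)
import Data.Nat.Coprimality as Cop
open import Data.Product using (_×_; proj₁; proj₂; _,_; Σ)
open import Data.Sum using (_⊎_; inj₁; inj₂)
open import Data.Empty using (⊥; ⊥-elim)
open import Data.Unit.Base using (⊤; tt)
open import Relation.Nullary using (Dec; yes; no; ¬_; does)
open import Relation.Binary.PropositionalEquality
import Data.Nat.Base as ℕ
import Data.Integer.Base as ℤ
open import Data.Rational.Base as ℚ using (ℚ; mkℚ; ↥_; ↧ₙ_)
import Data.Integer.Properties as ℤₚ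
import Data.Nat.Properties as Nat
import Data.Rational.Properties as ℚₚ
open import Data.List.Base using (List; []; _∷_)
open import Data.List.Membership.Propositional using (_∈_)
open import Data.List.Relation.Unary.Any using (here; there)
open import Data.Bool.Base using (Bool; true; false; T; not; if_then_else_)
open import Data.Nat.Solver using (module +-*-Solver)
open import Relation.Binary.Definitions using (Tri; tri<; tri≈; tri>)
open import Data.Nat.Induction using (<-wellFounded)
open import Induction.WellFounded using (Acc; acc)

-- Hypothesis H counts all parameters, while a parameter whose denominator is divisible by p
-- contributes no valuation once denominators are cleared. Averaging over a reconciles the two: each
-- such parameter then weighs the same multiple of n, compensated by the constant C, and the
-- p-integral ones keep their Pochhammer valuations. The role of p = 2 is a sign. The product of the
-- odd residues is -1 modulo 4 and 1 modulo 8, 16, ..., so block quotients at s = 1 tend to -1 to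
-- the number of denominators divisible by 4. For non-integral β the factor 2 in C' appears exactly
-- when that sign is -1; at p = 2 it makes φ positive, where divisibility alone suffices. Block
-- quotients are 1 modulo p^(s+1) only in the sense of 𝒜*; in 𝒜 one power of p is lost. If p divides
-- d, integral β repay it: the normalised constant has a positive exponent e, every A_r(n) with n ≥
-- 1 is divisible by p^e, and λ + (p-1)e = φ ≥ 0 makes e - 1 at least -1 - ⌊λ/(p-1)⌋.

module Q where

 import Defs
 open import Data.Integer.Base as ℤ using (ℤ; +_)
 open import Data.Rational.Base using (toℚᵘ; ≢-nonZero)
 import Data.Rational.Unnormalised.Base as ℚᵘ
 import Data.Rational.Unnormalised.Properties as ℚᵘₚ
 open import Data.Maybe.Base using (Maybe; just; nothing)
 open import Level using (0ℓ)
 import Algebra.Solver.Ring as RingSolver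
 import Algebra.Solver.Ring.AlmostCommutativeRing as ACR

 -- Rational arithmetic and a ring solver with integer coefficients.

 infixl 6 _+_ _-_
 infixl 7 _*_
 infix 8 -_

 -- Opaque copies of the rational operations keep goals small and unification first-order.
 opaque
  _+_ _*_ : ℚ → ℚ → ℚ
  _+_ = ℚ._+_
  _*_ = ℚ._*_

  -_ inv : ℚ → ℚ
  -_ = ℚ.-_
  inv = Defs.inv

  ιz : ℤ → ℚ
  ιz = Defs.fromℤ

 _-_ : ℚ → ℚ → ℚ
 x - y = x + (- y)

 ι : ℕ → ℚ
 ι n = ιz (+ n)

 0# 1# : ℚ
 0# = ι 0
 1# = ι 1

 opaque
  unfolding _+_

  *≡ : ∀ x y → x * y ≡ x ℚ.* y
  *≡ x y = refl

  inv≡ : ∀ x → inv x ≡ Defs.inv x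
  inv≡ x = refl

  ιz≡ : ∀ i → ιz i ≡ Defs.fromℤ i
  ιz≡ i = refl

  1≡ : 1# ≡ ℚ.1ℚ
  1≡ = refl

  +-assoc : ∀ x y z → (x + y) + z ≡ x + (y + z)
  +-assoc = ℚₚ.+-assoc

  +-comm : ∀ x y → x + y ≡ y + x
  +-comm = ℚₚ.+-comm

  +-idˡ : ∀ x → 0# + x ≡ x
  +-idˡ = ℚₚ.+-identityˡ

  +-idʳ : ∀ x → x + 0# ≡ x
  +-idʳ = ℚₚ.+-identityʳ

  -‿inverse : ∀ x → x - x ≡ 0#
  -‿inverse = ℚₚ.+-inverseʳ

  *-assoc : ∀ x y z → (x * y) * z ≡ x * (y * z)
  *-assoc = ℚₚ.*-assoc

  *-comm : ∀ x y → x * y ≡ y * x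
  *-comm = ℚₚ.*-comm

  *-idˡ : ∀ x → 1# * x ≡ x
  *-idˡ = ℚₚ.*-identityˡ

  *-idʳ : ∀ x → x * 1# ≡ x
  *-idʳ = ℚₚ.*-identityʳ

  *-0ˡ : ∀ x → 0# * x ≡ 0#
  *-0ˡ = ℚₚ.*-zeroˡ

  *-0ʳ : ∀ x → x * 0# ≡ 0#
  *-0ʳ = ℚₚ.*-zeroʳ

  *-distribˡ : ∀ x y z → x * (y + z) ≡ x * y + x * z
  *-distribˡ = ℚₚ.*-distribˡ-+

  *-distribʳ : ∀ x y z → (y + z) * x ≡ y * x + z * x
  *-distribʳ = ℚₚ.*-distribʳ-+

  neg-*ˡ : ∀ x y → (- x) * y ≡ - (x * y)
  neg-*ˡ x y = sym (ℚₚ.neg-distribˡ-* x y)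

  neg-+ : ∀ x y → (- x) + (- y) ≡ - (x + y)
  neg-+ x y = sym (ℚₚ.neg-distrib-+ x y)

  1≢0 : 1# ≢ 0#
  1≢0 = ℚₚ.1≢0

 _≟#_ : (x y : ℚ) → Dec (x ≡ y)
 _≟#_ = ℚₚ._≟_

 private
  unn : ∀ i → toℚᵘ (Defs.fromℤ i) ℚᵘ.≃ ℚᵘ.mkℚᵘ i 0
  unn i = ℚₚ.toℚᵘ-fromℚᵘ (ℚᵘ.mkℚᵘ i 0)

 opaque
  unfolding _+_

  ιz-+ : ∀ i j → ιz (i ℤ.+ j) ≡ ιz i + ιz j
  ιz-+ i j = ℚₚ.toℚᵘ-injective (begin
   toℚᵘ (ιz (i ℤ.+ j))                 ≈⟨ unn (i ℤ.+ j) ⟩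
   ℚᵘ.mkℚᵘ (i ℤ.+ j) 0                 ≈⟨ ℚᵘ.*≡* (cong (ℤ._* + 1) (cong₂ ℤ._+_ (sym (ℤₚ.*-identityʳ i)) (sym (ℤₚ.*-identityʳ j)))) ⟩
   ℚᵘ.mkℚᵘ i 0 ℚᵘ.+ ℚᵘ.mkℚᵘ j 0       ≈⟨ ℚᵘₚ.+-cong (unn i) (unn j) ⟨
   toℚᵘ (ιz i) ℚᵘ.+ toℚᵘ (ιz j)       ≈⟨ ℚₚ.toℚᵘ-homo-+ (ιz i) (ιz j) ⟨
   toℚᵘ (ιz i ℚ.+ ιz j)                ∎)
   where open ℚᵘₚ.≃-Reasoning

  ιz-* : ∀ i j → ιz (i ℤ.* j) ≡ ιz i * ιz j
  ιz-* i j = ℚₚ.toℚᵘ-injective (begin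
   toℚᵘ (ιz (i ℤ.* j))                 ≈⟨ unn (i ℤ.* j) ⟩
   ℚᵘ.mkℚᵘ i 0 ℚᵘ.* ℚᵘ.mkℚᵘ j 0       ≈⟨ ℚᵘₚ.*-cong (unn i) (unn j) ⟨
   toℚᵘ (ιz i) ℚᵘ.* toℚᵘ (ιz j)       ≈⟨ ℚₚ.toℚᵘ-homo-* (ιz i) (ιz j) ⟨
   toℚᵘ (ιz i ℚ.* ιz j)                ∎)
   where open ℚᵘₚ.≃-Reasoning

  ιz-neg : ∀ i → ιz (ℤ.- i) ≡ - ιz i
  ιz-neg i = ℚₚ.toℚᵘ-injective (begin
   toℚᵘ (ιz (ℤ.- i))                   ≈⟨ unn (ℤ.- i) ⟩
   ℚᵘ.- ℚᵘ.mkℚᵘ i 0                    ≈⟨ ℚᵘₚ.-‿cong (unn i) ⟨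
   ℚᵘ.- toℚᵘ (ιz i)                    ≈⟨ ℚₚ.toℚᵘ-homo‿- (ιz i) ⟨
   toℚᵘ (ℚ.- ιz i)                     ∎)
   where open ℚᵘₚ.≃-Reasoning

  ιz-injective : ∀ {i j} → ιz i ≡ ιz j → i ≡ j
  ιz-injective {i} {j} e with ℚᵘₚ.≃-trans (ℚᵘₚ.≃-sym (unn i)) (ℚᵘₚ.≃-trans (ℚᵘₚ.≃-reflexive (cong toℚᵘ e)) (unn j))
  ... | ℚᵘ.*≡* h = trans (sym (ℤₚ.*-identityʳ i)) (trans h (ℤₚ.*-identityʳ j))

  ιz-mono-≤ : ∀ {i j} → i ℤ.≤ j → ιz i ℚ.≤ ιz j
  ιz-mono-≤ {i} {j} le = ℚₚ.toℚᵘ-cancel-≤ (ℚᵘₚ.≤-respˡ-≃ (ℚᵘₚ.≃-sym (unn i)) (ℚᵘₚ.≤-respʳ-≃ (ℚᵘₚ.≃-sym (unn j))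
   (ℚᵘ.*≤* (ℤₚ.*-monoʳ-≤-nonNeg (+ 1) le))))

  ιz-cancel-≤ : ∀ {i j} → ιz i ℚ.≤ ιz j → i ℤ.≤ j
  ιz-cancel-≤ {i} {j} le with ℚᵘₚ.≤-respˡ-≃ (unn i) (ℚᵘₚ.≤-respʳ-≃ (unn j) (ℚₚ.toℚᵘ-mono-≤ le))
  ... | ℚᵘ.*≤* h = ℤₚ.*-cancelʳ-≤-pos i j (+ 1) h

  inv-r : ∀ {x} → x ≢ 0# → x * inv x ≡ 1#
  inv-r {x} ne with x ℚₚ.≟ ℚ.0ℚ
  ... | yes e = ⊥-elim (ne e)
  ... | no ne' = ℚₚ.*-inverseʳ x {{≢-nonZero ne'}}

  inv-0 : inv 0# ≡ 0#
  inv-0 = refl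

 ACRing : ACR.AlmostCommutativeRing 0ℓ 0ℓ
 ACRing = record
  { isAlmostCommutativeRing = record
   { isCommutativeSemiring = record
    { isSemiring = record
     { isSemiringWithoutAnnihilatingZero = record
      { +-isCommutativeMonoid = record
       { isMonoid = record
        { isSemigroup = record
         { isMagma = record { isEquivalence = isEquivalence ; ∙-cong = cong₂ _+_ }
         ; assoc = +-assoc }
        ; identity = +-idˡ , +-idʳ }
       ; comm = +-comm }
      ; *-cong = cong₂ _*_
      ; *-assoc = *-assoc
      ; *-identity = *-idˡ , *-idʳ
      ; distrib = *-distribˡ , *-distribʳ }
     ; zero = *-0ˡ , *-0ʳ }
    ; *-comm = *-comm }
   ; -‿cong = cong (λ z → - z)
   ; -‿*-distribˡ = neg-*ˡ
   ; -‿+-comm = neg-+ } }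

 private
  morphism : ℤ.+-*-rawRing ACR.-Raw-AlmostCommutative⟶ ACRing
  morphism = record
   { ⟦_⟧ = ιz ; +-homo = ιz-+ ; *-homo = ιz-* ; -‿homo = ιz-neg ; 0-homo = refl ; 1-homo = refl }

  dec : ∀ i j → Maybe (ιz i ≡ ιz j)
  dec i j with i ℤₚ.≟ j
  ... | yes e = just (cong ιz e)
  ... | no _ = nothing

 module ℚSolver = RingSolver ℤ.+-*-rawRing ACRing morphism dec

 open ℚSolver using (Polynomial; solve; _:+_; _:*_; _:-_; :-_; _:=_; con) public

 :0 :1 : ∀ {n} → Polynomial n
 :0 = con (+ 0)
 :1 = con (+ 1)

 ιz-mono-< : ∀ {i j} → i ℤ.< j → ιz i ℚ.< ιz j
 ιz-mono-< {i} {j} lt = ℚₚ.≰⇒> (λ le → ℤₚ.<⇒≱ lt (ιz-cancel-≤ le))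

 ι-+ : ∀ m n → ι (m ℕ.+ n) ≡ ι m + ι n
 ι-+ m n = ιz-+ (+ m) (+ n)

 ι-* : ∀ m n → ι (m ℕ.* n) ≡ ι m * ι n
 ι-* m n = trans (cong ιz (ℤₚ.pos-* m n)) (ιz-* (+ m) (+ n))

 ι-suc : ∀ n → ι (suc n) ≡ 1# + ι n
 ι-suc n = ι-+ 1 n

 ι-injective : ∀ {m n} → ι m ≡ ι n → m ≡ n
 ι-injective e = ℤₚ.+-injective (ιz-injective e)

 ι-mono-≤ : ∀ {m n} → m ℕ.≤ n → ι m ℚ.≤ ι n
 ι-mono-≤ le = ιz-mono-≤ (ℤ.+≤+ le)

 ι-cancel-≤ : ∀ {m n} → ι m ℚ.≤ ι n → m ℕ.≤ n
 ι-cancel-≤ le = ℤₚ.drop‿+≤+ (ιz-cancel-≤ le)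

 ι-mono-< : ∀ {m n} → m ℕ.< n → ι m ℚ.< ι n
 ι-mono-< lt = ιz-mono-< (ℤ.+<+ lt)

 ι≢0 : ∀ {n} → n ≢ 0 → ι n ≢ 0#
 ι≢0 ne e = ne (ι-injective e)

 inv-l : ∀ {x} → x ≢ 0# → inv x * x ≡ 1#
 inv-l {x} ne = trans (*-comm (inv x) x) (inv-r ne)

 *-cancel : ∀ x {y z} → x ≢ 0# → x * y ≡ x * z → y ≡ z
 *-cancel x {y} {z} ne e = begin
  y                 ≡⟨ lem y ⟩
  inv x * (x * y)   ≡⟨ cong (inv x *_) e ⟩
  inv x * (x * z)   ≡⟨ lem z ⟨
  z                 ∎
  where
  open ≡-Reasoning
  lem : ∀ w → w ≡ inv x * (x * w)
  lem w = trans (sym (*-idˡ w)) (trans (cong (_* w) (sym (inv-l ne))) (*-assoc (inv x) x w))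

 *-≢0 : ∀ {x y} → x ≢ 0# → y ≢ 0# → x * y ≢ 0#
 *-≢0 {x} {y} nx ny e = ny (*-cancel x nx (trans e (sym (*-0ʳ x))))

 inv-≢0 : ∀ {x} → x ≢ 0# → inv x ≢ 0#
 inv-≢0 {x} nx e = 1≢0 (trans (sym (inv-r nx)) (trans (cong (x *_) e) (*-0ʳ x)))

 inv-unique : ∀ x y → x * y ≡ 1# → y ≡ inv x
 inv-unique x y e = *-cancel x nx (trans e (sym (inv-r {x} nx)))
  where
  nx : x ≢ 0#
  nx x0 = 1≢0 (trans (sym e) (trans (cong (_* y) x0) (*-0ˡ y)))

 inv-* : ∀ x y → inv (x * y) ≡ inv x * inv y
 inv-* x y = helper (x ≟# 0#) (y ≟# 0#)
  where
  lem : ∀ x y a b → (x * y) * (a * b) ≡ (x * a) * (y * b)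
  lem = solve 4 (λ x y a b → (x :* y) :* (a :* b) := (x :* a) :* (y :* b)) refl
  helper : Dec (x ≡ 0#) → Dec (y ≡ 0#) → inv (x * y) ≡ inv x * inv y
  helper (yes e) _ = trans (cong inv (trans (cong (_* y) e) (*-0ˡ y))) (trans inv-0 (sym (trans (cong (λ z → inv z * inv y) e) (trans (cong (_* inv y) inv-0) (*-0ˡ (inv y))))))
  helper (no _) (yes e) = trans (cong inv (trans (cong (x *_) e) (*-0ʳ x))) (trans inv-0 (sym (trans (cong (λ z → inv x * inv z) e) (trans (cong (inv x *_) inv-0) (*-0ʳ (inv x))))))
  helper (no nx) (no ny) = sym (inv-unique (x * y) (inv x * inv y) (trans (lem x y (inv x) (inv y))
   (trans (cong₂ _*_ (inv-r {x} nx) (inv-r {y} ny)) (*-idˡ 1#))))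

 inv-inv : ∀ x → inv (inv x) ≡ x
 inv-inv x = helper (x ≟# 0#)
  where
  helper : Dec (x ≡ 0#) → inv (inv x) ≡ x
  helper (yes e) = trans (cong (λ z → inv (inv z)) e) (trans (cong inv inv-0) (trans inv-0 (sym e)))
  helper (no nx) = sym (inv-unique (inv x) x (inv-l {x} nx))

 infixr 8 _↑_
 _↑_ : ℚ → ℕ → ℚ
 x ↑ zero = 1#
 x ↑ suc n = x * x ↑ n

 ↑-+ : ∀ x m n → x ↑ (m ℕ.+ n) ≡ x ↑ m * x ↑ n
 ↑-+ x zero n = sym (*-idˡ _)
 ↑-+ x (suc m) n = trans (cong (x *_) (↑-+ x m n)) (sym (*-assoc x _ _))

 ↑-* : ∀ x m n → x ↑ (m ℕ.* n) ≡ (x ↑ n) ↑ m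
 ↑-* x zero n = refl
 ↑-* x (suc m) n = trans (↑-+ x n (m ℕ.* n)) (cong (x ↑ n *_) (↑-* x m n))

 1↑ : ∀ n → 1# ↑ n ≡ 1#
 1↑ zero = refl
 1↑ (suc n) = trans (*-idˡ _) (1↑ n)

 *-↑ : ∀ x y n → (x * y) ↑ n ≡ x ↑ n * y ↑ n
 *-↑ x y zero = sym (*-idˡ 1#)
 *-↑ x y (suc n) = trans (cong (x * y *_) (*-↑ x y n)) (lem x y (x ↑ n) (y ↑ n))
  where
  lem : ∀ a b c d → a * b * (c * d) ≡ a * c * (b * d)
  lem = solve 4 (λ a b c d → a :* b :* (c :* d) := a :* c :* (b :* d)) refl

 inv-↑ : ∀ x n → inv (x ↑ n) ≡ inv x ↑ n
 inv-↑ x zero = sym (inv-unique 1# 1# (*-idˡ 1#))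
 inv-↑ x (suc n) = trans (inv-* x (x ↑ n)) (cong (inv x *_) (inv-↑ x n))

 ↑-≢0 : ∀ {x} n → x ≢ 0# → x ↑ n ≢ 0#
 ↑-≢0 zero nx = 1≢0
 ↑-≢0 (suc n) nx = *-≢0 nx (↑-≢0 n nx)

 ι-^ : ∀ a n → ι (a ℕ.^ n) ≡ ι a ↑ n
 ι-^ a zero = refl
 ι-^ a (suc n) = trans (ι-* a (a ℕ.^ n)) (cong (ι a *_) (ι-^ a n))

 powQ≡↑ : ∀ c n → Defs.powQ c n ≡ c ↑ n
 powQ≡↑ c zero = sym 1≡
 powQ≡↑ c (suc n) = trans (sym (*≡ _ c)) (trans (*-comm _ c) (cong (c *_) (powQ≡↑ c n)))

 neg-*ʳ : ∀ x y → x * (- y) ≡ - (x * y)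
 neg-*ʳ x y = trans (*-comm x (- y)) (trans (neg-*ˡ y x) (cong (λ z → - z) (*-comm y x)))

 opaque
  unfolding _+_

  ↧-clear : ∀ x → x * ι (↧ₙ x) ≡ ιz (↥ x)
  ↧-clear x@(mkℚ n d-1 _) = ℚₚ.toℚᵘ-injective (begin
   toℚᵘ (x ℚ.* ι (suc d-1))                    ≈⟨ ℚₚ.toℚᵘ-homo-* x (ι (suc d-1)) ⟩
   toℚᵘ x ℚᵘ.* toℚᵘ (ι (suc d-1))              ≈⟨ ℚᵘₚ.*-congˡ {toℚᵘ x} (unn (+ suc d-1)) ⟩
   ℚᵘ.mkℚᵘ n d-1 ℚᵘ.* ℚᵘ.mkℚᵘ (+ suc d-1) 0    ≈⟨ ℚᵘ.*≡* (trans (ℤₚ.*-identityʳ _) (cong (λ z → n ℤ.* + z) (sym (Nat.*-identityʳ (suc d-1))))) ⟩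
   ℚᵘ.mkℚᵘ n 0                                 ≈⟨ unn n ⟨
   toℚᵘ (ιz n)                                 ∎)
   where open ℚᵘₚ.≃-Reasoning

-- Finite sums, products and counts.

module Sums where

 open import Data.Nat.Base using (_+_; _*_; _∸_; _≤_; _<_)
 open import Data.Nat.Properties

 module BigOp {A : Set} (_∙_ : A → A → A) (ε : A)
  (∙-assoc : ∀ x y z → (x ∙ y) ∙ z ≡ x ∙ (y ∙ z))
  (∙-comm : ∀ x y → x ∙ y ≡ y ∙ x) (ε∙ : ∀ x → ε ∙ x ≡ x) where

  B : ℕ → (ℕ → A) → A
  B zero f = ε
  B (suc n) f = B n f ∙ f n

  B-cong : ∀ n {f g} → (∀ i → i < n → f i ≡ g i) → B n f ≡ B n g
  B-cong zero e = refl
  B-cong (suc n) e = cong₂ _∙_ (B-cong n (λ i l → e i (m<n⇒m<1+n l))) (e n ≤-refl)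

  B-ext : ∀ n {f g} → (∀ i → f i ≡ g i) → B n f ≡ B n g
  B-ext n e = B-cong n (λ i _ → e i)

  ∙ε : ∀ x → x ∙ ε ≡ x
  ∙ε x = trans (∙-comm x ε) (ε∙ x)

  B-split : ∀ m n f → B (m + n) f ≡ B m f ∙ B n (λ i → f (m + i))
  B-split m zero f = trans (cong (λ k → B k f) (+-identityʳ m)) (sym (∙ε _))
  B-split m (suc n) f = trans (cong (λ k → B k f) (+-suc m n))
   (trans (cong (_∙ f (m + n)) (B-split m n f)) (∙-assoc _ _ _))

  B-first : ∀ n f → B (suc n) f ≡ f 0 ∙ B n (λ i → f (suc i))
  B-first n f = trans (B-split 1 n f) (cong₂ _∙_ (ε∙ (f 0)) refl)

  B-block : ∀ n m f → B (n * m) f ≡ B n (λ i → B m (λ j → f (j + i * m)))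
  B-block zero m f = refl
  B-block (suc n) m f = trans (cong (λ k → B k f) (+-comm m (n * m)))
   (trans (B-split (n * m) m f)
    (cong₂ _∙_ (B-block n m f) (B-ext m (λ j → cong f (+-comm (n * m) j)))))

  interchange : ∀ a b c d → (a ∙ b) ∙ (c ∙ d) ≡ (a ∙ c) ∙ (b ∙ d)
  interchange a b c d = trans (∙-assoc a b _) (trans (cong (a ∙_)
   (trans (sym (∙-assoc b c d)) (trans (cong (_∙ d) (∙-comm b c)) (∙-assoc c b d))))
   (sym (∙-assoc a c _)))

  B-∙ : ∀ n f g → B n (λ i → f i ∙ g i) ≡ B n f ∙ B n g
  B-∙ zero f g = sym (ε∙ ε)
  B-∙ (suc n) f g = trans (cong₂ _∙_ (B-∙ n f g) refl) (interchange _ _ _ _)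

  B-ε : ∀ n {f} → (∀ i → i < n → f i ≡ ε) → B n f ≡ ε
  B-ε zero e = refl
  B-ε (suc n) e = trans (cong₂ _∙_ (B-ε n (λ i l → e i (m<n⇒m<1+n l))) (e n ≤-refl)) (ε∙ ε)

  B-swap : ∀ n m (f : ℕ → ℕ → A) → B n (λ i → B m (f i)) ≡ B m (λ j → B n (λ i → f i j))
  B-swap zero m f = sym (B-ε m (λ _ _ → refl))
  B-swap (suc n) m f = trans (cong₂ _∙_ (B-swap n m f) refl) (sym (B-∙ m _ _))

  -- Sliding the window of a full period by one place exchanges its first term for the equal term
  -- one period later.
  B-shift : ∀ n f → (∀ i → f (n + i) ≡ f i) → ∀ c → B n (λ i → f (c + i)) ≡ B n f
  B-shift n f per zero = refl
  B-shift n f per (suc c) = trans (trans (rot (λ i → f (c + i)) (trans (cong f (+-comm c n)) (trans (per c) (cong f (sym (+-identityʳ c)))))) refl) (B-shift n f per c)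
   where
   rot : ∀ g → g n ≡ g 0 → B n (λ i → f (suc c + i)) ≡ B n (λ i → f (c + i))
   rot g e = go n refl
    where
    go : ∀ k → k ≡ n → B n (λ i → f (suc c + i)) ≡ B n (λ i → f (c + i))
    go zero refl = refl
    go (suc k) refl = trans (cong₂ _∙_ (B-ext k (λ i → cong f (sym (+-suc c i))))
      (trans (cong f (sym (+-suc c k))) (trans (cong f (+-comm c n)) (trans (per c) (cong f (sym (+-identityʳ c)))))))
     (trans (∙-comm _ _) (sym (B-first k (λ i → f (c + i)))))

  B-tail : ∀ m n f → m ≤ n → (∀ i → m ≤ i → f i ≡ ε) → B n f ≡ B m f
  B-tail m n f le e = trans (cong (λ k → B k f) (sym (m+[n∸m]≡n le)))
   (trans (B-split m (n ∸ m) f) (trans (cong (B m f ∙_) (B-ε (n ∸ m) (λ i _ → e (m + i) (m≤m+n m i)))) (∙ε _)))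

 open BigOp Q._+_ Q.0# Q.+-assoc Q.+-comm Q.+-idˡ public
  renaming (B to Σ<; B-cong to Σ-cong; B-ext to Σ-ext; B-split to Σ-split; B-first to Σ-first;
   B-block to Σ-block; B-∙ to Σ-+; B-ε to Σ-0; B-swap to Σ-swap; B-tail to Σ-tail)
  hiding (∙ε; interchange; B-shift)

 open BigOp Q._*_ Q.1# Q.*-assoc Q.*-comm Q.*-idˡ public
  renaming (B to Π<; B-cong to Π-cong; B-ext to Π-ext; B-split to Π-split; B-first to Π-first;
   B-block to Π-block; B-∙ to Π-*; B-ε to Π-1; B-swap to Π-swap)
  hiding (∙ε; interchange; B-shift; B-tail)

 open BigOp _+_ 0 +-assoc +-comm (λ _ → refl) public
  renaming (B to #<; B-cong to #-cong; B-ext to #-ext; B-split to #-split; B-first to #-first;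
   B-block to #-block; B-∙ to #-+; B-ε to #-0; B-swap to #-swap; B-tail to #-tail; B-shift to #-shift)
  hiding (∙ε; interchange)

 Σ-*ˡ : ∀ n c f → Σ< n (λ i → c Q.* f i) ≡ c Q.* Σ< n f
 Σ-*ˡ zero c f = sym (Q.*-0ʳ c)
 Σ-*ˡ (suc n) c f = trans (cong₂ Q._+_ (Σ-*ˡ n c f) refl) (sym (Q.*-distribˡ c _ _))

 #-*ˡ : ∀ n c f → #< n (λ i → c * f i) ≡ c * #< n f
 #-*ˡ zero c f = sym (*-zeroʳ c)
 #-*ˡ (suc n) c f = trans (cong₂ _+_ (#-*ˡ n c f) refl) (sym (*-distribˡ-+ c _ _))

 #-mono : ∀ n {f g} → (∀ i → i < n → f i ≤ g i) → #< n f ≤ #< n g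
 #-mono zero e = z≤n
 #-mono (suc n) e = +-mono-≤ (#-mono n (λ i l → e i (m<n⇒m<1+n l))) (e n ≤-refl)

 #-const : ∀ n c → #< n (λ _ → c) ≡ n * c
 #-const zero c = refl
 #-const (suc n) c = trans (cong (_+ c) (#-const n c)) (+-comm (n * c) c)

-- Cauchy products of coefficient sequences.

module Convolution where

 open Q
 open Sums
 open import Data.Nat.Base using (_≤_; _<_) renaming (_+_ to _∔_; _*_ to _·_)

 -- pad f K j is f (K - j), and 0 when j exceeds K.
 pad : (ℕ → ℚ) → ℕ → ℕ → ℚ
 pad f K zero = f K
 pad f zero (suc j) = 0#
 pad f (suc K) (suc j) = pad f K j

 pad-shift : ∀ f x K j → pad f (x ∔ K) (x ∔ j) ≡ pad f K j
 pad-shift f zero K j = refl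
 pad-shift f (suc x) K j = pad-shift f x K j

 pad-> : ∀ f K j → K < j → pad f K j ≡ 0#
 pad-> f zero (suc j) _ = refl
 pad-> f (suc K) (suc j) (s≤s l) = pad-> f K j l

 pad-≤ : ∀ f j i → pad f (j ∔ i) j ≡ f i
 pad-≤ f zero i = refl
 pad-≤ f (suc j) i = pad-≤ f j i

 pad-suc : ∀ f K j → j ≤ K → pad f (suc K) j ≡ pad (λ i → f (suc i)) K j
 pad-suc f K zero _ = refl
 pad-suc f (suc K) (suc j) (s≤s l) = pad-suc f K j l

 pad-diag : ∀ f K → pad f K K ≡ f 0
 pad-diag f zero = refl
 pad-diag f (suc K) = pad-diag f K

 pad-ext : ∀ {f g} → (∀ i → f i ≡ g i) → ∀ K j → pad f K j ≡ pad g K j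
 pad-ext e K zero = e K
 pad-ext e zero (suc j) = refl
 pad-ext e (suc K) (suc j) = pad-ext e K j

 conv : (ℕ → ℚ) → (ℕ → ℚ) → ℕ → ℚ
 conv f g n = Σ< (suc n) (λ j → f j * pad g n j)

 conv-ext : ∀ {f f' g g'} → (∀ i → f i ≡ f' i) → (∀ i → g i ≡ g' i) → ∀ n → conv f g n ≡ conv f' g' n
 conv-ext e e' n = Σ-ext (suc n) (λ j → cong₂ _*_ (e j) (pad-ext e' n j))

 conv-suc : ∀ f g n → conv f g (suc n) ≡ f 0 * g (suc n) + conv (λ i → f (suc i)) g n
 conv-suc f g n = Σ-first (suc n) (λ j → f j * pad g (suc n) j)

 conv-suc′ : ∀ f g n → conv f g (suc n) ≡ conv f (λ i → g (suc i)) n + f (suc n) * g 0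
 conv-suc′ f g n = cong₂ _+_ (Σ-cong (suc n) (λ j l → cong (f j *_) (pad-suc g n j (Nat.≤-pred l))))
  (cong (f (suc n) *_) (pad-diag g n))

 conv-comm : ∀ f g n → conv f g n ≡ conv g f n
 conv-comm f g zero = cong (0# +_) (*-comm (f 0) (g 0))
 conv-comm f g (suc n) = begin
  conv f g (suc n)                                    ≡⟨ conv-suc f g n ⟩
  f 0 * g (suc n) + conv (λ i → f (suc i)) g n        ≡⟨ cong (f 0 * g (suc n) +_) (conv-comm (λ i → f (suc i)) g n) ⟩
  f 0 * g (suc n) + conv g (λ i → f (suc i)) n        ≡⟨ +-comm (f 0 * g (suc n)) _ ⟩
  conv g (λ i → f (suc i)) n + f 0 * g (suc n)        ≡⟨ cong (conv g (λ i → f (suc i)) n +_) (*-comm (f 0) _) ⟩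
  conv g (λ i → f (suc i)) n + g (suc n) * f 0        ≡⟨ conv-suc′ g f n ⟨
  conv g f (suc n)                                    ∎
  where open ≡-Reasoning

 conv-+ˡ : ∀ f f' g n → conv (λ i → f i + f' i) g n ≡ conv f g n + conv f' g n
 conv-+ˡ f f' g n = trans (Σ-ext (suc n) (λ j → *-distribʳ (pad g n j) (f j) (f' j))) (Σ-+ (suc n) _ _)

 conv-*ˡ : ∀ c f g n → conv (λ i → c * f i) g n ≡ c * conv f g n
 conv-*ˡ c f g n = trans (Σ-ext (suc n) (λ j → *-assoc c (f j) (pad g n j))) (Σ-*ˡ (suc n) c _)

 conv-*ʳ : ∀ c f g n → conv f (λ i → c * g i) n ≡ c * conv f g n
 conv-*ʳ c f g n = trans (conv-comm f (λ i → c * g i) n) (trans (conv-*ˡ c g f n) (cong (c *_) (conv-comm g f n)))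

 conv-+ʳ : ∀ f g g' n → conv f (λ i → g i + g' i) n ≡ conv f g n + conv f g' n
 conv-+ʳ f g g' n = trans (conv-comm f _ n) (trans (conv-+ˡ g g' f n) (cong₂ _+_ (conv-comm g f n) (conv-comm g' f n)))

 conv-assoc : ∀ f g h n → conv (conv f g) h n ≡ conv f (conv g h) n
 conv-assoc f g h zero = cong (0# +_) (begin
  (0# + f 0 * g 0) * h 0        ≡⟨ cong (_* h 0) (+-idˡ _) ⟩
  f 0 * g 0 * h 0               ≡⟨ *-assoc (f 0) (g 0) (h 0) ⟩
  f 0 * (g 0 * h 0)             ≡⟨ cong (f 0 *_) (+-idˡ _) ⟨
  f 0 * (0# + g 0 * h 0)        ∎)
  where open ≡-Reasoning
 conv-assoc f g h (suc n) = begin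
  conv (conv f g) h (suc n)
   ≡⟨ conv-suc (conv f g) h n ⟩
  (0# + f 0 * g 0) * h (suc n) + conv (λ i → conv f g (suc i)) h n
   ≡⟨ cong₂ _+_ (cong (_* h (suc n)) (+-idˡ (f 0 * g 0))) (trans (conv-ext (conv-suc f g) (λ _ → refl) n) (conv-+ˡ (λ i → f 0 * g (suc i)) (conv f′ g) h n)) ⟩
  f 0 * g 0 * h (suc n) + (conv (λ i → f 0 * g (suc i)) h n + conv (conv f′ g) h n)
   ≡⟨ cong (f 0 * g 0 * h (suc n) +_) (cong₂ _+_ (conv-*ˡ (f 0) (λ i → g (suc i)) h n) (conv-assoc f′ g h n)) ⟩
  f 0 * g 0 * h (suc n) + (f 0 * conv (λ i → g (suc i)) h n + conv f′ (conv g h) n)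
   ≡⟨ lem (f 0) (g 0) (h (suc n)) _ _ ⟩
  f 0 * (g 0 * h (suc n) + conv (λ i → g (suc i)) h n) + conv f′ (conv g h) n
   ≡⟨ cong (λ z → f 0 * z + conv f′ (conv g h) n) (conv-suc g h n) ⟨
  f 0 * conv g h (suc n) + conv f′ (conv g h) n
   ≡⟨ conv-suc f (conv g h) n ⟨
  conv f (conv g h) (suc n) ∎
  where
  open ≡-Reasoning
  f′ = λ i → f (suc i)
  lem : ∀ a b c d e → a * b * c + (a * d + e) ≡ a * (b * c + d) + e
  lem = solve 5 (λ a b c d e → a :* b :* c :+ (a :* d :+ e) := a :* (b :* c :+ d) :+ e) refl

-- p-adic integrality, divisibility and units; the filtrations by 𝒜 and 𝒜*.

module Padic (p : ℕ) (pp : Prime p) where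
 open import Data.Nat.Base using (_≤_; _<_; _∸_; _^_) renaming (_+_ to _∔_; _*_ to _·_)

 open import Defs using (InZp; ModEq)
 open Q
 open Sums
 open import Data.Nat.Divisibility using (_∣_; divides; ∣-trans; ∣1⇒≡1)
 open import Data.Nat.Primality using (prime⇒nonTrivial)
 open import Data.Integer.Base as ℤ using (ℤ; +_)

 π : ℚ
 π = ι p

 p≢0 : p ≢ 0
 p≢0 refl = ℕ.≢-nonZero⁻¹ 0 {{prime⇒nonZero pp}} refl

 1<p : 1 < p
 1<p = ℕ.nonTrivial⇒n>1 p {{prime⇒nonTrivial pp}}

 p∤1 : ¬ p ∣ 1
 p∤1 d = Nat.<-irrefl (sym (∣1⇒≡1 d)) 1<p

 π≢0 : π ≢ 0#
 π≢0 = ι≢0 p≢0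

 ∤-* : ∀ {a b} → ¬ p ∣ a → ¬ p ∣ b → ¬ p ∣ a · b
 ∤-* {a} {b} na nb d with euclidsLemma a b pp d
 ... | inj₁ x = na x
 ... | inj₂ y = nb y

 ∤⇒≢0 : ∀ {a} → ¬ p ∣ a → a ≢ 0
 ∤⇒≢0 na refl = na (divides 0 refl)

 -- Any denominator prime to p is a witness, not only the reduced one, so sums and products need no
 -- reduction. The comparison with `InZp` is made once, from the coprimality of the reduced
 -- fraction.
 record Z (x : ℚ) : Set where
  constructor zmk
  field
   num : ℤ
   den : ℕ
   p∤den : ¬ p ∣ den
   frac≡ : x * ι den ≡ ιz num

 Z-+ : ∀ {x y} → Z x → Z y → Z (x + y)
 Z-+ {x} {y} (zmk a b nb e) (zmk a' b' nb' e') =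
  zmk (a ℤ.* + b' ℤ.+ a' ℤ.* + b) (b · b') (∤-* nb nb') (begin
   (x + y) * ι (b · b')                         ≡⟨ cong ((x + y) *_) (ι-* b b') ⟩
   (x + y) * (ι b * ι b')                       ≡⟨ lem x y (ι b) (ι b') ⟩
   (x * ι b) * ι b' + (y * ι b') * ι b          ≡⟨ cong₂ (λ u v → u * ι b' + v * ι b) e e' ⟩
   ιz a * ι b' + ιz a' * ι b                    ≡⟨ cong₂ _+_ (ιz-* a (+ b')) (ιz-* a' (+ b)) ⟨
   ιz (a ℤ.* + b') + ιz (a' ℤ.* + b)            ≡⟨ ιz-+ _ _ ⟨
   ιz (a ℤ.* + b' ℤ.+ a' ℤ.* + b)               ∎)
  where
  open ≡-Reasoning
  lem : ∀ x y b c → (x + y) * (b * c) ≡ (x * b) * c + (y * c) * b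
  lem = solve 4 (λ x y b c → (x :+ y) :* (b :* c) := (x :* b) :* c :+ (y :* c) :* b) refl

 Z-* : ∀ {x y} → Z x → Z y → Z (x * y)
 Z-* {x} {y} (zmk a b nb e) (zmk a' b' nb' e') =
  zmk (a ℤ.* a') (b · b') (∤-* nb nb') (trans (cong (x * y *_) (ι-* b b'))
   (trans (lem x y (ι b) (ι b')) (trans (cong₂ _*_ e e') (sym (ιz-* a a')))))
  where
  lem : ∀ x y b c → (x * y) * (b * c) ≡ (x * b) * (y * c)
  lem = solve 4 (λ x y b c → (x :* y) :* (b :* c) := (x :* b) :* (y :* c)) refl

 Z-ιz : ∀ a → Z (ιz a)
 Z-ιz a = zmk a 1 p∤1 (*-idʳ _)

 Z-ι : ∀ n → Z (ι n)
 Z-ι n = Z-ιz (+ n)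

 Z-neg : ∀ {x} → Z x → Z (- x)
 Z-neg {x} (zmk a b nb e) = zmk (ℤ.- a) b nb (trans (neg-*ˡ x (ι b)) (trans (cong (λ z → - z) e) (sym (ιz-neg a))))

 Z-inv : ∀ {b} → ¬ p ∣ b → Z (inv (ι b))
 Z-inv {b} nb = zmk (+ 1) b nb (inv-l {ι b} (ι≢0 (∤⇒≢0 nb)))

 record Dv (k : ℕ) (x : ℚ) : Set where
  constructor dmk
  field
   quo : ℚ
   quo-Z : Z quo
   quo-≡ : x ≡ π ↑ k * quo

 Z⇒Dv : ∀ {x} → Z x → Dv 0 x
 Z⇒Dv {x} z = dmk x z (sym (*-idˡ x))

 Dv⇒Z : ∀ {k x} → Dv k x → Z x
 Dv⇒Z {k} (dmk y z e) = subst Z (sym e) (Z-* (go k) z)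
  where
  go : ∀ k → Z (π ↑ k)
  go zero = Z-ι 1
  go (suc k) = Z-* (Z-ι p) (go k)

 Dv-0 : ∀ {k} → Dv k 0#
 Dv-0 {k} = dmk 0# (Z-ι 0) (sym (*-0ʳ (π ↑ k)))

 Dv-+ : ∀ {k x y} → Dv k x → Dv k y → Dv k (x + y)
 Dv-+ {k} (dmk a za ea) (dmk b zb eb) = dmk (a + b) (Z-+ za zb) (trans (cong₂ _+_ ea eb) (sym (*-distribˡ (π ↑ k) a b)))

 Dv-neg : ∀ {k x} → Dv k x → Dv k (- x)
 Dv-neg {k} (dmk a za ea) = dmk (- a) (Z-neg za) (trans (cong (λ z → - z) ea) (sym (neg-*ʳ (π ↑ k) a)))

 Dv-- : ∀ {k x y} → Dv k x → Dv k y → Dv k (x - y)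
 Dv-- dx dy = Dv-+ dx (Dv-neg dy)

 Dv-* : ∀ {i j x y} → Dv i x → Dv j y → Dv (i ∔ j) (x * y)
 Dv-* {i} {j} (dmk a za ea) (dmk b zb eb) = dmk (a * b) (Z-* za zb)
  (trans (cong₂ _*_ ea eb) (trans (lem (π ↑ i) a (π ↑ j) b) (cong (_* (a * b)) (sym (↑-+ π i j)))))
  where
  lem : ∀ x y b c → (x * y) * (b * c) ≡ (x * b) * (y * c)
  lem = solve 4 (λ x y b c → (x :* y) :* (b :* c) := (x :* b) :* (y :* c)) refl

 Dv-π₀ : ∀ j → Dv j (π ↑ j)
 Dv-π₀ j = dmk 1# (Z-ι 1) (sym (*-idʳ _))

 Dv-weaken : ∀ {j k x} → j ≤ k → Dv k x → Dv j x
 Dv-weaken {j} {k} le (dmk y z e) = dmk (π ↑ (k ∸ j) * y) (Z-* (Dv⇒Z {0} (Dv-weak0 (k ∸ j))) z)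
  (trans e (trans (cong (_* y) (trans (cong (π ↑_) (sym (Nat.m+[n∸m]≡n le))) (↑-+ π j _))) (*-assoc (π ↑ j) _ y)))
  where
  Dv-weak0 : ∀ k → Dv 0 (π ↑ k)
  Dv-weak0 k = Z⇒Dv (Dv⇒Z {k} (Dv-π₀ k))

 Dv-cancel : ∀ j {k x} → Dv (j ∔ k) (π ↑ j * x) → Dv k x
 Dv-cancel j {k} {x} (dmk y z e) = dmk y z (*-cancel (π ↑ j) (↑-≢0 j π≢0)
  (trans e (trans (cong (_* y) (↑-+ π j k)) (*-assoc (π ↑ j) _ y))))

 Dv-ι∣ : ∀ {k n} → p ^ k ∣ n → Dv k (ι n)
 Dv-ι∣ {k} (divides q refl) = dmk (ι q) (Z-ι q) (trans (ι-* q (p ^ k)) (trans (*-comm _ _) (cong (_* ι q) (ι-^ p k))))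

 Dv-ι : ∀ n → Dv 0 (ι n)
 Dv-ι n = Z⇒Dv (Z-ι n)

 ¬Z-inv-π : ¬ Z (inv π)
 ¬Z-inv-π (zmk a b nb e) = nb (divides ℤ.∣ a ∣ (trans (cong ℤ.∣_∣ eq) (trans (ℤₚ.abs-* (+ p) a) (Nat.*-comm p _))))
  where
  eq : + b ≡ + p ℤ.* a
  eq = ιz-injective (begin
   ι b                    ≡⟨ lem ⟨
   π * (inv π * ι b)      ≡⟨ cong (π *_) e ⟩
   π * ιz a               ≡⟨ ιz-* (+ p) a ⟨
   ιz (+ p ℤ.* a)         ∎)
   where
   open ≡-Reasoning
   lem : π * (inv π * ι b) ≡ ι b
   lem = trans (sym (*-assoc π (inv π) (ι b))) (trans (cong (_* ι b) (inv-r {π} π≢0)) (*-idˡ (ι b)))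

 InZp⇒Z : ∀ {x} → InZp p x → Z x
 InZp⇒Z {x} h = zmk (↥ x) (↧ₙ x) h (↧-clear x)

 Z⇒InZp : ∀ {x} → Z x → InZp p x
 Z⇒InZp {x} (zmk a b nb e) d = nb (∣-trans d (Cop.coprime-divisor cop (divides ℤ.∣ a ∣ eqₙ)))
  where
  eq : ↥ x ℤ.* + b ≡ a ℤ.* + (↧ₙ x)
  eq = ιz-injective (begin
   ιz (↥ x ℤ.* + b)          ≡⟨ ιz-* (↥ x) (+ b) ⟩
   ιz (↥ x) * ι b            ≡⟨ cong (_* ι b) (↧-clear x) ⟨
   x * ι (↧ₙ x) * ι b        ≡⟨ lem x (ι (↧ₙ x)) (ι b) ⟩
   x * ι b * ι (↧ₙ x)        ≡⟨ cong (_* ι (↧ₙ x)) e ⟩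
   ιz a * ι (↧ₙ x)           ≡⟨ ιz-* a (+ (↧ₙ x)) ⟨
   ιz (a ℤ.* + (↧ₙ x))       ∎)
   where
   open ≡-Reasoning
   lem : ∀ a b c → a * b * c ≡ a * c * b
   lem = solve 3 (λ a b c → a :* b :* c := a :* c :* b) refl
  eqₙ : ℤ.∣ ↥ x ∣ · b ≡ ℤ.∣ a ∣ · ↧ₙ x
  eqₙ = trans (sym (ℤₚ.abs-* (↥ x) (+ b))) (trans (cong ℤ.∣_∣ eq) (ℤₚ.abs-* a (+ (↧ₙ x))))
  cop : Cop.Coprime (↧ₙ x) ℤ.∣ ↥ x ∣
  cop = Cop.sym (go x)
   where
   go : ∀ x → Cop.Coprime ℤ.∣ ↥ x ∣ (↧ₙ x)
   go (mkℚ n d-1 c) = Cop.recompute c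

 record UnitQ (x : ℚ) : Set where
  constructor unitQ
  field
   integral : Z x
   invInt : Z (inv x)
   nonzero : x ≢ 0#
 open UnitQ public

 UnitQ-* : ∀ {x y} → UnitQ x → UnitQ y → UnitQ (x * y)
 UnitQ-* {x} {y} (unitQ a b c) (unitQ a' b' c') = unitQ (Z-* a a') (subst Z (sym (inv-* x y)) (Z-* b b')) (*-≢0 c c')

 UnitQ-inv : ∀ {x} → UnitQ x → UnitQ (inv x)
 UnitQ-inv {x} (unitQ a b c) = unitQ b (subst Z (sym (inv-inv x)) a) (inv-≢0 {x} c)

 UnitQ-ι : ∀ {b} → ¬ p ∣ b → UnitQ (ι b)
 UnitQ-ι nb = unitQ (Z-ι _) (Z-inv nb) (ι≢0 (∤⇒≢0 nb))

 UnitQ-1 : UnitQ 1#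
 UnitQ-1 = UnitQ-ι p∤1

 UnitQ-↑ : ∀ {x} n → UnitQ x → UnitQ (x ↑ n)
 UnitQ-↑ zero u = UnitQ-1
 UnitQ-↑ (suc n) u = UnitQ-* u (UnitQ-↑ n u)

 -- If j exceeded i, multiplying by the inverse unit and by p^(j-i-1) would make 1/p integral. This
 -- extracts an inequality of exponents from mere integrality.
 unit-val : ∀ {u} i j → UnitQ u → Z (u * (π ↑ i * inv (π ↑ j))) → j ≤ i
 unit-val {u} i j un z with j Nat.≤? i
 ... | yes le = le
 ... | no nle = ⊥-elim (¬Z-inv-π (subst Z eq (Z-* (Z-* (invInt un) z) (Dv⇒Z {j ∸ suc i} (Dv-π₀ _)))))
  where
  si≤j : suc i ≤ j
  si≤j = Nat.≰⇒> nle
  k = j ∸ suc i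
  eqj : π ↑ j ≡ π * (π ↑ i * π ↑ k)
  eqj = trans (cong (π ↑_) (sym (Nat.m+[n∸m]≡n si≤j))) (cong (π *_) (↑-+ π i k))
  lem : ∀ u' u a ia b ib c → u' * (u * (a * (b * (ia * ib)))) * c ≡ (u' * u) * (a * ia) * (ib * c) * b
  lem = solve 7 (λ u' u a ia b ib c → u' :* (u :* (a :* (b :* (ia :* ib)))) :* c := (u' :* u) :* (a :* ia) :* (ib :* c) :* b) refl
  one : ∀ b → 1# * 1# * 1# * b ≡ b
  one b = trans (cong (_* b) (trans (*-idʳ (1# * 1#)) (*-idʳ 1#))) (*-idˡ b)
  eq : inv u * (u * (π ↑ i * inv (π ↑ j))) * π ↑ k ≡ inv π
  eq = begin
   inv u * (u * (π ↑ i * inv (π ↑ j))) * π ↑ k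
    ≡⟨ cong (λ w → inv u * (u * (π ↑ i * w)) * π ↑ k) (trans (cong inv eqj) (trans (inv-* π _) (cong (inv π *_) (inv-* (π ↑ i) (π ↑ k))))) ⟩
   inv u * (u * (π ↑ i * (inv π * (inv (π ↑ i) * inv (π ↑ k))))) * π ↑ k
    ≡⟨ lem (inv u) u (π ↑ i) (inv (π ↑ i)) (inv π) (inv (π ↑ k)) (π ↑ k) ⟩
   (inv u * u) * (π ↑ i * inv (π ↑ i)) * (inv (π ↑ k) * π ↑ k) * inv π
    ≡⟨ cong (_* inv π) (cong₂ _*_ (cong₂ _*_ (inv-l {u} (nonzero un)) (inv-r {π ↑ i} (↑-≢0 i π≢0))) (inv-l {π ↑ k} (↑-≢0 k π≢0))) ⟩
   1# * 1# * 1# * inv π ≡⟨ one (inv π) ⟩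
   inv π ∎
   where open ≡-Reasoning

 -- Functions on Ω: values in p^k ℤ_(p), and differences in p^(k + lev m) when the arguments agree mod p^(m+1).
 -- lev = suc gives p^k 𝒜 and lev = id gives p^k 𝒜*.
 module Filt (Ω : ℕ → Set) where
  record M (lev : ℕ → ℕ) (k : ℕ) (f : ℕ → ℚ) : Set where
   constructor mkM
   field
    val : ∀ t → Ω t → Dv k (f t)
    dif : ∀ m t₁ t₂ → Ω t₁ → Ω t₂ → ModEq (p ^ suc m) t₁ t₂ → Dv (k ∔ lev m) (f t₁ - f t₂)
  open M public

  M-resp : ∀ {lev k f g} → (∀ t → Ω t → f t ≡ g t) → M lev k f → M lev k g
  M-resp {lev} {k} e (mkM v d) = mkM (λ t o → subst (Dv k) (e t o) (v t o))
   (λ m t₁ t₂ o₁ o₂ h → subst (Dv (k ∔ lev m)) (cong₂ _-_ (e t₁ o₁) (e t₂ o₂)) (d m t₁ t₂ o₁ o₂ h))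

  M-const : ∀ {lev k q} → Dv k q → M lev k (λ _ → q)
  M-const {q = q} d = mkM (λ _ _ → d) (λ _ _ _ _ _ _ → subst (Dv _) (sym (-‿inverse q)) Dv-0)

  M-0 : ∀ {lev k} → M lev k (λ _ → 0#)
  M-0 = M-const Dv-0

  M-1 : ∀ {lev} → M lev 0 (λ _ → 1#)
  M-1 = M-const (Dv-ι 1)

  M-+ : ∀ {lev k f g} → M lev k f → M lev k g → M lev k (λ t → f t + g t)
  M-+ {f = f} {g} (mkM v d) (mkM v' d') = mkM (λ t o → Dv-+ (v t o) (v' t o))
   (λ m t₁ t₂ o₁ o₂ h → subst (Dv _) (lem (f t₁) (f t₂) (g t₁) (g t₂)) (Dv-+ (d m t₁ t₂ o₁ o₂ h) (d' m t₁ t₂ o₁ o₂ h)))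
   where
   lem : ∀ a b c d → (a - b) + (c - d) ≡ (a + c) - (b + d)
   lem = solve 4 (λ a b c d → (a :- b) :+ (c :- d) := (a :+ c) :- (b :+ d)) refl

  M-neg : ∀ {lev k f} → M lev k f → M lev k (λ t → - f t)
  M-neg {f = f} (mkM v d) = mkM (λ t o → Dv-neg (v t o))
   (λ m t₁ t₂ o₁ o₂ h → subst (Dv _) (lem (f t₁) (f t₂)) (Dv-neg (d m t₁ t₂ o₁ o₂ h)))
   where
   lem : ∀ a b → - (a - b) ≡ - a - - b
   lem = solve 2 (λ a b → :- (a :- b) := :- a :- :- b) refl

  M-- : ∀ {lev k f g} → M lev k f → M lev k g → M lev k (λ t → f t - g t)
  M-- a b = M-+ a (M-neg b)

  M-* : ∀ {lev i j f g} → M lev i f → M lev j g → M lev (i ∔ j) (λ t → f t * g t)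
  M-* {lev} {i} {j} {f} {g} (mkM v d) (mkM v' d') = mkM (λ t o → Dv-* (v t o) (v' t o))
   (λ m t₁ t₂ o₁ o₂ h → subst (Dv _) (lem (f t₁) (f t₂) (g t₁) (g t₂))
    (Dv-+ (subst (λ k → Dv k (f t₁ * (g t₁ - g t₂))) (sym (Nat.+-assoc i j (lev m))) (Dv-* (v t₁ o₁) (d' m t₁ t₂ o₁ o₂ h)))
       (subst (λ k → Dv k ((f t₁ - f t₂) * g t₂)) (lem' i (lev m) j) (Dv-* (d m t₁ t₂ o₁ o₂ h) (v' t₂ o₂)))))
   where
   lem : ∀ a b c d → a * (c - d) + (a - b) * d ≡ a * c - b * d
   lem = solve 4 (λ a b c d → a :* (c :- d) :+ (a :- b) :* d := a :* c :- b :* d) refl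
   lem' : ∀ i l j → i ∔ l ∔ j ≡ i ∔ j ∔ l
   lem' i l j = trans (Nat.+-assoc i l j) (trans (cong (i ∔_) (Nat.+-comm l j)) (sym (Nat.+-assoc i j l)))

  M-weaken : ∀ {lev j k f} → j ≤ k → M lev k f → M lev j f
  M-weaken le (mkM v d) = mkM (λ t o → Dv-weaken le (v t o)) (λ m t₁ t₂ o₁ o₂ h → Dv-weaken (Nat.+-monoˡ-≤ _ le) (d m t₁ t₂ o₁ o₂ h))

  M-*0 : ∀ {lev k f g} → M lev k f → M lev 0 g → M lev k (λ t → f t * g t)
  M-*0 a b = M-weaken (Nat.m≤m+n _ 0) (M-* a b)

  M-π : ∀ {lev} j {k f} → M lev k f → M lev (j ∔ k) (λ t → π ↑ j * f t)
  M-π j a = M-* (M-const (Dv-π₀ j)) a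

  M-cancel : ∀ {lev} j {k f} → M lev (j ∔ k) (λ t → π ↑ j * f t) → M lev k f
  M-cancel {lev} j {k} {f} (mkM v d) = mkM (λ t o → Dv-cancel j (v t o))
   (λ m t₁ t₂ o₁ o₂ h → Dv-cancel j (subst₂ Dv (Nat.+-assoc j k (lev m)) (lem (π ↑ j) (f t₁) (f t₂)) (d m t₁ t₂ o₁ o₂ h)))
   where
   lem : ∀ c a b → c * a - c * b ≡ c * (a - b)
   lem = solve 3 (λ c a b → c :* a :- c :* b := c :* (a :- b)) refl

  M-Σ : ∀ {lev k} n {f : ℕ → ℕ → ℚ} → (∀ i → i < n → M lev k (f i)) → M lev k (λ t → Σ< n (λ i → f i t))
  M-Σ zero h = M-0
  M-Σ (suc n) h = M-+ (M-Σ n (λ i l → h i (Nat.m<n⇒m<1+n l))) (h n Nat.≤-refl)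

  M-Π : ∀ {lev} n {f : ℕ → ℕ → ℚ} → (∀ i → i < n → M lev 0 (f i)) → M lev 0 (λ t → Π< n (λ i → f i t))
  M-Π zero h = M-1
  M-Π (suc n) h = M-* (M-Π n (λ i l → h i (Nat.m<n⇒m<1+n l))) (h n Nat.≤-refl)

  M-↑ : ∀ {lev} n {f : ℕ → ℚ} → M lev 0 f → M lev 0 (λ t → f t ↑ n)
  M-↑ zero h = M-1
  M-↑ (suc n) h = M-* h (M-↑ n h)

  M₀ M₁ : ℕ → (ℕ → ℚ) → Set
  M₀ = M suc
  M₁ = M (λ m → m)

  M₀⇒M₁ : ∀ {k f} → M₀ k f → M₁ k f
  M₀⇒M₁ (mkM v d) = mkM v (λ m t₁ t₂ o₁ o₂ h → Dv-weaken (Nat.+-monoʳ-≤ _ (Nat.n≤1+n m)) (d m t₁ t₂ o₁ o₂ h))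

  -- The two filtrations interlace: p^(k+1) 𝒜* lies in p^k 𝒜, because the differences obey the same
  -- bound and only the values lose a factor p.
  M₁⇒M₀ : ∀ {k f} → M₁ (suc k) f → M₀ k f
  M₁⇒M₀ {k} {f} (mkM v d) = mkM (λ t o → Dv-weaken (Nat.n≤1+n _) (v t o))
   (λ m t₁ t₂ o₁ o₂ h → subst (λ z → Dv z (f t₁ - f t₂)) (sym (Nat.+-suc k m)) (d m t₁ t₂ o₁ o₂ h))

  -- An element of 𝒜 whose values are divisible by p lies in p 𝒜*, the bounds on differences being
  -- the same. Congruences modulo p that are known only pointwise, such as those of Fermat and
  -- Wilson, thus become usable in 𝒜* but not in 𝒜.
  M₀-val⇒M₁ : ∀ {f} → M₀ 0 f → (∀ t → Ω t → Dv 1 (f t)) → M₁ 1 f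
  M₀-val⇒M₁ (mkM _ d) v = mkM v d

  record U (lev : ℕ → ℕ) (f : ℕ → ℚ) : Set where
   constructor mkU
   field
    mem : M lev 0 f
    unit : ∀ t → Ω t → UnitQ (f t)
  open U public

  U-inv : ∀ {lev f} → U lev f → U lev (λ t → inv (f t))
  U-inv {f = f} (mkU (mkM v d) u) = mkU (mkM (λ t o → Z⇒Dv (invInt (u t o)))
    (λ m t₁ t₂ o₁ o₂ h → subst (Dv _) (eq t₁ t₂ o₁ o₂)
     (subst (λ k → Dv k (- (f t₁ - f t₂) * (inv (f t₁) * inv (f t₂)))) (Nat.+-identityʳ _)
      (Dv-* (Dv-neg (d m t₁ t₂ o₁ o₂ h)) (Dv-* (Z⇒Dv (invInt (u t₁ o₁))) (Z⇒Dv (invInt (u t₂ o₂))))))))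
   (λ t o → UnitQ-inv (u t o))
   where
   lem : ∀ a b ia ib → - (a - b) * (ia * ib) ≡ (b * ib) * ia - (a * ia) * ib
   lem = solve 4 (λ a b ia ib → :- (a :- b) :* (ia :* ib) := (b :* ib) :* ia :- (a :* ia) :* ib) refl
   eq : ∀ t₁ t₂ → Ω t₁ → Ω t₂ → - (f t₁ - f t₂) * (inv (f t₁) * inv (f t₂)) ≡ inv (f t₁) - inv (f t₂)
   eq t₁ t₂ o₁ o₂ = trans (lem (f t₁) (f t₂) (inv (f t₁)) (inv (f t₂)))
    (cong₂ _-_ (trans (cong (_* inv (f t₁)) (inv-r {f t₂} (nonzero (u t₂ o₂)))) (*-idˡ _))
          (trans (cong (_* inv (f t₂)) (inv-r {f t₁} (nonzero (u t₁ o₁)))) (*-idˡ _)))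

  U-* : ∀ {lev f g} → U lev f → U lev g → U lev (λ t → f t * g t)
  U-* (mkU a b) (mkU a' b') = mkU (M-* a a') (λ t o → UnitQ-* (b t o) (b' t o))

  U-const : ∀ {lev q} → UnitQ q → U lev (λ _ → q)
  U-const u = mkU (M-const (Z⇒Dv (integral u))) (λ _ _ → u)

  U-1 : ∀ {lev} → U lev (λ _ → 1#)
  U-1 = U-const UnitQ-1

  U-Π : ∀ {lev} n {f : ℕ → ℕ → ℚ} → (∀ i → i < n → U lev (f i)) → U lev (λ t → Π< n (λ i → f i t))
  U-Π zero h = U-1
  U-Π (suc n) h = U-* (U-Π n (λ i l → h i (Nat.m<n⇒m<1+n l))) (h n Nat.≤-refl)

  U-↑ : ∀ {lev} n {f : ℕ → ℚ} → U lev f → U lev (λ t → f t ↑ n)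
  U-↑ zero h = U-1
  U-↑ (suc n) h = U-* h (U-↑ n h)

  U-resp : ∀ {lev f g} → (∀ t → Ω t → f t ≡ g t) → U lev f → U lev g
  U-resp e (mkU a b) = mkU (M-resp e a) (λ t o → subst UnitQ (e t o) (b t o))

-- Dwork's congruences by Abel summation, over an abstract divisibility predicate.

module DworkCongruences (p : ℕ) where
 open Q
 open Sums
 open Convolution
 open import Data.Nat.Base using (_≤_; _<_; _∸_; _^_) renaming (_+_ to _∔_; _*_ to _·_)

 Fun : Set
 Fun = ℕ → ℚ

 block : (ℕ → ℚ) → ℕ → ℕ → ℚ
 block b s j = Σ< (p ^ s) (λ i → b (i ∔ j · p ^ s))

 private
  ring₁ : ∀ i v u q → i ∔ (v ∔ u · p) · q ≡ i ∔ v · q ∔ u · (p · q)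
  ring₁ i v u q = S.solve 5 (λ i v u q p → i S.:+ (v S.:+ u S.:* p) S.:* q S.:= i S.:+ v S.:* q S.:+ u S.:* (p S.:* q)) refl i v u q p
   where module S = +-*-Solver

 block-suc : ∀ b s u → block b (suc s) u ≡ Σ< p (λ v → block b s (v ∔ u · p))
 block-suc b s u = trans (Σ-block p (p ^ s) _)
  (Σ-ext p (λ v → Σ-ext (p ^ s) (λ i → cong b (sym (ring₁ i v u (p ^ s))))))

 block-0 : ∀ b j → block b 0 j ≡ b j
 block-0 b j = trans (+-idˡ _) (cong b (Nat.*-identityʳ j))

 Σ-digits : ∀ s f → Σ< (p ^ suc s) f ≡ Σ< (p ^ s) (λ u → Σ< p (λ v → f (v ∔ u · p)))
 Σ-digits s f = trans (cong (λ k → Σ< k f) (Nat.*-comm p (p ^ s))) (Σ-block (p ^ s) p f)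

 -- Summation by parts along the tree of truncated p-adic expansions.
 module Abel (Q : Fun → Set) (Q-resp : ∀ {f g} → (∀ t → f t ≡ g t) → Q f → Q g)
  (Q-0 : Q (λ _ → 0#)) (Q-+ : ∀ {f g} → Q f → Q g → Q (λ t → f t + g t)) where

  Q-Σ : ∀ n {f : ℕ → Fun} → (∀ i → i < n → Q (f i)) → Q (λ t → Σ< n (λ i → f i t))
  Q-Σ zero h = Q-0
  Q-Σ (suc n) h = Q-+ (Q-Σ n (λ i l → h i (Nat.m<n⇒m<1+n l))) (h n Nat.≤-refl)

  abel : ∀ s (F : ℕ → ℕ → Fun) (b : ℕ → Fun) →
   (∀ i s' → i ∔ suc s' ≡ s → ∀ v u → v < p → u < p ^ s' →
    Q (λ t → (F i (v ∔ u · p) t - F (suc i) u t) * block (λ j → b j t) i (v ∔ u · p))) →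
   Q (λ t → Σ< (p ^ s) (λ j → F 0 j t * b j t) - F s 0 t * block (λ j → b j t) s 0)
  abel s F b h = Q-resp (λ t → cong₂ _-_
    (Σ-ext (p ^ s) (λ j → cong (F 0 j t *_) (block-0 (λ j → b j t) j)))
    (trans (+-idˡ _) refl)) (go s 0 refl)
   where
   -- In `D s' i` the i lowest digits are already summed out into blocks, s' digits remain, and the
   -- weight is taken at level i. Successive values differ by the terms bounded in the hypothesis;
   -- `D s 0` and `D 0 s` are the two sides.
   D : ℕ → ℕ → Fun
   D s' i t = Σ< (p ^ s') (λ j → F i j t * block (λ j → b j t) i j)
   step : ∀ s' i → i ∔ suc s' ≡ s → Q (λ t → D (suc s') i t - D s' (suc i) t)
   step s' i e = Q-resp (λ t → eq t)
    (Q-Σ (p ^ s') (λ u lu → Q-Σ p (λ v lv → h i s' e v u lv lu)))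
    where
    eq : ∀ t → Σ< (p ^ s') (λ u → Σ< p (λ v → (F i (v ∔ u · p) t - F (suc i) u t) * block (λ j → b j t) i (v ∔ u · p)))
        ≡ D (suc s') i t - D s' (suc i) t
    eq t = begin
     Σ< (p ^ s') (λ u → Σ< p (λ v → (x u v - y u) * c u v))
      ≡⟨ Σ-ext (p ^ s') (λ u → trans (Σ-ext p (λ v → lem (x u v) (y u) (c u v)))
         (trans (Σ-+ p _ _) (cong (Σ< p (λ v → x u v * c u v) +_) (trans (Σ-*ˡ p (- y u) (c u)) (neg-*ˡ (y u) _))))) ⟩
     Σ< (p ^ s') (λ u → Σ< p (λ v → x u v * c u v) + (- (y u * Σ< p (c u))))
      ≡⟨ Σ-+ (p ^ s') _ _ ⟩
     Σ< (p ^ s') (λ u → Σ< p (λ v → x u v * c u v)) + Σ< (p ^ s') (λ u → - (y u * Σ< p (c u)))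
      ≡⟨ cong₂ _+_ (sym (Σ-digits s' (λ j → F i j t * block (λ j → b j t) i j)))
         (trans (Σ-neg (p ^ s') _) (cong (λ z → - z) (Σ-ext (p ^ s') (λ u → cong (y u *_) (sym (block-suc (λ j → b j t) i u)))))) ⟩
     D (suc s') i t - D s' (suc i) t ∎
     where
     open ≡-Reasoning
     x = λ u v → F i (v ∔ u · p) t
     y = λ u → F (suc i) u t
     c = λ u v → block (λ j → b j t) i (v ∔ u · p)
     lem : ∀ x y c → (x - y) * c ≡ x * c + (- y) * c
     lem = solve 3 (λ x y c → (x :- y) :* c := x :* c :+ (:- y) :* c) refl
     Σ-neg : ∀ n f → Σ< n (λ i → - f i) ≡ - Σ< n f
     Σ-neg n f = trans (Σ-ext n (λ i → solve 1 (λ x → :- x := con (ℤ.-[1+ 0 ]) :* x) refl (f i)))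
      (trans (Σ-*ˡ n (ιz ℤ.-[1+ 0 ]) f) (solve 1 (λ x → con (ℤ.-[1+ 0 ]) :* x := :- x) refl (Σ< n f)))
      where import Data.Integer.Base as ℤ
   go : ∀ s' i → i ∔ s' ≡ s → Q (λ t → D s' i t - D 0 s t)
   go zero i e = Q-resp (λ t → sym (trans (cong (λ k → D 0 k t - D 0 s t) (trans (sym (Nat.+-identityʳ i)) e)) (-‿inverse (D 0 s t)))) Q-0
   go (suc s') i e = Q-resp (λ t → lem (D (suc s') i t) (D s' (suc i) t) (D 0 s t))
     (Q-+ (step s' i e) (go s' (suc i) (trans (sym (Nat.+-suc i s')) e)))
    where
    lem : ∀ a b c → (a - b) + (b - c) ≡ a - c
    lem = solve 3 (λ a b c → (a :- b) :+ (b :- c) := a :- c) refl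

 -- `P r n k` reads: divisible by p^k and, on top of it, by the power of p that the digits of n
 -- guarantee for `A r n`. `bad r s j` marks the residues j < p^s at which the quotient of A_r(j + m
 -- p^s) by A_r(j) is not controlled by A_(r+s)(m); elsewhere `ρ` is that quotient, and at bad
 -- residues it is 0. Badness survives prepending a low digit, and where it first appears the gain
 -- of the index already contains p^(s+1).
 module Dwork (1≤p : 1 ≤ p)
  (P : ℕ → ℕ → ℕ → Fun → Set)
  (P-resp : ∀ {r n k f g} → (∀ t → f t ≡ g t) → P r n k f → P r n k g)
  (P-0 : ∀ {r n k} → P r n k (λ _ → 0#))
  (P-+ : ∀ {r n k f g} → P r n k f → P r n k g → P r n k (λ t → f t + g t))
  (P-neg : ∀ {r n k f} → P r n k f → P r n k (λ t → - f t))
  (P-base : ∀ {r n k f} → P r n k f → P r 0 k f)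
  (A : ℕ → ℕ → Fun)
  (P-A : ∀ {r k f} n → P r 0 k f → P r n k (λ t → A r n t * f t))
  (P-*A : ∀ {r n k f} r' n' → P r n k f → P r n k (λ t → f t * A r' n' t))
  (A∈P : ∀ r n → P r n 0 (A r n))
  (bad : ℕ → ℕ → ℕ → Bool)
  (bad-0 : ∀ r → bad r 0 0 ≡ false)
  (bad-suc : ∀ r s v u → v < p → u < p ^ s → bad (suc r) s u ≡ true → bad r (suc s) (v ∔ u · p) ≡ true)
  (new-bad : ∀ r s v u m k f → v < p → u < p ^ s → bad (suc r) s u ≡ false → bad r (suc s) (v ∔ u · p) ≡ true →
    P r (v ∔ u · p ∔ m · p ^ suc s) k f → P (r ∔ suc s) m (k ∔ suc s) f)
  (ρ : ℕ → ℕ → ℕ → ℕ → Fun)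
  (ρ-0 : ∀ r m t → ρ r 0 m 0 t ≡ A r m t)
  (ρ-bad : ∀ r s m j t → bad r s j ≡ true → ρ r s m j t ≡ 0#)
  (ρ-good : ∀ r s m j t → bad r s j ≡ false → A r (j ∔ m · p ^ s) t ≡ A r j t * ρ r s m j t)
  (ρ-step : ∀ r s v u m k f → v < p → u < p ^ s → P r (v ∔ u · p) k f →
    P (r ∔ suc s) m (k ∔ suc s) (λ t → (ρ r (suc s) m (v ∔ u · p) t - ρ (suc r) s m u t) * f t))
  where

  -- Antisymmetric under the exchange of j and K - j, so that the sum over all j ≤ K vanishes. This
  -- is the only exact identity behind the congruences.
  b : ℕ → ℕ → ℕ → ℕ → Fun
  b r a K j t = A r (a ∔ j · p) t * pad (λ i → A (suc r) i t) K j - A (suc r) j t * pad (λ i → A r (a ∔ i · p) t) K j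

  S : ℕ → ℕ → ℕ → ℕ → ℕ → Fun
  S r a K s m t = block (λ j → b r a K j t) s m

  private
   Claim : ℕ → Set
   Claim s = ∀ r a → a < p → ∀ K m → P (r ∔ suc s) m (suc s) (S r a K s m)

   χ : ℕ → ℕ → ℕ → ℚ
   χ r s j with bad r s j
   ... | true = 1#
   ... | false = 0#

   p^≢0 : ∀ s → 1 ≤ p ^ s
   p^≢0 zero = Nat.≤-refl
   p^≢0 (suc s) = Nat.*-mono-≤ 1≤p (p^≢0 s)

   P-*pad : ∀ {r n k f} r' (g : ℕ → ℕ) K j → P r n k f → P r n k (λ t → f t * pad (λ i → A r' (g i) t) K j)
   P-*pad r' g K zero h = P-*A r' (g K) h
   P-*pad r' g zero (suc j) h = P-resp (λ t → sym (*-0ʳ _)) P-0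
   P-*pad r' g (suc K) (suc j) h = P-*pad r' g K j h

   module Step (s : ℕ) (ih : ∀ t → t < s → Claim t) (r a : ℕ) (a<p : a < p) (m K : ℕ) where
    Q : Fun → Set
    Q = P (r ∔ suc s) m (suc s)

    open Abel Q P-resp P-0 P-+

    K′ : ℕ
    K′ = m · p ^ s ∔ K

    lt : ∀ i s' → i ∔ suc s' ≡ s → i < s
    lt i s' e = subst (i <_) e (subst (suc i ≤_) (sym (Nat.+-suc i s')) (s≤s (Nat.m≤m+n i s')))

    idx : ∀ i s' → i ∔ suc s' ≡ s → r ∔ suc i ∔ suc s' ≡ r ∔ suc s
    idx i s' e = trans (Nat.+-assoc r (suc i) (suc s')) (cong (λ z → r ∔ suc z) e)

    dif : ∀ i s' → i ∔ suc s' ≡ s → s ∸ i ≡ suc s' × s ∸ suc i ≡ s'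
    dif i s' refl = Nat.m+n∸m≡n i (suc s') , trans (cong (_∸ suc i) (Nat.+-suc i s')) (Nat.m+n∸m≡n i s')

    ρ-part : Q (λ t → Σ< (p ^ s) (λ j → ρ (r ∔ 1) s m j t * b r a K j t) - A (r ∔ suc s) m t * S r a K s 0 t)
    ρ-part = P-resp (λ t → cong (λ z → Σ< (p ^ s) (λ j → ρ (r ∔ 1) s m j t * b r a K j t) - z * S r a K s 0 t)
      (trans (cong (λ k → ρ (r ∔ suc s) k m 0 t) (Nat.n∸n≡0 s)) (ρ-0 (r ∔ suc s) m t)))
     (abel s (λ i j → ρ (r ∔ suc i) (s ∸ i) m j) (b r a K) step)
     where
     step : ∀ i s' → i ∔ suc s' ≡ s → ∀ v u → v < p → u < p ^ s' →
      Q (λ t → (ρ (r ∔ suc i) (s ∸ i) m (v ∔ u · p) t - ρ (r ∔ suc (suc i)) (s ∸ suc i) m u t) * S r a K i (v ∔ u · p) t)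
     step i s' e v u lv lu with s ∸ i | s ∸ suc i | dif i s' e
     ... | _ | _ | refl , refl = subst₂ (λ x y → P x m y (λ t → (ρ (r ∔ suc i) (suc s') m (v ∔ u · p) t - ρ (r ∔ suc (suc i)) s' m u t) * S r a K i (v ∔ u · p) t))
       (idx i s' e) (cong suc e)
       (subst (λ x → P (r ∔ suc i ∔ suc s') m (suc i ∔ suc s') (λ t → (ρ (r ∔ suc i) (suc s') m (v ∔ u · p) t - ρ x s' m u t) * S r a K i (v ∔ u · p) t)) (sym (Nat.+-suc r (suc i)))
        (ρ-step (r ∔ suc i) s' v u m (suc i) _ lv lu (ih i (lt i s' e) r a a<p K (v ∔ u · p))))

    χ-part : Q (λ t → Σ< (p ^ s) (λ j → χ (r ∔ 1) s j * b r a K′ (j ∔ m · p ^ s) t))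
    χ-part = P-resp (λ t → trans (cong (λ z → Σ< (p ^ s) (λ j → χ (r ∔ 1) s j * b r a K′ (j ∔ m · p ^ s) t) - z * block (λ j → b r a K′ (j ∔ m · p ^ s) t) s 0)
       (trans (cong (λ k → χ (r ∔ suc s) k 0) (Nat.n∸n≡0 s)) (χ0 (r ∔ suc s))))
       (solve 2 (λ x y → x :- :0 :* y := x) refl _ _))
     (abel s (λ i j _ → χ (r ∔ suc i) (s ∸ i) j) (λ j → b r a K′ (j ∔ m · p ^ s)) step)
     where
     χ0 : ∀ r → χ r 0 0 ≡ 0#
     χ0 r with bad r 0 0 | bad-0 r
     ... | _ | refl = refl
     blk : ∀ i s' → i ∔ suc s' ≡ s → ∀ j t → block (λ j → b r a K′ (j ∔ m · p ^ s) t) i j ≡ S r a K′ i (j ∔ m · p ^ suc s') t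
     blk i s' e j t = Σ-ext (p ^ i) (λ x → cong (λ z → b r a K′ z t)
      (trans (Nat.+-assoc x _ _) (cong (x ∔_) (trans (cong (λ z → j · p ^ i ∔ m · z) (trans (cong (p ^_) (trans (sym e) (Nat.+-comm i (suc s')))) (Nat.^-distribˡ-+-* p (suc s') i)))
       (trans (cong (j · p ^ i ∔_) (sym (Nat.*-assoc m _ _))) (sym (Nat.*-distribʳ-+ (p ^ i) j _)))))))
     step : ∀ i s' → i ∔ suc s' ≡ s → ∀ v u → v < p → u < p ^ s' →
      Q (λ t → (χ (r ∔ suc i) (s ∸ i) (v ∔ u · p) - χ (r ∔ suc (suc i)) (s ∸ suc i) u) * block (λ j → b r a K′ (j ∔ m · p ^ s) t) i (v ∔ u · p))
     step i s' e v u lv lu with s ∸ i | s ∸ suc i | dif i s' e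
     ... | _ | _ | refl , refl = P-resp (λ t → cong (λ z → (χ (r ∔ suc i) (suc s') (v ∔ u · p) - χ z s' u) * block (λ j → b r a K′ (j ∔ m · p ^ s) t) i (v ∔ u · p)) (sym (Nat.+-suc r (suc i)))) (cases refl refl)
      where
      cases : ∀ {b₁ b₂} → bad (r ∔ suc i) (suc s') (v ∔ u · p) ≡ b₁ → bad (suc (r ∔ suc i)) s' u ≡ b₂ →
       Q (λ t → (χ (r ∔ suc i) (suc s') (v ∔ u · p) - χ (suc (r ∔ suc i)) s' u) * block (λ j → b r a K′ (j ∔ m · p ^ s) t) i (v ∔ u · p))
      cases {b₁} {b₂} e₁ e₂ with bad (r ∔ suc i) (suc s') (v ∔ u · p) | bad (suc (r ∔ suc i)) s' u | bad-suc (r ∔ suc i) s' v u lv lu | new-bad (r ∔ suc i) s' v u m (suc i)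
      ... | true | true | _ | _ = P-resp (λ t → solve 1 (λ z → :0 := (:1 :- :1) :* z) refl _) P-0
      ... | false | false | _ | _ = P-resp (λ t → solve 1 (λ z → :0 := (:0 :- :0) :* z) refl _) P-0
      ... | false | true | g | _ with g refl
      ... | ()
      cases {b₁} {b₂} e₁ e₂ | true | false | _ | nb = P-resp (λ t → trans (sym (blk i s' e (v ∔ u · p) t)) (solve 1 (λ z → z := (:1 :- :0) :* z) refl _))
       (subst₂ (λ x y → P x m y (S r a K′ i (v ∔ u · p ∔ m · p ^ suc s'))) (idx i s' e) (cong suc e)
        (nb (S r a K′ i (v ∔ u · p ∔ m · p ^ suc s')) lv lu refl refl (ih i (lt i s' e) r a a<p K′ _)))

    e : ℕ → Fun
    e j t with bad (r ∔ 1) s j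
    ... | true = 0#
    ... | false = (A r (a ∔ j · p ∔ m · p ^ suc s) t - A r (a ∔ j · p) t * ρ (r ∔ 1) s m j t) * pad (λ i → A (suc r) i t) K j

    e-part : ∀ j → j < p ^ s → Q (e j)
    e-part j lj with bad (r ∔ 1) s j in eb
    ... | true = P-0
    ... | false = P-*pad (suc r) (λ i → i) K j main
     where
     r1 : r ∔ 1 ≡ suc r
     r1 = Nat.+-comm r 1
     eb′ : bad (suc r) s j ≡ false
     eb′ = subst (λ x → bad x s j ≡ false) r1 eb
     dρ : Q (λ t → (ρ r (suc s) m (a ∔ j · p) t - ρ (r ∔ 1) s m j t) * A r (a ∔ j · p) t)
     dρ = P-resp (λ t → cong (λ x → (ρ r (suc s) m (a ∔ j · p) t - ρ x s m j t) * A r (a ∔ j · p) t) (sym r1))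
      (ρ-step r s a j m 0 _ a<p lj (A∈P r (a ∔ j · p)))
     main : Q (λ t → A r (a ∔ j · p ∔ m · p ^ suc s) t - A r (a ∔ j · p) t * ρ (r ∔ 1) s m j t)
     main with bad r (suc s) (a ∔ j · p) in eb₂
     ... | false = P-resp (λ t → trans (solve 3 (λ x y z → (x :- y) :* z := z :* x :- z :* y) refl (ρ r (suc s) m (a ∔ j · p) t) (ρ (r ∔ 1) s m j t) (A r (a ∔ j · p) t))
         (cong (_- A r (a ∔ j · p) t * ρ (r ∔ 1) s m j t) (sym (ρ-good r (suc s) m (a ∔ j · p) t eb₂)))) dρ
     ... | true = P-resp (λ t → trans (cong (λ z → A r (a ∔ j · p ∔ m · p ^ suc s) t + (z - ρ (r ∔ 1) s m j t) * A r (a ∔ j · p) t) (ρ-bad r (suc s) m (a ∔ j · p) t eb₂))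
         (solve 3 (λ x y z → x :+ (:0 :- y) :* z := x :- z :* y) refl (A r (a ∔ j · p ∔ m · p ^ suc s) t) (ρ (r ∔ 1) s m j t) (A r (a ∔ j · p) t)))
        (P-+ (new-bad r s a j m 0 _ a<p lj eb′ eb₂ (A∈P r _)) dρ)
      where import Data.Integer.Base as ℤ

    term : ∀ j t → ρ (r ∔ 1) s m j t * b r a K j t + e j t + χ (r ∔ 1) s j * b r a K′ (j ∔ m · p ^ s) t ≡ b r a K′ (j ∔ m · p ^ s) t
    term j t with bad (r ∔ 1) s j in eb
    ... | true = trans (cong (λ z → z * b r a K j t + 0# + 1# * b r a K′ (j ∔ m · p ^ s) t) (ρ-bad (r ∔ 1) s m j t eb))
            (solve 2 (λ x y → :0 :* x :+ :0 :+ :1 :* y := y) refl _ _)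
     where import Data.Integer.Base as ℤ
    ... | false = begin
      ρ₁ * (A₀ * p₁ - A₁ * p₀) + (A₀′ - A₀ * ρ₁) * p₁ + 0# * b r a K′ (j ∔ m · p ^ s) t
       ≡⟨ solve 7 (λ ρ₁ A₀ p₁ A₁ p₀ A₀′ z → ρ₁ :* (A₀ :* p₁ :- A₁ :* p₀) :+ (A₀′ :- A₀ :* ρ₁) :* p₁ :+ :0 :* z := A₀′ :* p₁ :- (A₁ :* ρ₁) :* p₀) refl ρ₁ A₀ p₁ A₁ p₀ A₀′ _ ⟩
      A₀′ * p₁ - (A₁ * ρ₁) * p₀
       ≡⟨ cong₂ (λ x y → x * p₁ - y * p₀) (cong (λ z → A r z t) (ix a j)) (sym (trans (cong (λ x → A x (j ∔ m · p ^ s) t) r1)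
          (trans (cong (λ x → A x (j ∔ m · p ^ s) t) (sym r1)) (trans (ρ-good (r ∔ 1) s m j t eb) (cong (λ x → A x j t * ρ₁) r1))))) ⟩
      A r (a ∔ (j ∔ m · p ^ s) · p) t * p₁ - A (r ∔ 1) (j ∔ m · p ^ s) t * p₀
       ≡⟨ cong₂ _-_ (cong (A r (a ∔ (j ∔ m · p ^ s) · p) t *_) (sh (λ i → A (suc r) i t)))
          (cong₂ _*_ (cong (λ x → A x (j ∔ m · p ^ s) t) r1) (sh (λ i → A r (a ∔ i · p) t))) ⟩
      b r a K′ (j ∔ m · p ^ s) t ∎
     where
     open ≡-Reasoning
     r1 : r ∔ 1 ≡ suc r
     r1 = Nat.+-comm r 1
     ρ₁ = ρ (r ∔ 1) s m j t
     A₀ = A r (a ∔ j · p) t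
     A₁ = A (suc r) j t
     p₁ = pad (λ i → A (suc r) i t) K j
     p₀ = pad (λ i → A r (a ∔ i · p) t) K j
     A₀′ = A r (a ∔ j · p ∔ m · p ^ suc s) t
     ix : ∀ a j → a ∔ j · p ∔ m · p ^ suc s ≡ a ∔ (j ∔ m · p ^ s) · p
     ix a j = S′.solve 5 (λ a j m p q → a S′.:+ j S′.:* p S′.:+ m S′.:* (p S′.:* q) S′.:= a S′.:+ (j S′.:+ m S′.:* q) S′.:* p) refl a j m p (p ^ s)
      where module S′ = +-*-Solver
     sh : ∀ f → pad f K j ≡ pad f K′ (j ∔ m · p ^ s)
     sh f = sym (trans (cong (pad f K′) (Nat.+-comm j (m · p ^ s))) (pad-shift f (m · p ^ s) K j))

    -- Translating both j and K by m p^s multiplies `b` by `ρ` up to an error. At good j the error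
    -- is `e`, bounded by `ρ-step`; at bad j nothing can be compared and the whole translated term
    -- is kept with weight `χ`. Both weights vary little along the tree of digits, so Abel summation
    -- with the congruences for smaller s replaces `ρ` by its root value A_(r+s+1)(m) and `χ` by its
    -- root value 0.
    shifted : Q (λ t → S r a K′ s m t - A (r ∔ suc s) m t * S r a K s 0 t)
    shifted = P-resp (λ t → trans (lem _ _ _ _) (cong (_- A (r ∔ suc s) m t * S r a K s 0 t)
       (trans (cong (_+ Σ< (p ^ s) (λ j → χ (r ∔ 1) s j * b r a K′ (j ∔ m · p ^ s) t)) (sym (Σ-+ (p ^ s) _ _)))
       (trans (sym (Σ-+ (p ^ s) _ _)) (Σ-ext (p ^ s) (λ j → term j t))))))
     (P-+ ρ-part (P-+ (Q-Σ (p ^ s) e-part) χ-part))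
     where
     lem : ∀ x y z w → (x - y) + (z + w) ≡ (x + z + w) - y
     lem = solve 4 (λ x y z w → (x :- y) :+ (z :+ w) := (x :+ z :+ w) :- y) refl

   -- Induction on s and, inside it, on K. For m > 0 the translation by m p^s lowers K; for m = 0
   -- the block is minus the sum of all the other blocks, since the antisymmetric terms add up to 0.
   claim : ∀ s → (∀ t → t < s → Claim t) → Claim s
   claim s ih r a a<p K m = go K (<-wellFounded K) m
    where
    open Abel (P (r ∔ suc s) 0 (suc s)) P-resp P-0 P-+ using (Q-Σ)
    total : ∀ K t → Σ< (suc K) (λ m → S r a K s m t) ≡ 0#
    total K t = begin
     Σ< (suc K) (λ m → S r a K s m t)         ≡⟨ Σ-block (suc K) (p ^ s) (λ j → b r a K j t) ⟨
     Σ< (suc K · p ^ s) (λ j → b r a K j t) ≡⟨ Σ-tail (suc K) (suc K · p ^ s) _ (Nat.≤-trans (Nat.≤-reflexive (sym (Nat.*-identityʳ (suc K)))) (Nat.*-monoʳ-≤ (suc K) (p^≢0 s)))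
                            (λ j l → trans (cong₂ (λ x y → A r (a ∔ j · p) t * x - A (suc r) j t * y) (pad-> _ K j l) (pad-> _ K j l)) (zz _ _)) ⟩
     Σ< (suc K) (λ j → b r a K j t)           ≡⟨ Σ-+ (suc K) _ _ ⟩
     conv f g K + Σ< (suc K) (λ j → - (g j * pad f K j))
      ≡⟨ cong (conv f g K +_) (trans (Σ-ext (suc K) (λ j → solve 1 (λ x → :- x := con (ℤ.-[1+ 0 ]) :* x) refl _)) (Σ-*ˡ (suc K) (ιz ℤ.-[1+ 0 ]) _)) ⟩
     conv f g K + ιz ℤ.-[1+ 0 ] * conv g f K  ≡⟨ cong (λ z → z + ιz ℤ.-[1+ 0 ] * conv g f K) (conv-comm f g K) ⟩
     conv g f K + ιz ℤ.-[1+ 0 ] * conv g f K  ≡⟨ solve 1 (λ x → x :+ con (ℤ.-[1+ 0 ]) :* x := :0) refl _ ⟩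
     0# ∎
     where
     open ≡-Reasoning
     f = λ i → A r (a ∔ i · p) t
     g = λ i → A (suc r) i t
     zz : ∀ x y → x * 0# - y * 0# ≡ 0#
     zz = solve 2 (λ x y → x :* :0 :- y :* :0 := :0) refl
    go : ∀ K → Acc _<_ K → ∀ m → P (r ∔ suc s) m (suc s) (S r a K s m)
    pos : ∀ K → Acc _<_ K → ∀ m → P (r ∔ suc s) (suc m) (suc s) (S r a K s (suc m))
    pos K (acc rec) m with suc m · p ^ s Nat.≤? K
    ... | no K≱ = P-resp (λ t → sym (trans (Σ-ext (p ^ s) (λ i → trans (cong₂ (λ x y → A r (a ∔ (i ∔ suc m · p ^ s) · p) t * x - A (suc r) (i ∔ suc m · p ^ s) t * y)
          (pad-> _ K _ (Nat.≤-trans (Nat.≰⇒> K≱) (Nat.m≤n+m _ i))) (pad-> _ K _ (Nat.≤-trans (Nat.≰⇒> K≱) (Nat.m≤n+m _ i)))) (zz _ _))) (Σ-0 (p ^ s) (λ _ _ → refl)))) P-0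
     where
     zz : ∀ x y → x * 0# - y * 0# ≡ 0#
     zz = solve 2 (λ x y → x :* :0 :- y :* :0 := :0) refl
    ... | yes le = P-resp (λ t → trans (solve 2 (λ x y → (x :- y) :+ y := x) refl _ _) (cong (λ k → S r a k s (suc m) t) eK))
       (P-+ (Step.shifted s ih r a a<p (suc m) K₀) (P-A (suc m) (go K₀ (rec K₀<K) 0)))
     where
     K₀ = K ∸ suc m · p ^ s
     eK : suc m · p ^ s ∔ K₀ ≡ K
     eK = Nat.m+[n∸m]≡n le
     K₀<K : K₀ < K
     K₀<K = subst (suc K₀ ≤_) eK (Nat.+-monoˡ-≤ K₀ (Nat.≤-trans (p^≢0 s) (Nat.m≤m+n _ _)))
    go K ac (suc m) = pos K ac m
    go K ac zero = P-resp (λ t → lem _ _ (trans (sym (Σ-first K (λ m → S r a K s m t))) (total K t)))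
      (P-neg (Q-Σ K (λ i _ → P-base (pos K ac i))))
     where
     lem : ∀ x y → x + y ≡ 0# → - y ≡ x
     lem x y e = trans (solve 2 (λ x y → :- y := x :- (x :+ y)) refl x y) (trans (cong (λ z → x - z) e) (solve 1 (λ x → x :- :0 := x) refl x))
      where import Data.Integer.Base as ℤ

   below : ∀ s t → t < s → Claim t
   below (suc s) t lt = claim t (λ t' lt' → below s t' (Nat.<-≤-trans lt' (Nat.≤-pred lt)))

  dwork : ∀ s r a → a < p → ∀ K m → P (r ∔ suc s) m (suc s) (S r a K s m)
  dwork s = claim s (below s)

-- Products of p-adic units in arithmetic progression.

module UnitProducts (p : ℕ) (pp : Prime p) (Ω : ℕ → Set) where
 open Q
 open Sums
 open import Data.Nat.Base using (_≤_; _<_; _∸_; _^_) renaming (_+_ to _∔_; _*_ to _·_)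

 open Padic p pp
 open Filt Ω
 open import Data.Nat.Divisibility using (_∣_; ∣-refl; m∣m*n; ∣⇒≤)

 Fun : Set
 Fun = ℕ → ℚ

 Cg : ℕ → Fun → Fun → Set
 Cg k f g = M₁ k (λ t → f t - g t)

 Cg-refl : ∀ {k f} → Cg k f f
 Cg-refl {f = f} = M-resp (λ t _ → sym (-‿inverse (f t))) M-0

 Cg-≡ : ∀ {k f g} → (∀ t → f t ≡ g t) → Cg k f g
 Cg-≡ {f = f} e = M-resp (λ t _ → trans (sym (-‿inverse (f t))) (cong (λ z → f t - z) (e t))) M-0

 Cg-resp : ∀ {k f f' g g'} → (∀ t → f t ≡ f' t) → (∀ t → g t ≡ g' t) → Cg k f g → Cg k f' g'
 Cg-resp e e' c = M-resp (λ t _ → cong₂ _-_ (e t) (e' t)) c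

 Cg-trans : ∀ {k f g h} → Cg k f g → Cg k g h → Cg k f h
 Cg-trans {f = f} {g} {h} c d = M-resp (λ t _ → solve 3 (λ a b c → (a :- b) :+ (b :- c) := a :- c) refl (f t) (g t) (h t)) (M-+ c d)

 Cg-weaken : ∀ {j k f g} → j ≤ k → Cg k f g → Cg j f g
 Cg-weaken = M-weaken

 Cg-* : ∀ {k f f' g g'} → M₁ 0 f → M₁ 0 g' → Cg k f f' → Cg k g g' → Cg k (λ t → f t * g t) (λ t → f' t * g' t)
 Cg-* {k} {f} {f'} {g} {g'} mf mg c d =
  M-resp (λ t _ → solve 4 (λ a a' b b' → a :* (b :- b') :+ (a :- a') :* b' := a :* b :- a' :* b') refl (f t) (f' t) (g t) (g' t))
   (M-+ (M-* mf d) (M-*0 c mg))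

 Cg-mem : ∀ {k f g} → Cg k f g → M₁ 0 g → M₁ 0 f
 Cg-mem {f = f} {g} c m = M-resp (λ t _ → solve 2 (λ a b → (a :- b) :+ b := a) refl (f t) (g t)) (M-+ (M-weaken z≤n c) m)

 one : Fun
 one _ = 1#

 Cg-*1 : ∀ {k f g} → Cg k f one → Cg k g one → Cg k (λ t → f t * g t) one
 Cg-*1 c d = Cg-resp (λ _ → refl) (λ _ → *-idˡ 1#) (Cg-* (Cg-mem c M-1) M-1 c d)

 Cg-Π1 : ∀ {k} n {f : ℕ → Fun} → (∀ i → i < n → Cg k (f i) one) → Cg k (λ t → Π< n (λ i → f i t)) one
 Cg-Π1 zero h = Cg-refl
 Cg-Π1 (suc n) h = Cg-*1 (Cg-Π1 n (λ i l → h i (Nat.m<n⇒m<1+n l))) (h n Nat.≤-refl)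

 Cg-Π : ∀ {k} n {f g : ℕ → Fun} → (∀ i → i < n → M₁ 0 (f i)) → (∀ i → i < n → M₁ 0 (g i)) → (∀ i → i < n → Cg k (f i) (g i)) →
  Cg k (λ t → Π< n (λ i → f i t)) (λ t → Π< n (λ i → g i t))
 Cg-Π zero a b h = Cg-refl
 Cg-Π (suc n) a b h = Cg-* (M-Π n (λ i l → a i (Nat.m<n⇒m<1+n l))) (b n Nat.≤-refl)
  (Cg-Π n (λ i l → a i (Nat.m<n⇒m<1+n l)) (λ i l → b i (Nat.m<n⇒m<1+n l)) (λ i l → h i (Nat.m<n⇒m<1+n l))) (h n Nat.≤-refl)

 Cg-↑1 : ∀ {k f} n → Cg k f one → Cg k (λ t → f t ↑ n) one
 Cg-↑1 zero c = Cg-refl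
 Cg-↑1 (suc n) c = Cg-*1 c (Cg-↑1 n c)

 Π-const : ∀ n x → Π< n (λ _ → x) ≡ x ↑ n
 Π-const zero x = refl
 Π-const (suc n) x = trans (cong (_* x) (Π-const n x)) (*-comm _ x)

 M₁-ι· : ∀ {k f} j → M₁ k f → M₁ k (λ t → ι j * f t)
 M₁-ι· j m = M-* (M-const (Dv-ι j)) m

 -- Adding a small ε to n factors that are 1 mod p changes the product by n ε to first order.
 prod-ε : ∀ k n (f : ℕ → Fun) (ε : Fun) → (∀ j → Cg 1 (f j) one) → M₁ (suc k) ε →
  Cg (suc (suc k)) (λ t → Π< n (λ j → f j t + ε t)) (λ t → Π< n (λ j → f j t) + ι n * ε t)
 prod-ε k zero f ε h m = Cg-≡ (λ t → sym (trans (cong (1# +_) (*-0ˡ (ε t))) (+-idʳ 1#)))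
 prod-ε k (suc n) f ε h m = M-resp (λ t _ → trans (lem (A' t) (A t) (ι n) (ε t) (f n t))
    (cong (λ z → A' t * (f n t + ε t) - (A t * f n t + z * ε t)) (sym (ι-suc n))))
   (M-+ (M-+ (M-*0 (prod-ε k n f ε h m) (Cg-mem (h n) M-1))
        (M-weaken (Nat.≤-reflexive (Nat.+-comm 1 (suc k))) (M-* (M₁-ι· n m) (h n))))
      (M-* A'1 m))
  where
  A A' : Fun
  A t = Π< n (λ j → f j t)
  A' t = Π< n (λ j → f j t + ε t)
  A'1 : Cg 1 A' one
  A'1 = Cg-Π1 n (λ i _ → M-resp (λ t _ → solve 2 (λ a b → (a :- :1) :+ b := (a :+ b) :- :1) refl (f i t) (ε t)) (M-+ (h i) (M-weaken (s≤s z≤n) m)))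
  lem : ∀ A' A n ε f → (A' - (A + n * ε)) * f + n * ε * (f - 1#) + (A' - 1#) * ε ≡ A' * (f + ε) - (A * f + (1# + n) * ε)
  lem = solve 5 (λ A' A n ε f → (A' :- (A :+ n :* ε)) :* f :+ n :* ε :* (f :- :1) :+ (A' :- :1) :* ε
      := A' :* (f :+ ε) :- (A :* f :+ (:1 :+ n) :* ε)) refl

 -- (1 + f)^p = 1 + p f + O(f²), hence raising to the p-th power gains one factor p.
 pow-p : ∀ k {f} → Cg (suc k) f one → Cg (suc (suc k)) (λ t → f t ↑ p) one
 pow-p k {f} c = Cg-trans (Cg-resp eqL (λ t → cong (_+ ι p * ε t) (trans (Π-const p 1#) (1↑ p)))
   (prod-ε k p (λ _ → one) ε (λ _ → Cg-refl) c))
   (M-resp (λ t _ → trans (cong (λ z → z * ε t) (*-idʳ π)) (solve 2 (λ a b → a :* b := (:1 :+ a :* b) :- :1) refl π (ε t))) (M-π 1 c))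
  where
  ε : Fun
  ε t = f t - 1#
  eqL : ∀ t → Π< p (λ _ → 1# + ε t) ≡ f t ↑ p
  eqL t = trans (Π-const p _) (cong (_↑ p) (solve 1 (λ x → :1 :+ (x :- :1) := x) refl (f t)))

 pow-p^ : ∀ s {f} → Cg 1 f one → Cg (suc s) (λ t → f t ↑ (p ^ s)) one
 pow-p^ zero {f} c = Cg-resp (λ t → sym (*-idʳ (f t))) (λ _ → refl) c
 pow-p^ (suc s) {f} c = Cg-resp (λ t → sym (↑-* (f t) p (p ^ s))) (λ _ → refl) (pow-p s (pow-p^ s c))

 -- With z = 1/y this is the product of the p^e terms y + j h after y^(p^e) has been pulled out.
 L : ℕ → ℕ → Fun → Fun
 L h e z t = Π< (p ^ e) (λ j → 1# + ι (j · h) * z t)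

 P-block : ℕ → ℕ → Fun → Fun
 P-block h e y t = Π< (p ^ e) (λ j → y t + ι (j · h))

 P≡L : ∀ h e y t → y t ≢ 0# → P-block h e y t ≡ y t ↑ (p ^ e) * L h e (λ t → inv (y t)) t
 P≡L h e y t ne = trans (Π-ext (p ^ e) (λ j → eq (ι (j · h))))
   (trans (Π-* (p ^ e) (λ _ → y t) _) (cong (_* L h e (λ t → inv (y t)) t) (Π-const (p ^ e) (y t))))
  where
  eq : ∀ x → y t + x ≡ y t * (1# + x * inv (y t))
  eq x = trans (cong (y t +_) (trans (sym (*-idʳ x)) (cong (x *_) (sym (inv-r {y t} ne)))))
   (solve 3 (λ y x i → y :+ x :* (y :* i) := y :* (:1 :+ x :* i)) refl (y t) x (inv (y t)))

 module _ (h : ℕ) (p∣h : p ∣ h) (z : Fun) (mz : M₁ 0 z) where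
  private
   hz : M₁ 1 (λ t → ι h * z t)
   hz = M-* (M-const (Dv-ι∣ {1} (subst (_∣ h) (sym (Nat.*-identityʳ p)) p∣h))) mz

   jhz : ∀ j → M₁ 1 (λ t → ι (j · h) * z t)
   jhz j = M-resp (λ t _ → trans (sym (*-assoc (ι j) (ι h) (z t))) (cong (_* z t) (sym (ι-* j h)))) (M₁-ι· j hz)

   f1 : ∀ j → Cg 1 (λ t → 1# + ι (j · h) * z t) one
   f1 j = M-resp (λ t _ → solve 1 (λ x → x := (:1 :+ x) :- :1) refl (ι (j · h) * z t)) (jhz j)

   L1 : ∀ e → Cg 1 (L h e z) one
   L1 e = Cg-Π1 (p ^ e) (λ j _ → f1 j)

  -- The p^(e+2) factors form p blocks of length p^(e+1). Translating a block adds a multiple of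
  -- p^(e+2) to each factor, which to first order changes the product by p^(e+1) times as much and
  -- is negligible. So modulo p^(e+3) the product is a p-th power, and `pow-p` gains the factor p.
  L-step : ∀ e → Cg (suc (suc e)) (L h (suc e) z) one → Cg (suc (suc (suc e))) (L h (suc (suc e)) z) one
  L-step e c = Cg-trans (Cg-resp (λ t → sym (eq t)) (λ t → Π-const p (L h (suc e) z t))
    (Cg-Π p (λ i _ → Cg-mem (blk i) (Cg-mem (L1 (suc e)) M-1)) (λ i _ → Cg-mem (L1 (suc e)) M-1) (λ i _ → blk i)))
    (pow-p (suc e) c)
   where
   q = p ^ suc e
   ε : ℕ → Fun
   ε i t = ι (i · q · h) * z t
   mε : ∀ i → M₁ (suc (suc e)) (ε i)
   mε i = M-resp (λ t _ → trans (solve 4 (λ i q h z → (i :* q) :* (h :* z) := i :* q :* h :* z) refl (ι i) (ι q) (ι h) (z t))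
      (cong (_* z t) (trans (cong (_* ι h) (sym (ι-* i q))) (sym (ι-* (i · q) h)))))
     (M-weaken (Nat.≤-reflexive (Nat.+-comm 1 (suc e))) (M-* (M-* (M-const (Dv-ι i)) (M-const (Dv-ι∣ {suc e} ∣-refl))) hz))
   blk : ∀ i → Cg (suc (suc (suc e))) (λ t → Π< q (λ j → 1# + ι ((j ∔ i · q) · h) * z t)) (L h (suc e) z)
   blk i = Cg-trans (Cg-resp (λ t → Π-ext q (λ j → trans (solve 4 (λ o x y z → (o :+ x :* z) :+ y :* z := o :+ (x :+ y) :* z) refl 1# (ι (j · h)) (ι (i · q · h)) (z t))
       (cong (λ w → 1# + w * z t) (trans (sym (ι-+ (j · h) (i · q · h))) (cong ι (sym (Nat.*-distribʳ-+ h j (i · q)))))))) (λ _ → refl)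
      (prod-ε (suc e) q (λ j t → 1# + ι (j · h) * z t) (ε i) f1 (mε i)))
     (M-resp (λ t _ → solve 2 (λ a b → b := (a :+ b) :- a) refl (L h (suc e) z t) (ι q * ε i t))
      (M-weaken (s≤s (Nat.m≤n+m _ e)) (M-* (M-const (Dv-ι∣ {suc e} ∣-refl)) (mε i))))
   eq : ∀ t → L h (suc (suc e)) z t ≡ Π< p (λ i → Π< q (λ j → 1# + ι ((j ∔ i · q) · h) * z t))
   eq t = Π-block p q (λ j → 1# + ι (j · h) * z t)

  L-from : ∀ e₀ → Cg (suc (suc e₀)) (L h (suc e₀) z) one → ∀ e → Cg (suc (suc (e ∔ e₀))) (L h (suc (e ∔ e₀)) z) one
  L-from e₀ c zero = c
  L-from e₀ c (suc e) = L-step (e ∔ e₀) (L-from e₀ c e)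

  -- Modulo p² the product is linear in η = h z, because p divides h and all products of two such
  -- terms vanish; the coefficient is a triangular number.
  prod-1+iη : ∀ n → Cg 2 (λ t → Π< n (λ i → 1# + ι (i · h) * z t)) (λ t → 1# + ι (#< n (λ i → i)) * (ι h * z t))
  prod-1+iη zero = Cg-≡ (λ t → sym (trans (cong (1# +_) (*-0ˡ _)) (+-idʳ 1#)))
  prod-1+iη (suc n) = M-resp (λ t _ → trans (lem (A t) (ι (#< n (λ i → i))) (ι n) (ι h * z t))
    (cong₂ (λ x y → A t * (1# + x) - (1# + y * (ι h * z t))) (trans (sym (*-assoc _ _ _)) (cong (_* z t) (sym (ι-* n h)))) (sym (ι-+ _ n))))
   (M-+ (M-*0 (prod-1+iη n) (M-+ M-1 (M-weaken z≤n (M₁-ι· n hz)))) (M-* (M₁-ι· (#< n (λ i → i)) hz) (M₁-ι· n hz)))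
   where
   A : Fun
   A t = Π< n (λ i → 1# + ι (i · h) * z t)
   lem : ∀ A s n η → (A - (1# + s * η)) * (1# + n * η) + (s * η) * (n * η) ≡ A * (1# + n * η) - (1# + (s + n) * η)
   lem = solve 4 (λ A s n η → (A :- (:1 :+ s :* η)) :* (:1 :+ n :* η) :+ (s :* η) :* (n :* η)
       := A :* (:1 :+ n :* η) :- (:1 :+ (s :+ n) :* η)) refl

  private
   base : (p ∣ #< p (λ i → i)) → Cg 2 (L h 1 z) one
   base d = Cg-trans (Cg-resp (λ t → cong (λ k → Π< k (λ j → 1# + ι (j · h) * z t)) (sym (Nat.*-identityʳ p))) (λ _ → refl) (prod-1+iη p))
    (M-resp (λ t _ → solve 1 (λ x → x := (:1 :+ x) :- :1) refl _)
     (M-* (M-const (Dv-ι∣ {1} (subst (_∣ #< p (λ i → i)) (sym (Nat.*-identityʳ p)) d))) hz))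

  -- The triangular number p(p-1)/2 is divisible by p exactly when p is odd.
  L-odd : p ≢ 2 → ∀ e → Cg (suc e) (L h e z) one
  L-odd p≢2 zero = Cg-≡ (λ t → solve 1 (λ z → :1 :* (:1 :+ :0 :* z) := :1) refl (z t))
  L-odd p≢2 (suc e) = subst (λ k → Cg (suc (suc k)) (L h (suc k) z) one) (Nat.+-identityʳ e) (L-from 0 (base (tri)) e)
   where
   gauss : ∀ n → 2 · #< n (λ i → i) ≡ n · (n ∸ 1)
   gauss zero = refl
   gauss (suc zero) = refl
   gauss (suc (suc n)) = trans (Nat.*-distribˡ-+ 2 (#< (suc n) (λ i → i)) (suc n)) (trans (cong (_∔ 2 · suc n) (gauss (suc n)))
    (S.solve 1 (λ n → (S.con 1 S.:+ n) S.:* n S.:+ S.con 2 S.:* (S.con 1 S.:+ n) S.:= (S.con 2 S.:+ n) S.:* (S.con 1 S.:+ n)) refl n))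
    where module S = +-*-Solver
   tri : p ∣ #< p (λ i → i)
   tri with euclidsLemma 2 (#< p (λ i → i)) pp (subst (p ∣_) (sym (gauss p)) (m∣m*n _))
   ... | inj₂ d = d
   ... | inj₁ d with ∣⇒≤ d
   ... | p≤2 = ⊥-elim (p≢2 (Nat.≤-antisym p≤2 1<p))

  L-4∣ : p ≡ 2 → 4 ∣ h → ∀ e → Cg (suc e) (L h e z) one
  L-4∣ refl d zero = Cg-≡ (λ t → solve 1 (λ z → :1 :* (:1 :+ :0 :* z) := :1) refl (z t))
  L-4∣ refl d (suc e) = subst (λ k → Cg (suc (suc k)) (L h (suc k) z) one) (Nat.+-identityʳ e) (L-from 0 b e)
   where
   b : Cg 2 (L h 1 z) one
   b = M-resp (λ t _ → trans (solve 1 (λ x → x := :1 :* (:1 :+ :0) :* (:1 :+ x) :- :1) refl (ι h * z t))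
       (cong₂ (λ u w → 1# * (1# + u) * (1# + w * z t) - 1#) (sym (*-0ˡ (z t))) (cong ι (sym (Nat.*-identityˡ h)))))
      (M-* (M-const (Dv-ι∣ {2} d)) mz)

  -- p = 2 and h ≡ 2 mod 4: here y = (h/2) z is an odd function, so y + 1 is even.
  module _ (p2 : p ≡ 2) (y1 : ∀ g → h ≡ g · 2 → M₁ 1 (λ t → 1# + ι g * z t)) where
   private
    g : ℕ
    g = _∣_.quotient (subst (_∣ h) p2 p∣h)
    hg : h ≡ g · 2
    hg = _∣_.equality (subst (_∣ h) p2 p∣h)
    Y : Fun
    Y t = ι g * z t
    D2 : ∀ k → Dv k (ι (2 ^ k))
    D2 k = subst (λ q → Dv k (ι (q ^ k))) p2 (Dv-ι∣ {k} ∣-refl)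
    ηY : ∀ j t → ι (j · h) * z t ≡ ι (j · 2) * Y t
    ηY j t = trans (cong (λ w → ι w * z t) (trans (cong (j ·_) (trans hg (Nat.*-comm g 2))) (sym (Nat.*-assoc j 2 g)))) (trans (cong (_* z t) (ι-* (j · 2) g)) (*-assoc _ _ _))
    mY : M₁ 0 Y
    mY = M₁-ι· g mz

   L-2-1 : Cg 2 (L h 1 z) (λ _ → - 1#)
   L-2-1 = M-resp (λ t _ → trans (solve 1 (λ y → con (ℤ.+ 2) :* (:1 :+ y) := (:1 :* (:1 :+ :0 :* y)) :* (:1 :+ con (ℤ.+ 2) :* y) :- (:- :1)) refl (Y t))
     (trans (cong (_- (- 1#)) (cong₂ (λ u w → (1# * (1# + u)) * (1# + w)) (sym (ηY 0 t)) (sym (ηY 1 t)))) (cong (λ q → Π< (q ^ 1) (λ j → 1# + ι (j · h) * z t) - (- 1#)) (sym p2))))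
    (M-* (M-const (D2 1)) (y1 g hg))

   -- The three nontrivial factors multiply to 1 + 12y + 44y² + 48y³. The part not divisible by 8 is
   -- grouped as 12y(1 + y), whose last factor is even.
   L-2-2 : Cg 3 (L h 2 z) one
   L-2-2 = M-resp (λ t _ → trans (solve 1 (λ y → con (ℤ.+ 4) :* (con (ℤ.+ 3) :* y :* (:1 :+ y)) :+ con (ℤ.+ 8) :* (con (ℤ.+ 4) :* y :* y :+ con (ℤ.+ 6) :* y :* y :* y)
        := (:1 :* (:1 :+ :0 :* y)) :* (:1 :+ con (ℤ.+ 2) :* y) :* (:1 :+ con (ℤ.+ 4) :* y) :* (:1 :+ con (ℤ.+ 6) :* y) :- :1) refl (Y t))
     (trans (cong (_- 1#) (cong₂ _*_ (cong₂ _*_ (cong₂ (λ u w → (1# * (1# + u)) * (1# + w)) (sym (ηY 0 t)) (sym (ηY 1 t))) (cong (1# +_) (sym (ηY 2 t)))) (cong (1# +_) (sym (ηY 3 t)))))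
         (cong (λ q → Π< (q ^ 2) (λ j → 1# + ι (j · h) * z t) - 1#) (sym p2))))
    (M-+ (M-* (M-const (D2 2)) (M-* (M₁-ι· 3 mY) (y1 g hg)))
       (M-weaken Nat.≤-refl (M-* (M-const (D2 3)) (M-+ (M-* (M₁-ι· 4 mY) mY) (M-* (M-* (M₁-ι· 6 mY) mY) mY)))))

   L-2-≥2 : ∀ e → Cg (suc (suc (suc e))) (L h (suc (suc e)) z) one
   L-2-≥2 e = subst (λ k → Cg (suc (suc k)) (L h (suc k) z) one) (Nat.+-comm e 1) (L-from 1 L-2-2 e)

-- Fermat's little theorem and congruences between p-integral rationals.

module Fermat (p : ℕ) (pp : Prime p) where
 open Q
 open Sums
 open import Data.Nat.Base using (_≤_; _<_; _∸_; _^_) renaming (_+_ to _∔_; _*_ to _·_)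

 open Padic p pp
 open import Data.Nat.Divisibility using (_∣_; divides; ∣m∣n⇒∣m+n; m∣m*n; ∣⇒≤; ∣m⇒∣m*n; _∣0)
 private module S = +-*-Solver

 bin : ℕ → ℕ → ℕ
 bin n zero = 1
 bin zero (suc k) = 0
 bin (suc n) (suc k) = bin n k ∔ bin n (suc k)

 bin-> : ∀ n k → n < k → bin n k ≡ 0
 bin-> zero (suc k) _ = refl
 bin-> (suc n) (suc k) (s≤s l) = cong₂ _∔_ (bin-> n k l) (bin-> n (suc k) (Nat.m<n⇒m<1+n l))

 -- With n + 1 = p this forces p to divide the inner binomial coefficients, k + 1 being prime to p.
 absorb : ∀ n k → suc k · bin (suc n) (suc k) ≡ suc n · bin n k
 absorb zero zero = refl
 absorb zero (suc k) = Nat.*-zeroʳ (suc (suc k))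
 absorb (suc n) zero = trans (S.solve 1 (λ b → S.con 1 S.:* (S.con 1 S.:+ b) S.:= S.con 1 S.:+ S.con 1 S.:* b) refl (bin (suc n) 1)) (cong suc (absorb n 0))
 absorb (suc n) (suc k) = trans (S.solve 3 (λ k x y → (S.con 2 S.:+ k) S.:* (x S.:+ y) S.:= (S.con 1 S.:+ k) S.:* x S.:+ x S.:+ (S.con 2 S.:+ k) S.:* y) refl k (bin (suc n) (suc k)) (bin (suc n) (suc (suc k))))
  (trans (cong₂ (λ a b → a ∔ bin (suc n) (suc k) ∔ b) (absorb n k) (absorb n (suc k)))
   (S.solve 3 (λ n x y → (S.con 1 S.:+ n) S.:* x S.:+ (x S.:+ y) S.:+ (S.con 1 S.:+ n) S.:* y S.:= (S.con 2 S.:+ n) S.:* (x S.:+ y)) refl n (bin n k) (bin n (suc k))))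

 binomial : ∀ a n → suc a ^ n ≡ #< (suc n) (λ k → bin n k · a ^ k)
 binomial a zero = refl
 binomial a (suc n) = begin
  suc a · suc a ^ n                ≡⟨ cong (suc a ·_) (binomial a n) ⟩
  suc a · X                          ≡⟨ Nat.+-comm X (a · X) ⟩
  a · X ∔ X                          ≡⟨ cong (a · X ∔_) (trans (sym (Nat.+-identityʳ X)) (cong (λ z → X ∔ z · a ^ suc n) (sym (bin-> n (suc n) Nat.≤-refl)))) ⟩
  a · X ∔ #< (suc (suc n)) (λ k → bin n k · a ^ k)  ≡⟨ cong (a · X ∔_) (#-first (suc n) _) ⟩
  a · X ∔ (1 ∔ Y)                    ≡⟨ S.solve 2 (λ x y → x S.:+ (S.con 1 S.:+ y) S.:= S.con 1 S.:+ (x S.:+ y)) refl (a · X) Y ⟩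
  1 ∔ (a · X ∔ Y)                    ≡⟨ cong (λ z → 1 ∔ (z ∔ Y)) (sym (#-*ˡ (suc n) a _)) ⟩
  1 ∔ (#< (suc n) (λ k → a · (bin n k · a ^ k)) ∔ Y) ≡⟨ cong (1 ∔_) (sym (#-+ (suc n) _ _)) ⟩
  1 ∔ #< (suc n) (λ k → a · (bin n k · a ^ k) ∔ bin n (suc k) · a ^ suc k)
   ≡⟨ cong (1 ∔_) (#-ext (suc n) (λ k → S.solve 4 (λ a x y e → a S.:* (x S.:* e) S.:+ y S.:* (a S.:* e) S.:= (x S.:+ y) S.:* (a S.:* e)) refl a (bin n k) (bin n (suc k)) (a ^ k))) ⟩
  1 ∔ #< (suc n) (λ k → bin (suc n) (suc k) · a ^ suc k) ≡⟨ #-first (suc n) _ ⟨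
  #< (suc (suc n)) (λ k → bin (suc n) k · a ^ k) ∎
  where
  open ≡-Reasoning
  X = #< (suc n) (λ k → bin n k · a ^ k)
  Y = #< (suc n) (λ k → bin n (suc k) · a ^ suc k)

 ∣-# : ∀ {d} n f → (∀ i → i < n → d ∣ f i) → d ∣ #< n f
 ∣-# zero f h = _ ∣0
 ∣-# (suc n) f h = ∣m∣n⇒∣m+n (∣-# n f (λ i l → h i (Nat.m<n⇒m<1+n l))) (h n Nat.≤-refl)

 <p⇒∤ : ∀ {k} → 0 < k → k < p → ¬ p ∣ k
 <p⇒∤ {suc k} _ l d = Nat.<⇒≱ l (∣⇒≤ d)

 private
  p-1 = p ∸ 1
  p≡ : p ≡ suc p-1
  p≡ = sym (Nat.m+[n∸m]≡n (Nat.<⇒≤ 1<p))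

  p∣bin : ∀ k → suc k < p → p ∣ bin p (suc k)
  p∣bin k l with euclidsLemma (suc k) (bin p (suc k)) pp (subst (λ q → q ∣ suc k · bin q (suc k)) (sym p≡) (subst (suc p-1 ∣_) (sym (absorb p-1 k)) (m∣m*n _)))
  ... | inj₁ d = ⊥-elim (<p⇒∤ (s≤s z≤n) l d)
  ... | inj₂ d = d

  bin-diag : ∀ n → bin n n ≡ 1
  bin-diag zero = refl
  bin-diag (suc n) = cong₂ _∔_ (bin-diag n) (bin-> n (suc n) Nat.≤-refl)

  fermat′ : ∀ a → Σ ℕ λ c → a ^ p ≡ a ∔ p · c
  fermat′ zero = 0 , trans (cong (0 ^_) p≡) (sym (Nat.*-zeroʳ p))
  fermat′ (suc a) with fermat′ a | ∣-# p-1 (λ k → bin p (suc k) · a ^ suc k) (λ k l → ∣m⇒∣m*n _ (p∣bin k (subst (suc k <_) (sym p≡) (s≤s l))))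
  ... | c , ec | divides q eq = q ∔ c , (begin
   suc a ^ p                                             ≡⟨ binomial a p ⟩
   #< (suc p) (λ k → bin p k · a ^ k)                    ≡⟨ #-first p _ ⟩
   1 ∔ #< p (λ k → bin p (suc k) · a ^ suc k)            ≡⟨ cong (λ z → 1 ∔ #< z (λ k → bin p (suc k) · a ^ suc k)) p≡ ⟩
   1 ∔ (#< p-1 (λ k → bin p (suc k) · a ^ suc k) ∔ bin p (suc p-1) · a ^ suc p-1)
    ≡⟨ cong₂ (λ x y → 1 ∔ (x ∔ y)) eq (trans (cong₂ (λ x y → bin p x · a ^ y) (sym p≡) (sym p≡)) (trans (cong (_· a ^ p) (bin-diag p)) (trans (Nat.*-identityˡ _) ec))) ⟩
   1 ∔ (q · p ∔ (a ∔ p · c))                               ≡⟨ S.solve 4 (λ q p a c → S.con 1 S.:+ (q S.:* p S.:+ (a S.:+ p S.:* c)) S.:= (S.con 1 S.:+ a) S.:+ p S.:* (q S.:+ c)) refl q p a c ⟩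
   suc a ∔ p · (q ∔ c)                                     ∎)
   where open ≡-Reasoning

 cg-* : ∀ {k x x' y y'} → Z x → Z y' → Dv k (x - x') → Dv k (y - y') → Dv k (x * y - x' * y')
 cg-* {k} {x} {x'} {y} {y'} zx zy' c d = subst (Dv k) (solve 4 (λ a a' b b' → a :* (b :- b') :+ (a :- a') :* b' := a :* b :- a' :* b') refl x x' y y')
  (Dv-+ (Dv-* (Z⇒Dv zx) d) (subst (λ n → Dv n ((x - x') * y')) (Nat.+-identityʳ k) (Dv-* c (Z⇒Dv zy'))))

 cg-refl : ∀ {k x} → Dv k (x - x)
 cg-refl {x = x} = subst (Dv _) (sym (-‿inverse x)) Dv-0

 cg-trans : ∀ {k x y z} → Dv k (x - y) → Dv k (y - z) → Dv k (x - z)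
 cg-trans {x = x} {y} {z} c d = subst (Dv _) (solve 3 (λ a b c → (a :- b) :+ (b :- c) := a :- c) refl x y z) (Dv-+ c d)

 Z-↑ : ∀ {x} n → Z x → Z (x ↑ n)
 Z-↑ zero z = Z-ι 1
 Z-↑ (suc n) z = Z-* z (Z-↑ n z)

 cg-↑ : ∀ {k x y} n → Z x → Z y → Dv k (x - y) → Dv k (x ↑ n - y ↑ n)
 cg-↑ zero zx zy c = cg-refl
 cg-↑ (suc n) zx zy c = cg-* zx (Z-↑ n zy) c (cg-↑ n zx zy c)

 Z-Π : ∀ n {f} → (∀ i → i < n → Z (f i)) → Z (Π< n f)
 Z-Π zero h = Z-ι 1
 Z-Π (suc n) h = Z-* (Z-Π n (λ i l → h i (Nat.m<n⇒m<1+n l))) (h n Nat.≤-refl)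

 cg-Π : ∀ {k} n {f g} → (∀ i → i < n → Z (f i)) → (∀ i → i < n → Z (g i)) → (∀ i → i < n → Dv k (f i - g i)) → Dv k (Π< n f - Π< n g)
 cg-Π zero a b h = cg-refl
 cg-Π (suc n) a b h = cg-* (Z-Π n (λ i l → a i (Nat.m<n⇒m<1+n l))) (b n Nat.≤-refl)
  (cg-Π n (λ i l → a i (Nat.m<n⇒m<1+n l)) (λ i l → b i (Nat.m<n⇒m<1+n l)) (λ i l → h i (Nat.m<n⇒m<1+n l))) (h n Nat.≤-refl)

 Dv-unit-cancel : ∀ {k u x} → UnitQ u → Dv k (u * x) → Dv k x
 Dv-unit-cancel {k} {u} {x} un d = subst (Dv k) (trans (sym (*-assoc (inv u) u x)) (trans (cong (_* x) (inv-l {u} (nonzero un))) (*-idˡ x))) (Dv-* (Z⇒Dv (invInt un)) d)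

 ¬UnitQ-Dv : ∀ {x} → UnitQ x → ¬ Dv 1 x
 ¬UnitQ-Dv {x} u (dmk q zq e) = ¬Z-inv-π (subst Z (inv-unique π (q * inv x) eq) (Z-* zq (invInt u)))
  where
  eq : π * (q * inv x) ≡ 1#
  eq = trans (sym (*-assoc π q (inv x))) (trans (cong (_* inv x) (trans (cong (_* q) (sym (*-idʳ π))) (sym e))) (inv-r {x} (nonzero u)))

 fermat : ∀ {a} → ¬ p ∣ a → Dv 1 (ι a ↑ p-1 - 1#)
 fermat {a} na with fermat′ a
 ... | c , e = Dv-unit-cancel (UnitQ-ι na) (dmk (ι c) (Z-ι c) (begin
   ι a * (ι a ↑ p-1 - 1#)       ≡⟨ solve 2 (λ a b → a :* (b :- :1) := a :* b :- a) refl (ι a) (ι a ↑ p-1) ⟩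
   ι a ↑ suc p-1 - ι a          ≡⟨ cong (_- ι a) (trans (sym (ι-^ a (suc p-1))) (trans (cong (λ k → ι (a ^ k)) (sym p≡)) (trans (cong ι e) (trans (ι-+ a (p · c)) (cong (ι a +_) (ι-* p c)))))) ⟩
   ι a + π * ι c - ι a          ≡⟨ solve 3 (λ a b c → a :+ b :* c :- a := b :* :1 :* c) refl (ι a) π (ι c) ⟩
   π ↑ 1 * ι c                  ∎))
  where open ≡-Reasoning

 residue : ∀ {x} → Z x → Σ ℕ λ n → Dv 1 (x - ι n)
 residue {x} (zmk a b nb e) with zres a
  where
  zres : ∀ a → Σ ℕ λ n → Dv 1 (ιz a - ι n)
  zres (ℤ.+ n) = n , cg-refl
  zres ℤ.-[1+ n ] = suc n · p-1 , subst (Dv 1) eq (Dv-neg (Dv-* {1} {0} (Dv-π₀ 1) (Dv-ι (suc n))))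
   where
   eq : - (π ↑ 1 * ι (suc n)) ≡ ιz ℤ.-[1+ n ] - ι (suc n · p-1)
   eq = trans (cong (λ z → - (z * 1# * ι (suc n))) (trans (cong ι p≡) (ι-suc p-1)))
    (trans (solve 2 (λ q n → :- ((:1 :+ q) :* :1 :* n) := :- n :- n :* q) refl (ι p-1) (ι (suc n)))
     (cong₂ _-_ (sym (ιz-neg (ℤ.+ suc n))) (sym (ι-* (suc n) p-1))))
 -- By Fermat's theorem b^(p-2) inverts b modulo p.
 ... | n , d = n · b ^ (p-1 ∸ 1) , cg-trans
    (subst (λ z → Dv 1 (z - ι n * inv (ι b))) xeq (cg-* {1} {ιz a} {ι n} {inv (ι b)} {inv (ι b)} (Z-ιz a) (Z-inv nb) d cg-refl))
    (subst (λ z → Dv 1 (ι n * inv (ι b) - z)) (trans (cong (ι n *_) (sym (ι-^ b (p-1 ∸ 1)))) (sym (ι-* n _)))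
     (cg-* (Z-ι n) (Z-↑ (p-1 ∸ 1) (Z-ι b)) cg-refl binv))
  where
  xeq : ιz a * inv (ι b) ≡ x
  xeq = trans (cong (_* inv (ι b)) (sym e)) (trans (*-assoc x (ι b) (inv (ι b))) (trans (cong (x *_) (inv-r {ι b} (ι≢0 (∤⇒≢0 nb)))) (*-idʳ x)))
  p-1≡ : p-1 ≡ suc (p-1 ∸ 1)
  p-1≡ = sym (Nat.m+[n∸m]≡n (Nat.≤-pred (subst (2 ≤_) p≡ 1<p)))
  binv : Dv 1 (inv (ι b) - ι b ↑ (p-1 ∸ 1))
  binv = Dv-unit-cancel (UnitQ-ι nb) (subst (Dv 1) (trans (cong (λ z → - (z - 1#)) (cong (ι b ↑_) p-1≡))
    (trans (solve 2 (λ b x → :- (b :* x :- :1) := :1 :- b :* x) refl (ι b) (ι b ↑ (p-1 ∸ 1)))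
     (trans (cong (_- ι b * ι b ↑ (p-1 ∸ 1)) (sym (inv-r {ι b} (ι≢0 (∤⇒≢0 nb))))) (solve 3 (λ b x y → b :* x :- b :* y := b :* (x :- y)) refl (ι b) (inv (ι b)) (ι b ↑ (p-1 ∸ 1)))))) (Dv-neg (fermat nb)))

 fermatQ : ∀ {x} → UnitQ x → Dv 1 (x ↑ p-1 - 1#)
 fermatQ {x} u = go (residue (integral u))
  where
  go : Σ ℕ (λ n → Dv 1 (x - ι n)) → Dv 1 (x ↑ p-1 - 1#)
  go (n , d) = cg-trans {1} {x ↑ p-1} {ι n ↑ p-1} {1#} (cg-↑ p-1 (integral u) (Z-ι n) d) (fermat {n} p∤n)
   where
   p∤n : ¬ p ∣ n
   p∤n pn = ¬UnitQ-Dv u (subst (Dv 1) (solve 2 (λ x n → (x :- n) :+ n := x) refl x (ι n))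
    (Dv-+ d (Dv-ι∣ {1} (subst (_∣ n) (sym (Nat.*-identityʳ p)) pn))))

 -- Writing x = 1 + p a/b gives x = (b + p a)/b with a numerator prime to p; the two cases of `zinv`
 -- are the sign of that numerator.
 UnitQ-≡1 : ∀ {x} → Dv 1 (x - 1#) → UnitQ x
 UnitQ-≡1 {x} d@(dmk q (zmk a b nb e) eq) = unitQ zx (zinv (ℤ.+ b ℤ.+ ℤ.+ p ℤ.* a) refl) nz
  where
  zx : Z x
  zx = subst Z (solve 1 (λ x → (x :- :1) :+ :1 := x) refl x) (Z-+ (Dv⇒Z d) (Z-ι 1))
  nz : x ≢ 0#
  nz x0 = ¬UnitQ-Dv UnitQ-1 (subst (Dv 1) (trans (cong (λ z → - (z - 1#)) x0) (solve 1 (λ o → :- (:0 :- o) := o) refl 1#)) (Dv-neg d))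
  xb : x * ι b ≡ ιz (ℤ.+ b ℤ.+ ℤ.+ p ℤ.* a)
  xb = trans (solve 2 (λ x b → x :* b := b :+ (x :- :1) :* b) refl x (ι b))
   (trans (cong (λ z → ι b + z * ι b) eq) (trans (solve 3 (λ b p q → b :+ (p :* :1 :* q) :* b := b :+ p :* (q :* b)) refl (ι b) π q)
    (trans (cong (λ z → ι b + π * z) e) (sym (trans (ιz-+ (ℤ.+ b) (ℤ.+ p ℤ.* a)) (cong (ι b +_) (ιz-* (ℤ.+ p) a)))))))
  pabs : ∀ c → ℤ.+ b ℤ.+ ℤ.+ p ℤ.* a ≡ c → ¬ p ∣ ℤ.∣ c ∣
  pabs c ec pc = ¬UnitQ-Dv (UnitQ-ι nb) (subst (Dv 1) (trans (cong (_- π * ιz a) (trans (cong ιz (sym ec)) (trans (ιz-+ (ℤ.+ b) (ℤ.+ p ℤ.* a)) (cong (ι b +_) (ιz-* (ℤ.+ p) a))))) (solve 2 (λ b y → (b :+ y) :- y := b) refl (ι b) (π * ιz a)))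
    (Dv-- (dc c pc) (subst (Dv 1) (cong (_* ιz a) (*-idʳ π)) (Dv-* {1} {0} (Dv-π₀ 1) (Z⇒Dv (Z-ιz a))))))
   where
   dc : ∀ c → p ∣ ℤ.∣ c ∣ → Dv 1 (ιz c)
   dc (ℤ.+ n) d = Dv-ι∣ {1} (subst (_∣ n) (sym (Nat.*-identityʳ p)) d)
   dc ℤ.-[1+ n ] d = subst (Dv 1) (sym (ιz-neg (ℤ.+ suc n))) (Dv-neg (Dv-ι∣ {1} (subst (_∣ suc n) (sym (Nat.*-identityʳ p)) d)))
  zinv : ∀ c → ℤ.+ b ℤ.+ ℤ.+ p ℤ.* a ≡ c → Z (inv x)
  zinv c₀@(ℤ.+ n) ec = zmk (ℤ.+ b) n (pabs c₀ ec) (trans (cong (inv x *_) (sym (trans xb (cong ιz ec)))) (trans (sym (*-assoc (inv x) x (ι b))) (trans (cong (_* ι b) (inv-l {x} nz)) (*-idˡ (ι b)))))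
  zinv c₀@(ℤ.-[1+ n ]) ec = zmk (ℤ.- ℤ.+ b) (suc n) (pabs c₀ ec)
   (trans (cong (inv x *_) (trans (solve 1 (λ y → y := :- (:- y)) refl (ι (suc n))) (cong (λ z → - z) (trans (sym (ιz-neg (ℤ.+ suc n))) (sym (trans xb (cong ιz ec)))))))
    (trans (solve 3 (λ i x b → i :* (:- (x :* b)) := :- ((i :* x) :* b)) refl (inv x) x (ι b)) (trans (cong (λ z → - (z * ι b)) (inv-l {x} nz)) (trans (cong (λ z → - z) (*-idˡ (ι b))) (sym (ιz-neg (ℤ.+ b)))))))

-- Parameters, Dwork shifts and quotients of blocks of consecutive factors.

module Parameters (p : ℕ) (pp : Prime p) (Ω : ℕ → Set) where
 open Q
 open Sums
 open import Data.Nat.Base using (_≤_; _<_; _∸_; _^_) renaming (_+_ to _∔_; _*_ to _·_)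

 open Padic p pp
 open Filt Ω
 open UnitProducts p pp Ω
 open Fermat p pp
 open import Data.Nat.Divisibility using (_∣_; _∣?_; divides; ∣-refl; ∣m∣n⇒∣m+n; ∣m+n∣m⇒∣n; ∣⇒≤; ∣n⇒∣m*n)
 open import Data.Bool.Base using (_∧_)
 private module S = +-*-Solver

 -- A p-integral parameter with denominator N: x_r/N in (0,1] is its r-th Dwork shift γ_r, and
 -- `step` reads p γ_(r+1) - γ_r = μ_r. Hence μ_r, μ_(r+1), ... are the p-adic digits of -γ_r.
 record IntP : Set where
  field
   N : ℕ
   x μ : ℕ → ℕ
   p∤N : ¬ p ∣ N
   x≥1 : ∀ r → 1 ≤ x r
   x≤N : ∀ r → x r ≤ N
   step : ∀ r → p · x (suc r) ≡ x r ∔ μ r · N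
   μ<p : ∀ r → μ r < p

 -- A parameter whose denominator N is divisible by p. Its factors are multiplied by N, which makes
 -- each x + jN a unit, and x varies with t. The congruence `x-cong` will come from a shift that
 -- multiplies t by a number congruent to 1 modulo p.
 record NonP : Set where
  field
   N : ℕ
   x : ℕ → ℕ → ℕ
   p∣N : p ∣ N
   x≥1 : ∀ r t → 1 ≤ x r t
   x-unit : ∀ r t → Ω t → ¬ p ∣ x r t
   x-mem : ∀ r → M₀ 0 (λ t → ι (x r t))
   x-cong : ∀ r t → Ω t → Dv 1 (ι (x (suc r) t) - ι (x r t))

 data Param : Set where
  int : IntP → Param
  non : NonP → Param

 module _ (q : IntP) where
  open IntP q
  γ : ℕ → ℚ
  γ r = ι (x r) * inv (ι N)

  N≢0 : ι N ≢ 0#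
  N≢0 = ι≢0 (∤⇒≢0 p∤N)

  γ-Z : ∀ r → Z (γ r)
  γ-Z r = Z-* (Z-ι (x r)) (Z-inv p∤N)

  γ+ : ∀ r j → γ r + ι j ≡ ι (x r ∔ j · N) * inv (ι N)
  γ+ r j = sym (trans (cong (_* inv (ι N)) (trans (ι-+ (x r) (j · N)) (cong (ι (x r) +_) (ι-* j N))))
   (trans (solve 4 (λ x j n i → (x :+ j :* n) :* i := x :* i :+ j :* (n :* i)) refl (ι (x r)) (ι j) (ι N) (inv (ι N)))
    (cong (γ r +_) (trans (cong (ι j *_) (inv-r {ι N} N≢0)) (*-idʳ (ι j))))))

  γ-step : ∀ r → π * γ (suc r) ≡ γ r + ι (μ r)
  γ-step r = trans (sym (*-assoc π (ι (x (suc r))) (inv (ι N)))) (trans (cong (_* inv (ι N)) (trans (sym (ι-* p (x (suc r)))) (cong ι (step r)))) (sym (γ+ r (μ r))))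

  γ-dwork : ∀ r u → γ r + ι (μ r ∔ u · p) ≡ π * (γ (suc r) + ι u)
  γ-dwork r u = trans (cong (γ r +_) (trans (ι-+ (μ r) (u · p)) (cong (ι (μ r) +_) (ι-* u p))))
   (trans (solve 4 (λ g m u p → g :+ (m :+ u :* p) := (g :+ m) :+ p :* u) refl (γ r) (ι (μ r)) (ι u) π)
    (trans (cong (_+ π * ι u) (sym (γ-step r))) (sym (*-distribˡ π (γ (suc r)) (ι u)))))

 fac : Param → ℕ → ℕ → Fun
 fac (int q) r j t = γ q r + ι j
 fac (non q) r j t = ι (NonP.x q r t) + ι (j · NonP.N q)

 ≥1⇒≢0 : ∀ {n} → 1 ≤ n → n ≢ 0
 ≥1⇒≢0 (s≤s _) ()

 fac≢0 : ∀ g r j t → fac g r j t ≢ 0#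
 fac≢0 (int q) r j t e = *-≢0 (ι≢0 (≥1⇒≢0 (Nat.≤-trans (IntP.x≥1 q r) (Nat.m≤m+n _ (j · IntP.N q))))) (inv-≢0 {ι (IntP.N q)} (N≢0 q)) (trans (sym (γ+ q r j)) e)
 fac≢0 (non q) r j t e = ι≢0 (≥1⇒≢0 (Nat.≤-trans (NonP.x≥1 q r t) (Nat.m≤m+n _ (j · NonP.N q)))) (trans (ι-+ _ (j · NonP.N q)) e)

 R : Param → ℕ → ℕ → ℕ → Fun
 R g r j l t = Π< l (λ i → fac g r (j ∔ i) t)

 Π-≢0 : ∀ n {f} → (∀ i → i < n → f i ≢ 0#) → Π< n f ≢ 0#
 Π-≢0 zero h = 1≢0
 Π-≢0 (suc n) h = *-≢0 (Π-≢0 n (λ i l → h i (Nat.m<n⇒m<1+n l))) (h n Nat.≤-refl)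

 R≢0 : ∀ g r j l t → R g r j l t ≢ 0#
 R≢0 g r j l t = Π-≢0 l (λ i _ → fac≢0 g r (j ∔ i) t)

 opaque
  p≟2 : Dec (p ≡ 2)
  p≟2 = p Nat.≟ 2

  4∣?_ : ∀ h → Dec (4 ∣ h)
  4∣? h = 4 ∣? h

  p∣?_ : ∀ n → Dec (p ∣ n)
  p∣? n = p ∣? n

 flagH : ℕ → Bool
 flagH h = does p≟2 ∧ not (does (4∣? h))

 flag : Param → Bool
 flag (int _) = does p≟2
 flag (non q) = flagH (NonP.N q)

 -- The value modulo p^(s+1) of the product of 1 + j h z over j < p^s. For p = 2 and h ≡ 2 modulo 4
 -- the factors, scaled by a unit, run through all odd residues modulo 2^(s+1), whose product is -1
 -- for s = 1 and 1 for s ≥ 2.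
 κ : ℕ → Bool → ℚ
 κ (suc zero) true = - 1#
 κ _ _ = 1#

 κ² : ∀ s b → κ s b * κ s b ≡ 1#
 κ² zero b = *-idˡ 1#
 κ² (suc zero) true = solve 1 (λ o → :- :1 :* :- :1 := :1) refl 1#
 κ² (suc zero) false = *-idˡ 1#
 κ² (suc (suc s)) b = *-idˡ 1#

 UnitQ-neg1 : UnitQ (- 1#)
 UnitQ-neg1 = unitQ (Z-neg (Z-ι 1)) (subst Z (inv-unique (- 1#) (- 1#) (solve 1 (λ o → :- :1 :* :- :1 := :1) refl 1#)) (Z-neg (Z-ι 1)))
  (λ e → 1≢0 (trans (solve 1 (λ o → :1 := :- (:- :1)) refl 1#) (trans (cong (λ z → - z) e) (solve 1 (λ o → :- :0 := :0) refl 1#))))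

 κ-unit : ∀ s b → UnitQ (κ s b)
 κ-unit zero b = UnitQ-1
 κ-unit (suc zero) true = UnitQ-neg1
 κ-unit (suc zero) false = UnitQ-1
 κ-unit (suc (suc s)) b = UnitQ-1

 κ-const : ∀ s b {lev} → M lev 0 (λ _ → κ s b)
 κ-const s b = M-const (Z⇒Dv (integral (κ-unit s b)))

 UnitQ-≡ : ∀ {x y} → UnitQ y → Dv 1 (x - y) → UnitQ x
 UnitQ-≡ {x} {y} u d = subst UnitQ eq (UnitQ-* (UnitQ-≡1 d') u)
  where
  d' : Dv 1 (x * inv y - 1#)
  d' = subst (Dv 1) (trans (*-distribʳ (inv y) x (- y)) (cong (x * inv y +_) (trans (neg-*ˡ y (inv y)) (cong (λ z → - z) (inv-r {y} (nonzero u)))))) (Dv-* d (Z⇒Dv (invInt u)))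
  eq : x * inv y * y ≡ x
  eq = trans (*-assoc x (inv y) y) (trans (cong (x *_) (inv-l {y} (nonzero u))) (*-idʳ x))

 Cg-val : ∀ {k f g} → Cg k f g → ∀ t → Ω t → Dv k (f t - g t)
 Cg-val c t o = M.val c t o

 U-κ : ∀ {k s b W} → Cg (suc k) W (λ _ → κ s b) → U (λ m → m) W
 U-κ {k} {s} {b} c = mkU (Cg-mem c (κ-const s b)) (λ t o → UnitQ-≡ (κ-unit s b) (Dv-weaken (s≤s z≤n) (Cg-val c t o)))

 Cg-inv-κ : ∀ {k s b W} → Cg (suc k) W (λ _ → κ s b) → Cg (suc k) (λ t → inv (W t)) (λ _ → κ s b)
 Cg-inv-κ {k} {s} {b} {W} c = M-resp eq (M-neg (M-* (κ-const s b) (M-*0 c (mem (U-inv uW)))))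
  where
  uW = U-κ {k} {s} {b} c
  eq : ∀ t → Ω t → - (κ s b * ((W t - κ s b) * inv (W t))) ≡ inv (W t) - κ s b
  eq t o = trans (solve 3 (λ k w i → :- (k :* ((w :- k) :* i)) := (k :* k) :* i :- k :* (w :* i)) refl (κ s b) (W t) (inv (W t)))
   (cong₂ _-_ (trans (cong (_* inv (W t)) (κ² s b)) (*-idˡ _)) (trans (cong (κ s b *_) (inv-r {W t} (nonzero (unit uW t o)))) (*-idʳ _)))

 module _ (h : ℕ) (p∣h : p ∣ h) (y : Fun) (uy : U suc y) where
  private
   z : Fun
   z t = inv (y t)
   uz : U suc z
   uz = U-inv uy
   mz : M₁ 0 z
   mz = M₀⇒M₁ (mem uz)
   y1 : p ≡ 2 → ¬ 4 ∣ h → ∀ g → h ≡ g · 2 → M₁ 1 (λ t → 1# + ι g * z t)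
   y1 p2 n4 g hg = M₀-val⇒M₁ (M-+ M-1 (M-* (M-const (Dv-ι g)) (mem uz))) val'
    where
    odd : UnitQ (ι g)
    odd = UnitQ-ι (λ pg → n4 (subst (4 ∣_) (sym hg) (go (subst (_∣ g) p2 pg))))
     where
     go : 2 ∣ g → 4 ∣ g · 2
     go (divides k refl) = divides k (Nat.*-assoc k 2 2)
    val' : ∀ t → Ω t → Dv 1 (1# + ι g * z t)
    val' t o = subst (Dv 1) (solve 1 (λ x → con (ℤ.+ 2) :* :1 :+ (x :* :1 :- :1) := :1 :+ x) refl (ι g * z t))
     (Dv-+ (Dv-* (subst (λ q → Dv 1 (ι q)) p2 (subst (Dv 1) (*-idʳ π) (Dv-π₀ 1))) (Dv-ι 1)) (subst (λ q → Dv 1 ((ι g * z t) ↑ (q ∸ 1) - 1#)) p2 (fermatQ (UnitQ-* odd (unit uz t o)))))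

  L-κ : ∀ s → Cg (suc s) (L h s z) (λ _ → κ s (flagH h))
  L-κ zero = Cg-≡ (λ t → solve 1 (λ z → :1 :* (:1 :+ :0 :* z) := :1) refl (z t))
  L-κ (suc zero) with p≟2 | 4∣? h
  ... | no ¬2 | _ = L-odd h p∣h z mz ¬2 1
  ... | yes e | yes d = L-4∣ h p∣h z mz e d 1
  ... | yes e | no nd = L-2-1 h p∣h z mz e (y1 e nd)
  L-κ (suc (suc s)) with p≟2 | 4∣? h
  ... | no ¬2 | _ = L-odd h p∣h z mz ¬2 (suc (suc s))
  ... | yes e | yes d = L-4∣ h p∣h z mz e d (suc (suc s))
  ... | yes e | no nd = L-2-≥2 h p∣h z mz e (y1 e nd) s

  -- One power of p is given away relative to `L-κ`, and this hides the sign, -1 and 1 being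
  -- congruent modulo 2. In a quotient of a longer by a shorter product only the shorter one
  -- therefore carries a sign.
  L-suc-1 : ∀ s → Cg (suc s) (L h (suc s) z) one
  L-suc-1 (suc s) = Cg-weaken (Nat.n≤1+n _) (L-κ (suc (suc s)))
  L-suc-1 zero with p≟2 | 4∣? h
  ... | no ¬2 | _ = Cg-weaken (s≤s z≤n) (L-odd h p∣h z mz ¬2 1)
  ... | yes e | yes d = Cg-weaken (s≤s z≤n) (L-4∣ h p∣h z mz e d 1)
  ... | yes e | no nd = Cg-trans (Cg-weaken (s≤s z≤n) (L-2-1 h p∣h z mz e (y1 e nd)))
    (M-const (subst (Dv 1) (solve 1 (λ o → :- con (ℤ.+ 2) := :- :1 :- :1) refl 1#) (Dv-neg (subst (λ q → Dv 1 (ι q)) e (subst (Dv 1) (*-idʳ π) (Dv-π₀ 1))))))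

 -- The product of the nonzero residues; each p-integral parameter contributes it once per period.
 unitPart : ℕ → ℕ
 unitPart n = if does (p∣? n) then 1 else n

 w : ℚ
 w = Π< p (λ n → ι (unitPart n))

 unitPart-unit : ∀ n → UnitQ (ι (unitPart n))
 unitPart-unit n with p∣? n
 ... | yes _ = UnitQ-1
 ... | no nd = UnitQ-ι nd

 UnitQ-Π : ∀ n {f} → (∀ i → i < n → UnitQ (f i)) → UnitQ (Π< n f)
 UnitQ-Π zero h = UnitQ-1
 UnitQ-Π (suc n) h = UnitQ-* (UnitQ-Π n (λ i l → h i (Nat.m<n⇒m<1+n l))) (h n Nat.≤-refl)

 w-unit : UnitQ w
 w-unit = UnitQ-Π p (λ i _ → unitPart-unit i)

 unitPart-shift : ∀ n → Dv 1 (ι (unitPart (p ∔ n)) - ι (unitPart n))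
 unitPart-shift n with p∣? n | p∣? (p ∔ n)
 ... | yes _ | yes _ = cg-refl
 ... | yes d | no nd = ⊥-elim (nd (∣m∣n⇒∣m+n ∣-refl d))
 ... | no nd | yes d = ⊥-elim (nd (∣m+n∣m⇒∣n d ∣-refl))
 ... | no _ | no _ = subst (Dv 1) (trans (solve 2 (λ a b → a := (a :+ b) :- b) refl π (ι n)) (cong (_- ι n) (sym (ι-+ p n)))) (subst (Dv 1) (*-idʳ π) (Dv-π₀ 1))

 -- The sliding window over a period again, with terms that are periodic only modulo p^k.
 cg-shift : ∀ {k} n g → (∀ i → Z (g i)) → (∀ i → Dv k (g (n ∔ i) - g i)) → ∀ c → Dv k (Π< n (λ i → g (c ∔ i)) - Π< n g)
 cg-shift n g zg per zero = cg-refl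
 cg-shift {k} n g zg per (suc c) = cg-trans (rot n refl) (cg-shift n g zg per c)
  where
  rot : ∀ m → m ≡ n → Dv k (Π< m (λ i → g (suc c ∔ i)) - Π< m (λ i → g (c ∔ i)))
  rot zero e = cg-refl
  rot (suc m) e = subst (λ z → Dv k (Π< m (λ i → g (suc c ∔ i)) * g (suc c ∔ m) - z))
    (sym (trans (Π-first m (λ i → g (c ∔ i))) (trans (*-comm _ _) (cong₂ _*_ (Π-ext m (λ i → cong g (Nat.+-suc c i))) (cong g (Nat.+-identityʳ c))))))
    (cg-* (Z-Π m (λ i _ → zg _)) (zg c) cg-refl (subst (λ z → Dv k (g z - g c)) (trans (cong (_∔ c) (sym e)) (cong suc (Nat.+-comm m c))) (per c)))

 ωval : Param → ℚ
 ωval (int _) = w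
 ωval (non _) = 1#

 πpow : Param → ℕ → ℚ
 πpow (int _) n = π ↑ n
 πpow (non _) n = 1#

 -- Among p consecutive indices starting at v + u p exactly one is congruent to μ_r. The factor
 -- there is p(γ_(r+1) + u + shift): one period later when v has already passed μ_r.
 shift : Param → ℕ → ℕ → ℕ
 shift (int q) r v = if IntP.μ q r ℕ.<ᵇ v then 1 else 0
 shift (non q) r v = 0

 -- One block of p^(s+1) consecutive factors, compared with p^s factors of the Dwork-shifted parameter:
 -- the unit quotient E is a p^s-th power up to a sign and a factor that is 1 mod p^(s+1).
 record Block (g : Param) (r v u s : ℕ) : Set where
  field
   E Θ W : Fun
   E-eq : ∀ t → Ω t → E t ≡ Θ t ↑ (p ^ s) * W t
   Θ-U : U suc Θ
   Θ-val : ∀ t → Ω t → Dv 1 (Θ t - ωval g)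
   W-κ : Cg (suc s) W (λ _ → κ s (flag g))
   R-eq : ∀ t → Ω t → R g r (v ∔ u · p) (p ^ suc s) t ≡ E t * (πpow g (p ^ s) * R g (suc r) (u ∔ shift g r v) (p ^ s) t)

 sel : ℕ → ℕ → ℚ → ℚ
 sel z i x = if i ℕ.≡ᵇ z then 1# else x

 ≡ᵇ-refl : ∀ n → (n ℕ.≡ᵇ n) ≡ true
 ≡ᵇ-refl zero = refl
 ≡ᵇ-refl (suc n) = ≡ᵇ-refl n

 sel-eq : ∀ z x → sel z z x ≡ 1#
 sel-eq z x rewrite ≡ᵇ-refl z = refl

 ≢⇒≡ᵇ : ∀ i z → i ≢ z → (i ℕ.≡ᵇ z) ≡ false
 ≢⇒≡ᵇ zero zero ne = ⊥-elim (ne refl)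
 ≢⇒≡ᵇ zero (suc z) ne = refl
 ≢⇒≡ᵇ (suc i) zero ne = refl
 ≢⇒≡ᵇ (suc i) (suc z) ne = ≢⇒≡ᵇ i z (λ e → ne (cong suc e))

 sel-ne : ∀ z i x → i ≢ z → sel z i x ≡ x
 sel-ne z i x ne rewrite ≢⇒≡ᵇ i z ne = refl

 Π-extract : ∀ n z f → z < n → Π< n f ≡ f z * Π< n (λ i → sel z i (f i))
 Π-extract (suc n) z f l with z Nat.≟ n
 ... | yes refl = trans (*-comm _ (f z)) (cong (f z *_) (trans (sym (*-idʳ _)) (cong₂ _*_ (Π-cong z (λ i l → sym (sel-ne z i (f i) (Nat.<⇒≢ l)))) (sym (sel-eq z (f z))))))
 ... | no ne = trans (cong (_* f n) (Π-extract n z f (Nat.≤∧≢⇒< (Nat.≤-pred l) ne)))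
   (trans (*-assoc (f z) _ (f n)) (cong (f z *_) (cong (Π< n (λ i → sel z i (f i)) *_) (sym (sel-ne z n (f n) (λ e → ne (sym e)))))))

 Π-↑ : ∀ n f k → Π< n f ↑ k ≡ Π< n (λ i → f i ↑ k)
 Π-↑ zero f k = 1↑ k
 Π-↑ (suc n) f k = trans (*-↑ (Π< n f) (f n) k) (cong (_* f n ↑ k) (Π-↑ n f k))

 Π-digits : ∀ s f → Π< (p ^ suc s) f ≡ Π< (p ^ s) (λ u → Π< p (λ v → f (v ∔ u · p)))
 Π-digits s f = trans (cong (λ k → Π< k f) (Nat.*-comm p (p ^ s))) (Π-block (p ^ s) p f)

 module IntBlock (q : IntP) (r v u s : ℕ) (v<p : v < p) where
  open IntP q
  private
   μr = μ r
   g = int q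
   sh = shift g r v

   zsig : Σ ℕ λ z → z < p × v ∔ z ≡ μr ∔ sh · p
   zsig with μr ℕ.<ᵇ v in e
   ... | true = μr ∔ p ∸ v , lt , trans (Nat.m+[n∸m]≡n (Nat.≤-trans (Nat.<⇒≤ v<p) (Nat.m≤n+m p μr))) (cong (μr ∔_) (sym (Nat.+-identityʳ p)))
    where
    lt : μr ∔ p ∸ v < p
    lt = Nat.+-cancelˡ-< v _ _ (subst (_< v ∔ p) (sym (Nat.m+[n∸m]≡n (Nat.≤-trans (Nat.<⇒≤ v<p) (Nat.m≤n+m p μr)))) (Nat.+-monoˡ-< p (Nat.<ᵇ⇒< μr v (subst T (sym e) tt))))
   ... | false = μr ∸ v , Nat.≤-<-trans (Nat.m∸n≤m μr v) (μ<p r) , trans (Nat.m+[n∸m]≡n v≤μ) (sym (Nat.+-identityʳ μr))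
    where
    v≤μ : v ≤ μr
    v≤μ = Nat.≮⇒≥ (λ l → subst T e (Nat.<⇒<ᵇ l))
   z = proj₁ zsig
   z<p = proj₁ (proj₂ zsig)
   vz = proj₂ (proj₂ zsig)

   j₀ = v ∔ u · p
   y : ℕ → ℚ
   y v' = γ q r + ι (j₀ ∔ v')
   -- γ_r is -μ_r modulo p, so the factor at offset v' is v - μ_r + v' modulo p; adding p keeps it a
   -- natural number.
   c = v ∔ (p ∸ μr)

   y-cong : ∀ v' → Dv 1 (y v' - ι (c ∔ v'))
   y-cong v' = subst (Dv 1) (trans (solve 6 (λ p g v' v u m → p :* :1 :* (g :+ (u :- :1)) := ((p :* g :- m) :+ (v :+ u :* p :+ v')) :- ((v :+ (p :- m)) :+ v')) refl π (γ q (suc r)) (ι v') (ι v) (ι u) (ι μr))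
     (cong₂ _-_ (cong₂ _+_ (trans (cong (_- ι μr) (γ-step q r)) (solve 2 (λ a b → (a :+ b) :- b := a) refl (γ q r) (ι μr))) (sym (trans (ι-+ j₀ v') (cong (_+ ι v') (trans (ι-+ v (u · p)) (cong (ι v +_) (ι-* u p)))))))
      (sym (trans (ι-+ c v') (cong (_+ ι v') (trans (ι-+ v (p ∸ μr)) (cong (ι v +_) (ι∸ (Nat.<⇒≤ (μ<p r))))))))))
     (Dv-* {1} {0} (Dv-π₀ 1) (Z⇒Dv (Z-+ (γ-Z q (suc r)) (Z-+ (Z-ι u) (Z-neg (Z-ι 1))))))
    where
    ι∸ : ∀ {m n} → m ≤ n → ι (n ∸ m) ≡ ι n - ι m
    ι∸ {m} {n} le = trans (solve 2 (λ a b → a := (b :+ a) :- b) refl (ι (n ∸ m)) (ι m)) (cong (_- ι m) (trans (sym (ι-+ m (n ∸ m))) (cong ι (Nat.m+[n∸m]≡n le))))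

   cz : p ∣ c ∔ z
   cz = divides (suc sh) (begin
    v ∔ (p ∸ μr) ∔ z       ≡⟨ S.solve 3 (λ a b c → a S.:+ b S.:+ c S.:= (a S.:+ c) S.:+ b) refl v (p ∸ μr) z ⟩
    v ∔ z ∔ (p ∸ μr)       ≡⟨ cong (_∔ (p ∸ μr)) vz ⟩
    μr ∔ sh · p ∔ (p ∸ μr) ≡⟨ S.solve 3 (λ a b c → a S.:+ b S.:+ c S.:= (a S.:+ c) S.:+ b) refl μr (sh · p) (p ∸ μr) ⟩
    μr ∔ (p ∸ μr) ∔ sh · p ≡⟨ cong (_∔ sh · p) (Nat.m+[n∸m]≡n (Nat.<⇒≤ (μ<p r))) ⟩
    p ∔ sh · p               ∎)
    where open ≡-Reasoning

   c∤ : ∀ v' → v' < p → v' ≢ z → ¬ p ∣ c ∔ v'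
   c∤ v' l ne d with Nat.<-cmp v' z
   ... | tri≈ _ e _ = ne e
   ... | tri< a _ _ = <p⇒∤ (Nat.m<n⇒0<n∸m a) (Nat.≤-<-trans (Nat.m∸n≤m z v') z<p) (∣m+n∣m⇒∣n (subst (p ∣_) (trans (cong (c ∔_) (sym (Nat.m+[n∸m]≡n (Nat.<⇒≤ a)))) (sym (Nat.+-assoc c v' _))) cz) d)
   ... | tri> _ _ a = <p⇒∤ (Nat.m<n⇒0<n∸m a) (Nat.≤-<-trans (Nat.m∸n≤m v' z) l) (∣m+n∣m⇒∣n (subst (p ∣_) (trans (cong (c ∔_) (sym (Nat.m+[n∸m]≡n (Nat.<⇒≤ a)))) (sym (Nat.+-assoc c z _))) d) cz)

   yU : ∀ v' → v' < p → v' ≢ z → UnitQ (y v')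
   yU v' l ne = UnitQ-≡ (UnitQ-ι (c∤ v' l ne)) (y-cong v')

   selU : ∀ v' → v' < p → UnitQ (sel z v' (y v'))
   selU v' l with v' Nat.≟ z
   ... | yes refl = subst UnitQ (sym (sel-eq z (y z))) UnitQ-1
   ... | no ne = subst UnitQ (sym (sel-ne z v' (y v') ne)) (yU v' l ne)

   selcg : ∀ v' → v' < p → Dv 1 (sel z v' (y v') - ι (unitPart (c ∔ v')))
   selcg v' l with v' Nat.≟ z | p∣? (c ∔ v')
   ... | yes refl | yes _ = subst (λ a → Dv 1 (a - 1#)) (sym (sel-eq z (y z))) cg-refl
   ... | yes refl | no nd = ⊥-elim (nd cz)
   ... | no ne | yes d = ⊥-elim (c∤ v' l ne d)
   ... | no ne | no _ = subst (λ a → Dv 1 (a - ι (c ∔ v'))) (sym (sel-ne z v' (y v') ne)) (y-cong v')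

   Lv : ℕ → Fun
   Lv v' = L p s (λ _ → inv (y v'))
   Θ₀ : ℚ
   Θ₀ = Π< p (λ v' → sel z v' (y v'))
   W₀ : Fun
   W₀ t = Π< p (λ v' → sel z v' (Lv v' t))

   q^s = p ^ s

   inner : ∀ t v' → v' < p → Π< q^s (λ i → sel z v' (γ q r + ι (j₀ ∔ (v' ∔ i · p)))) ≡ sel z v' (y v') ↑ q^s * sel z v' (Lv v' t)
   inner t v' l with v' Nat.≟ z
   ... | yes refl = trans (Π-1 q^s (λ i _ → sel-eq z _)) (sym (trans (cong₂ (λ a b → a ↑ q^s * b) (sel-eq z (y z)) (sel-eq z (Lv z t))) (trans (*-idʳ _) (1↑ q^s))))
   ... | no ne = trans (Π-ext q^s (λ i → trans (sel-ne z v' _ ne) (trans (cong (γ q r +_) (trans (cong ι (sym (Nat.+-assoc j₀ v' (i · p)))) (ι-+ (j₀ ∔ v') (i · p)))) (sym (+-assoc (γ q r) _ _)))))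
     (trans (P≡L p s (λ _ → y v') t (nonzero (yU v' l ne))) (sym (cong₂ (λ a b → a ↑ q^s * b) (sel-ne z v' (y v') ne) (sel-ne z v' (Lv v' t) ne))))

   -- Arrange the factors by their offset modulo p. The column at z consists of p times the factors
   -- of the shifted parameter. Every other column is a product of y + i p over i < p^s with y a
   -- unit, hence y^(p^s) times an `L`. The units y fill one period of nonzero residues, and their
   -- product is `Θ₀`.
   blkeq : ∀ t → R g r j₀ (p ^ suc s) t ≡ Θ₀ ↑ q^s * W₀ t * (π ↑ q^s * R g (suc r) (u ∔ sh) q^s t)
   blkeq t = begin
    R g r j₀ (p ^ suc s) t
     ≡⟨ Π-digits s (λ i → fac g r (j₀ ∔ i) t) ⟩
    Π< q^s (λ i → Π< p (λ v' → f v' i))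
     ≡⟨ Π-ext q^s (λ i → trans (Π-extract p z (λ v' → f v' i) z<p) (cong (_* Π< p (λ v' → sel z v' (f v' i))) (fz i))) ⟩
    Π< q^s (λ i → π * fac g (suc r) (u ∔ sh ∔ i) t * Π< p (λ v' → sel z v' (f v' i)))
     ≡⟨ Π-* q^s (λ i → π * fac g (suc r) (u ∔ sh ∔ i) t) (λ i → Π< p (λ v' → sel z v' (f v' i))) ⟩
    Π< q^s (λ i → π * fac g (suc r) (u ∔ sh ∔ i) t) * Π< q^s (λ i → Π< p (λ v' → sel z v' (f v' i)))
     ≡⟨ cong₂ _*_ (trans (Π-* q^s (λ _ → π) _) (cong (_* R g (suc r) (u ∔ sh) q^s t) (Π-const q^s π)))
        (trans (Π-swap q^s p (λ i v' → sel z v' (f v' i))) (trans (Π-cong p (inner t)) (trans (Π-* p _ _) (cong (_* W₀ t) (sym (Π-↑ p _ q^s)))))) ⟩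
    π ↑ q^s * R g (suc r) (u ∔ sh) q^s t * (Θ₀ ↑ q^s * W₀ t)
     ≡⟨ *-comm _ _ ⟩
    Θ₀ ↑ q^s * W₀ t * (π ↑ q^s * R g (suc r) (u ∔ sh) q^s t) ∎
    where
    open ≡-Reasoning
    f : ℕ → ℕ → ℚ
    f v' i = γ q r + ι (j₀ ∔ (v' ∔ i · p))
    fz : ∀ i → f z i ≡ π * (γ q (suc r) + ι (u ∔ sh ∔ i))
    fz i = trans (cong (λ k → γ q r + ι k) (trans (S.solve 5 (λ v u z i p → v S.:+ u S.:* p S.:+ (z S.:+ i S.:* p) S.:= (v S.:+ z) S.:+ (u S.:* p S.:+ i S.:* p)) refl v u z i p)
      (trans (cong (_∔ (u · p ∔ i · p)) vz) (S.solve 5 (λ m h u i p → m S.:+ h S.:* p S.:+ (u S.:* p S.:+ i S.:* p) S.:= m S.:+ (u S.:+ h S.:+ i) S.:* p) refl μr sh u i p))))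
     (γ-dwork q r (u ∔ sh ∔ i))

   Wκ : Cg (suc s) W₀ (λ _ → κ s (flag g))
   Wκ with p≟2
   ... | no ¬2 = Cg-trans (Cg-Π1 p one') (Cg-≡ (λ _ → sym (κf s)))
    where
    κf : ∀ s → κ s false ≡ 1#
    κf zero = refl
    κf (suc zero) = refl
    κf (suc (suc s)) = refl
    one' : ∀ v' → v' < p → Cg (suc s) (λ t → sel z v' (Lv v' t)) one
    one' v' l with v' Nat.≟ z
    ... | yes refl = Cg-≡ (λ t → sel-eq z _)
    ... | no ne = Cg-resp (λ t → sym (sel-ne z v' _ ne)) (λ _ → refl) (L-odd p ∣-refl (λ _ → inv (y v')) (M-const (Z⇒Dv (invInt (yU v' l ne)))) ¬2 s)
   -- For p = 2 a single offset differs from z, so the sign enters once; for odd p the Wilson sign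
   -- sits inside `Θ₀`.
   ... | yes p2 = two
    where
    fl : flagH p ≡ true
    fl with p≟2 | 4∣? p
    ... | no n | _ = ⊥-elim (n p2)
    ... | yes _ | yes d = ⊥-elim (Nat.<⇒≱ (s≤s (s≤s (s≤s z≤n))) (∣⇒≤ (subst (4 ∣_) p2 d)))
    ... | yes _ | no _ = refl
    Lcase : ∀ v' → v' < p → v' ≢ z → Cg (suc s) (λ t → sel z v' (Lv v' t)) (λ _ → κ s true)
    Lcase v' l ne = Cg-resp (λ t → sym (sel-ne z v' _ ne)) (λ _ → cong (κ s) fl) (L-κ p ∣-refl (λ _ → y v') (U-const (yU v' l ne)) s)
    Wz : Cg (suc s) (λ t → sel z z (Lv z t)) one
    Wz = Cg-≡ (λ t → sel-eq z _)
    0<p : 0 < p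
    0<p = Nat.<⇒≤ 1<p
    zz : z ≡ 0 ⊎ z ≡ 1
    zz with z | subst (z <_) p2 z<p
    ... | zero | _ = inj₁ refl
    ... | suc zero | _ = inj₂ refl
    ... | suc (suc _) | s≤s (s≤s ())
    W2 : ∀ t → W₀ t ≡ 1# * sel z 0 (Lv 0 t) * sel z 1 (Lv 1 t)
    W2 t = cong (λ k → Π< k (λ v' → sel z v' (Lv v' t))) p2
    two : Cg (suc s) W₀ (λ _ → κ s true)
    two with zz
    ... | inj₁ e = Cg-resp (λ t → sym (trans (W2 t) (cong (_* sel z 1 (Lv 1 t)) (*-idˡ _)))) (λ _ → *-idˡ _)
       (Cg-* (Cg-mem c0 M-1) (κ-const s true) c0 (Lcase 1 1<p (λ e' → case e')))
     where
     c0 : Cg (suc s) (λ t → sel z 0 (Lv 0 t)) one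
     c0 = subst (λ k → Cg (suc s) (λ t → sel z k (Lv k t)) one) e Wz
     case : ¬ (1 ≡ z)
     case e' with trans e' e
     ... | ()
    ... | inj₂ e = Cg-resp (λ t → sym (trans (W2 t) (cong (_* sel z 1 (Lv 1 t)) (*-idˡ _)))) (λ _ → *-idʳ _)
       (Cg-* (Cg-mem c0 (κ-const s true)) M-1 c0 c1)
     where
     case : ¬ (0 ≡ z)
     case e' with trans e' e
     ... | ()
     c0 : Cg (suc s) (λ t → sel z 0 (Lv 0 t)) (λ _ → κ s true)
     c0 = Lcase 0 0<p case
     c1 : Cg (suc s) (λ t → sel z 1 (Lv 1 t)) one
     c1 = subst (λ k → Cg (suc s) (λ t → sel z k (Lv k t)) one) e Wz

  intBlock : Block (int q) r v u s
  intBlock = record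
   { E = λ t → Θ₀ ↑ q^s * W₀ t
   ; Θ = λ _ → Θ₀
   ; W = W₀
   ; E-eq = λ _ _ → refl
   ; Θ-U = U-const (UnitQ-Π p selU)
   ; Θ-val = λ _ _ → cg-trans (cg-Π p (λ i l → integral (selU i l)) (λ i _ → Z-ι _) selcg)
     (cg-shift p (λ n → ι (unitPart n)) (λ _ → Z-ι _) unitPart-shift c)
   ; W-κ = Wκ
   ; R-eq = λ t _ → blkeq t }

 module NonBlock (q : NonP) (r v u s : ℕ) where
  open NonP q
  private
   g = non q
   y y' : Fun
   y t = ι (x r t) + ι ((v ∔ u · p) · N)
   y' t = ι (x (suc r) t) + ι (u · N)
   dN : ∀ j → Dv 1 (ι (j · N))
   dN j = Dv-ι∣ {1} (subst (_∣ j · N) (sym (Nat.*-identityʳ p)) (∣n⇒∣m*n j p∣N))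
   yU : ∀ r j → U suc (λ t → ι (x r t) + ι (j · N))
   yU r j = mkU (M-+ (x-mem r) (M-const (Dv-ι _))) (λ t o → UnitQ-≡ (UnitQ-ι (x-unit r t o)) (subst (Dv 1) (solve 2 (λ a b → b := (a :+ b) :- a) refl (ι (x r t)) (ι (j · N))) (dN j)))
   uy = yU r (v ∔ u · p)
   uy' = yU (suc r) u
   ynz : ∀ t → y t ≢ 0#
   ynz t = fac≢0 g r (v ∔ u · p) t
   y'nz : ∀ t → y' t ≢ 0#
   y'nz t = fac≢0 g (suc r) u t
   L₁ L₀ W₀ Θ₀ : Fun
   L₁ = L N (suc s) (λ t → inv (y t))
   L₀ = L N s (λ t → inv (y' t))
   W₀ t = L₁ t * inv (L₀ t)
   Θ₀ t = y t ↑ p * inv (y' t)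
   Req : ∀ r j e t → R g r j (p ^ e) t ≡ P-block N e (λ t → ι (x r t) + ι (j · N)) t
   Req r j e t = Π-ext (p ^ e) (λ i → trans (cong (ι (x r t) +_) (trans (cong ι (Nat.*-distribʳ-+ N j i)) (ι-+ (j · N) (i · N)))) (sym (+-assoc _ _ _)))
   yp : ∀ t → Ω t → Dv 1 (Θ₀ t - 1#)
   yp t o = subst₂ (λ a b → Dv 1 (a - b)) e1 (*-idˡ 1#)
     (cg-* (integral (UnitQ-↑ (p ∸ 1) (unit uy t o))) (Z-ι 1) (fermatQ (unit uy t o)) yy')
    where
    yy' : Dv 1 (y t * inv (y' t) - 1#)
    yy' = subst (Dv 1) (trans (*-distribʳ (inv (y' t)) (y t) (- y' t)) (cong (y t * inv (y' t) +_) (trans (neg-*ˡ _ _) (cong (λ z → - z) (inv-r {y' t} (y'nz t))))))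
     (Dv-* d0 (Z⇒Dv (invInt (unit uy' t o))))
     where
     d0 : Dv 1 (y t - y' t)
     d0 = subst (Dv 1) (solve 4 (λ a b c d → (c :- d) :- (b :- a) := (a :+ c) :- (b :+ d)) refl (ι (x r t)) (ι (x (suc r) t)) (ι ((v ∔ u · p) · N)) (ι (u · N)))
      (Dv-- (Dv-- (dN (v ∔ u · p)) (dN u)) (x-cong r t o))
    e1 : y t ↑ (p ∸ 1) * (y t * inv (y' t)) ≡ Θ₀ t
    e1 = trans (sym (*-assoc _ _ _)) (cong (_* inv (y' t)) (trans (*-comm _ (y t)) (cong (y t ↑_) (Nat.m+[n∸m]≡n (Nat.<⇒≤ 1<p)))))
   κ₀ : Cg (suc s) L₀ (λ _ → κ s (flagH N))
   κ₀ = L-κ N p∣N y' uy' s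
   -- No factor is divisible by p, so none is set aside. Pulling y and y' out of the two products
   -- leaves (y^p / y')^(p^s) times L₁ / L₀, and y^p, y, y' are congruent modulo p.
   Eq : ∀ t → P-block N (suc s) y t ≡ Θ₀ t ↑ (p ^ s) * W₀ t * P-block N s y' t
   Eq' : ∀ t → Ω t → P-block N (suc s) y t ≡ Θ₀ t ↑ (p ^ s) * W₀ t * (1# * P-block N s y' t)
   Eq t = trans (P≡L N (suc s) y t (ynz t)) (sym (begin
    Θ₀ t ↑ Q * (L₁ t * inv (L₀ t)) * P-block N s y' t
     ≡⟨ cong₂ (λ a b → a * (L₁ t * inv (L₀ t)) * b) (trans (*-↑ (y t ↑ p) (inv (y' t)) Q) (cong (_* inv (y' t) ↑ Q) (trans (sym (↑-* (y t) Q p)) (cong (y t ↑_) (Nat.*-comm Q p))))) (P≡L N s y' t (y'nz t)) ⟩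
    y t ↑ (p · Q) * inv (y' t) ↑ Q * (L₁ t * inv (L₀ t)) * (y' t ↑ Q * L₀ t)
     ≡⟨ solve 6 (λ a i l il y l0 → a :* i :* (l :* il) :* (y :* l0) := (a :* l) :* (i :* y) :* (il :* l0)) refl (y t ↑ (p · Q)) (inv (y' t) ↑ Q) (L₁ t) (inv (L₀ t)) (y' t ↑ Q) (L₀ t) ⟩
    (y t ↑ (p · Q) * L₁ t) * (inv (y' t) ↑ Q * y' t ↑ Q) * (inv (L₀ t) * L₀ t)
     ≡⟨ cong₂ (λ a b → (y t ↑ (p · Q) * L₁ t) * a * b) (trans (sym (*-↑ (inv (y' t)) (y' t) Q)) (trans (cong (_↑ Q) (inv-l {y' t} (y'nz t))) (1↑ Q))) (inv-l {L₀ t} L₀nz) ⟩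
    (y t ↑ (p · Q) * L₁ t) * 1# * 1#  ≡⟨ trans (*-idʳ _) (*-idʳ _) ⟩
    y t ↑ (p · Q) * L₁ t ∎))
    where
    open ≡-Reasoning
    Q = p ^ s
    L₀nz : L₀ t ≢ 0#
    L₀nz e = Π-≢0 Q (λ i _ → fac≢0 g (suc r) (u ∔ i) t) (trans (Req (suc r) u s t) (trans (P≡L N s y' t (y'nz t)) (trans (cong (y' t ↑ Q *_) e) (*-0ʳ _))))
   Eq' t o = trans (Eq t) (cong (Θ₀ t ↑ (p ^ s) * W₀ t *_) (sym (*-idˡ _)))

  nonBlock : Block (non q) r v u s
  nonBlock = record
   { E = λ t → Θ₀ t ↑ (p ^ s) * W₀ t
   ; Θ = Θ₀
   ; W = W₀
   ; E-eq = λ _ _ → refl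
   ; Θ-U = U-* (U-↑ p uy) (U-inv uy')
   ; Θ-val = yp
   ; W-κ = Cg-resp (λ _ → refl) (λ _ → *-idˡ _) (Cg-* (Cg-mem (L-suc-1 N p∣N y uy s) M-1) (κ-const s (flagH N)) (L-suc-1 N p∣N y uy s) (Cg-inv-κ {s} {s} {flagH N} κ₀))
   ; R-eq = λ t o → trans (Req r (v ∔ u · p) (suc s) t) (trans (Eq' t o) (cong (λ z → Θ₀ t ↑ (p ^ s) * W₀ t * (1# * z)) (trans (sym (Req (suc r) u s t)) (cong (λ k → R g (suc r) k (p ^ s) t) (sym (Nat.+-identityʳ u)))))) }

 blockOf : ∀ g r v u s → v < p → Block g r v u s
 blockOf (int q) r v u s l = IntBlock.intBlock q r v u s l
 blockOf (non q) r v u s l = NonBlock.nonBlock q r v u s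

-- Signed products over upper and lower parameters.

module SignedProducts (p : ℕ) (pp : Prime p) (Ω : ℕ → Set) where
 open Q
 open Sums
 open import Data.Nat.Base using (_<_; _^_) renaming (_+_ to _∔_; _*_ to _·_)

 open Padic p pp
 open Filt Ω
 open UnitProducts p pp Ω
 open Fermat p pp
 open Parameters p pp Ω
 private module S = +-*-Solver

 -- `true` marks the upper parameters α and `false` the lower parameters β, which enter products
 -- inverted and sums negated.
 Signed : Set
 Signed = List (Bool × Param)

 pw : Bool → ℚ → ℚ
 pw true x = x
 pw false x = inv x

 prodS : Signed → (Param → ℚ) → ℚ
 prodS [] f = 1#
 prodS ((σ , g) ∷ ps) f = pw σ (f g) * prodS ps f

 prodS-cong : ∀ ps {f f'} → (∀ {σ g} → (σ , g) ∈ ps → f g ≡ f' g) → prodS ps f ≡ prodS ps f'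
 prodS-cong [] e = refl
 prodS-cong ((σ , g) ∷ ps) e = cong₂ _*_ (cong (pw σ) (e (here refl))) (prodS-cong ps (λ i → e (there i)))

 prodS-ext : ∀ ps {f f'} → (∀ g → f g ≡ f' g) → prodS ps f ≡ prodS ps f'
 prodS-ext ps e = prodS-cong ps (λ {_} {g} _ → e g)

 pw-* : ∀ σ x y → pw σ (x * y) ≡ pw σ x * pw σ y
 pw-* true x y = refl
 pw-* false x y = inv-* x y

 prodS-* : ∀ ps f f' → prodS ps (λ g → f g * f' g) ≡ prodS ps f * prodS ps f'
 prodS-* [] f f' = sym (*-idˡ 1#)
 prodS-* ((σ , g) ∷ ps) f f' = trans (cong₂ _*_ (pw-* σ (f g) (f' g)) (prodS-* ps f f'))
  (solve 4 (λ a b c d → (a :* b) :* (c :* d) := (a :* c) :* (b :* d)) refl (pw σ (f g)) (pw σ (f' g)) (prodS ps f) (prodS ps f'))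

 pw-1 : ∀ σ → pw σ 1# ≡ 1#
 pw-1 true = refl
 pw-1 false = sym (inv-unique 1# 1# (*-idˡ 1#))

 prodS-1 : ∀ ps → prodS ps (λ _ → 1#) ≡ 1#
 prodS-1 [] = refl
 prodS-1 ((σ , g) ∷ ps) = trans (cong₂ _*_ (pw-1 σ) (prodS-1 ps)) (*-idˡ 1#)

 prodS-↑ : ∀ ps f n → prodS ps (λ g → f g ↑ n) ≡ prodS ps f ↑ n
 prodS-↑ ps f zero = prodS-1 ps
 prodS-↑ ps f (suc n) = trans (prodS-* ps f (λ g → f g ↑ n)) (cong (prodS ps f *_) (prodS-↑ ps f n))

 prodS-Π : ∀ ps n (f : ℕ → Param → ℚ) → prodS ps (λ g → Π< n (λ i → f i g)) ≡ Π< n (λ i → prodS ps (f i))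
 prodS-Π ps zero f = prodS-1 ps
 prodS-Π ps (suc n) f = trans (prodS-* ps _ _) (cong (_* prodS ps (f n)) (prodS-Π ps n f))

 pw≢0 : ∀ σ {x} → x ≢ 0# → pw σ x ≢ 0#
 pw≢0 true h = h
 pw≢0 false {x} h = inv-≢0 {x} h

 prodS≢0 : ∀ ps {f} → (∀ g → f g ≢ 0#) → prodS ps f ≢ 0#
 prodS≢0 [] h = 1≢0
 prodS≢0 ((σ , g) ∷ ps) h = *-≢0 (pw≢0 σ (h g)) (prodS≢0 ps h)

 U-pw : ∀ {lev f} σ → U lev f → U lev (λ t → pw σ (f t))
 U-pw true u = u
 U-pw false u = U-inv u

 U-prodS : ∀ {lev} ps {f : Param → Fun} → (∀ {σ g} → (σ , g) ∈ ps → U lev (f g)) → U lev (λ t → prodS ps (λ g → f g t))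
 U-prodS [] h = U-1
 U-prodS ((σ , g) ∷ ps) h = U-* (U-pw σ (h (here refl))) (U-prodS ps (λ i → h (there i)))

 UnitQ-pw : ∀ σ {x} → UnitQ x → UnitQ (pw σ x)
 UnitQ-pw true u = u
 UnitQ-pw false u = UnitQ-inv u

 UnitQ-prodS : ∀ ps {f} → (∀ g → UnitQ (f g)) → UnitQ (prodS ps f)
 UnitQ-prodS [] h = UnitQ-1
 UnitQ-prodS ((σ , g) ∷ ps) h = UnitQ-* (UnitQ-pw σ (h g)) (UnitQ-prodS ps h)

 cg-inv : ∀ {k x y} → UnitQ x → UnitQ y → Dv k (x - y) → Dv k (inv x - inv y)
 cg-inv {k} {x} {y} ux uy d = subst (Dv k) eq (subst (λ n → Dv n (- (x - y) * (inv x * inv y))) (Nat.+-identityʳ k) (Dv-* (Dv-neg d) (Z⇒Dv (Z-* (invInt ux) (invInt uy)))))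
  where
  eq : - (x - y) * (inv x * inv y) ≡ inv x - inv y
  eq = trans (solve 4 (λ a b ia ib → :- (a :- b) :* (ia :* ib) := (b :* ib) :* ia :- (a :* ia) :* ib) refl x y (inv x) (inv y))
   (cong₂ _-_ (trans (cong (_* inv x) (inv-r {y} (nonzero uy))) (*-idˡ _)) (trans (cong (_* inv y) (inv-r {x} (nonzero ux))) (*-idˡ _)))

 cg-prodS : ∀ {k} ps {f f'} → (∀ {σ g} → (σ , g) ∈ ps → UnitQ (f g)) → (∀ {σ g} → (σ , g) ∈ ps → UnitQ (f' g)) → (∀ {σ g} → (σ , g) ∈ ps → Dv k (f g - f' g)) → Dv k (prodS ps f - prodS ps f') × UnitQ (prodS ps f) × UnitQ (prodS ps f')
 cg-prodS [] u u' d = cg-refl , UnitQ-1 , UnitQ-1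
 cg-prodS {k} ((σ , g) ∷ ps) {f} {f'} u u' d with cg-prodS ps {f} {f'} (λ i → u (there i)) (λ i → u' (there i)) (λ i → d (there i))
 ... | c , ua , ub = cg-* (integral (UnitQ-pw σ (u (here refl)))) (integral ub) (hd σ) c , UnitQ-* (UnitQ-pw σ (u (here refl))) ua , UnitQ-* (UnitQ-pw σ (u' (here refl))) ub
  where
  hd : ∀ σ' → Dv k (pw σ' (f g) - pw σ' (f' g))
  hd true = d (here refl)
  hd false = cg-inv (u (here refl)) (u' (here refl)) (d (here refl))

 Cg-pw : ∀ {k s b W} σ → Cg (suc k) W (λ _ → κ s b) → Cg (suc k) (λ t → pw σ (W t)) (λ _ → pw σ (κ s b))
 Cg-pw true c = c
 Cg-pw {k} {s} {b} false c = Cg-resp (λ _ → refl) (λ _ → inv-unique (κ s b) (κ s b) (κ² s b)) (Cg-inv-κ {k} {s} {b} c)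

 Cg-prodS-κ : ∀ {k} s ps {W : Param → Fun} → (∀ {σ g} → (σ , g) ∈ ps → Cg (suc k) (W g) (λ _ → κ s (flag g))) → Cg (suc k) (λ t → prodS ps (λ g → W g t)) (λ _ → prodS ps (λ g → κ s (flag g)))
 Cg-prodS-κ s [] h = Cg-refl
 Cg-prodS-κ s ((σ , g) ∷ ps) h = Cg-* (Cg-mem (Cg-pw {s = s} {b = flag g} σ (h (here refl))) (kp σ)) (M-const (Z⇒Dv (integral (UnitQ-prodS ps (λ g → κ-unit s (flag g)))))) (Cg-pw {s = s} {b = flag g} σ (h (here refl))) (Cg-prodS-κ s ps (λ i → h (there i)))
  where
  kp : ∀ σ → M₁ 0 (λ _ → pw σ (κ s (flag g)))
  kp σ = M-const (Z⇒Dv (integral (UnitQ-pw σ (κ-unit s (flag g)))))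

 πpow-↑ : ∀ g m n → πpow g (m · n) ≡ πpow g n ↑ m
 πpow-↑ (int _) m n = ↑-* π m n
 πpow-↑ (non _) m n = sym (1↑ m)

 πpow-+ : ∀ g m n → πpow g (m ∔ n) ≡ πpow g m * πpow g n
 πpow-+ (int _) m n = ↑-+ π m n
 πpow-+ (non _) m n = sym (*-idˡ 1#)

 R-split : ∀ g r j m n t → R g r j (m ∔ n) t ≡ R g r j m t * R g r (j ∔ m) n t
 R-split g r j m n t = trans (Π-split m n _) (cong (R g r j m t *_) (Π-ext n (λ i → cong (λ k → fac g r k t) (sym (Nat.+-assoc j m i)))))

 R-blocks : ∀ g r j m n t → R g r j (m · n) t ≡ Π< m (λ i → R g r (j ∔ i · n) n t)
 R-blocks g r j m n t = trans (Π-block m n _) (Π-ext m (λ i → Π-ext n (λ k → cong (λ z → fac g r z t)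
   (trans (cong (j ∔_) (Nat.+-comm k (i · n))) (sym (Nat.+-assoc j (i · n) k))))))

 module _ (g : Param) (r v u s : ℕ) (v<p : v < p) where
  blk : ∀ i → Block g r v (u ∔ i · p ^ s) s
  blk i = blockOf g r v (u ∔ i · p ^ s) s v<p

  Eprod : ℕ → Fun
  Eprod m t = Π< m (λ i → Block.E (blk i) t)

  mBlock : ∀ m t → Ω t → R g r (v ∔ u · p) (m · p ^ suc s) t ≡ Eprod m t * (πpow g (m · p ^ s) * R g (suc r) (u ∔ shift g r v) (m · p ^ s) t)
  mBlock m t o = begin
   R g r (v ∔ u · p) (m · p ^ suc s) t
    ≡⟨ R-blocks g r (v ∔ u · p) m (p ^ suc s) t ⟩
   Π< m (λ i → R g r (v ∔ u · p ∔ i · p ^ suc s) (p ^ suc s) t)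
    ≡⟨ Π-ext m (λ i → trans (cong (λ k → R g r k (p ^ suc s) t) (S.solve 5 (λ v u p i q → v S.:+ u S.:* p S.:+ i S.:* (p S.:* q) S.:= v S.:+ (u S.:+ i S.:* q) S.:* p) refl v u p i (p ^ s))) (Block.R-eq (blk i) t o)) ⟩
   Π< m (λ i → Block.E (blk i) t * (πpow g (p ^ s) * R g (suc r) (u ∔ i · p ^ s ∔ shift g r v) (p ^ s) t))
    ≡⟨ trans (Π-* m _ _) (cong (Eprod m t *_) (Π-* m _ _)) ⟩
   Eprod m t * (Π< m (λ _ → πpow g (p ^ s)) * Π< m (λ i → R g (suc r) (u ∔ i · p ^ s ∔ shift g r v) (p ^ s) t))
    ≡⟨ cong₂ (λ a b → Eprod m t * (a * b)) (trans (Π-const m _) (sym (πpow-↑ g m (p ^ s))))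
       (trans (Π-ext m (λ i → cong (λ k → R g (suc r) k (p ^ s) t) (S.solve 3 (λ u x h → u S.:+ x S.:+ h S.:= (u S.:+ h) S.:+ x) refl u (i · p ^ s) (shift g r v)))) (sym (R-blocks g (suc r) (u ∔ shift g r v) m (p ^ s) t))) ⟩
   Eprod m t * (πpow g (m · p ^ s) * R g (suc r) (u ∔ shift g r v) (m · p ^ s) t) ∎
   where open ≡-Reasoning

 Block-U₀ : ∀ {g r v u s} (B : Block g r v u s) → U suc (Block.E B)
 Block-U₀ {g} {r} {v} {u} {s} B = U-resp (λ t o → sym (Block.E-eq B t o)) (U-* (U-↑ (p ^ s) (Block.Θ-U B))
  (mkU (M-resp (λ t _ → solve 2 (λ a k → (a :- k) :+ k := a) refl (Block.W B t) (κ s (flag g))) (M-+ (M-weaken z≤n (M₁⇒M₀ (Block.W-κ B))) (κ-const s (flag g))))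
     (unit (U-κ {s} {s} {flag g} (Block.W-κ B)))))

 module Total (ps : Signed) (ĉ : ℚ) (ĉ-unit : UnitQ ĉ) (ĉ-1 : Dv 1 (ĉ - 1#)) (ω-1 : Dv 1 (prodS ps ωval - 1#)) where

  κtot : ℕ → ℚ
  κtot s = prodS ps (λ g → κ s (flag g))

  Etot : ∀ r v u s → v < p → Fun
  Etot r v u s l t = ĉ ↑ (p ^ s) * prodS ps (λ g → Block.E (blockOf g r v u s l) t)

  -- All p^s-th powers combine into one base, `ĉ` times the signed product of the Θ. Since Θ agrees
  -- with `ωval` modulo p, the two hypotheses make this base 1 modulo p; its p^s-th power is then 1
  -- modulo p^(s+1), and only the signs remain.
  Etot-κ : ∀ r v u s l → Cg (suc s) (Etot r v u s l) (λ _ → κtot s)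
  Etot-κ r v u s l = M-resp (λ t o → cong (_- κtot s) (sym (Eeq t o)))
    (Cg-resp (λ _ → refl) (λ _ → *-idˡ _) (Cg-* (Cg-mem c1 M-1) (M-const (Z⇒Dv (integral (UnitQ-prodS ps (λ g → κ-unit s (flag g)))))) c1 (Cg-prodS-κ s ps (λ {_} {g} _ → Block.W-κ (B g)))))
   where
   B : ∀ g → Block g r v u s
   B g = blockOf g r v u s l
   X : Fun
   X t = ĉ * prodS ps (λ g → Block.Θ (B g) t)
   UX : U suc X
   UX = U-* (U-const ĉ-unit) (U-prodS ps (λ {_} {g} _ → Block.Θ-U (B g)))
   ωU : ∀ g → UnitQ (ωval g)
   ωU (int _) = w-unit
   ωU (non _) = UnitQ-1
   X1 : Cg 1 X one
   X1 = M₀-val⇒M₁ (M-- (mem UX) M-1) (λ t o → subst (λ z → Dv 1 (X t - z)) (*-idˡ 1#)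
     (cg-* (integral ĉ-unit) (Z-ι 1) ĉ-1 (cg-trans (proj₁ (cg-prodS ps {λ g → Block.Θ (B g) t} {ωval} (λ {_} {g} _ → unit (Block.Θ-U (B g)) t o) (λ {_} {g} _ → ωU g) (λ {_} {g} _ → Block.Θ-val (B g) t o))) ω-1)))
   c1 : Cg (suc s) (λ t → X t ↑ (p ^ s)) one
   c1 = pow-p^ s X1
   Eeq : ∀ t → Ω t → Etot r v u s l t ≡ X t ↑ (p ^ s) * prodS ps (λ g → Block.W (B g) t)
   Eeq t o = trans (cong (ĉ ↑ (p ^ s) *_) (trans (prodS-ext ps (λ g → Block.E-eq (B g) t o)) (trans (prodS-* ps _ _) (cong (_* prodS ps (λ g → Block.W (B g) t)) (prodS-↑ ps _ (p ^ s))))))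
    (trans (sym (*-assoc _ _ _)) (cong (_* prodS ps (λ g → Block.W (B g) t)) (sym (*-↑ ĉ _ (p ^ s)))))

  κtot-weak : ∀ s → Dv s (κtot s - 1#)
  κtot-weak zero = Z⇒Dv (Z-+ (integral (UnitQ-prodS ps (λ g → κ-unit 0 (flag g)))) (Z-neg (Z-ι 1)))
  κtot-weak (suc zero) = subst (λ z → Dv 1 (κtot 1 - z)) (prodS-1 ps)
    (proj₁ (cg-prodS ps {λ g → κ 1 (flag g)} {λ _ → 1#} (λ {_} {g} _ → κ-unit 1 (flag g)) (λ _ → UnitQ-1) (λ {_} {g} _ → k1 g)))
   where
   two : p ≡ 2 → Dv 1 (- 1# - 1#)
   two e = subst (Dv 1) (solve 1 (λ o → :- con (ℤ.+ 2) := :- :1 :- :1) refl 1#) (Dv-neg (subst (λ q → Dv 1 (ι q)) e (subst (Dv 1) (*-idʳ π) (Dv-π₀ 1))))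
   kH : ∀ h → Dv 1 (κ 1 (flagH h) - 1#)
   kH h with p≟2 | 4∣? h
   ... | no _ | _ = cg-refl
   ... | yes _ | yes _ = cg-refl
   ... | yes e | no _ = two e
   k1 : ∀ g → Dv 1 (κ 1 (flag g) - 1#)
   k1 (non q) = kH (NonP.N q)
   k1 (int q) with p≟2
   ... | no _ = cg-refl
   ... | yes e = two e
  κtot-weak (suc (suc s)) = subst (λ z → Dv (suc (suc s)) (z - 1#)) (sym (prodS-1 ps)) cg-refl

  -- Valid whatever the signs: giving up one power of p passes from 𝒜* to 𝒜, and modulo p^s the
  -- total sign is 1.
  E-weak : ∀ r v u s l → M₀ s (λ t → Etot r v u s l t - 1#)
  E-weak r v u s l = M-resp (λ t _ → solve 2 (λ a k → (a :- k) :+ (k :- :1) := a :- :1) refl (Etot r v u s l t) (κtot s))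
   (M-+ (M₁⇒M₀ (Etot-κ r v u s l)) (M-const (κtot-weak s)))

  -- The total sign can differ from 1 only at s = 1, whence the single condition.
  E-strong : (κtot 1 ≡ 1#) → ∀ r v u s l → M₁ (suc s) (λ t → Etot r v u s l t - 1#)
  E-strong e r v u zero l = subst (λ z → M₁ 1 (λ t → Etot r v u 0 l t - z)) (prodS-1 ps) (Etot-κ r v u 0 l)
  E-strong e r v u (suc zero) l = subst (λ z → M₁ 2 (λ t → Etot r v u 1 l t - z)) e (Etot-κ r v u 1 l)
  E-strong e r v u (suc (suc s)) l = subst (λ z → M₁ (suc (suc (suc s))) (λ t → Etot r v u (suc (suc s)) l t - z)) (prodS-1 ps) (Etot-κ r v u (suc (suc s)) l)

-- Base-p digits of indices and of p-integral parameters.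

module Digit (p : ℕ) (pp : Prime p) (Ω : ℕ → Set) where
 open Q
 open Sums
 open import Data.Nat.Base using (_≤_; _<_; _∸_; _^_) renaming (_+_ to _∔_; _*_ to _·_)

 open Padic p pp
 open Filt Ω
 open UnitProducts p pp Ω
 open Fermat p pp
 open Parameters p pp Ω
 open SignedProducts p pp Ω
 open import Data.Nat.DivMod using (_/_; _%_; m%n<n; m≡m%n+[m/n]*n; [m+kn]%n≡m%n; m<n⇒m%n≡m; m<n⇒m/n≡0; +-distrib-/-∣ʳ; m*n/n≡m)
 open import Data.Nat.Divisibility using (n∣m*n)
 open import Data.Bool.Base using (_∨_)
 private module S = +-*-Solver

 instance
  nzp : NonZero p
  nzp = prime⇒nonZero pp

 p>0 : 0 < p
 p>0 = Nat.<⇒≤ 1<p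

 p^>0 : ∀ s → 0 < p ^ s
 p^>0 zero = s≤s z≤n
 p^>0 (suc s) = Nat.*-mono-≤ p>0 (p^>0 s)

 dig% : ∀ v u → v < p → (v ∔ u · p) % p ≡ v
 dig% v u l = trans ([m+kn]%n≡m%n v u p) (m<n⇒m%n≡m l)

 dig/ : ∀ v u → v < p → (v ∔ u · p) / p ≡ u
 dig/ v u l = trans (+-distrib-/-∣ʳ v (n∣m*n u)) (cong₂ _∔_ (m<n⇒m/n≡0 l) (m*n/n≡m u p))

 -- md l n is n mod p^l.
 md : ℕ → ℕ → ℕ
 md zero n = 0
 md (suc l) n = n % p ∔ md l (n / p) · p

 md-dig : ∀ l v u → v < p → md (suc l) (v ∔ u · p) ≡ v ∔ md l u · p
 md-dig l v u vl = cong₂ (λ a b → a ∔ md l b · p) (dig% v u vl) (dig/ v u vl)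

 +·< : ∀ {v u s} → v < p → u < p ^ s → v ∔ u · p < p ^ suc s
 +·< {v} {u} {s} vl ul = Nat.≤-trans (Nat.+-monoˡ-≤ (u · p) vl) (Nat.≤-trans (Nat.*-monoˡ-≤ p ul) (Nat.≤-reflexive (Nat.*-comm (p ^ s) p)))

 /-< : ∀ n s → n < p ^ suc s → n / p < p ^ s
 /-< n s l = Nat.*-cancelʳ-< p (n / p) (p ^ s) (Nat.≤-<-trans (Nat.m≤n+m (n / p · p) (n % p)) (subst₂ _<_ (m≡m%n+[m/n]*n n p) (Nat.*-comm p (p ^ s)) l))

 md< : ∀ l n → md l n < p ^ l
 md< zero n = s≤s z≤n
 md< (suc l) n = +·< {n % p} {md l (n / p)} {l} (m%n<n n p) (md< l (n / p))

 md-0 : ∀ l → md l 0 ≡ 0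
 md-0 zero = refl
 md-0 (suc l) = trans (md-dig l 0 0 p>0) (cong (_· p) (md-0 l))

 md-shift : ∀ s l j m → j < p ^ s → md (s ∔ l) (j ∔ m · p ^ s) ≡ j ∔ md l m · p ^ s
 md-shift zero l zero m _ = trans (cong (md l) (Nat.*-identityʳ m)) (sym (Nat.*-identityʳ (md l m)))
 md-shift zero l (suc j) m (s≤s ())
 md-shift (suc s) l j m jl = begin
  md (suc (s ∔ l)) (j ∔ m · (p · Q))        ≡⟨ cong (md (suc (s ∔ l))) (trans (cong (_∔ m · (p · Q)) (m≡m%n+[m/n]*n j p)) (S.solve 5 (λ a b p m q → a S.:+ b S.:* p S.:+ m S.:* (p S.:* q) S.:= a S.:+ (b S.:+ m S.:* q) S.:* p) refl (j % p) (j / p) p m Q)) ⟩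
  md (suc (s ∔ l)) (j % p ∔ (j / p ∔ m · Q) · p) ≡⟨ md-dig (s ∔ l) (j % p) _ (m%n<n j p) ⟩
  j % p ∔ md (s ∔ l) (j / p ∔ m · Q) · p     ≡⟨ cong (λ z → j % p ∔ z · p) (md-shift s l (j / p) m (/-< j s jl)) ⟩
  j % p ∔ (j / p ∔ md l m · Q) · p           ≡⟨ S.solve 5 (λ a b p m q → a S.:+ (b S.:+ m S.:* q) S.:* p S.:= a S.:+ b S.:* p S.:+ m S.:* (p S.:* q)) refl (j % p) (j / p) p (md l m) Q ⟩
  j % p ∔ j / p · p ∔ md l m · (p · Q)       ≡⟨ cong (_∔ md l m · (p · Q)) (m≡m%n+[m/n]*n j p) ⟨
  j ∔ md l m · (p · Q) ∎
  where
  open ≡-Reasoning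
  Q = p ^ s

 md-small : ∀ s j → j < p ^ s → md s j ≡ j
 md-small s j jl = trans (cong₂ md (sym (Nat.+-identityʳ s)) (sym (Nat.+-identityʳ j))) (trans (md-shift s 0 j 0 jl) (Nat.+-identityʳ j))

 -- cc q r l is the residue of -γ_r modulo p^l.
 cc : IntP → ℕ → ℕ → ℕ
 cc q r zero = 0
 cc q r (suc l) = IntP.μ q r ∔ cc q (suc r) l · p

 cc< : ∀ q r l → cc q r l < p ^ l
 cc< q r zero = s≤s z≤n
 cc< q r (suc l) = +·< {IntP.μ q r} {cc q (suc r) l} {l} (IntP.μ<p q r) (cc< q (suc r) l)

 cc-+ : ∀ q r s l → cc q r (s ∔ l) ≡ cc q r s ∔ cc q (r ∔ s) l · p ^ s
 cc-+ q r zero l = trans (cong (λ k → cc q k l) (sym (Nat.+-identityʳ r))) (sym (Nat.*-identityʳ _))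
 cc-+ q r (suc s) l = trans (cong (λ z → IntP.μ q r ∔ z · p) (cc-+ q (suc r) s l))
  (trans (S.solve 5 (λ m a b q p → m S.:+ (a S.:+ b S.:* q) S.:* p S.:= m S.:+ a S.:* p S.:+ b S.:* (p S.:* q)) refl (IntP.μ q r) (cc q (suc r) s) (cc q (suc r ∔ s) l) (p ^ s) p)
   (cong (λ k → IntP.μ q r ∔ cc q (suc r) s · p ∔ cc q k l · (p · p ^ s)) (sym (Nat.+-suc r s))))

 lex< : ∀ {v u c c'} → c' < u → c < p → c ∔ c' · p < v ∔ u · p
 lex< {v} {u} {c} {c'} l cl = Nat.≤-trans (Nat.≤-trans (Nat.+-monoˡ-≤ (c' · p) cl) (Nat.*-monoˡ-≤ p l)) (Nat.m≤n+m (u · p) v)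

 lex-split : ∀ {v u c c'} → v < p → c ∔ c' · p < v ∔ u · p → c' < u ⊎ (c' ≡ u × c < v)
 lex-split {v} {u} {c} {c'} vl h with c' Nat.<? u
 ... | yes l = inj₁ l
 ... | no n with c' Nat.≟ u
 ... | yes refl = inj₂ (refl , Nat.+-cancelʳ-< (u · p) c v h)
 ... | no ne = ⊥-elim (Nat.<-asym h (Nat.≤-trans (lex< {c} {c'} {v} {u} (Nat.≤∧≢⇒< (Nat.≮⇒≥ n) (λ e → ne (sym e))) vl) Nat.≤-refl))

 -- The f lowest digits of u are μ_r, ..., μ_(r+f-1); equivalently, p^f divides γ_r + u.
 data Digits (q : IntP) : ℕ → ℕ → ℕ → Set where
  dz : ∀ {r u} → Digits q r 0 u
  ds : ∀ {r f u} → Digits q (suc r) f u → Digits q r (suc f) (IntP.μ q r ∔ u · p)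

 Digits-md : ∀ {q r f u} → Digits q r f u → ∀ i → i ≤ f → md i u ≡ cc q r i
 Digits-md d zero _ = refl
 Digits-md {q} {r} (ds {u = u} d) (suc i) (s≤s l) = trans (md-dig i (IntP.μ q r) u (IntP.μ<p q r)) (cong (λ z → IntP.μ q r ∔ z · p) (Digits-md d i l))

 record Ord (q : IntP) (r u : ℕ) : Set where
  constructor mkOrd
  field
   f : ℕ
   υ : ℚ
   υ-unit : UnitQ υ
   val≡ : γ q r + ι u ≡ π ↑ f * υ
   digits : Digits q r f u

 γ-unit : ∀ q r v u → v < p → v ≢ IntP.μ q r → UnitQ (γ q r + ι (v ∔ u · p))
 γ-unit q r v u vl ne = UnitQ-≡ {γ q r + ι (v ∔ u · p)} {ι v - ι μr} uv (subst (Dv 1) eq (Dv-* {1} {0} (Dv-π₀ 1) (Z⇒Dv (Z-+ (γ-Z q (suc r)) (Z-ι u)))))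
  where
  μr = IntP.μ q r
  uv : UnitQ (ι v - ι μr)
  uv with Nat.<-cmp v μr
  ... | tri≈ _ e _ = ⊥-elim (ne e)
  ... | tri< a _ _ = subst UnitQ (trans (cong (λ z → - 1# * z) (ι∸ (Nat.<⇒≤ a))) (solve 2 (λ a b → :- :1 :* (a :- b) := b :- a) refl (ι μr) (ι v)))
     (UnitQ-* UnitQ-neg1 (UnitQ-ι (<p⇒∤ (Nat.m<n⇒0<n∸m a) (Nat.≤-<-trans (Nat.m∸n≤m μr v) (IntP.μ<p q r)))))
   where
   ι∸ : ∀ {m n} → m ≤ n → ι (n ∸ m) ≡ ι n - ι m
   ι∸ {m} {n} le = trans (solve 2 (λ a b → a := (b :+ a) :- b) refl (ι (n ∸ m)) (ι m)) (cong (_- ι m) (trans (sym (ι-+ m (n ∸ m))) (cong ι (Nat.m+[n∸m]≡n le))))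
  ... | tri> _ _ a = subst UnitQ (ι∸ (Nat.<⇒≤ a)) (UnitQ-ι (<p⇒∤ (Nat.m<n⇒0<n∸m a) (Nat.≤-<-trans (Nat.m∸n≤m v μr) vl)))
   where
   ι∸ : ∀ {m n} → m ≤ n → ι (n ∸ m) ≡ ι n - ι m
   ι∸ {m} {n} le = trans (solve 2 (λ a b → a := (b :+ a) :- b) refl (ι (n ∸ m)) (ι m)) (cong (_- ι m) (trans (sym (ι-+ m (n ∸ m))) (cong ι (Nat.m+[n∸m]≡n le))))
  eq : π ↑ 1 * (γ q (suc r) + ι u) ≡ γ q r + ι (v ∔ u · p) - (ι v - ι μr)
  eq = trans (cong (_* (γ q (suc r) + ι u)) (*-idʳ π)) (trans (*-distribˡ π _ _) (trans (cong (_+ π * ι u) (γ-step q r))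
    (trans (solve 5 (λ g m p u v → (g :+ m) :+ p :* u := (g :+ (v :+ u :* p)) :- (v :- m)) refl (γ q r) (ι μr) π (ι u) (ι v))
     (cong (λ z → γ q r + z - (ι v - ι μr)) (sym (trans (ι-+ v (u · p)) (cong (ι v +_) (ι-* u p))))))))

 -- Removing a lowest digit equal to μ_r divides x_r + uN by p, so the recursion terminates. It
 -- stops at the first digit that differs, where the remaining sum is a unit.
 ord : ∀ q r u → Ord q r u
 ord q r u = go r u (<-wellFounded (IntP.x q r ∔ u · IntP.N q))
  where
  open IntP q
  go : ∀ r u → Acc _<_ (x r ∔ u · N) → Ord q r u
  go r u (acc rec) with u % p Nat.≟ μ r
  ... | no ne = mkOrd 0 (γ q r + ι u) (subst (λ z → UnitQ (γ q r + ι z)) (sym (m≡m%n+[m/n]*n u p)) (γ-unit q r (u % p) (u / p) (m%n<n u p) ne)) (sym (*-idˡ _)) dz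
  ... | yes e with go (suc r) (u / p) (rec smaller)
   where
   eqn : x r ∔ u · N ≡ p · (x (suc r) ∔ u / p · N)
   eqn = trans (cong (λ z → x r ∔ z · N) (trans (m≡m%n+[m/n]*n u p) (cong (_∔ u / p · p) e)))
    (trans (S.solve 5 (λ x m u p n → x S.:+ (m S.:+ u S.:* p) S.:* n S.:= (x S.:+ m S.:* n) S.:+ p S.:* (u S.:* n)) refl (x r) (μ r) (u / p) p N)
     (trans (cong (_∔ p · (u / p · N)) (sym (step r))) (sym (Nat.*-distribˡ-+ p (x (suc r)) (u / p · N)))))
   smaller : x (suc r) ∔ u / p · N < x r ∔ u · N
   smaller = subst (x (suc r) ∔ u / p · N <_) (sym (trans eqn (Nat.*-comm p _)))
    (Nat.m<m*n (x (suc r) ∔ u / p · N) p {{ℕ.>-nonZero (Nat.≤-trans (x≥1 (suc r)) (Nat.m≤m+n _ _))}} 1<p)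
  ... | mkOrd f υ uu ve dd = mkOrd (suc f) υ uu
    (trans (cong (λ z → γ q r + ι z) ueq) (trans (γ-dwork q r (u / p)) (trans (cong (π *_) ve) (sym (*-assoc π _ υ)))))
    (subst (Digits q r (suc f)) (sym ueq) (ds dd))
   where
   ueq : u ≡ μ r ∔ u / p · p
   ueq = trans (m≡m%n+[m/n]*n u p) (cong (_∔ u / p · p) e)

 -- For j < p^s: the factors γ_r + k with k < j already include a multiple of p^s. The factors of
 -- the other kind of parameter are units and never cause this.
 badP : Param → ℕ → ℕ → ℕ → Bool
 badP (int q) r s j = cc q r s ℕ.<ᵇ j
 badP (non q) r s j = false

 bad : Signed → ℕ → ℕ → ℕ → Bool
 bad [] r s j = false
 bad ((_ , g) ∷ ps) r s j = badP g r s j ∨ bad ps r s j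

 record Bad∈ (ps : Signed) (r s j : ℕ) : Set where
  constructor mkBad
  field
   {sg} : Bool
   {q} : IntP
   mem∈ : (sg , int q) ∈ ps
   less : cc q r s < j

 bad⇒ : ∀ ps r s j → bad ps r s j ≡ true → Bad∈ ps r s j
 bad⇒ ((σ , int q) ∷ ps) r s j e with cc q r s ℕ.<ᵇ j in eq
 ... | true = mkBad (here refl) (Nat.<ᵇ⇒< (cc q r s) j (subst T (sym eq) tt))
 ... | false with bad⇒ ps r s j e
 ... | mkBad i l = mkBad (there i) l
 bad⇒ ((σ , non q) ∷ ps) r s j e with bad⇒ ps r s j e
 ... | mkBad i l = mkBad (there i) l

 ⇒bad : ∀ ps r s j {σ q} → (σ , int q) ∈ ps → cc q r s < j → bad ps r s j ≡ true
 ⇒bad ((σ , int q) ∷ ps) r s j (here refl) l with cc q r s ℕ.<ᵇ j in eq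
 ... | true = refl
 ... | false = ⊥-elim (subst T eq (Nat.<⇒<ᵇ l))
 ⇒bad ((σ , int q) ∷ ps) r s j (there i) l with cc q r s ℕ.<ᵇ j
 ... | true = refl
 ... | false = ⇒bad ps r s j i l
 ⇒bad ((σ , non q) ∷ ps) r s j (there i) l = ⇒bad ps r s j i l

 good⇒ : ∀ ps r s j {σ q} → bad ps r s j ≡ false → (σ , int q) ∈ ps → j ≤ cc q r s
 good⇒ ps r s j {σ} {q} e i = Nat.≮⇒≥ λ l → case (trans (sym e) (⇒bad ps r s j i l))
  where
  case : ¬ (false ≡ true)
  case ()

 b2n : Bool → ℕ
 b2n true = 1
 b2n false = 0

 module Levels (ps : Signed) where
  pos : ℕ → ℕ → ℕ → Bool
  pos r l n = bad ps r l (md l n)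

  -- the number of levels 1 ≤ l ≤ L at which some p-integral parameter lies below n mod p^l
  gL : ℕ → ℕ → ℕ → ℕ
  gL L r n = #< L (λ l → b2n (pos r (suc l) n))

  pos-0 : ∀ r l → pos r l 0 ≡ false
  pos-0 r l with bad ps r l (md l 0) in e
  ... | false = refl
  ... | true with Bad∈.less (bad⇒ ps r l (md l 0) e)
  ... | lt with md l 0 | md-0 l
  pos-0 r l | true | () | _ | refl

  gL-0 : ∀ L r → gL L r 0 ≡ 0
  gL-0 L r = #-0 L (λ l _ → cong b2n (pos-0 r (suc l)))

  -- The digits above the lowest agree with those of the parameter, so at each level up to the
  -- length of the match the comparison is decided by μ_r < v.
  key : ∀ {σ q} → (σ , int q) ∈ ps → ∀ r v u f → v < p → IntP.μ q r < v → Digits q (suc r) f u → ∀ l → l ≤ f → pos r (suc l) (v ∔ u · p) ≡ true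
  key {σ} {q} i r v u f vl μl d l le = ⇒bad ps r (suc l) _ i (subst₂ _<_ refl (sym (md-dig l v u vl))
   (subst (λ z → IntP.μ q r ∔ cc q (suc r) l · p < v ∔ z · p) (sym (Digits-md d l le)) (Nat.+-monoˡ-< _ μl)))

  all-pos⇒ : ∀ L r n → (∀ l → l < L → pos r (suc l) n ≡ true) → gL L r n ≡ L
  all-pos⇒ L r n h = trans (#-cong L (λ l lt → cong b2n (h l lt))) (trans (#-const L 1) (Nat.*-identityʳ L))

  gL-key : ∀ {σ q} → (σ , int q) ∈ ps → ∀ r v u f → v < p → IntP.μ q r < v → Digits q (suc r) f u → gL (suc f) r (v ∔ u · p) ≡ suc f
  gL-key i r v u f vl μl d = all-pos⇒ (suc f) r _ (λ l lt → key i r v u f vl μl d l (Nat.≤-pred lt))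

  digits-of : ∀ q r s m → Digits q r s (cc q r s ∔ m · p ^ s)
  digits-of q r zero m = dz
  digits-of q r (suc s) m = subst (Digits q r (suc s)) (S.solve 5 (λ a b p m q → a S.:+ (b S.:+ m S.:* q) S.:* p S.:= a S.:+ b S.:* p S.:+ m S.:* (p S.:* q)) refl (IntP.μ q r) (cc q (suc r) s) p m (p ^ s)) (ds (digits-of q (suc r) s m))

  pos-shift : ∀ r s l j m → j < p ^ s → pos (r ∔ s) l m ≡ true → pos r (s ∔ l) (j ∔ m · p ^ s) ≡ true
  pos-shift r s l j m jl e with bad⇒ ps (r ∔ s) l (md l m) e
  ... | mkBad {q = q} i lt = ⇒bad ps r (s ∔ l) _ i (subst₂ _<_ (sym (cc-+ q r s l)) (sym (md-shift s l j m jl))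
     (Nat.≤-trans (Nat.+-monoˡ-≤ (cc q (r ∔ s) l · p ^ s) (cc< q r s)) (Nat.≤-trans (Nat.*-monoˡ-≤ (p ^ s) lt) (Nat.m≤n+m _ j))))

  -- The levels beyond s see only the digits of m, compared with the parameters shifted s times; the
  -- first s levels are all positive by hypothesis.
  gL-shift : ∀ r s L j m → j < p ^ s → (∀ l → l < s → pos r (suc l) (j ∔ m · p ^ s) ≡ true) → s ∔ gL L (r ∔ s) m ≤ gL (s ∔ L) r (j ∔ m · p ^ s)
  gL-shift r s L j m jl h = subst (s ∔ gL L (r ∔ s) m ≤_) (sym (#-split s L _))
   (Nat.+-mono-≤ (Nat.≤-reflexive (sym (all-pos⇒ s r _ h))) (#-mono L (λ l _ → mono l)))
   where
   mono : ∀ l → b2n (pos (r ∔ s) (suc l) m) ≤ b2n (pos r (suc (s ∔ l)) (j ∔ m · p ^ s))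
   mono l with pos (r ∔ s) (suc l) m in e
   ... | false = z≤n
   ... | true = Nat.≤-reflexive (sym (cong b2n (trans (cong (λ k → pos r k (j ∔ m · p ^ s)) (sym (Nat.+-suc s l))) (pos-shift r s (suc l) j m jl e))))

  bad-suc : ∀ r s v u → v < p → u < p ^ s → bad ps (suc r) s u ≡ true → bad ps r (suc s) (v ∔ u · p) ≡ true
  bad-suc r s v u vl ul e with bad⇒ ps (suc r) s u e
  ... | mkBad {q = q} i lt = ⇒bad ps r (suc s) _ i (lex< {v} {u} {IntP.μ q r} {cc q (suc r) s} lt (IntP.μ<p q r))

  -- If prepending v creates badness, then u equals the residue of -γ_(r+1) modulo p^s for some
  -- parameter and v exceeds its μ_r. So s digits match, and `key` makes all s + 1 levels positive
  -- whatever digits m adds above.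
  new-bad-pos : ∀ r s v u m → v < p → u < p ^ s → bad ps (suc r) s u ≡ false → bad ps r (suc s) (v ∔ u · p) ≡ true →
   ∀ l → l < suc s → pos r (suc l) (v ∔ u · p ∔ m · p ^ suc s) ≡ true
  new-bad-pos r s v u m vl ul g b l lt with bad⇒ ps r (suc s) _ b
  ... | mkBad {q = q} i less with lex-split {v} {u} {IntP.μ q r} {cc q (suc r) s} vl less
  ... | inj₁ c<u = ⊥-elim (Nat.<⇒≱ c<u (good⇒ ps (suc r) s u g i))
  ... | inj₂ (refl , μ<v) = subst (λ z → pos r (suc l) z ≡ true) (S.solve 5 (λ v c m q p → v S.:+ (c S.:+ m S.:* q) S.:* p S.:= v S.:+ c S.:* p S.:+ m S.:* (p S.:* q)) refl v (cc q (suc r) s) m (p ^ s) p)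
     (key i r v (cc q (suc r) s ∔ m · p ^ s) s vl μ<v (digits-of q (suc r) s m) l (Nat.≤-pred lt))

-- The quotients of A_r(j + m p^s) by A_r(j) and the hypotheses of Dwork's congruences.

module Ratios (p : ℕ) (pp : Prime p) (Ω : ℕ → Set) where
 open Q
 open Sums
 open Convolution
 open import Data.Nat.Base using (_≤_; _<_; _∸_; _^_) renaming (_+_ to _∔_; _*_ to _·_)

 open Padic p pp
 open Filt Ω
 open UnitProducts p pp Ω
 open Fermat p pp
 open Parameters p pp Ω
 open SignedProducts p pp Ω
 open Digit p pp Ω
 private module S = +-*-Solver

 nz : ℕ → ℕ
 nz zero = 0
 nz (suc _) = 1

 geom : ℕ → ℕ
 geom zero = 0
 geom (suc s) = p ^ s ∔ geom s

 p≡1+ : p ≡ suc (p ∸ 1)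
 p≡1+ = sym (Nat.m+[n∸m]≡n p>0)

 geom-eq : ∀ s → p ^ s ≡ suc ((p ∸ 1) · geom s)
 geom-eq zero = cong suc (sym (Nat.*-zeroʳ (p ∸ 1)))
 geom-eq (suc s) = trans (cong (_· p ^ s) p≡1+) (trans (cong (_∔ (p ∸ 1) · p ^ s) (geom-eq s))
  (cong suc (S.solve 3 (λ a g q → a S.:* g S.:+ a S.:* q S.:= a S.:* (q S.:+ g)) refl (p ∸ 1) (geom s) (p ^ s))))

 πpow-one : ∀ g n → πpow g n ≡ πpow g 1 ↑ n
 πpow-one g n = trans (cong (πpow g) (sym (Nat.*-identityʳ n))) (πpow-↑ g n 1)

 M-Π1 : ∀ {lev k} n {f : ℕ → Fun} → (∀ i → i < n → M lev k (λ t → f i t - 1#)) → M lev k (λ t → Π< n (λ i → f i t) - 1#)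
 M-Π1 zero h = M-resp (λ _ _ → sym (-‿inverse 1#)) M-0
 M-Π1 {lev} {k} (suc n) {f} h = M-resp (λ t _ → solve 2 (λ a b → (a :- :1) :* b :+ (b :- :1) := a :* b :- :1) refl _ (f n t))
  (M-+ (M-*0 (M-Π1 n (λ i l → h i (Nat.m<n⇒m<1+n l))) fm) (h n Nat.≤-refl))
  where
  fm : M lev 0 (f n)
  fm = M-resp (λ t _ → solve 1 (λ b → (b :- :1) :+ :1 := b) refl (f n t)) (M-+ (M-weaken z≤n (h n Nat.≤-refl)) M-1)

 prodS-Σ : ∀ ps {f f' : Param → Fun} → (∀ {σ g} → (σ , g) ∈ ps → Σ Fun λ Y → U suc Y × (∀ t → Ω t → f g t ≡ Y t * f' g t)) →
  Σ Fun λ Y → U suc Y × (∀ t → Ω t → prodS ps (λ g → f g t) ≡ Y t * prodS ps (λ g → f' g t))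
 prodS-Σ [] h = (λ _ → 1#) , U-1 , λ _ _ → sym (*-idˡ 1#)
 prodS-Σ ((σ , g) ∷ ps) {f} {f'} h with h (here refl) | prodS-Σ ps {f} {f'} (λ i → h (there i))
 ... | Y , uY , eY | Y' , uY' , eY' = (λ t → pw σ (Y t) * Y' t) , U-* (U-pw σ uY) uY' , λ t o → trans (cong₂ _*_ (trans (cong (pw σ) (eY t o)) (pw-* σ (Y t) (f' g t))) (eY' t o))
   (solve 4 (λ a b c d → (a :* b) :* (c :* d) := (a :* c) :* (b :* d)) refl (pw σ (Y t)) (pw σ (f' g t)) (Y' t) _)

 -- The correction for starting the shifted product at u rather than at u + 1: moving a window of l
 -- factors by one place trades its first factor for the one just after its end.
 Kval : Param → ℕ → ℕ → ℕ → ℕ → ℚ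
 Kval (int q) r v u l = if IntP.μ q r ℕ.<ᵇ v then (γ q (suc r) + ι (u ∔ l)) * inv (γ q (suc r) + ι u) else 1#
 Kval (non q) r v u l = 1#

 R-K : ∀ g r v u l t → R g (suc r) (u ∔ shift g r v) l t ≡ Kval g r v u l * R g (suc r) u l t
 R-K (non q) r v u l t = trans (cong (λ k → R (non q) (suc r) k l t) (Nat.+-identityʳ u)) (sym (*-idˡ _))
 R-K (int q) r v u l t with IntP.μ q r ℕ.<ᵇ v
 ... | false = trans (cong (λ k → R (int q) (suc r) k l t) (Nat.+-identityʳ u)) (sym (*-idˡ _))
 ... | true = *-cancel (fac g (suc r) u t) (fac≢0 g (suc r) u t) (begin
   a * R g (suc r) (u ∔ 1) l t          ≡⟨ cong₂ _*_ (sym (trans (*-idˡ _) (cong (λ k → fac g (suc r) k t) (Nat.+-identityʳ u)))) refl ⟩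
   R g (suc r) u 1 t * R g (suc r) (u ∔ 1) l t ≡⟨ R-split g (suc r) u 1 l t ⟨
   R g (suc r) u (suc l) t              ≡⟨ cong (λ k → R g (suc r) u k t) refl ⟩
   R g (suc r) u l t * b                ≡⟨ solve 2 (λ r b → r :* b := :1 :* b :* r) refl (R g (suc r) u l t) b ⟩
   1# * b * R g (suc r) u l t           ≡⟨ cong (λ z → z * b * R g (suc r) u l t) (inv-r {a} (fac≢0 g (suc r) u t)) ⟨
   a * inv a * b * R g (suc r) u l t    ≡⟨ solve 4 (λ a i b r → a :* i :* b :* r := a :* (b :* i :* r)) refl a (inv a) b (R g (suc r) u l t) ⟩
   a * (b * inv a * R g (suc r) u l t)  ∎)
  where
  open ≡-Reasoning
  g = int q
  a = fac g (suc r) u t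
  b = fac g (suc r) (u ∔ l) t

 GoodP : Param → ℕ → ℕ → ℕ → Set
 GoodP (int q) r s j = j ≤ cc q r s
 GoodP (non q) r s j = ⊤

 -- The carry of the shift stays in range: when v exceeds μ_r, goodness forces u to lie strictly
 -- below the residue of -γ_(r+1) modulo p^s.
 GoodP-suc : ∀ g r s v u → v < p → u < p ^ s → GoodP g r (suc s) (v ∔ u · p) → GoodP g (suc r) s (u ∔ shift g r v) × u ∔ shift g r v < p ^ s
 GoodP-suc (non q) r s v u vl ul h = tt , subst (_< p ^ s) (sym (Nat.+-identityʳ u)) ul
 GoodP-suc (int q) r s v u vl ul h with IntP.μ q r ℕ.<ᵇ v in e
 ... | false = le , Nat.≤-<-trans le (cc< q (suc r) s)
  where
  le : u ∔ 0 ≤ cc q (suc r) s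
  le = subst (_≤ cc q (suc r) s) (sym (Nat.+-identityʳ u)) (Nat.≮⇒≥ λ l → Nat.<⇒≱ (lex< {v} {u} {IntP.μ q r} {cc q (suc r) s} l (IntP.μ<p q r)) h)
 ... | true = le , Nat.≤-<-trans le (cc< q (suc r) s)
  where
  μ<v = Nat.<ᵇ⇒< (IntP.μ q r) v (subst T (sym e) tt)
  le : u ∔ 1 ≤ cc q (suc r) s
  le = subst (_≤ cc q (suc r) s) (Nat.+-comm 1 u) (Nat.≮⇒≥ λ l → Nat.<⇒≱ (Nat.+-mono-<-≤ μ<v (Nat.*-monoˡ-≤ p (Nat.≤-pred l))) h)

 -- Applying `mBlock` s times strips the s digits of j. Goodness keeps every carry in range, so at
 -- the end the product of an integral parameter starts at 0. The powers of p extracted on the way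
 -- number m(p^(s-1) + ... + p + 1).
 ratio : ∀ s g r j m → j < p ^ s → GoodP g r s j →
  Σ Fun λ Y → U suc Y × (∀ t → Ω t → R g r j (m · p ^ s) t ≡ Y t * (πpow g (m · geom s) * R g (r ∔ s) 0 m t))
 ratio zero (int q) r zero m jl h = (λ _ → 1#) , U-1 , λ t o → trans (cong₂ (λ a b → R (int q) a 0 b t) (sym (Nat.+-identityʳ r)) (Nat.*-identityʳ m))
  (sym (trans (*-idˡ _) (trans (cong (λ k → π ↑ k * R (int q) (r ∔ 0) 0 m t) (Nat.*-zeroʳ m)) (*-idˡ _))))
 ratio zero (int q) r (suc j) m (s≤s ()) h
 ratio zero (non q) r j m jl h = (λ t → R g r j m t * inv (R g r 0 m t)) , U-* (RU j) (U-inv (RU 0)) , λ t o →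
   trans (cong (λ k → R g r j k t) (Nat.*-identityʳ m)) (sym (trans (cong (λ z → R g r j m t * inv (R g r 0 m t) * z) (trans (*-idˡ _) (cong (λ k → R g k 0 m t) (Nat.+-identityʳ r))))
    (trans (*-assoc _ _ _) (trans (cong (R g r j m t *_) (inv-l {R g r 0 m t} (R≢0 g r 0 m t))) (*-idʳ _)))))
  where
  g = non q
  RU : ∀ j → U suc (R g r j m)
  RU j = U-Π m (λ i _ → facU (j ∔ i))
   where
   facU : ∀ i → U suc (fac g r i)
   facU i = mkU (M-+ (NonP.x-mem q r) (M-const (Dv-ι _))) (λ t o → UnitQ-≡ (UnitQ-ι (NonP.x-unit q r t o))
    (subst (Dv 1) (solve 2 (λ a b → b := (a :+ b) :- a) refl (ι (NonP.x q r t)) (ι (i · NonP.N q))) (Dv-ι∣ {1} (subst (λ z → _∣_ z (i · NonP.N q)) (sym (Nat.*-identityʳ p)) (∣n⇒∣m*n i (NonP.p∣N q))))))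
    where open import Data.Nat.Divisibility using (_∣_; ∣n⇒∣m*n)
 ratio (suc s) g r j m jl h = Y , UY , eq
  where
  v = j % p
   where open import Data.Nat.DivMod using (_%_)
  u = j / p
   where open import Data.Nat.DivMod using (_/_)
  open import Data.Nat.DivMod using (m≡m%n+[m/n]*n; m%n<n)
  vl : v < p
  vl = m%n<n j p
  je : j ≡ v ∔ u · p
  je = m≡m%n+[m/n]*n j p
  ul : u < p ^ s
  ul = /-< j s jl
  gs = GoodP-suc g r s v u vl ul (subst (GoodP g r (suc s)) je h)
  w′ = u ∔ shift g r v
  rec = ratio s g (suc r) w′ m (proj₂ gs) (proj₁ gs)
  Y' = proj₁ rec
  Y : Fun
  Y t = Eprod g r v u s vl m t * Y' t
  UY : U suc Y
  UY = U-* (U-Π m (λ i _ → Block-U₀ (blk g r v u s vl i))) (proj₁ (proj₂ rec))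
  eq : ∀ t → Ω t → R g r j (m · p ^ suc s) t ≡ Y t * (πpow g (m · geom (suc s)) * R g (r ∔ suc s) 0 m t)
  eq t o = begin
   R g r j (m · p ^ suc s) t
    ≡⟨ cong (λ k → R g r k (m · p ^ suc s) t) je ⟩
   R g r (v ∔ u · p) (m · p ^ suc s) t
    ≡⟨ mBlock g r v u s vl m t o ⟩
   E * (πpow g (m · p ^ s) * R g (suc r) w′ (m · p ^ s) t)
    ≡⟨ cong (λ z → E * (πpow g (m · p ^ s) * z)) (proj₂ (proj₂ rec) t o) ⟩
   E * (πpow g (m · p ^ s) * (Y' t * (πpow g (m · geom s) * R g (suc r ∔ s) 0 m t)))
    ≡⟨ solve 5 (λ e a y b r → e :* (a :* (y :* (b :* r))) := (e :* y) :* ((a :* b) :* r)) refl E (πpow g (m · p ^ s)) (Y' t) (πpow g (m · geom s)) _ ⟩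
   Y t * (πpow g (m · p ^ s) * πpow g (m · geom s) * R g (suc r ∔ s) 0 m t)
    ≡⟨ cong₂ (λ a b → Y t * (a * R g b 0 m t)) (trans (sym (πpow-+ g (m · p ^ s) (m · geom s))) (cong (πpow g) (sym (Nat.*-distribˡ-+ m (p ^ s) (geom s))))) (sym (Nat.+-suc r s)) ⟩
   Y t * (πpow g (m · geom (suc s)) * R g (r ∔ suc s) 0 m t) ∎
   where
   open ≡-Reasoning
   E = Eprod g r v u s vl m t

 -- Two settings share this development. With `lev` the identity and τ = ω = 0 the block quotients
 -- are known to full precision, in 𝒜*. With `lev` = `suc` and τ = 1 they are known to one power of
 -- p less, in 𝒜, and each A_r(n) with n ≥ 1 must bring one further factor p to make up for it; a
 -- remaining surplus ω is carried through to the conclusion.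
 module Instance (ps : Signed) (c : ℚ) (c≢0 : c ≢ 0#) (lev : ℕ → ℕ) (emb : ∀ {k f} → M₀ k f → M lev k f)
  (τ ω : ℕ) (τ≤1 : τ ≤ 1)
  (ĉ-unit : UnitQ (c ↑ (p ∸ 1) * prodS ps (λ g → πpow g 1)))
  where

  open Levels ps

  ĉ : ℚ
  ĉ = c ↑ (p ∸ 1) * prodS ps (λ g → πpow g 1)

  Rt : ℕ → ℕ → ℕ → Fun
  Rt r j l t = c ↑ l * prodS ps (λ g → R g r j l t)

  A : ℕ → ℕ → Fun
  A r n = Rt r 0 n

  A-0 : ∀ r t → A r 0 t ≡ 1#
  A-0 r t = trans (cong (1# *_) (prodS-1 ps)) (*-idˡ 1#)

  A-split : ∀ r j l t → A r (j ∔ l) t ≡ A r j t * Rt r j l t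
  A-split r j l t = trans (cong₂ _*_ (↑-+ c j l) (trans (prodS-ext ps (λ g → R-split g r 0 j l t)) (prodS-* ps _ _)))
   (solve 4 (λ a b c d → (a :* b) :* (c :* d) := (a :* c) :* (b :* d)) refl (c ↑ j) (c ↑ l) _ _)

  Et : ∀ r v u s → v < p → Fun
  Et r v u s l t = ĉ ↑ (p ^ s) * prodS ps (λ g → Block.E (blockOf g r v u s l) t)

  ĉ-pow : ∀ n → c ↑ ((p ∸ 1) · n) * prodS ps (λ g → πpow g n) ≡ ĉ ↑ n
  ĉ-pow n = trans (cong₂ _*_ (trans (cong (c ↑_) (Nat.*-comm (p ∸ 1) n)) (↑-* c n (p ∸ 1))) (trans (prodS-ext ps (λ g → πpow-one g n)) (prodS-↑ ps _ n))) (sym (*-↑ (c ↑ (p ∸ 1)) _ n))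

  ratioA : ∀ r s j m → j < p ^ s → bad ps r s j ≡ false → Σ Fun λ Y → U suc Y × (∀ t → Ω t → Rt r j (m · p ^ s) t ≡ Y t * A (r ∔ s) m t)
  ratioA r s j m jl g = (λ t → ĉ ↑ (m · geom s) * Y t) , U-* (U-const (UnitQ-↑ (m · geom s) ĉ-unit)) UY , λ t o → begin
    c ↑ (m · p ^ s) * prodS ps (λ g → R g r j (m · p ^ s) t)
     ≡⟨ cong₂ _*_ (trans (cong (λ k → c ↑ k) (trans (cong (m ·_) (geom-eq s)) (S.solve 3 (λ m a g → m S.:* (S.con 1 S.:+ a S.:* g) S.:= a S.:* (m S.:* g) S.:+ m) refl m (p ∸ 1) (geom s)))) (↑-+ c ((p ∸ 1) · (m · geom s)) m)) (trans (Yeq t o) (cong (Y t *_) (prodS-* ps _ _))) ⟩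
    (c ↑ ((p ∸ 1) · (m · geom s)) * c ↑ m) * (Y t * (prodS ps (λ g → πpow g (m · geom s)) * prodS ps (λ g → R g (r ∔ s) 0 m t)))
     ≡⟨ solve 5 (λ a c y b r → (a :* c) :* (y :* (b :* r)) := (a :* b) :* y :* (c :* r)) refl (c ↑ ((p ∸ 1) · (m · geom s))) (c ↑ m) (Y t) (prodS ps (λ g → πpow g (m · geom s))) _ ⟩
    (c ↑ ((p ∸ 1) · (m · geom s)) * prodS ps (λ g → πpow g (m · geom s))) * Y t * A (r ∔ s) m t
     ≡⟨ cong (λ z → z * Y t * A (r ∔ s) m t) (ĉ-pow (m · geom s)) ⟩
    ĉ ↑ (m · geom s) * Y t * A (r ∔ s) m t ∎
   where
   open ≡-Reasoning
   goodP : ∀ {σ} g → (σ , g) ∈ ps → GoodP g r s j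
   goodP (int q) i = good⇒ ps r s j g i
   goodP (non q) i = tt
   total = prodS-Σ ps {λ g t → R g r j (m · p ^ s) t} {λ g t → πpow g (m · geom s) * R g (r ∔ s) 0 m t} (λ {_} {g} i → ratio s g r j m jl (goodP g i))
   Y = proj₁ total
   UY = proj₁ (proj₂ total)
   Yeq = proj₂ (proj₂ total)

  Em : ∀ r v u s → v < p → ℕ → Fun
  Em r v u s l m t = Π< m (λ i → Et r v (u ∔ i · p ^ s) s l t)

  Kt : ℕ → ℕ → ℕ → ℕ → ℚ
  Kt r v u l = prodS ps (λ g → Kval g r v u l)

  -- `mBlock` multiplied over all parameters. The constant c^(m p^(s+1)) is split into c^((p-1) m
  -- p^s) and c^(m p^s): the first part merges with the extracted powers of p into powers of `ĉ`,
  -- the second belongs to the shifted product.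
  Rt-step : ∀ r v u s (l : v < p) m t → Ω t → Rt r (v ∔ u · p) (m · p ^ suc s) t ≡ Rt (suc r) u (m · p ^ s) t * (Em r v u s l m t * Kt r v u (m · p ^ s))
  Rt-step r v u s l m t o = begin
   c ↑ (m · p ^ suc s) * prodS ps (λ g → R g r (v ∔ u · p) (m · p ^ suc s) t)
    ≡⟨ cong₂ _*_ (trans (cong (c ↑_) expo) (↑-+ c ((p ∸ 1) · mq) mq))
      (trans (prodS-ext ps (λ g → trans (mBlock g r v u s l m t o) (cong (λ z → Eprod g r v u s l m t * (πpow g mq * z)) (R-K g r v u mq t))))
       (trans (prodS-* ps _ _) (cong₂ _*_ (prodS-Π ps m _) (trans (prodS-* ps _ _) (cong (prodS ps (λ g → πpow g mq) *_) (prodS-* ps _ _)))))) ⟩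
   (c ↑ ((p ∸ 1) · mq) * c ↑ mq) * (PE' * (prodS ps (λ g → πpow g mq) * (Kt r v u mq * prodS ps (λ g → R g (suc r) u mq t))))
    ≡⟨ solve 6 (λ a c e b k r → (a :* c) :* (e :* (b :* (k :* r))) := (c :* r) :* (((a :* b) :* e) :* k)) refl (c ↑ ((p ∸ 1) · mq)) (c ↑ mq) PE' (prodS ps (λ g → πpow g mq)) (Kt r v u mq) _ ⟩
   Rt (suc r) u mq t * ((c ↑ ((p ∸ 1) · mq) * prodS ps (λ g → πpow g mq)) * PE' * Kt r v u mq)
    ≡⟨ cong (λ z → Rt (suc r) u mq t * (z * Kt r v u mq)) (trans (cong (_* PE') (trans (ĉ-pow mq) (trans (↑-* ĉ m (p ^ s)) (sym (Π-const m _))))) (sym (Π-* m _ _))) ⟩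
   Rt (suc r) u mq t * (Em r v u s l m t * Kt r v u mq) ∎
   where
   open ≡-Reasoning
   mq = m · p ^ s
   PE' = Π< m (λ i → prodS ps (λ g → Block.E (blockOf g r v (u ∔ i · p ^ s) s l) t))
   expo : m · p ^ suc s ≡ (p ∸ 1) · mq ∔ mq
   expo = trans (cong (λ z → m · (z · p ^ s)) p≡1+) (S.solve 3 (λ m a q → m S.:* ((S.con 1 S.:+ a) S.:* q) S.:= a S.:* (m S.:* q) S.:+ m S.:* q) refl m (p ∸ 1) (p ^ s))

  -- All truncations L are demanded at once, because passing from an index to its higher digits
  -- changes the number of levels in sight. The surplus ω is claimed only away from n = 0, where the
  -- coefficient is 1.
  record P (r n k : ℕ) (f : Fun) : Set where
   constructor mkP
   field at : ∀ L → M lev (k ∔ (gL L r n ∔ ω · nz n)) f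
  open P

  P⇒M : ∀ {r n k f} → P r n k f → M lev k f
  P⇒M {r} {n} {k} h = M-weaken (Nat.m≤m+n k _) (at h 0)

  ρ : ℕ → ℕ → ℕ → ℕ → Fun
  ρ r s m j t = if bad ps r s j then 0# else Rt r j (m · p ^ s) t

  -- near n = 0 nothing is claimed: A r 0 = 1
  module WithBound (A-mem : ∀ r n L → 1 ≤ n → M lev (gL L r n ∔ ω ∔ τ) (A r n))
   (E-mem : ∀ r v u s l → M lev (suc s ∸ τ) (λ t → Et r v u s l t - 1#)) where

   A-P : ∀ r n L → M lev (gL L r n ∔ ω · nz n) (A r n)
   A-P r zero L = subst (λ k → M lev k (A r 0)) (sym (cong₂ _∔_ (gL-0 L r) (Nat.*-zeroʳ ω))) (M-resp (λ t _ → sym (A-0 r t)) M-1)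
   A-P r (suc n) L = M-weaken (Nat.≤-trans (Nat.≤-reflexive (cong (gL L r (suc n) ∔_) (Nat.*-identityʳ ω))) (Nat.m≤m+n _ τ)) (A-mem r (suc n) L (s≤s z≤n))

   A-int : ∀ r n → M lev 0 (A r n)
   A-int r n = M-weaken z≤n (A-P r n 0)

   -- a factor that is 1 up to the accuracy the filtration of f leaves room for
   Close : ℕ → Fun → ℚ → Set
   Close k f x = Z x × M lev k (λ t → (x - 1#) * f t)

   Close-* : ∀ {k f x y} → Close k f x → Close k f y → Close k f (x * y)
   Close-* {f = f} {x} {y} (zx , mx) (zy , my) = Z-* zx zy , M-resp (λ t _ → solve 3 (λ x y f → ((x :- :1) :* f) :* y :+ (y :- :1) :* f := (x :* y :- :1) :* f) refl x y (f t))
    (M-+ (M-*0 mx (M-const (Z⇒Dv zy))) my)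

   Close-prodS : ∀ {k f} ps' {x : Param → ℚ} → (∀ {σ g} → (σ , g) ∈ ps' → UnitQ (x g) × M lev k (λ t → (x g - 1#) * f t)) → Close k f (prodS ps' x)
   Close-prodS {f = f} [] h = Z-ι 1 , M-resp (λ t _ → solve 1 (λ f → :0 := (:1 :- :1) :* f) refl (f t)) M-0
   Close-prodS {k} {f} ((σ , g) ∷ ps') {x} h = Close-* (hd σ) (Close-prodS ps' (λ i → h (there i)))
    where
    u = proj₁ (h (here refl))
    m = proj₂ (h (here refl))
    hd : ∀ σ → Close k f (pw σ (x g))
    hd true = integral u , m
    hd false = invInt u , M-resp (λ t _ → trans (solve 3 (λ x i f → :- (((x :- :1) :* f) :* i) := (i :- x :* i) :* f) refl (x g) (inv (x g)) (f t)) (cong (λ z → (inv (x g) - z) * f t) (inv-r {x g} (nonzero u))))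
     (M-neg (M-*0 m (M-const (Z⇒Dv (invInt u)))))

   ρ-mem : ∀ r s m j → j < p ^ s → bad ps r s j ≡ false → ∀ L → 1 ≤ m → M lev (gL L (r ∔ s) m ∔ ω ∔ τ) (Rt r j (m · p ^ s))
   ρ-mem r s m j jl g L m≥1 = M-resp (λ t o → sym (trans (proj₂ (proj₂ ra) t o) (*-comm (proj₁ ra t) (A (r ∔ s) m t))))
     (M-*0 {f = A (r ∔ s) m} (A-mem (r ∔ s) m L m≥1) (emb (mem (proj₁ (proj₂ ra)))))
    where
    ra : Σ Fun λ Y → U suc Y × (∀ t → Ω t → Rt r j (m · p ^ s) t ≡ Y t * A (r ∔ s) m t)
    ra = ratioA r s j m jl g

   Q : ℕ → ℕ → ℕ → ℕ → Fun → Set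
   Q r s m k f = ∀ L → M lev (k ∔ suc s ∔ (gL L (r ∔ suc s) m ∔ ω · nz m)) f

   P-+ : ∀ {r n k f g} → P r n k f → P r n k g → P r n k (λ t → f t + g t)
   P-+ h h' = mkP λ L → M-+ (at h L) (at h' L)

   gL-full : ∀ r s v u k → (∀ l → l < suc s → pos r (suc l) (v ∔ u · p) ≡ true) → ∀ {f} → P r (v ∔ u · p) k f → M lev (k ∔ suc s) f
   gL-full r s v u k h pf = M-weaken (Nat.+-monoʳ-≤ k (Nat.≤-trans (Nat.≤-reflexive (sym (all-pos⇒ (suc s) r _ h))) (Nat.m≤m+n _ _))) (at pf (suc s))

   -- If only the longer residue is bad, one quotient is 0 and f alone supplies p^(s+1). If both are
   -- good, the two quotients differ by a factor E K: E is close to 1 by hypothesis, and K is close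
   -- to 1 to the precision that f leaves open.
   ρ-step : ∀ r s v u m k f → v < p → u < p ^ s → P r (v ∔ u · p) k f →
    Q r s m k (λ t → (ρ r (suc s) m (v ∔ u · p) t - ρ (suc r) s m u t) * f t)
   ρ-step r s v u m k f vl ul pf L with bad ps r (suc s) (v ∔ u · p) in e₁ | bad ps (suc r) s u in e₂
   ... | true | true = M-resp (λ t _ → solve 1 (λ f → :0 := (:0 :- :0) :* f) refl (f t)) M-0
   ... | false | true = ⊥-elim (case (trans (sym e₁) (bad-suc r s v u vl ul e₂)))
    where
    case : ¬ (false ≡ true)
    case ()
   ... | true | false = M-resp (λ t _ → solve 2 (λ r f → :- (r :* f) := (:0 :- r) :* f) refl (Rt (suc r) u (m · p ^ s) t) (f t))
      (M-neg (M-weaken (Nat.≤-reflexive (Nat.+-comm (k ∔ suc s) _)) (M-* (rm m) fm)))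
    where
    fm : M lev (k ∔ suc s) f
    fm = gL-full r s v u k (λ l lt → subst (λ z → pos r (suc l) z ≡ true) (Nat.+-identityʳ _) (new-bad-pos r s v u 0 vl ul e₂ e₁ l lt)) pf
    rm : ∀ m → M lev (gL L (r ∔ suc s) m ∔ ω · nz m) (Rt (suc r) u (m · p ^ s))
    rm zero = subst (λ k → M lev k (Rt (suc r) u 0)) (sym (cong₂ _∔_ (gL-0 L (r ∔ suc s)) (Nat.*-zeroʳ ω))) (M-resp (λ t _ → sym (A-0 (suc r) t)) M-1)
    rm (suc m) = M-weaken (Nat.≤-trans (Nat.≤-reflexive (cong₂ (λ x y → gL L x (suc m) ∔ y) (Nat.+-suc r s) (Nat.*-identityʳ ω))) (Nat.m≤m+n _ τ)) (ρ-mem (suc r) s (suc m) u ul e₂ L (s≤s z≤n))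
   ... | false | false = go m
    where
    -- If p^f₀ exactly divides γ_(r+1) + u, then K - 1 is divisible by p^(s-f₀). The missing f₀ + 1
    -- factors come from f, whose index v + u p has f₀ + 1 positive levels by `key`.
    μ-case : ∀ {σ} q → (σ , int q) ∈ ps → ∀ l → UnitQ (Kval (int q) r v u (l · p ^ s)) × M lev (k ∔ suc s) (λ t → (Kval (int q) r v u (l · p ^ s) - 1#) * f t)
    μ-case q i l with IntP.μ q r ℕ.<ᵇ v in eμ
    ... | false = UnitQ-1 , M-resp (λ t _ → solve 1 (λ f → :0 := (:1 :- :1) :* f) refl (f t)) M-0
    ... | true with ord q (suc r) u
    ... | mkOrd f₀ υ uυ ve dg = UnitQ-≡1 (Dv-weaken (Nat.m<n⇒0<n∸m f₀<s) dK) , M-weaken (Nat.≤-reflexive expo) (M-* (M-const dK) fm)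
     where
     μ<v : IntP.μ q r < v
     μ<v = Nat.<ᵇ⇒< (IntP.μ q r) v (subst T (sym eμ) tt)
     -- A match of s digits would make u the residue of -γ_(r+1) modulo p^s itself, and then μ_r < v
     -- contradicts goodness.
     f₀<s : f₀ < s
     f₀<s = Nat.≰⇒> λ s≤f → Nat.<⇒≱ (Nat.+-monoˡ-< (u · p) μ<v)
      (subst (λ z → v ∔ u · p ≤ IntP.μ q r ∔ z · p) (trans (sym (Digits-md dg s s≤f)) (md-small s u ul)) (good⇒ ps r (suc s) (v ∔ u · p) e₁ i))
     fm : M lev (k ∔ suc f₀) f
     fm = gL-full r f₀ v u k (λ j lt → key i r v u f₀ vl μ<v dg j (Nat.≤-pred lt)) pf
     a = γ q (suc r) + ι u
     a≢0 : a ≢ 0#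
     a≢0 = fac≢0 (int q) (suc r) u 0
     l′ = l · p ^ s
     dK : Dv (s ∸ f₀) ((γ q (suc r) + ι (u ∔ l′)) * inv a - 1#)
     dK = subst (Dv (s ∸ f₀)) (sym eqK) (Dv-weaken (Nat.m≤m+n _ 0) (Dv-* (Dv-π₀ (s ∸ f₀)) (Z⇒Dv (Z-* (Z-ι l) (invInt uυ)))))
      where
      open ≡-Reasoning
      πs : π ↑ s ≡ π ↑ f₀ * π ↑ (s ∸ f₀)
      πs = trans (cong (π ↑_) (sym (Nat.m+[n∸m]≡n (Nat.<⇒≤ f₀<s)))) (↑-+ π f₀ _)
      eqK : (γ q (suc r) + ι (u ∔ l′)) * inv a - 1# ≡ π ↑ (s ∸ f₀) * (ι l * inv υ)
      eqK = begin
       (γ q (suc r) + ι (u ∔ l′)) * inv a - 1#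
        ≡⟨ cong₂ (λ x y → x * inv a - y) (trans (cong (γ q (suc r) +_) (ι-+ u l′)) (sym (+-assoc _ _ _))) (sym (inv-r {a} a≢0)) ⟩
       (a + ι l′) * inv a - a * inv a
        ≡⟨ solve 3 (λ a l i → (a :+ l) :* i :- a :* i := l :* i) refl a (ι l′) (inv a) ⟩
       ι l′ * inv a
        ≡⟨ cong₂ _*_ (trans (ι-* l (p ^ s)) (cong (ι l *_) (trans (ι-^ p s) πs))) (trans (cong inv ve) (inv-* (π ↑ f₀) υ)) ⟩
       ι l * (π ↑ f₀ * π ↑ (s ∸ f₀)) * (inv (π ↑ f₀) * inv υ)
        ≡⟨ solve 5 (λ l a b ia iu → l :* (a :* b) :* (ia :* iu) := (a :* ia) :* (b :* (l :* iu))) refl (ι l) (π ↑ f₀) (π ↑ (s ∸ f₀)) (inv (π ↑ f₀)) (inv υ) ⟩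
       (π ↑ f₀ * inv (π ↑ f₀)) * (π ↑ (s ∸ f₀) * (ι l * inv υ))
        ≡⟨ trans (cong (_* (π ↑ (s ∸ f₀) * (ι l * inv υ))) (inv-r {π ↑ f₀} (↑-≢0 f₀ π≢0))) (*-idˡ _) ⟩
       π ↑ (s ∸ f₀) * (ι l * inv υ) ∎
     expo : k ∔ suc s ≡ s ∸ f₀ ∔ (k ∔ suc f₀)
     expo = trans (cong (λ z → k ∔ suc z) (sym (Nat.m∸n+n≡m (Nat.<⇒≤ f₀<s)))) (S.solve 3 (λ k d f → k S.:+ (S.con 1 S.:+ (d S.:+ f)) S.:= d S.:+ (k S.:+ (S.con 1 S.:+ f))) refl k (s ∸ f₀) f₀)
    K-case : ∀ l {σ g} → (σ , g) ∈ ps → UnitQ (Kval g r v u (l · p ^ s)) × M lev (k ∔ suc s) (λ t → (Kval g r v u (l · p ^ s) - 1#) * f t)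
    K-case l {g = int q} i = μ-case q i l
    K-case l {g = non q} i = UnitQ-1 , M-resp (λ t _ → solve 1 (λ f → :0 := (:1 :- :1) :* f) refl (f t)) M-0
    go : ∀ m → M lev (k ∔ suc s ∔ (gL L (r ∔ suc s) m ∔ ω · nz m)) (λ t → (Rt r (v ∔ u · p) (m · p ^ suc s) t - Rt (suc r) u (m · p ^ s) t) * f t)
    go zero = M-resp (λ t _ → solve 2 (λ a f → :0 := (a :- a) :* f) refl (Rt r (v ∔ u · p) 0 t) (f t)) M-0
    go m@(suc m') = M-resp (λ t o → trans (solve 4 (λ R E K f → R :* ((E :- :1) :* (f :* K)) :+ R :* ((K :- :1) :* f) := (R :* (E :* K) :- R) :* f) refl (R' t) (Em r v u s vl m t) (Kt r v u (m · p ^ s)) (f t))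
        (cong (λ z → (z - R' t) * f t) (sym (Rt-step r v u s vl m t o))))
      (M-+ (M-weaken e1 (M-* R'm (M-* (M-Π1 m (λ i _ → E-mem r v (u ∔ i · p ^ s) s vl)) (M-*0 (P⇒M pf) (M-const (Z⇒Dv (proj₁ cl)))))))
         (M-weaken e2 (M-* R'm (proj₂ cl))))
     where
     R' : Fun
     R' t = Rt (suc r) u (m · p ^ s) t
     G = gL L (r ∔ suc s) m
     R'm : M lev (G ∔ ω ∔ τ) R'
     R'm = subst (λ x → M lev (gL L x m ∔ ω ∔ τ) R') (sym (Nat.+-suc r s)) (ρ-mem (suc r) s m u ul e₂ L (s≤s z≤n))
     cl : Close (k ∔ suc s) f (Kt r v u (m · p ^ s))
     cl = Close-prodS ps (K-case m)
     e1 : k ∔ suc s ∔ (G ∔ ω · 1) ≤ G ∔ ω ∔ τ ∔ (suc s ∸ τ ∔ k)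
     e1 = Nat.≤-reflexive (trans (cong (λ z → k ∔ z ∔ (G ∔ ω · 1)) (sym (Nat.m+[n∸m]≡n (Nat.≤-trans τ≤1 (s≤s z≤n)))))
      (S.solve 5 (λ k t d g w → k S.:+ (t S.:+ d) S.:+ (g S.:+ w S.:* S.con 1) S.:= g S.:+ w S.:+ t S.:+ (d S.:+ k)) refl k τ (suc s ∸ τ) G ω))
     e2 : k ∔ suc s ∔ (G ∔ ω · 1) ≤ G ∔ ω ∔ τ ∔ (k ∔ suc s)
     e2 = Nat.≤-trans (Nat.≤-reflexive (trans (Nat.+-comm (k ∔ suc s) _) (cong (λ z → G ∔ z ∔ (k ∔ suc s)) (Nat.*-identityʳ ω)))) (Nat.+-monoˡ-≤ (k ∔ suc s) (Nat.m≤m+n (G ∔ ω) τ))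

   new-bad : ∀ r s v u m k f → v < p → u < p ^ s → bad ps (suc r) s u ≡ false → bad ps r (suc s) (v ∔ u · p) ≡ true →
    P r (v ∔ u · p ∔ m · p ^ suc s) k f → Q r s m k f
   new-bad r s v u m k f vl ul g b pf L = M-weaken le (at pf (suc s ∔ L))
    where
    n = v ∔ u · p ∔ m · p ^ suc s
    nz≤ : nz m ≤ nz n
    nz≤ = go m refl
     where
     go : ∀ m' → m' ≡ m → nz m ≤ nz n
     go zero refl = z≤n
     go (suc m') refl with v ∔ u · p ∔ m · p ^ suc s | Nat.≤-trans (p^>0 (suc s)) (Nat.≤-trans (Nat.m≤m+n (p ^ suc s) (m' · p ^ suc s)) (Nat.m≤n+m (suc m' · p ^ suc s) (v ∔ u · p)))
     ... | suc _ | _ = s≤s z≤n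
    le : k ∔ suc s ∔ (gL L (r ∔ suc s) m ∔ ω · nz m) ≤ k ∔ (gL (suc s ∔ L) r n ∔ ω · nz n)
    le = Nat.≤-trans (Nat.≤-reflexive (S.solve 4 (λ k s g w → k S.:+ s S.:+ (g S.:+ w) S.:= k S.:+ ((s S.:+ g) S.:+ w)) refl k (suc s) (gL L (r ∔ suc s) m) (ω · nz m)))
     (Nat.+-monoʳ-≤ k (Nat.+-mono-≤ (gL-shift r (suc s) L (v ∔ u · p) m (+·< {v} {u} {s} vl ul) (new-bad-pos r s v u m vl ul g b)) (Nat.*-monoʳ-≤ ω nz≤)))

   bad-0 : ∀ r → bad ps r 0 0 ≡ false
   bad-0 r = pos-0 r 0

   open DworkCongruences p using (module Dwork; module Abel; block) public
   private
    P-resp : ∀ {r n k f g} → (∀ t → f t ≡ g t) → P r n k f → P r n k g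
    P-resp e h = mkP λ L → M-resp (λ t _ → e t) (at h L)
    P-0 : ∀ {r n k} → P r n k (λ _ → 0#)
    P-0 = mkP λ L → M-0
    P-neg : ∀ {r n k f} → P r n k f → P r n k (λ t → - f t)
    P-neg h = mkP λ L → M-neg (at h L)
    P-base : ∀ {r n k f} → P r n k f → P r 0 k f
    P-base {r} {n} {k} h = mkP λ L → M-weaken (Nat.≤-reflexive (trans (cong (k ∔_) (cong₂ _∔_ (gL-0 L r) (Nat.*-zeroʳ ω))) (Nat.+-identityʳ k))) (P⇒M {r} {n} {k} h)
    P-A : ∀ {r k f} n → P r 0 k f → P r n k (λ t → A r n t * f t)
    P-A {r} {k} n h = mkP λ L → M-weaken (Nat.≤-reflexive (Nat.+-comm k _)) (M-* (A-P r n L) (P⇒M {r} {0} {k} h))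
    P-*A : ∀ {r n k f} r' n' → P r n k f → P r n k (λ t → f t * A r' n' t)
    P-*A r' n' h = mkP λ L → M-*0 (at h L) (A-int r' n')
    A∈P : ∀ r n → P r n 0 (A r n)
    A∈P r n = mkP (A-P r n)
    new-bad′ : ∀ r s v u m k f → v < p → u < p ^ s → bad ps (suc r) s u ≡ false → bad ps r (suc s) (v ∔ u · p) ≡ true →
     P r (v ∔ u · p ∔ m · p ^ suc s) k f → P (r ∔ suc s) m (k ∔ suc s) f
    new-bad′ r s v u m k f a b c d h = mkP (new-bad r s v u m k f a b c d h)
    ρ-step′ : ∀ r s v u m k f → v < p → u < p ^ s → P r (v ∔ u · p) k f →
     P (r ∔ suc s) m (k ∔ suc s) (λ t → (ρ r (suc s) m (v ∔ u · p) t - ρ (suc r) s m u t) * f t)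
    ρ-step′ r s v u m k f a b h = mkP (ρ-step r s v u m k f a b h)
    ρ-0 : ∀ r m t → ρ r 0 m 0 t ≡ A r m t
    ρ-0 r m t = trans (cong (λ b → if b then 0# else Rt r 0 (m · 1) t) (bad-0 r)) (cong (λ k → Rt r 0 k t) (Nat.*-identityʳ m))
    ρ-bad : ∀ r s m j t → bad ps r s j ≡ true → ρ r s m j t ≡ 0#
    ρ-bad r s m j t e = cong (λ b → if b then 0# else Rt r j (m · p ^ s) t) e
    ρ-good : ∀ r s m j t → bad ps r s j ≡ false → A r (j ∔ m · p ^ s) t ≡ A r j t * ρ r s m j t
    ρ-good r s m j t e = trans (A-split r j (m · p ^ s) t) (cong (λ b → A r j t * (if b then 0# else Rt r j (m · p ^ s) t)) (sym e))

   open Dwork p>0 P P-resp P-0 P-+ P-neg P-base A P-A P-*A A∈P (bad ps) bad-0 bad-suc new-bad′ ρ ρ-0 ρ-bad ρ-good ρ-step′ public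

-- Harmonic sums and the coefficients of p G(z) F'(z^p) - F(z) G'(z^p).

module Harmonic (p : ℕ) (pp : Prime p) (Ω : ℕ → Set) where
 open Q
 open Sums
 open Convolution
 open import Data.Nat.Base using (_≤_; _<_; _∸_; _^_) renaming (_+_ to _∔_; _*_ to _·_)

 open Padic p pp
 open Filt Ω
 open UnitProducts p pp Ω
 open Fermat p pp
 open Parameters p pp Ω
 open SignedProducts p pp Ω
 open Digit p pp Ω
 open Ratios p pp Ω
 open import Data.Nat.DivMod using (_/_; _%_; m≡m%n+[m/n]*n; m%n<n)
 open import Data.Nat.Divisibility using (_∣_)
 private module S = +-*-Solver

 pm : Bool → ℚ → ℚ
 pm true x = x
 pm false x = - x

 sumS : Signed → (Param → ℚ) → ℚ
 sumS [] f = 0#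
 sumS ((σ , g) ∷ ps) f = pm σ (f g) + sumS ps f

 sumS-ext : ∀ ps {f f'} → (∀ g → f g ≡ f' g) → sumS ps f ≡ sumS ps f'
 sumS-ext [] e = refl
 sumS-ext ((σ , g) ∷ ps) e = cong₂ _+_ (cong (pm σ) (e g)) (sumS-ext ps e)

 sumS-lin : ∀ ps c d f f' → sumS ps (λ g → c * f g + d * f' g) ≡ c * sumS ps f + d * sumS ps f'
 sumS-lin [] c d f f' = solve 2 (λ c d → :0 := c :* :0 :+ d :* :0) refl c d
 sumS-lin ((true , g) ∷ ps) c d f f' = trans (cong (_ +_) (sumS-lin ps c d f f')) (solve 6 (λ c d x y a b → (c :* x :+ d :* y) :+ (c :* a :+ d :* b) := c :* (x :+ a) :+ d :* (y :+ b)) refl c d (f g) (f' g) (sumS ps f) (sumS ps f'))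
 sumS-lin ((false , g) ∷ ps) c d f f' = trans (cong (_ +_) (sumS-lin ps c d f f')) (solve 6 (λ c d x y a b → :- (c :* x :+ d :* y) :+ (c :* a :+ d :* b) := c :* (:- x :+ a) :+ d :* (:- y :+ b)) refl c d (f g) (f' g) (sumS ps f) (sumS ps f'))

 M-sumS : ∀ {lev k} ps (X : Fun) {f : Param → Fun} → (∀ {σ g} → (σ , g) ∈ ps → M lev k (λ t → X t * f g t)) → M lev k (λ t → X t * sumS ps (λ g → f g t))
 M-sumS [] X h = M-resp (λ t _ → sym (*-0ʳ (X t))) M-0
 M-sumS {lev} {k} ((σ , g) ∷ ps) X {f} h = M-resp (λ t _ → sym (*-distribˡ (X t) _ _)) (M-+ (hd σ) (M-sumS ps X (λ i → h (there i))))
  where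
  hd : ∀ σ → M lev k (λ t → X t * pm σ (f g t))
  hd true = h (here refl)
  hd false = M-resp (λ t _ → sym (neg-*ʳ (X t) (f g t))) (M-neg (h (here refl)))

 -- The factor of a parameter with p dividing N has been scaled by N, so the harmonic summand 1/(γ +
 -- k) is N over that factor, a multiple of p.
 hterm : Param → ℕ → ℕ → Fun
 hterm g@(int q) r k t = inv (fac g r k t)
 hterm g@(non q) r k t = ι (NonP.N q) * inv (fac g r k t)

 hterm-non : ∀ q r k → M₀ 1 (hterm (non q) r k)
 hterm-non q r k = M-* (M-const (Dv-ι∣ {1} (subst (_∣ NonP.N q) (sym (Nat.*-identityʳ p)) (NonP.p∣N q)))) (mem (U-inv facU))
  where
  open import Data.Nat.Divisibility using (∣n⇒∣m*n)
  facU : U suc (fac (non q) r k)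
  facU = mkU (M-+ (NonP.x-mem q r) (M-const (Dv-ι _))) (λ t o → UnitQ-≡ (UnitQ-ι (NonP.x-unit q r t o))
    (subst (Dv 1) (solve 2 (λ a b → b := (a :+ b) :- a) refl (ι (NonP.x q r t)) (ι (k · NonP.N q))) (Dv-ι∣ {1} (subst (_∣ (k · NonP.N q)) (sym (Nat.*-identityʳ p)) (∣n⇒∣m*n k (NonP.p∣N q))))))

 harm : Param → ℕ → ℕ → Fun
 harm g r n t = Σ< n (λ k → hterm g r k t)

 Hs : Signed → ℕ → ℕ → Fun
 Hs ps r n t = sumS ps (λ g → harm g r n t)

 Digits-uncons : ∀ {q r f n} → Digits q r (suc f) n → n % p ≡ IntP.μ q r × Digits q (suc r) f (n / p)
 Digits-uncons {q} {r} {f} (ds {u = u} d) = dig% (IntP.μ q r) u (IntP.μ<p q r) , subst (Digits q (suc r) f) (sym (dig/ (IntP.μ q r) u (IntP.μ<p q r))) d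

 Digits-drop : ∀ i {q r f} lo m → lo < p ^ i → Digits q r (i ∔ f) (lo ∔ m · p ^ i) → Digits q (r ∔ i) f m
 Digits-drop zero {q} {r} {f} zero m _ d = subst₂ (λ a b → Digits q a f b) (sym (Nat.+-identityʳ r)) (Nat.*-identityʳ m) d
 Digits-drop zero (suc lo) m (s≤s ()) d
 Digits-drop (suc i) {q} {r} {f} lo m l d = subst (λ a → Digits q a f m) (sym (Nat.+-suc r i))
   (Digits-drop i (lo / p) m (/-< lo i l) (subst (Digits q (suc r) (i ∔ f)) eq (proj₂ (Digits-uncons d))))
  where
  eq : (lo ∔ m · p ^ suc i) / p ≡ lo / p ∔ m · p ^ i
  eq = trans (cong (_/ p) (trans (cong (_∔ m · p ^ suc i) (m≡m%n+[m/n]*n lo p)) (S.solve 5 (λ a b p m q → a S.:+ b S.:* p S.:+ m S.:* (p S.:* q) S.:= a S.:+ (b S.:+ m S.:* q) S.:* p) refl (lo % p) (lo / p) p m (p ^ i))))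
   (dig/ (lo % p) _ (m%n<n lo p))

 s<p^s : ∀ s → s < p ^ s
 s<p^s zero = s≤s z≤n
 s<p^s (suc s) = Nat.≤-trans (s≤s (s<p^s s)) (Nat.≤-trans (Nat.+-monoˡ-≤ (p ^ s) (p^>0 s)) (Nat.≤-trans (Nat.≤-reflexive (cong (p ^ s ∔_) (sym (Nat.+-identityʳ _)))) (Nat.*-monoˡ-≤ (p ^ s) 1<p)))

 M-divide : ∀ {lev k} f {υ y X} → UnitQ υ → y ≡ π ↑ f * υ → M lev (f ∔ k) X → M lev k (λ t → X t * inv y)
 M-divide {lev} {k} f {υ} {y} {X} uυ e m = M-cancel f (M-resp (λ t _ → sym (trans (cong (λ z → π ↑ f * (X t * z)) (trans (cong inv e) (inv-* (π ↑ f) υ)))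
   (trans (solve 4 (λ a x i j → a :* (x :* (i :* j)) := (a :* i) :* (x :* j)) refl (π ↑ f) (X t) (inv (π ↑ f)) (inv υ))
    (trans (cong (_* (X t * inv υ)) (inv-r {π ↑ f} (↑-≢0 f π≢0))) (*-idˡ _))))) (M-*0 m (M-const (Z⇒Dv (invInt uυ)))))

 nz-pos : ∀ {n} → 1 ≤ n → nz n ≡ 1
 nz-pos (s≤s _) = refl

 kron : ℕ → ℕ → ℚ → ℚ
 kron m v x = if v ℕ.≡ᵇ m then x else 0#

 kron-eq : ∀ m x → kron m m x ≡ x
 kron-eq m x rewrite ≡ᵇ-refl m = refl

 kron-ne : ∀ m v x → v ≢ m → kron m v x ≡ 0#
 kron-ne m v x ne rewrite ≢⇒≡ᵇ v m ne = refl

 Σ-kron-≤ : ∀ m a x → a ≤ m → Σ< a (λ v → kron m v x) ≡ 0#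
 Σ-kron-≤ m a x le = Σ-0 a (λ v l → kron-ne m v x (Nat.<⇒≢ (Nat.<-≤-trans l le)))

 Σ-kron-< : ∀ m a x → m < a → Σ< a (λ v → kron m v x) ≡ x
 Σ-kron-< m (suc a) x (s≤s l) with m Nat.≟ a
 ... | yes refl = trans (cong₂ _+_ (Σ-kron-≤ m m x Nat.≤-refl) (kron-eq m x)) (+-idˡ x)
 ... | no ne = trans (cong₂ _+_ (Σ-kron-< m a x (Nat.≤∧≢⇒< l ne)) (kron-ne m a x (λ e → ne (sym e)))) (+-idʳ x)

 module HSum (ps : Signed) (c : ℚ) (c≢0 : c ≢ 0#) (lev : ℕ → ℕ) (emb : ∀ {k f} → M₀ k f → M lev k f)
  (τ ω : ℕ) (τ≤1 : τ ≤ 1)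
  (ĉ-unit : UnitQ (c ↑ (p ∸ 1) * prodS ps (λ g → πpow g 1)))
  (A-mem : ∀ r n L → 1 ≤ n → M lev (Levels.gL ps L r n ∔ ω ∔ τ) (Instance.A ps c c≢0 lev emb τ ω τ≤1 ĉ-unit r n))
  (E-mem : ∀ r v u s l → M lev (suc s ∸ τ) (λ t → Instance.Et ps c c≢0 lev emb τ ω τ≤1 ĉ-unit r v u s l t - 1#))
  where

  open Levels ps
  open Instance ps c c≢0 lev emb τ ω τ≤1 ĉ-unit
  open WithBound A-mem E-mem

  H : ℕ → ℕ → Fun
  H = Hs ps

  private
   M-pad : ∀ {k} {X : Fun} r' (g : ℕ → ℕ) K j → M lev k X → M lev k (λ t → X t * pad (λ i → A r' (g i) t) K j)
   M-pad r' g K zero h = M-*0 h (A-int r' (g K))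
   M-pad {X = X} r' g zero (suc j) h = M-resp (λ t _ → sym (*-0ʳ (X t))) M-0
   M-pad r' g (suc K) (suc j) h = M-pad r' g K j h

   A-ω : ∀ r n → 1 ≤ n → M lev ω (A r n)
   A-ω r n l = M-weaken (Nat.m≤m+n ω τ) (A-mem r n 0 l)

   diffH : Param → ℕ → ℕ → ℕ → Fun
   diffH g r a j t = π * harm g r (a ∔ j · p) t + (- 1#) * harm g (suc r) j t

   module IntDiff (q : IntP) (r : ℕ) (t : ℕ) where
    open IntP q
    g = int q
    -- At offset μ_r, p times the summand at v + i p equals the summand 1/(γ_(r+1) + i) of the
    -- shifted sum, and the two cancel exactly; at every other offset p times an inverse unit is
    -- left.
    δ : ℕ → ℕ → ℚ
    δ i v = π * hterm g r (v ∔ i · p) t - kron (μ r) v (hterm g (suc r) i t)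
    δ-Dv : ∀ i v → v < p → Dv 1 (δ i v)
    δ-Dv i v l with v Nat.≟ μ r
    ... | yes refl = subst (Dv 1) (sym (trans (cong₂ (λ a b → π * a - b) (trans (cong inv (γ-dwork q r i)) (inv-* π _)) (kron-eq (μ r) _))
        (trans (cong (_- hterm g (suc r) i t) (trans (sym (*-assoc π (inv π) _)) (trans (cong (_* hterm g (suc r) i t) (inv-r {π} π≢0)) (*-idˡ _)))) (-‿inverse _)))) Dv-0
    ... | no ne = subst (Dv 1) (sym (trans (cong (λ z → π * hterm g r (v ∔ i · p) t - z) (kron-ne (μ r) v _ ne)) (trans (solve 2 (λ a b → a :* b :- :0 := a :* :1 :* b) refl π (hterm g r (v ∔ i · p) t)) refl)))
        (Dv-* {1} {0} (Dv-π₀ 1) (Z⇒Dv (invInt (γ-unit q r v i l ne))))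
    row : ∀ i a → Σ< a (λ v → π * hterm g r (v ∔ i · p) t) ≡ Σ< a (δ i) + Σ< a (λ v → kron (μ r) v (hterm g (suc r) i t))
    row i a = sym (trans (sym (Σ-+ a _ _)) (Σ-ext a (λ v → solve 2 (λ x k → (x :- k) :+ k := x) refl (π * hterm g r (v ∔ i · p) t) (kron (μ r) v (hterm g (suc r) i t)))))
    D : ℕ → ℕ → ℚ
    D a j = Σ< j (λ i → Σ< p (δ i)) + Σ< a (δ j)
    D-Dv : ∀ a j → a ≤ p → Dv 1 (D a j)
    D-Dv a j le = Dv-+ (Dv-Σ j (λ i _ → Dv-Σ p (δ-Dv i))) (Dv-Σ a (λ v l → δ-Dv j v (Nat.<-≤-trans l le)))
     where
     Dv-Σ : ∀ n {f} → (∀ i → i < n → Dv 1 (f i)) → Dv 1 (Σ< n f)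
     Dv-Σ zero h = Dv-0
     Dv-Σ (suc n) h = Dv-+ (Dv-Σ n (λ i l → h i (Nat.m<n⇒m<1+n l))) (h n Nat.≤-refl)
    eq : ∀ a j → a ≤ p → diffH g r a j t ≡ D a j + Σ< a (λ v → kron (μ r) v (hterm g (suc r) j t))
    eq a j le = begin
     π * harm g r (a ∔ j · p) t + (- 1#) * harm g (suc r) j t
      ≡⟨ cong (_+ (- 1#) * harm g (suc r) j t) (trans (cong (λ n → π * harm g r n t) (Nat.+-comm a (j · p))) (trans (sym (Σ-*ˡ (j · p ∔ a) π _)) (trans (Σ-split (j · p) a _) (cong₂ _+_ (Σ-block j p _) (Σ-ext a (λ v → cong (λ k → π * hterm g r k t) (Nat.+-comm (j · p) v))))))) ⟩
     Σ< j (λ i → Σ< p (λ v → π * hterm g r (v ∔ i · p) t)) + Σ< a (λ v → π * hterm g r (v ∔ j · p) t) + (- 1#) * harm g (suc r) j t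
      ≡⟨ cong (_+ (- 1#) * harm g (suc r) j t) (cong₂ _+_ (trans (Σ-ext j (λ i → trans (row i p) (cong (Σ< p (δ i) +_) (Σ-kron-< (μ r) p _ (μ<p r))))) (Σ-+ j _ _)) (row j a)) ⟩
     Σ< j (λ i → Σ< p (δ i)) + harm g (suc r) j t + (Σ< a (δ j) + Σ< a (λ v → kron (μ r) v (hterm g (suc r) j t))) + (- 1#) * harm g (suc r) j t
      ≡⟨ solve 4 (λ x h y k → x :+ h :+ (y :+ k) :+ (:- :1) :* h := (x :+ y) :+ k) refl (Σ< j (λ i → Σ< p (δ i))) (harm g (suc r) j t) (Σ< a (δ j)) _ ⟩
     D a j + Σ< a (λ v → kron (μ r) v (hterm g (suc r) j t)) ∎
     where open ≡-Reasoning

   -- Modulo p, whole periods of p H_r reproduce H_(r+1). The last, partial period may contain one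
   -- more pole 1/(γ_(r+1) + j), namely when μ_r < a; its denominator p^f, and one further factor p,
   -- are paid by the f + 1 positive levels of a + j p.
   part₁-param : ∀ {σ} g → (σ , g) ∈ ps → ∀ r a j → a < p → 1 ≤ a ∔ j · p → M lev (1 ∔ ω) (λ t → A r (a ∔ j · p) t * diffH g r a j t)
   part₁-param (non q) i r a j al n≥1 = M-weaken (Nat.≤-reflexive (Nat.+-comm 1 ω)) (M-* (A-ω r (a ∔ j · p) n≥1)
     (emb (M-+ (M-weaken (s≤s z≤n) (M-* (M-const (Dv-ι p)) (M-Σ (a ∔ j · p) (λ k _ → hterm-non q r k)))) (M-weaken (s≤s z≤n) (M-* (M-const (Dv-neg (Dv-ι 1))) (M-Σ j (λ k _ → hterm-non q (suc r) k)))))))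
   part₁-param (int q) i r a j al n≥1 = M-resp (λ t _ → sym (trans (cong (A r n t *_) (trans (IntDiff.eq q r t a j (Nat.<⇒≤ al)) (cong (_+ K) refl))) (*-distribˡ (A r n t) Dc K)))
     (M-+ (M-weaken (Nat.≤-reflexive (Nat.+-comm 1 ω)) (M-* (A-ω r n n≥1) (M-const (IntDiff.D-Dv q r 0 a j (Nat.<⇒≤ al))))) last)
    where
    n = a ∔ j · p
    Dc = IntDiff.D q r 0 a j
    K = Σ< a (λ v → kron (IntP.μ q r) v (inv (γ q (suc r) + ι j)))
    last : M lev (1 ∔ ω) (λ t → A r n t * K)
    last with IntP.μ q r Nat.<? a
    ... | no ge = M-resp (λ t _ → sym (trans (cong (A r n t *_) (Σ-kron-≤ (IntP.μ q r) a _ (Nat.≮⇒≥ ge))) (*-0ʳ (A r n t)))) M-0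
    ... | yes μ<a = M-resp (λ t _ → cong (A r n t *_) (sym (Σ-kron-< (IntP.μ q r) a _ μ<a)))
       (M-divide o.f o.υ-unit o.val≡ (M-weaken le (A-mem r n (suc o.f) n≥1)))
     where
     module o = Ord (ord q (suc r) j)
     le : o.f ∔ (1 ∔ ω) ≤ gL (suc o.f) r n ∔ ω ∔ τ
     le = Nat.≤-trans (Nat.≤-reflexive (trans (Nat.+-suc o.f ω) (cong (_∔ ω) (sym (gL-key i r a j o.f al μ<a o.digits))))) (Nat.m≤m+n _ τ)

   part₁ : ∀ r a j → a < p → M lev (1 ∔ ω) (λ t → A r (a ∔ j · p) t * (π * H r (a ∔ j · p) t - H (suc r) j t))
   part₁ r a j al = M-resp (λ t _ → cong (A r (a ∔ j · p) t *_) (trans (sumS-lin ps π (- 1#) _ _) (solve 2 (λ x y → x :+ (:- :1) :* y := x :- y) refl (π * H r (a ∔ j · p) t) (H (suc r) j t))))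
     (M-sumS ps (A r (a ∔ j · p)) {λ g → diffH g r a j} (each a j al))
    where
    each : ∀ a j → a < p → ∀ {σ g} → (σ , g) ∈ ps → M lev (1 ∔ ω) (λ t → A r (a ∔ j · p) t * diffH g r a j t)
    each zero zero al {g = g} i = M-resp (λ t _ → solve 2 (λ a x → :0 := a :* (x :* :0 :+ (:- :1) :* :0)) refl (A r 0 t) π) M-0
    each (suc a) j al {g = g} i = part₁-param g i r (suc a) j al (s≤s z≤n)
    each zero (suc j) al {g = g} i = part₁-param g i r zero (suc j) al (Nat.≤-trans p>0 (Nat.m≤m+n p (j · p)))

   module Part₂ (r a : ℕ) (al : a < p) (K : ℕ) where
    open Abel (M lev (1 ∔ ω)) (λ e → M-resp (λ t _ → e t)) M-0 M-+

    -- `S` brings p^(i+1), which settles poles of order f ≤ i. A pole of order f > i at k + u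
    -- p^(i+1) with k < v p^i means that the digits of the shifted parameter match those of u above
    -- a digit smaller than v. Then v + u p has f - i positive levels, and these pay the difference.
    term-mem : ∀ {σ} g → (σ , g) ∈ ps → ∀ i v u → v < p → 1 ≤ v → ∀ k → k < v · p ^ i →
     M lev (1 ∔ ω) (λ t → S r a K i (v ∔ u · p) t * hterm g (suc r) (k ∔ u · p ^ suc i) t)
    term-mem g g∈ i v u vl v≥1 k kl = go g g∈
     where
     SP : P (r ∔ suc i) (v ∔ u · p) (suc i) (S r a K i (v ∔ u · p))
     SP = dwork i r a al K (v ∔ u · p)
     nz1 : nz (v ∔ u · p) ≡ 1
     nz1 = nz-pos (Nat.≤-trans v≥1 (Nat.m≤m+n v _))
     base : ∀ L → M lev (suc i ∔ (gL L (r ∔ suc i) (v ∔ u · p) ∔ ω)) (S r a K i (v ∔ u · p))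
     base L = subst (λ z → M lev (suc i ∔ (gL L (r ∔ suc i) (v ∔ u · p) ∔ z)) (S r a K i (v ∔ u · p))) (trans (cong (ω ·_) nz1) (Nat.*-identityʳ ω)) (P.at SP L)
     go : ∀ {σ} g → (σ , g) ∈ ps → M lev (1 ∔ ω) (λ t → S r a K i (v ∔ u · p) t * hterm g (suc r) (k ∔ u · p ^ suc i) t)
     go (non q) _ = M-weaken (Nat.≤-trans (s≤s (Nat.m≤n+m ω i)) (Nat.m≤m+n _ 1)) (M-* (base 0) (emb (hterm-non q (suc r) (k ∔ u · p ^ suc i))))
     go (int q) q∈ with Ord.f o Nat.≤? i
      where o = ord q (suc r) (k ∔ u · p ^ suc i)
     ... | yes f≤i = M-divide (Ord.f o) (Ord.υ-unit o) (Ord.val≡ o) (M-weaken (Nat.≤-trans (Nat.+-monoˡ-≤ (1 ∔ ω) f≤i) (Nat.≤-reflexive (Nat.+-suc i ω))) (base 0))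
      where o = ord q (suc r) (k ∔ u · p ^ suc i)
     ... | no f≰i = M-divide (Ord.f o) (Ord.υ-unit o) (Ord.val≡ o) (M-weaken le (base (suc f')))
      where
      o = ord q (suc r) (k ∔ u · p ^ suc i)
      f' = Ord.f o ∸ suc i
      fe : Ord.f o ≡ i ∔ suc f'
      fe = trans (sym (Nat.m+[n∸m]≡n (Nat.≰⇒> f≰i))) (sym (Nat.+-suc i f'))
      instance
       nzq : NonZero (p ^ i)
       nzq = ℕ.>-nonZero (p^>0 i)
      lo = k % (p ^ i)
      v' = k / (p ^ i)
      ke : k ∔ u · p ^ suc i ≡ lo ∔ (v' ∔ u · p) · p ^ i
      ke = trans (cong (_∔ u · p ^ suc i) (m≡m%n+[m/n]*n k (p ^ i))) (S.solve 5 (λ l v q u p → l S.:+ v S.:* q S.:+ u S.:* (p S.:* q) S.:= l S.:+ (v S.:+ u S.:* p) S.:* q) refl lo v' (p ^ i) u p)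
      v'<v : v' < v
      v'<v = Nat.*-cancelʳ-< (p ^ i) v' v (Nat.≤-<-trans (Nat.m≤n+m _ lo) (subst (_< v · p ^ i) (m≡m%n+[m/n]*n k (p ^ i)) kl))
      dd : Digits q (suc r ∔ i) (suc f') (v' ∔ u · p)
      dd = Digits-drop i lo (v' ∔ u · p) (m%n<n k (p ^ i)) (subst₂ (Digits q (suc r)) fe ke (Ord.digits o))
      v'<p = Nat.<-trans v'<v vl
      μ<v : IntP.μ q (r ∔ suc i) < v
      μ<v = subst (_< v) (trans (sym (dig% v' u v'<p)) (trans (proj₁ (Digits-uncons dd)) (cong (IntP.μ q) (sym (Nat.+-suc r i))))) v'<v
      du : Digits q (suc (r ∔ suc i)) f' u
      du = subst₂ (λ x y → Digits q (suc x) f' y) (sym (Nat.+-suc r i)) (dig/ v' u v'<p) (proj₂ (Digits-uncons dd))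
      le : Ord.f o ∔ (1 ∔ ω) ≤ suc i ∔ (gL (suc f') (r ∔ suc i) (v ∔ u · p) ∔ ω)
      le = Nat.≤-reflexive (trans (cong (_∔ (1 ∔ ω)) fe) (trans (S.solve 3 (λ i f w → i S.:+ (S.con 1 S.:+ f) S.:+ (S.con 1 S.:+ w) S.:= S.con 1 S.:+ i S.:+ (S.con 1 S.:+ f S.:+ w)) refl i f' ω)
          (cong (λ z → suc i ∔ (z ∔ ω)) (sym (gL-key q∈ (r ∔ suc i) v u f' vl μ<v du)))))

    step : ∀ s i s' → i ∔ suc s' ≡ s → ∀ v u → v < p → u < p ^ s' →
     M lev (1 ∔ ω) (λ t → (H (suc r) ((v ∔ u · p) · p ^ i) t - H (suc r) (u · p ^ suc i) t) * S r a K i (v ∔ u · p) t)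
    step s i s' _ v u vl _ = M-resp (λ t _ → trans (*-comm _ _) (cong (_* S r a K i (v ∔ u · p) t) (trans (sumS-ext ps (λ g → eq g t)) (trans (sumS-lin ps 1# (- 1#) _ _) (solve 2 (λ x y → :1 :* x :+ (:- :1) :* y := x :- y) refl (H (suc r) ((v ∔ u · p) · p ^ i) t) (H (suc r) (u · p ^ suc i) t))))))
      (M-sumS ps (S r a K i (v ∔ u · p)) {λ g t → Σ< (v · p ^ i) (λ k → hterm g (suc r) (k ∔ u · p ^ suc i) t)} (λ {σ} {g} g∈ → sums g g∈ v vl))
     where
     eq : ∀ g t → Σ< (v · p ^ i) (λ k → hterm g (suc r) (k ∔ u · p ^ suc i) t) ≡ 1# * harm g (suc r) ((v ∔ u · p) · p ^ i) t + (- 1#) * harm g (suc r) (u · p ^ suc i) t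
     eq g t = sym (trans (cong (λ z → 1# * z + (- 1#) * harm g (suc r) (u · p ^ suc i) t) (trans (cong (λ n → harm g (suc r) n t) (S.solve 4 (λ v u p q → (v S.:+ u S.:* p) S.:* q S.:= u S.:* (p S.:* q) S.:+ v S.:* q) refl v u p (p ^ i)))
       (trans (Σ-split (u · p ^ suc i) (v · p ^ i) _) (cong (harm g (suc r) (u · p ^ suc i) t +_) (Σ-ext (v · p ^ i) (λ k → cong (λ z → hterm g (suc r) z t) (Nat.+-comm (u · p ^ suc i) k)))))))
      (solve 2 (λ x y → :1 :* (x :+ y) :+ (:- :1) :* x := y) refl (harm g (suc r) (u · p ^ suc i) t) _))
     sums : ∀ {σ} g → (σ , g) ∈ ps → ∀ v → v < p → M lev (1 ∔ ω) (λ t → S r a K i (v ∔ u · p) t * Σ< (v · p ^ i) (λ k → hterm g (suc r) (k ∔ u · p ^ suc i) t))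
     sums g g∈ zero vl = M-resp (λ t _ → sym (*-0ʳ (S r a K i (u · p) t))) M-0
     sums g g∈ v@(suc v₀) vl = M-resp (λ t _ → Σ-*ˡ (v · p ^ i) (S r a K i (v ∔ u · p) t) _) (M-Σ (v · p ^ i) (λ k kl → term-mem g g∈ i v u vl (s≤s z≤n) k kl))

    -- Abel summation with weights H_(r+1)(j p^i) at level i: each step adds the summands between u
    -- p^(i+1) and (v + u p) p^i, and the root weight is H_(r+1)(0) = 0. The range is extended from
    -- K + 1 to p^(K+1) indices, the terms beyond K being 0.
    part₂ : M lev (1 ∔ ω) (λ t → Σ< (suc K) (λ j → H (suc r) j t * b r a K j t))
    part₂ = M-resp (λ t _ → trans (cong₂ _-_ (trans (Σ-tail (suc K) (p ^ suc K) _ (Nat.<⇒≤ (s<p^s (suc K))) (λ j l → trans (cong (H (suc r) (j · 1) t *_) (b-0 j l t)) (*-0ʳ _))) (Σ-ext (suc K) (λ j → cong (λ z → H (suc r) z t * b r a K j t) (Nat.*-identityʳ j))))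
        (trans (cong (_* block (λ j → b r a K j t) (suc K) 0) (trans (sumS-ext ps (λ g → refl)) (H-0 t))) (*-0ˡ _))) (solve 1 (λ x → x :- :0 := x) refl _))
      (abel (suc K) (λ i j → H (suc r) (j · p ^ i)) (b r a K) (step (suc K)))
     where
     b-0 : ∀ j → suc K ≤ j → ∀ t → b r a K j t ≡ 0#
     b-0 j l t = trans (cong₂ (λ x y → A r (a ∔ j · p) t * x - A (suc r) j t * y) (pad-> _ K j l) (pad-> _ K j l)) (solve 2 (λ x y → x :* :0 :- y :* :0 := :0) refl _ _)
     H-0 : ∀ t → H (suc r) 0 t ≡ 0#
     H-0 t = go ps
      where
      go : ∀ ps → sumS ps (λ g → 0#) ≡ 0#
      go [] = refl
      go ((true , _) ∷ ps) = trans (+-idˡ _) (go ps)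
      go ((false , _) ∷ ps) = trans (cong (_+ sumS ps (λ g → 0#)) (solve 1 (λ o → :- :0 := :0) refl 1#)) (trans (+-idˡ _) (go ps))

  -- Write p H_r(a + j p) as H_(r+1)(j) plus a remainder. The remainder is handled by `part₁`; what
  -- is left is the sum of H_(r+1)(j) times the antisymmetric term `b`.
  logNumerator : ∀ r a K → a < p → M lev (1 ∔ ω) (λ t →
   conv (λ j → A (suc r) j t) (λ j → π * (A r (a ∔ j · p) t * H r (a ∔ j · p) t)) K
   - conv (λ j → A (suc r) j t * H (suc r) j t) (λ j → A r (a ∔ j · p) t) K)
  logNumerator r a K al = M-resp (λ t _ → eq t) (M-+ (M-Σ (suc K) (λ j _ → M-pad (suc r) (λ i → i) K j (part₁ r a j al))) (Part₂.part₂ r a al K))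
   where
   eq : ∀ t → Σ< (suc K) (λ j → A r (a ∔ j · p) t * (π * H r (a ∔ j · p) t - H (suc r) j t) * pad (λ i → A (suc r) i t) K j) + Σ< (suc K) (λ j → H (suc r) j t * b r a K j t)
    ≡ conv (λ j → A (suc r) j t) (λ j → π * (A r (a ∔ j · p) t * H r (a ∔ j · p) t)) K - conv (λ j → A (suc r) j t * H (suc r) j t) (λ j → A r (a ∔ j · p) t) K
   eq t = begin
    _ ≡⟨ Σ-+ (suc K) _ _ ⟨
    Σ< (suc K) (λ j → A r (a ∔ j · p) t * (π * H r (a ∔ j · p) t - H (suc r) j t) * pad (λ i → A (suc r) i t) K j + H (suc r) j t * b r a K j t)
     ≡⟨ Σ-ext (suc K) (λ j → solve 7 (λ A π h h' pa A' pb → A :* (π :* h :- h') :* pa :+ h' :* (A :* pa :- A' :* pb) := π :* (A :* h) :* pa :+ con (ℤ.-[1+ 0 ]) :* (A' :* h' :* pb)) refl (A r (a ∔ j · p) t) π (H r (a ∔ j · p) t) (H (suc r) j t) (pad (λ i → A (suc r) i t) K j) (A (suc r) j t) (pad (λ i → A r (a ∔ i · p) t) K j)) ⟩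
    Σ< (suc K) (λ j → π * (A r (a ∔ j · p) t * H r (a ∔ j · p) t) * pad (λ i → A (suc r) i t) K j + ιz ℤ.-[1+ 0 ] * (A (suc r) j t * H (suc r) j t * pad (λ i → A r (a ∔ i · p) t) K j))
     ≡⟨ trans (Σ-+ (suc K) _ _) (cong₂ _+_ (conv-comm (λ j → π * (A r (a ∔ j · p) t * H r (a ∔ j · p) t)) (λ j → A (suc r) j t) K) (Σ-*ˡ (suc K) (ιz ℤ.-[1+ 0 ]) _)) ⟩
    conv (λ j → A (suc r) j t) (λ j → π * (A r (a ∔ j · p) t * H r (a ∔ j · p) t)) K + ιz ℤ.-[1+ 0 ] * conv (λ j → A (suc r) j t * H (suc r) j t) (λ j → A r (a ∔ j · p) t) K
     ≡⟨ solve 2 (λ x y → x :+ con (ℤ.-[1+ 0 ]) :* y := x :- y) refl _ _ ⟩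
    _ ∎
    where open ≡-Reasoning

-- Counting multiples of p^l among the factors, and averages over units.

module Counting (p : ℕ) (pp : Prime p) (Ω : ℕ → Set) where
 open import Data.Nat.Base using (_+_; _*_; _∸_; _^_; _≤_; _<_; pred)
 open import Data.Nat.Primality using (prime⇒irreducible)

 open Sums
 open Padic p pp using (p≢0; 1<p; ∤-*; ∤⇒≢0)
 open Parameters p pp Ω using (IntP; int; non; shift; Param)
 open Digit p pp Ω using (nzp; p>0; p^>0; cc; cc<; lex<; lex-split; b2n; md; md<)
 open Fermat p pp using (<p⇒∤)
 open import Data.Nat.Properties
 open import Data.Nat.DivMod
 open import Data.Nat.Divisibility
 open import Data.Nat.GCD using (module Bézout)
 open +-*-Solver

 le : ℕ → ℕ → ℕ
 le a b = b2n (a ℕ.≤ᵇ b)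

 le-yes : ∀ {a b} → a ≤ b → le a b ≡ 1
 le-yes {a} {b} l with a ℕ.≤ᵇ b in e
 ... | true = refl
 ... | false = ⊥-elim (subst T e (≤⇒≤ᵇ l))

 le-no : ∀ {a b} → b < a → le a b ≡ 0
 le-no {a} {b} l with a ℕ.≤ᵇ b in e
 ... | false = refl
 ... | true = ⊥-elim (<⇒≱ l (≤ᵇ⇒≤ a b (subst T (sym e) tt)))

 count-thr : ∀ M w (f : ℕ → ℕ) → (∀ j → j < w → f j ≡ 1) → (∀ j → w ≤ j → f j ≡ 0) → w ≤ M → #< M f ≡ w
 count-thr M w f h1 h0 le' = trans (#-tail w M f le' h0) (trans (#-cong w h1) (trans (#-const w 1) (*-identityʳ w)))

 -- The number of k < n for which p^l divides γ_r + k, computed by l Dwork shifts. Summed over l ≥ 1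
 -- it is the valuation of the Pochhammer product.
 wc : IntP → ℕ → ℕ → ℕ → ℕ
 wc q r zero n = n
 wc q r (suc l) n = wc q (suc r) l (n / p + shift (int q) r (n % p))

 module _ (q : IntP) where
  open IntP q

  private
   one-< : ∀ r n i → i < n / p + shift (int q) r (n % p) → μ r + i * p < n
   one-< r n i l = subst (μ r + i * p <_) (sym (m≡m%n+[m/n]*n n p)) (go (n % p) (n / p) l)
    where
    go : ∀ v u → i < u + shift (int q) r v → μ r + i * p < v + u * p
    go v u l with μ r ℕ.<ᵇ v in e
    ... | true = ≤-trans (+-monoˡ-≤ (i * p) (<ᵇ⇒< (μ r) v (subst T (sym e) tt))) (+-monoʳ-≤ v (*-monoˡ-≤ p (≤-pred (subst (i <_) (+-comm u 1) l))))
    ... | false = lex< {v} {u} {μ r} {i} (subst (i <_) (+-identityʳ u) l) (μ<p r)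

   one-≥ : ∀ r n i → n / p + shift (int q) r (n % p) ≤ i → n ≤ μ r + i * p
   one-≥ r n i l = subst (_≤ μ r + i * p) (sym (m≡m%n+[m/n]*n n p)) (go (n % p) (n / p) (m%n<n n p) l)
    where
    go : ∀ v u → v < p → u + shift (int q) r v ≤ i → v + u * p ≤ μ r + i * p
    go v u vl l with μ r ℕ.<ᵇ v in e
    ... | true = <⇒≤ (lex< {μ r} {i} {v} {u} (subst (_≤ i) (+-comm u 1) l) vl)
    ... | false = +-mono-≤ (≮⇒≥ (λ x → subst T e (<⇒<ᵇ x))) (*-monoˡ-≤ p (subst (_≤ i) (+-identityʳ u) l))

   idx : ∀ r l j → μ r + (cc q (suc r) l + j * p ^ l) * p ≡ cc q r (suc l) + j * p ^ suc l
   idx r l j = solve 5 (λ m c j Q p → m :+ (c :+ j :* Q) :* p := m :+ c :* p :+ j :* (p :* Q)) refl (μ r) (cc q (suc r) l) j (p ^ l) p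

  wc-< : ∀ r l n j → j < wc q r l n → cc q r l + j * p ^ l < n
  wc-< r zero n j h = subst (_< n) (sym (*-identityʳ j)) h
  wc-< r (suc l) n j h = subst (_< n) (idx r l j) (one-< r n _ (wc-< (suc r) l _ j h))

  wc-≥ : ∀ r l n j → wc q r l n ≤ j → n ≤ cc q r l + j * p ^ l
  wc-≥ r zero n j h = subst (n ≤_) (sym (*-identityʳ j)) h
  wc-≥ r (suc l) n j h = subst (n ≤_) (idx r l j) (one-≥ r n _ (wc-≥ (suc r) l _ j h))

  -- The l-fold Dwork shift in one equation. It turns a comparison of n with the residue of -γ_r
  -- modulo p^l into a comparison of n/p^l with γ_(r+l), the form in which hypothesis H can be
  -- applied.
  cc-x : ∀ r l → p ^ l * x (r + l) ≡ x r + cc q r l * N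
  cc-x r zero = trans (+-identityʳ _) (trans (cong x (+-identityʳ r)) (sym (+-identityʳ _)))
  cc-x r (suc l) = begin
   p * p ^ l * x (r + suc l)                    ≡⟨ *-assoc p (p ^ l) _ ⟩
   p * (p ^ l * x (r + suc l))                  ≡⟨ cong (λ k → p * (p ^ l * x k)) (+-suc r l) ⟩
   p * (p ^ l * x (suc r + l))                  ≡⟨ cong (p *_) (cc-x (suc r) l) ⟩
   p * (x (suc r) + cc q (suc r) l * N)         ≡⟨ *-distribˡ-+ p (x (suc r)) _ ⟩
   p * x (suc r) + p * (cc q (suc r) l * N)     ≡⟨ cong (_+ p * (cc q (suc r) l * N)) (step r) ⟩
   x r + μ r * N + p * (cc q (suc r) l * N)     ≡⟨ solve 5 (λ x m n p c → x :+ m :* n :+ p :* (c :* n) := x :+ (m :+ c :* p) :* n) refl (x r) (μ r) N p (cc q (suc r) l) ⟩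
   x r + cc q r (suc l) * N                     ∎
   where open ≡-Reasoning

  cc-xj : ∀ r l j → (x (r + l) + j * N) * p ^ l ≡ x r + (cc q r l + j * p ^ l) * N
  cc-xj r l j = trans (solve 4 (λ x j n q → (x :+ j :* n) :* q := q :* x :+ j :* q :* n) refl (x (r + l)) j N (p ^ l))
   (trans (cong (_+ j * p ^ l * N) (cc-x r l)) (solve 4 (λ x c j n → x :+ c :* n :+ j :* n := x :+ (c :+ j) :* n) refl (x r) (cc q r l) (j * p ^ l) N))

  c<⇒ : ∀ r {c n} → c < n → x r + c * N ≤ n * N
  c<⇒ r {c} {n} l = ≤-trans (+-monoˡ-≤ (c * N) (x≤N r)) (*-monoˡ-≤ N l)

  c≥⇒ : ∀ r {c n} → n ≤ c → n * N < x r + c * N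
  c≥⇒ r {c} {n} l = ≤-trans (s≤s (*-monoˡ-≤ N l)) (+-monoˡ-≤ (c * N) (x≥1 r))

  wc-count : ∀ r l n M → wc q r l n ≤ M → #< M (λ j → le ((x (r + l) + j * N) * p ^ l) (n * N)) ≡ wc q r l n
  wc-count r l n M wM = count-thr M (wc q r l n) _
   (λ j h → le-yes (subst (_≤ n * N) (sym (cc-xj r l j)) (c<⇒ r (wc-< r l n j h))))
   (λ j h → le-no (subst (n * N <_) (sym (cc-xj r l j)) (c≥⇒ r (wc-≥ r l n j h)))) wM

  wc-≤n : ∀ r l n → wc q r l n ≤ n
  wc-≤n r l n = ≮⇒≥ λ h → <⇒≱ (wc-< r l n n h) (≤-trans (m≤m*n n (p ^ l) {{ℕ.>-nonZero (p^>0 l)}}) (m≤n+m _ (cc q r l)))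

  wc-0 : ∀ r l n → n * N < p ^ l → wc q r l n ≡ 0
  wc-0 r l n h with wc q r l n in e
  ... | zero = refl
  ... | suc w = ⊥-elim (<⇒≱ h (≤-trans (subst (p ^ l ≤_) (sym (cc-xj' )) (≤-trans (≤-reflexive (sym (*-identityˡ (p ^ l)))) (*-monoˡ-≤ (p ^ l) (x≥1 (r + l))))) (c<⇒ r (wc-< r l n 0 (subst (0 <_) (sym e) (s≤s z≤n))))))
   where
   cc-xj' : x r + (cc q r l + 0 * p ^ l) * N ≡ x (r + l) * p ^ l
   cc-xj' = trans (sym (cc-xj r l 0)) (cong (_* p ^ l) (+-identityʳ (x (r + l))))

 cnt : ℕ → ℕ → ℕ → ℕ → ℕ
 cnt x N l n = #< (suc n) (λ j → le ((x + j * N) * p ^ l) (n * N))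

 module _ {x N : ℕ} (x≥1 : 1 ≤ x) (x≤N : x ≤ N) where
  -- Every full period of length p^l contributes one j whatever the parameter; only the indicator of
  -- x/N ≤ m/p^l depends on it. With equally many upper and lower parameters the Q will cancel.
  cnt-dec : ∀ l m Q → m < p ^ l → cnt x N l (m + Q * p ^ l) ≡ Q + le (x * p ^ l) (m * N)
  cnt-dec l m Q ml = trans (#-tail (suc Q) (suc n) f (s≤s Q≤n) high) (cong₂ _+_ (trans (#-cong Q low) (trans (#-const Q 1) (*-identityʳ Q))) mid)
   where
   n = m + Q * p ^ l
   P = p ^ l
   f : ℕ → ℕ
   f j = le ((x + j * N) * P) (n * N)
   Q≤n : Q ≤ n
   Q≤n = ≤-trans (m≤m*n Q P {{ℕ.>-nonZero (p^>0 l)}}) (m≤n+m _ m)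
   low : ∀ j → j < Q → f j ≡ 1
   low j h = le-yes (≤-trans (*-monoˡ-≤ P (≤-trans (+-monoˡ-≤ (j * N) x≤N) (*-monoˡ-≤ N h))) (≤-trans (≤-reflexive (solve 3 (λ a b c → a :* b :* c := a :* c :* b) refl Q N P)) (*-monoˡ-≤ N (m≤n+m (Q * P) m))))
   high : ∀ j → suc Q ≤ j → f j ≡ 0
   high j h = le-no (≤-trans (s≤s (*-monoˡ-≤ N (≤-trans (+-monoˡ-≤ (Q * P) (<⇒≤ ml)) (*-monoˡ-≤ P h)))) (≤-trans (+-monoˡ-≤ (j * P * N) (*-mono-≤ x≥1 (p^>0 l))) (≤-reflexive (solve 4 (λ x j n q → x :* q :+ j :* q :* n := (x :+ j :* n) :* q) refl x j N P))))
   mid : f Q ≡ le (x * P) (m * N)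
   mid with x * P ≤? m * N
   ... | yes a = trans (le-yes (≤-trans (≤-reflexive (e1)) (≤-trans (+-monoˡ-≤ (Q * P * N) a) (≤-reflexive e2)))) (sym (le-yes a))
    where
    e1 = solve 4 (λ x j n q → (x :+ j :* n) :* q := x :* q :+ j :* q :* n) refl x Q N P
    e2 = solve 3 (λ m n q → m :* n :+ q :* n := (m :+ q) :* n) refl m N (Q * P)
   ... | no a = trans (le-no (≤-trans (s≤s (≤-reflexive (sym e2))) (≤-trans (+-monoˡ-< (Q * P * N) (≰⇒> a)) (≤-reflexive (sym e1))))) (sym (le-no (≰⇒> a)))
    where
    e1 = solve 4 (λ x j n q → (x :+ j :* n) :* q := x :* q :+ j :* q :* n) refl x Q N P
    e2 = solve 3 (λ m n q → m :* n :+ q :* n := (m :+ q) :* n) refl m N (Q * P)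

 md-quot : ∀ l n → Σ ℕ λ Q → n ≡ md l n + Q * p ^ l
 md-quot zero n = n , sym (*-identityʳ n)
 md-quot (suc l) n with md-quot l (n / p)
 ... | Q , e = Q , trans (m≡m%n+[m/n]*n n p) (trans (cong (λ z → n % p + z * p) e) (solve 5 (λ a m Q q p → a :+ (m :+ Q :* q) :* p := a :+ m :* p :+ Q :* (p :* q)) refl (n % p) (md l (n / p)) Q (p ^ l) p))

 -- res N m ∈ {1,…,N} is congruent to m modulo N.
 res : (N : ℕ) .{{_ : NonZero N}} → ℕ → ℕ
 res N m = suc ((m + pred N) % N)

 module Res (N : ℕ) {{nzN : NonZero N}} where
  sN : suc (pred N) ≡ N
  sN = suc-pred N

  res≥1 : ∀ m → 1 ≤ res N m
  res≥1 m = s≤s z≤n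

  res≤N : ∀ m → res N m ≤ N
  res≤N m = m%n<n (m + pred N) N

  res-+ : ∀ m k → res N (m + k * N) ≡ res N m
  res-+ m k = cong suc (trans (cong (_% N) (solve 3 (λ m k n → m :+ k :+ n := m :+ n :+ k) refl m (k * N) (pred N))) ([m+kn]%n≡m%n (m + pred N) k N))

  res-small : ∀ x → 1 ≤ x → x ≤ N → res N x ≡ x
  res-small (suc x) _ l = cong suc (trans (cong (_% N) (trans (sym (+-suc x (pred N))) (cong (x +_) sN))) (trans ([m+n]%n≡m%n x N) (m<n⇒m%n≡m l)))

  res-quot : ∀ m → 1 ≤ m → Σ ℕ λ k → m ≡ res N m + k * N
  res-quot (suc m) _ = m / N , trans (cong suc (m≡m%n+[m/n]*n m N)) (cong (λ z → suc z + m / N * N)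
   (sym (trans (cong (_% N) (trans (sym (+-suc m (pred N))) (cong (m +_) sN))) ([m+n]%n≡m%n m N))))

  res-cong : ∀ m m' k k' → m + k * N ≡ m' + k' * N → res N m ≡ res N m'
  res-cong m m' k k' e = trans (sym (res-+ m k)) (trans (cong (res N) e) (res-+ m' k'))

 opaque
  inverse : ∀ m n → 1 ≤ m → 1 ≤ n → Cop.Coprime m n → Σ ℕ λ w → Σ ℕ λ z → w * m ≡ 1 + z * n
  inverse m n m≥1 n≥1 c with Cop.coprime-Bézout c
  ... | Bézout.+- x y e = x , y , sym e
  ... | Bézout.-+ x y e with x * m in eq
  ... | zero = 1 , pred m , trans (*-identityˡ m) (trans (sym (suc-pred m {{ℕ.>-nonZero m≥1}})) (cong suc (trans (sym (*-identityʳ (pred m))) (cong (pred m *_) (sym (m*n≡1⇒n≡1 y n (sym e)))))))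
  -- Here x m = k + 1 is -1 modulo n, so x times x m inverts m, and the excess k(k + 2) is k times
  -- the multiple 1 + x m of n.
  ... | suc k = x * (x * m) , k * y , (begin
    x * (x * m) * m         ≡⟨ solve 2 (λ x m → x :* (x :* m) :* m := (x :* m) :* (x :* m)) refl x m ⟩
    (x * m) * (x * m)       ≡⟨ cong₂ _*_ eq eq ⟩
    suc k * suc k           ≡⟨ solve 1 (λ k → (con 1 :+ k) :* (con 1 :+ k) := con 1 :+ k :* (con 2 :+ k)) refl k ⟩
    1 + k * (2 + k)         ≡⟨ cong (λ z → 1 + k * z) e ⟩
    1 + k * (y * n)         ≡⟨ cong (1 +_) (sym (*-assoc k y n)) ⟩
    1 + k * y * n           ∎)
   where open ≡-Reasoning

 unit-index : ∀ j w' i w z q → w' * w ≡ 1 + z * q → (j * w' + i) * w ≡ (j + i * w) + (j * z) * q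
 unit-index j w' i w z q e = begin
  (j * w' + i) * w            ≡⟨ solve 4 (λ j w' i w → (j :* w' :+ i) :* w := j :* (w' :* w) :+ i :* w) refl j w' i w ⟩
  j * (w' * w) + i * w        ≡⟨ cong (λ y → j * y + i * w) e ⟩
  j * (1 + z * q) + i * w     ≡⟨ solve 5 (λ j z q i w → j :* (con 1 :+ z :* q) :+ i :* w := (j :+ i :* w) :+ (j :* z) :* q) refl j z q i w ⟩
  (j + i * w) + (j * z) * q   ∎
  where open ≡-Reasoning

 per-+ : ∀ q (F : ℕ → ℕ) → (∀ i → F (q + i) ≡ F i) → ∀ k i → F (i + k * q) ≡ F i
 per-+ q F per zero i = cong F (+-identityʳ i)
 per-+ q F per (suc k) i = trans (cong F (solve 3 (λ i q r → i :+ (q :+ r) := q :+ (i :+ r)) refl i q (k * q))) (trans (per (i + k * q)) (per-+ q F per k i))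

 #-periods : ∀ k q (F : ℕ → ℕ) → (∀ i → F (q + i) ≡ F i) → #< (k * q) F ≡ k * #< q F
 #-periods k q F per = trans (#-block k q F) (trans (#-ext k (λ i → #-ext q (λ j → per-+ q F per i j))) (#-const k _))

 -- Multiplication by a unit permutes the residues mod q: count both sides over w full periods and cancel w.
 #-affine : ∀ q (F : ℕ → ℕ) w → 1 ≤ w → 1 ≤ q → Cop.Coprime w q → (∀ i → F (q + i) ≡ F i) → #< q (λ i → F (i * w)) ≡ #< q F
 #-affine q F w w≥1 q≥1 c per = *-cancelˡ-≡ _ _ w {{ℕ.>-nonZero w≥1}} (sym (begin
  w * #< q F                                     ≡⟨ #-periods w q F per ⟨
  #< (w * q) F                                   ≡⟨ cong (λ n → #< n F) (*-comm w q) ⟩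
  #< (q * w) F                                   ≡⟨ #-block q w F ⟩
  #< q (λ i → #< w (λ j → F (j + i * w)))        ≡⟨ #-swap q w (λ i j → F (j + i * w)) ⟩
  #< w (λ j → #< q (λ i → F (j + i * w)))        ≡⟨ #-ext w (λ j → trans (#-ext q (λ i → shiftF j i)) (#-shift q G Gper (j * w'))) ⟩
  #< w (λ _ → #< q G)                            ≡⟨ #-const w _ ⟩
  w * #< q G                                     ∎))
  where
  open ≡-Reasoning
  G : ℕ → ℕ
  G i = F (i * w)
  inv' = inverse w q w≥1 q≥1 c
  w' = proj₁ inv'
  z = proj₁ (proj₂ inv')
  Gper : ∀ i → G (q + i) ≡ G i
  Gper i = trans (cong F (solve 3 (λ q i w → (q :+ i) :* w := i :* w :+ w :* q) refl q i w)) (per-+ q F per w (i * w))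
  shiftF : ∀ j i → F (j + i * w) ≡ G (j * w' + i)
  shiftF j i = sym (trans (cong F (unit-index j w' i w z q (proj₂ (proj₂ inv')))) (per-+ q F per (j * z) (j + i * w)))

 opaque
  p∤ind : ℕ → ℕ
  p∤ind n = b2n (not (does (p ∣? n)))

  p∤ind-∣ : ∀ {n} → p ∣ n → p∤ind n ≡ 0
  p∤ind-∣ {n} d with p ∣? n
  ... | yes _ = refl
  ... | no nd = ⊥-elim (nd d)

  p∤ind-∤ : ∀ {n} → ¬ p ∣ n → p∤ind n ≡ 1
  p∤ind-∤ {n} nd with p ∣? n
  ... | yes d = ⊥-elim (nd d)
  ... | no _ = refl

 p∤ind-cong : ∀ {m n} → (p ∣ m → p ∣ n) → (p ∣ n → p ∣ m) → p∤ind m ≡ p∤ind n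
 p∤ind-cong {m} {n} f g with p ∣? m
 ... | yes d = trans (p∤ind-∣ d) (sym (p∤ind-∣ (f d)))
 ... | no nd = trans (p∤ind-∤ nd) (sym (p∤ind-∤ (λ d → nd (g d))))

 p∤ind-+ : ∀ m k → p ∣ k → p∤ind (m + k) ≡ p∤ind m
 p∤ind-+ m k d = p∤ind-cong (λ h → ∣m+n∣m⇒∣n (subst (p ∣_) (+-comm m k) h) d) (λ h → ∣m∣n⇒∣m+n h d)

 coprime-* : ∀ {n m o} → Cop.Coprime n m → Cop.Coprime n o → Cop.Coprime n (m * o)
 coprime-* {n} {m} {o} c c' {d} (dn , dmo) = c' (dn , Cop.coprime-divisor (λ {e} (ed , em) → c (∣-trans ed dn , em)) dmo)

 ∤⇒Coprime : ∀ {n} → ¬ p ∣ n → Cop.Coprime n p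
 ∤⇒Coprime {n} nd {d} (dn , dp) with prime⇒irreducible pp dp
 ... | inj₁ e = e
 ... | inj₂ refl = ⊥-elim (nd dn)

 Coprime-^ : ∀ {n} k → ¬ p ∣ n → Cop.Coprime n (p ^ k)
 Coprime-^ zero nd = Cop.sym (Cop.1-coprimeTo _)
 Coprime-^ (suc k) nd = coprime-* (∤⇒Coprime nd) (Coprime-^ k nd)

 #-single : ∀ n m (f : ℕ → ℕ) → m < n → (∀ i → i < n → i ≢ m → f i ≡ 0) → #< n f ≡ f m
 #-single (suc n) m f l h with m ≟ n
 ... | yes refl = cong (_+ f m) (#-0 m (λ i il → h i (m<n⇒m<1+n il) (<⇒≢ il)))
 ... | no ne = trans (cong₂ _+_ (#-single n m f (≤∧≢⇒< (≤-pred l) ne) (λ i il → h i (m<n⇒m<1+n il))) (h n ≤-refl (λ e → ne (sym e)))) (+-identityʳ _)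

 IntP-∣ : ∀ (q : IntP) r v u → v < p → v ≢ IntP.μ q r → ¬ p ∣ IntP.x q r + (v + u * p) * IntP.N q
 IntP-∣ q r v u vl ne d = go (<-cmp v (μ r))
  where
  open IntP q
  pd : p ∣ x r + (μ r + u * p) * N
  pd = subst (p ∣_) (trans (+-assoc (x r) (μ r * N) (u * p * N)) (cong (x r +_) (sym (*-distribʳ-+ N (μ r) (u * p)))))
   (∣m∣n⇒∣m+n (subst (p ∣_) (step r) (m∣m*n (x (suc r)))) (∣m⇒∣m*n N (n∣m*n u)))
  gap : ∀ lo e → x r + (lo + e + u * p) * N ≡ (x r + (lo + u * p) * N) + e * N
  gap lo e = solve 5 (λ x l e u n → x :+ (l :+ e :+ u) :* n := (x :+ (l :+ u) :* n) :+ e :* n) refl (x r) lo e (u * p) N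
  sub : ∀ {hi} lo → lo < hi → hi < p → p ∣ x r + (hi + u * p) * N → ¬ p ∣ x r + (lo + u * p) * N
  sub {hi} lo l hp dh dl = ∤-* (<p⇒∤ (m<n⇒0<n∸m l) (≤-<-trans (m∸n≤m hi lo) hp)) p∤N
   (∣m+n∣m⇒∣n (subst (p ∣_) (trans (cong (λ z → x r + (z + u * p) * N) (sym (m+[n∸m]≡n (<⇒≤ l)))) (gap lo (hi ∸ lo))) dh) dl)
  go : Tri (v < μ r) (v ≡ μ r) (μ r < v) → ⊥
  go (tri≈ _ e _) = ne e
  go (tri< l _ _) = sub v l (μ<p r) pd d
  go (tri> _ _ l) = sub (μ r) l vl d pd

 -- Averaging over the p-adic units a ≡ b κ^s mod D: a parameter with denominator N = p^k N' contributes,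
 -- up to the factor p^(ν+1-k), the count for the p-integral parameter with denominator N' minus that of its
 -- Dwork shift, so the sum over the levels telescopes.
 module Avg (q : IntP) (k' ν : ℕ) (k≤ : suc k' ≤ suc ν) (D' ag b κ : ℕ) (p∤D' : ¬ p ∣ D') (p∤ag : ¬ p ∣ ag)
  (A≥1 : ∀ s → 1 ≤ b * κ ^ s * ag) {{nzN' : NonZero (IntP.N q)}} {{nzN : NonZero (p ^ suc k' * IntP.N q)}}
  (x≡ : ∀ s → IntP.x q s ≡ res (IntP.N q) (b * κ ^ s * ag)) where

  open IntP q renaming (N to N')
  k = suc k'
  N = p ^ k * N'
  D = N' * D'
  E = p ^ (suc ν ∸ k)

  a : ℕ → ℕ → ℕ
  a s i = b * κ ^ s + i * D

  T₁ : ℕ → ℕ → ℕ → ℕ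
  T₁ s l n = #< (p ^ suc ν) (λ i → p∤ind (a s i) * cnt (res N (a s i * ag)) N l n)

  private
   module RN = Res N
   module RN' = Res N'
   p∣N : p ∣ N
   p∣N = ∣m⇒∣m*n N' (m∣m*n (p ^ k'))
   w = D' * ag
   w≥1 : 1 ≤ w
   w≥1 = n≢0⇒n>0 (∤⇒≢0 (∤-* p∤D' p∤ag))
   Eq : E * p ^ k ≡ p ^ suc ν
   Eq = trans (sym (^-distribˡ-+-* p (suc ν ∸ k) k)) (cong (p ^_) (m∸n+n≡m k≤))

   module _ (s l n : ℕ) where
    Ψ : ℕ → ℕ
    Ψ m = p∤ind m * cnt (res N m) N l n
    A0 = b * κ ^ s * ag
    F F₀ f : ℕ → ℕ
    F i = Ψ (A0 + i * N')
    y = x s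
    F₀ i = Ψ (y + i * N')
    f I = p∤ind (y + I * N') * le ((y + I * N') * p ^ l) (n * N)
    Ψ-per : ∀ m j → Ψ (m + j * N) ≡ Ψ m
    Ψ-per m j = cong₂ (λ u z → u * cnt z N l n) (p∤ind-+ m (j * N) (∣n⇒∣m*n j p∣N)) (RN.res-+ m j)
    per : ∀ c i → Ψ (c + (p ^ k + i) * N') ≡ Ψ (c + i * N')
    per c i = trans (cong Ψ (solve 4 (λ c P i n → c :+ (P :+ i) :* n := (c :+ i :* n) :+ con 1 :* (P :* n)) refl c (p ^ k) i N')) (Ψ-per (c + i * N') 1)
    step1 : T₁ s l n ≡ #< (p ^ suc ν) (λ i → F (i * w))
    step1 = #-ext (p ^ suc ν) (λ i → trans (cong (_* cnt (res N (a s i * ag)) N l n)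
       (p∤ind-cong {a s i} {a s i * ag} (∣m⇒∣m*n ag) (λ h → case i h))) (cong Ψ (eqa i)))
     where
     eqa : ∀ i → a s i * ag ≡ A0 + i * w * N'
     eqa i = solve 5 (λ B i n d g → (B :+ i :* (n :* d)) :* g := B :* g :+ i :* (d :* g) :* n) refl (b * κ ^ s) i N' D' ag
     case : ∀ i → p ∣ a s i * ag → p ∣ a s i
     case i h with euclidsLemma (a s i) ag pp h
     ... | inj₁ d = d
     ... | inj₂ d = ⊥-elim (p∤ag d)
    step2 : T₁ s l n ≡ E * #< (p ^ k) F
    step2 = trans step1 (trans (#-affine (p ^ suc ν) F w w≥1 (p^>0 (suc ν)) (Coprime-^ (suc ν) (∤-* p∤D' p∤ag)) (λ i → trans (cong F (trans (+-comm (p ^ suc ν) i) (cong (i +_) (sym Eq)))) (per-+ (p ^ k) F (per A0) E i)))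
     (trans (cong (λ z → #< z F) (sym Eq)) (#-periods E (p ^ k) F (per A0))))
    step3 : #< (p ^ k) F ≡ #< (p ^ k) F₀
    step3 = trans (#-ext (p ^ k) (λ i → cong Ψ (trans (cong (_+ i * N') (trans (proj₂ rq) (cong (_+ proj₁ rq * N') (sym (x≡ s))))) (solve 4 (λ y z i n → y :+ z :* n :+ i :* n := y :+ (z :+ i) :* n) refl y (proj₁ rq) i N'))))
      (#-shift (p ^ k) F₀ (per y) (proj₁ rq))
     where
     rq = RN'.res-quot A0 (A≥1 s)
    step4 : #< (p ^ k) F₀ ≡ #< (suc n * p ^ k) f
    step4 = trans (#-cong (p ^ k) (λ i il → trans (cong (λ z → p∤ind (y + i * N') * cnt z N l n) (RN.res-small (y + i * N') (≤-trans (x≥1 s) (m≤m+n y _)) (≤-trans (+-monoˡ-≤ (i * N') (x≤N s)) (*-monoˡ-≤ N' il))))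
        (trans (sym (#-*ˡ (suc n) (p∤ind (y + i * N')) _)) (#-ext (suc n) (λ j → trans (cong₂ (λ u z → u * le (z * p ^ l) (n * N)) (trans (sym (p∤ind-+ (y + i * N') (j * N) (∣n⇒∣m*n j p∣N))) (cong p∤ind (eqI i j))) (eqI i j)) refl)))))
      (trans (#-swap (p ^ k) (suc n) (λ i j → f (i + j * p ^ k))) (sym (#-block (suc n) (p ^ k) f)))
     where
     eqI : ∀ i j → y + i * N' + j * N ≡ y + (i + j * p ^ k) * N'
     eqI i j = solve 5 (λ y i j P n → y :+ i :* n :+ j :* (P :* n) := y :+ (i :+ j :* P) :* n) refl y i j (p ^ k) N'

  n̂ : ℕ → ℕ
  n̂ n = n * p ^ k

  private
   nN : ∀ n → n * N ≡ n̂ n * N'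
   nN n = sym (*-assoc n (p ^ k) N')

   wc-suc-≤ : ∀ r l n → wc q r (suc l) (n̂ n) ≤ n * p ^ k'
   wc-suc-≤ r l n = ≤-trans (wc-≤n q (suc r) l _) (≤-reflexive (first r n))
    where
    first : ∀ r n → n̂ n / p + shift (int q) r (n̂ n % p) ≡ n * p ^ k'
    first r n = trans (cong₂ (λ u v → u + shift (int q) r v) e1 e2) (+-identityʳ _)
     where
     e0 : n̂ n ≡ n * p ^ k' * p
     e0 = solve 3 (λ n p P → n :* (p :* P) := n :* P :* p) refl n p (p ^ k')
     e1 : n̂ n / p ≡ n * p ^ k'
     e1 = trans (cong (_/ p) e0) (m*n/n≡m (n * p ^ k') p)
     e2 : n̂ n % p ≡ 0
     e2 = trans (cong (_% p) e0) (m*n%n≡0 (n * p ^ k') p)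

   total : ∀ r l n → #< (suc n * p ^ k) (λ I → le ((x (r + l) + I * N') * p ^ l) (n * N)) ≡ wc q r l (n̂ n)
   total r l n = trans (#-ext (suc n * p ^ k) (λ I → cong (le ((x (r + l) + I * N') * p ^ l)) (nN n))) (wc-count q r l (n̂ n) (suc n * p ^ k) (≤-trans (wc-≤n q r l (n̂ n)) (m≤n+m _ (p ^ k))))

   -- The I with p dividing x + I N' are μ + I' p, and dividing by p there gives the numerators of
   -- the Dwork shift. So the terms excluded at level l are precisely all the terms of level l + 1.
   divpart : ∀ r l n → #< (suc n * p ^ k) (λ I → (1 ∸ p∤ind (x (r + l) + I * N')) * le ((x (r + l) + I * N') * p ^ l) (n * N)) ≡ wc q r (suc l) (n̂ n)
   divpart r l n = begin
    #< (suc n * p ^ k) g                                   ≡⟨ cong (λ z → #< z g) (solve 3 (λ n p P → n :* (p :* P) := n :* P :* p) refl (suc n) p (p ^ k')) ⟩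
    #< (M' * p) g                                          ≡⟨ #-block M' p g ⟩
    #< M' (λ I' → #< p (λ v → g (v + I' * p)))             ≡⟨ #-ext M' (λ I' → trans (#-single p (μ s) (λ v → g (v + I' * p)) (μ<p s) (λ v vl ne → trans (cong (λ z → (1 ∸ z) * le ((x s + (v + I' * p) * N') * p ^ l) (n * N)) (p∤ind-∤ (IntP-∣ q s v I' vl ne))) refl)) (at I')) ⟩
    #< M' (λ I' → le ((x (r + suc l) + I' * N') * p ^ suc l) (n̂ n * N')) ≡⟨ wc-count q r (suc l) (n̂ n) M' (≤-trans (wc-suc-≤ r l n) (*-monoˡ-≤ (p ^ k') (n≤1+n n))) ⟩
    wc q r (suc l) (n̂ n)                                   ∎
    where
    open ≡-Reasoning
    s = r + l
    M' = suc n * p ^ k'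
    g : ℕ → ℕ
    g I = (1 ∸ p∤ind (x s + I * N')) * le ((x s + I * N') * p ^ l) (n * N)
    pe : ∀ I' → x s + (μ s + I' * p) * N' ≡ p * (x (suc s) + I' * N')
    pe I' = trans (solve 5 (λ x m I p n → x :+ (m :+ I :* p) :* n := (x :+ m :* n) :+ p :* (I :* n)) refl (x s) (μ s) I' p N') (trans (cong (_+ p * (I' * N')) (sym (step s))) (sym (*-distribˡ-+ p (x (suc s)) _)))
    at : ∀ I' → g (μ s + I' * p) ≡ le ((x (r + suc l) + I' * N') * p ^ suc l) (n̂ n * N')
    at I' = trans (cong₂ (λ u z → (1 ∸ u) * le (z * p ^ l) (n * N)) (p∤ind-∣ (subst (p ∣_) (sym (pe I')) (m∣m*n _))) (pe I'))
     (trans (*-identityˡ _) (cong₂ le (trans (solve 3 (λ p x P → p :* x :* P := x :* (p :* P)) refl p (x (suc s) + I' * N') (p ^ l)) (cong (λ z → (x z + I' * N') * p ^ suc l) (sym (+-suc r l)))) (nN n)))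

  avg : ∀ r l n → T₁ (r + l) l n + E * wc q r (suc l) (n̂ n) ≡ E * wc q r l (n̂ n)
  avg r l n = begin
   T₁ s l n + E * wc q r (suc l) (n̂ n)          ≡⟨ cong₂ (λ u z → u + E * z) (trans (step2 s l n) (cong (E *_) (trans (step3 s l n) (step4 s l n)))) (sym (divpart r l n)) ⟩
   E * #< M (f s l n) + E * #< M g              ≡⟨ *-distribˡ-+ E _ _ ⟨
   E * (#< M (f s l n) + #< M g)                ≡⟨ cong (E *_) (sym (#-+ M (f s l n) g)) ⟩
   E * #< M (λ I → f s l n I + g I)             ≡⟨ cong (E *_) (#-ext M (λ I → comb (p∤ind (x s + I * N')) _ (b01 _))) ⟩
   E * #< M (λ I → le ((x s + I * N') * p ^ l) (n * N)) ≡⟨ cong (E *_) (total r l n) ⟩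
   E * wc q r l (n̂ n)                           ∎
   where
   open ≡-Reasoning
   s = r + l
   M = suc n * p ^ k
   g : ℕ → ℕ
   g I = (1 ∸ p∤ind (x s + I * N')) * le ((x s + I * N') * p ^ l) (n * N)
   b01 : ∀ m → p∤ind m ≡ 0 ⊎ p∤ind m ≡ 1
   b01 m with p ∣? m
   ... | yes d = inj₁ (p∤ind-∣ d)
   ... | no nd = inj₂ (p∤ind-∤ nd)
   comb : ∀ u c → u ≡ 0 ⊎ u ≡ 1 → u * c + (1 ∸ u) * c ≡ c
   comb u c (inj₁ refl) = +-identityʳ c
   comb u c (inj₂ refl) = trans (+-identityʳ _) (+-identityʳ c)

  -- The telescope ends at level 1, where n p^(k-1) of the n p^k indices are counted. The total p^ν
  -- n no longer depends on the parameter: this is how a denominator divisible by p enters the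
  -- balance.
  avg-sum : ∀ r n L → n * N < p ^ suc L → #< L (λ l → T₁ (r + suc l) (suc l) n) ≡ p ^ ν * n
  avg-sum r n L h = begin
   S L                                    ≡⟨ +-identityʳ _ ⟨
   S L + 0                                ≡⟨ cong (S L +_) (trans (sym (*-zeroʳ E)) (cong (E *_) (sym (wc-0 q r (suc L) (n̂ n) (subst (_< p ^ suc L) (nN n) h))))) ⟩
   S L + E * wc q r (suc L) (n̂ n)         ≡⟨ tele L ⟩
   E * wc q r 1 (n̂ n)                     ≡⟨ cong (E *_) wc1 ⟩
   E * (n * p ^ k')                       ≡⟨ solve 3 (λ e n P → e :* (n :* P) := e :* P :* n) refl E n (p ^ k') ⟩
   E * p ^ k' * n                         ≡⟨ cong (_* n) (trans (sym (^-distribˡ-+-* p (suc ν ∸ k) k')) (cong (p ^_) (m∸n+n≡m (≤-pred k≤)))) ⟩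
   p ^ ν * n                              ∎
   where
   open ≡-Reasoning
   S : ℕ → ℕ
   S L = #< L (λ l → T₁ (r + suc l) (suc l) n)
   tele : ∀ L → S L + E * wc q r (suc L) (n̂ n) ≡ E * wc q r 1 (n̂ n)
   tele zero = refl
   tele (suc L) = trans (+-assoc (S L) _ _) (trans (cong (S L +_) (avg r (suc L) n)) (tele L))
   wc1 : wc q r 1 (n̂ n) ≡ n * p ^ k'
   wc1 = ≤-antisym (wc-suc-≤ r 0 n) (≮⇒≥ λ lt → <⇒≱ (m<n⇒0<n∸m lt) (≤-trans (≤-reflexive refl) (contr lt)))
    where
    contr : wc q r 1 (n̂ n) < n * p ^ k' → n * p ^ k' ∸ wc q r 1 (n̂ n) ≤ 0
    contr lt = ⊥-elim (<⇒≱ (≤-trans (+-monoˡ-≤ _ (μ<p r)) (≤-trans (*-monoˡ-≤ p lt) (≤-reflexive (solve 3 (λ n p P → n :* P :* p := n :* (p :* P)) refl n p (p ^ k')))))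
     (≤-trans (wc-≥ q r 1 (n̂ n) (wc q r 1 (n̂ n)) ≤-refl) (≤-reflexive (trans (cong (λ z → μ r + 0 * p + wc q r 1 (n̂ n) * z) (*-identityʳ p)) (cong (_+ wc q r 1 (n̂ n) * p) (+-identityʳ (μ r)))))))

-- Residues of multiples of a rational parameter and the construction of its shifts.

module Reduced (p : ℕ) (pp : Prime p) (ν D b : ℕ) (D≥1 : 1 ℕ.≤ D) (b≥1 : 1 ℕ.≤ b) (D-p : Cop.Coprime D p) (b-D : Cop.Coprime b D) where
 open import Data.Nat.Base using (_+_; _*_; _∸_; _^_; _≤_; _<_)
 open import Data.Nat.Divisibility using (_∣_)
 open import Defs using (InΩ; ModEq)

 open Q using (ι; inv)
 open Sums
 open Padic p pp
 Ω : ℕ → Set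
 Ω = InΩ p ν D b
 open Filt Ω
 open Parameters p pp Ω using (IntP; NonP; Param; int; non; p∣?_)
 open Digit p pp Ω using (nzp; p>0; p^>0)
 open Counting p pp Ω
 open import Data.Nat.Properties
 open import Data.Nat.DivMod
 open import Data.Nat.Divisibility
 import Data.Integer.Divisibility.Signed as ZSg
 open +-*-Solver

 p∤D : ¬ p ∣ D
 p∤D d = p∤1 (subst (p ∣_) (D-p (d , ∣-refl)) ∣-refl)

 -- κ is 1 modulo p^ν and inverse to p modulo D, so that multiplication by κ realises the shift t ↦ t^(1).
 private
  κ-alg : ∀ p q w P E z D → p ≡ 1 + P → D ≡ 1 + E → w * (p * q) ≡ 1 + z * D → p * (1 + q * (w * (P * E))) ≡ 1 + (P + z * (P * E)) * D
  κ-alg p q w P E z D pe De e = begin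
   p * (1 + q * (w * F))        ≡⟨ solve 4 (λ p q w F → p :* (con 1 :+ q :* (w :* F)) := p :+ w :* (p :* q) :* F) refl p q w F ⟩
   p + w * (p * q) * F          ≡⟨ cong₂ (λ x y → x + y * F) pe e ⟩
   (1 + P) + (1 + z * D) * F    ≡⟨ solve 3 (λ P Y F → (con 1 :+ P) :+ (con 1 :+ Y) :* F := con 1 :+ (P :+ F) :+ Y :* F) refl P (z * D) F ⟩
   1 + (P + F) + z * D * F      ≡⟨ cong₂ (λ x y → 1 + x + y) (trans (sym (*-suc P E)) (cong (P *_) (sym De))) (solve 3 (λ z D F → z :* D :* F := z :* F :* D) refl z D F) ⟩
   1 + P * D + z * F * D        ≡⟨ cong suc (sym (*-distribʳ-+ D P (z * F))) ⟩
   1 + (P + z * F) * D          ∎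
   where
   open ≡-Reasoning
   F = P * E

 opaque
  κ-data : Σ ℕ λ k₁ → Σ ℕ λ k₂ → p * (1 + p ^ ν * k₁) ≡ 1 + k₂ * D
  κ-data = go (inverse (p ^ suc ν) D (p^>0 (suc ν)) D≥1 (Cop.sym (Coprime-^ (suc ν) p∤D)))
   where
   go : (Σ ℕ λ w → Σ ℕ λ z → w * p ^ suc ν ≡ 1 + z * D) → Σ ℕ λ k₁ → Σ ℕ λ k₂ → p * (1 + p ^ ν * k₁) ≡ 1 + k₂ * D
   -- D - 1 plays the role of -1 modulo D: as w inverts p^(ν+1) there, p κ becomes p - (p - 1) = 1.
   go (w , z , e) = w * ((p ∸ 1) * (D ∸ 1)) , (p ∸ 1) + z * ((p ∸ 1) * (D ∸ 1)) ,
    κ-alg p (p ^ ν) w (p ∸ 1) (D ∸ 1) z D (sym (m+[n∸m]≡n p>0)) (sym (m+[n∸m]≡n D≥1)) e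

  κ k₁ k₂ : ℕ
  κ = 1 + p ^ ν * proj₁ κ-data
  k₁ = proj₁ κ-data
  k₂ = proj₁ (proj₂ κ-data)

  κ-ν : κ ≡ 1 + p ^ ν * k₁
  κ-ν = refl

  κ-D : p * κ ≡ 1 + k₂ * D
  κ-D = proj₂ (proj₂ κ-data)

 κ≥1 : 1 ≤ κ
 κ≥1 = subst (1 ≤_) (sym κ-ν) (s≤s z≤n)

 κ^≥1 : ∀ r → 1 ≤ κ ^ r
 κ^≥1 zero = ≤-refl
 κ^≥1 (suc r) = *-mono-≤ κ≥1 (κ^≥1 r)

 κ-D-coprime : Cop.Coprime κ D
 κ-D-coprime {d} (dκ , dD) = ∣1⇒≡1 (∣m+n∣m⇒∣n (subst (d ∣_) (trans κ-D (+-comm 1 _)) (∣n⇒∣m*n p dκ)) (∣n⇒∣m*n k₂ dD))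

 coprime-*ˡ : ∀ {m n o} → Cop.Coprime m o → Cop.Coprime n o → Cop.Coprime (m * n) o
 coprime-*ˡ c c' = Cop.sym (coprime-* (Cop.sym c) (Cop.sym c'))

 κ^-D : ∀ r → Cop.Coprime (κ ^ r) D
 κ^-D zero = Cop.1-coprimeTo D
 κ^-D (suc r) = coprime-*ˡ κ-D-coprime (κ^-D r)

 ν≥1⇒p∤κ : 1 ≤ ν → ¬ p ∣ κ
 ν≥1⇒p∤κ (s≤s {n = n} _) d = p∤1 (∣m+n∣m⇒∣n (subst (p ∣_) (trans κ-ν (+-comm 1 _)) d) (∣m⇒∣m*n k₁ (m∣m*n (p ^ n))))

 p∤^ : ∀ {m} r → ¬ p ∣ m → ¬ p ∣ m ^ r
 p∤^ zero h d = p∤1 d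
 p∤^ (suc r) h d with euclidsLemma _ _ pp d
 ... | inj₁ x = h x
 ... | inj₂ y = p∤^ r h y

 ModEq⇒∣ : ∀ {n x y} → ModEq n x y → Σ ℕ λ k → Σ ℕ λ k' → x + k * n ≡ y + k' * n
 ModEq⇒∣ {n} {x} {y} h with ≤-total x y
 ... | inj₁ le = quotient d , 0 , trans (trans (cong (x +_) (sym (_∣_.equality d))) (m+[n∸m]≡n le)) (sym (+-identityʳ y))
  where
  d : n ∣ y ∸ x
  d = subst (n ∣_) (trans (cong ℤ.∣_∣ (ℤₚ.m-n≡m⊖n x y)) (trans (ℤₚ.∣m⊖n∣≡∣n⊖m∣ x y) (cong ℤ.∣_∣ (ℤₚ.⊖-≥ le)))) h
 ... | inj₂ le = 0 , quotient d , trans (+-identityʳ x) (sym (trans (cong (y +_) (sym (_∣_.equality d))) (m+[n∸m]≡n le)))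
  where
  d : n ∣ x ∸ y
  d = subst (n ∣_) (trans (cong ℤ.∣_∣ (ℤₚ.m-n≡m⊖n x y)) (cong ℤ.∣_∣ (ℤₚ.⊖-≥ le))) h

 ModEq⇒Dv : ∀ {m x y} → ModEq (p ^ m) x y → Dv m (ι x Q.- ι y)
 ModEq⇒Dv {m} {x} {y} h with ModEq⇒∣ {p ^ m} {x} {y} h
 ... | k , k' , e = subst (Dv m) (trans (cong (Q._- ι (k * p ^ m)) (sub2 (ι x) (ι y) (ι (k * p ^ m)) (ι (k' * p ^ m)) (trans (sym (Q.ι-+ x _)) (trans (cong ι e) (Q.ι-+ y _))))) (Q.solve 2 (λ a b → (a Q.:+ b) Q.:- b Q.:= a) refl (ι x Q.- ι y) (ι (k * p ^ m))))
   (Dv-- (Dv-ι∣ {m} (n∣m*n k')) (Dv-ι∣ {m} (n∣m*n k)))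
  where
  sub2 : ∀ a b c d → a Q.+ c ≡ b Q.+ d → d ≡ (a Q.- b) Q.+ c
  sub2 a b c d e = trans (Q.solve 2 (λ b d → d Q.:= (b Q.:+ d) Q.:- b) refl b d) (trans (cong (Q._- b) (sym e)) (Q.solve 3 (λ a b c → (a Q.:+ c) Q.:- b Q.:= (a Q.:- b) Q.:+ c) refl a b c))

 Dv-*0 : ∀ {k x y} → Dv k x → Dv 0 y → Dv k (x Q.* y)
 Dv-*0 {k} {x} {y} a b = subst (λ z → Dv z (x Q.* y)) (+-identityʳ k) (Dv-* a b)

 record Raw : Set where
  field
   N a : ℕ
   N≥1 : 1 ≤ N
   a≥1 : 1 ≤ a
   N∣d : N ∣ p ^ ν * D
   cop : Cop.Coprime a N

 module _ (N a : ℕ) (N≥1 : 1 ≤ N) (a≥1 : 1 ≤ a) (p∤N : ¬ p ∣ N) (N∣D : N ∣ D) where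
  private
   instance
    nzN : NonZero N
    nzN = ℕ.>-nonZero N≥1
   module RN = Res N
   B : ℕ → ℕ
   B r = b * κ ^ r * a
   xx : ℕ → ℕ
   xx r = res N (B r)
   B≥1 : ∀ r → 1 ≤ B r
   B≥1 r = *-mono-≤ (*-mono-≤ b≥1 (κ^≥1 r)) a≥1
   px≥1 : ∀ r → 1 ≤ p * xx (suc r)
   px≥1 r = *-mono-≤ p>0 (RN.res≥1 (B (suc r)))
   mq : ∀ r → Σ ℕ λ k → p * xx (suc r) ≡ res N (p * xx (suc r)) + k * N
   mq r = RN.res-quot (p * xx (suc r)) (px≥1 r)
   same : ∀ r → res N (p * xx (suc r)) ≡ xx r
   same r = RN.res-cong (p * xx (suc r)) (B r) (p * k) (B r * k₂ * quotient N∣D) (begin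
     p * xx (suc r) + p * k * N           ≡⟨ solve 4 (λ p x k n → p :* x :+ p :* k :* n := p :* (x :+ k :* n)) refl p (xx (suc r)) k N ⟩
     p * (xx (suc r) + k * N)             ≡⟨ cong (p *_) (sym (proj₂ rq)) ⟩
     p * (b * (κ * κ ^ r) * a)            ≡⟨ solve 5 (λ p b κ K a → p :* (b :* (κ :* K) :* a) := (p :* κ) :* (b :* K :* a)) refl p b κ (κ ^ r) a ⟩
     p * κ * B r                          ≡⟨ cong (_* B r) κ-D ⟩
     (1 + k₂ * D) * B r                   ≡⟨ cong (λ d → (1 + k₂ * d) * B r) (_∣_.equality N∣D) ⟩
     (1 + k₂ * (quotient N∣D * N)) * B r  ≡⟨ solve 4 (λ k q n B → (con 1 :+ k :* (q :* n)) :* B := B :+ B :* k :* q :* n) refl k₂ (quotient N∣D) N (B r) ⟩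
     B r + B r * k₂ * quotient N∣D * N    ∎)
    where
    open ≡-Reasoning
    rq = RN.res-quot (B (suc r)) (B≥1 (suc r))
    k = proj₁ rq

  mkInt : IntP
  mkInt = record
   { N = N ; x = xx ; μ = λ r → proj₁ (mq r) ; p∤N = p∤N ; x≥1 = λ r → RN.res≥1 (B r) ; x≤N = λ r → RN.res≤N (B r)
   ; step = st
   ; μ<p = λ r → *-cancelʳ-< N (proj₁ (mq r)) p (≤-trans (≤-trans (+-monoˡ-≤ _ (RN.res≥1 (B r))) (≤-reflexive (sym (st r)))) (*-monoʳ-≤ p (RN.res≤N (B (suc r))))) }
   where
   st : ∀ r → p * xx (suc r) ≡ xx r + proj₁ (mq r) * N
   st r = trans (proj₂ (mq r)) (cong (_+ proj₁ (mq r) * N) (same r))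

 opaque
  factor : ∀ N → 1 ≤ N → Σ ℕ λ k → Σ ℕ λ N' → N ≡ p ^ k * N' × ¬ p ∣ N'
  factor N h = go N h (<-wellFounded N)
   where
   go : ∀ N → 1 ≤ N → Acc ℕ._<_ N → Σ ℕ λ k → Σ ℕ λ N' → N ≡ p ^ k * N' × ¬ p ∣ N'
   go N h (acc rec) with p ∣? N
   ... | no nd = 0 , N , sym (+-identityʳ N) , nd
   ... | yes (divides zero refl) = ⊥-elim (<⇒≱ h z≤n)
   ... | yes (divides q@(suc _) refl) with go q (s≤s z≤n) (rec (m<m*n q p 1<p))
   ... | k , N' , e , nd = suc k , N' , trans (cong (_* p) e) (trans (*-comm (p ^ k * N') p) (sym (*-assoc p (p ^ k) N'))) , nd

 coprime-∣D : ∀ {N} → ¬ p ∣ N → N ∣ p ^ ν * D → N ∣ D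
 coprime-∣D nd h = Cop.coprime-divisor (Coprime-^ ν nd) h

 module RawP (g : Raw) where
  open Raw g
  instance
   nzN : NonZero N
   nzN = ℕ.>-nonZero N≥1
  module RN = Res N

  xr : ℕ → ℕ → ℕ
  xr r t = res N (t * κ ^ r * a)

  -- On Ω every t is b modulo D, so a parameter with denominator prime to p has residues independent
  -- of t. This is why `IntP` carries no t.
  xr-D : N ∣ D → ∀ r t s → ModEq D t s → xr r t ≡ xr r s
  xr-D (divides q e) r t s h with ModEq⇒∣ {D} {t} {s} h
  ... | k , k' , eq = RN.res-cong _ _ (k * q * (κ ^ r * a)) (k' * q * (κ ^ r * a)) (trans (fold t k) (trans (cong (λ z → z * (κ ^ r * a)) (trans (cong (λ d → t + k * d) (sym e)) (trans eq (cong (λ d → s + k' * d) e)))) (sym (fold s k'))))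
   where
   fold : ∀ t k → t * κ ^ r * a + k * q * (κ ^ r * a) * N ≡ (t + k * (q * N)) * (κ ^ r * a)
   fold t k = solve 6 (λ t K a k q n → t :* K :* a :+ k :* q :* (K :* a) :* n := (t :+ k :* (q :* n)) :* (K :* a)) refl t (κ ^ r) a k q N

  xr-N : ∀ r t s k k' → t + k * N ≡ s + k' * N → xr r t ≡ xr r s
  xr-N r t s k k' eq = RN.res-cong _ _ (k * (κ ^ r * a)) (k' * (κ ^ r * a)) (trans (fold t k) (trans (cong (_* (κ ^ r * a)) eq) (sym (fold s k'))))
   where
   fold : ∀ t k → t * κ ^ r * a + k * (κ ^ r * a) * N ≡ (t + k * N) * (κ ^ r * a)
   fold t k = solve 5 (λ t K a k n → t :* K :* a :+ k :* (K :* a) :* n := (t :+ k :* n) :* (K :* a)) refl t (κ ^ r) a k N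

  module NonCase (p∣N : p ∣ N) where
   ν≥1 : 1 ≤ ν
   ν≥1 = go ν N∣d
    where
    go : ∀ n → N ∣ p ^ n * D → 1 ≤ n
    go zero d = ⊥-elim (p∤D (∣-trans p∣N (subst (N ∣_) (+-identityʳ D) d)))
    go (suc _) _ = s≤s z≤n

   p∣d : p ∣ p ^ ν * D
   p∣d = ∣-trans p∣N N∣d

   p∤a : ¬ p ∣ a
   p∤a d = p∤1 (subst (p ∣_) (cop (d , p∣N)) ∣-refl)

   p∤t : ∀ {t} → Ω t → ¬ p ∣ t
   p∤t (_ , _ , c , _) d = p∤1 (subst (p ∣_) (c (d , p∣d)) ∣-refl)

   x-unit′ : ∀ r t → Ω t → ¬ p ∣ xr r t
   x-unit′ r t o d = ∤-* (∤-* (p∤t o) (p∤^ r (ν≥1⇒p∤κ ν≥1))) p∤a (subst (p ∣_) (sym (proj₂ rq)) (∣m∣n⇒∣m+n d (∣n⇒∣m*n (proj₁ rq) p∣N)))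
    where
    rq = RN.res-quot (t * κ ^ r * a) (n≢0⇒n>0 (∤⇒≢0 (∤-* (∤-* (p∤t o) (p∤^ r (ν≥1⇒p∤κ ν≥1))) p∤a)))

   val-eq : ∀ r t → Ω t → Σ ℕ λ k → ι (xr r t) ≡ ι t Q.* ι (κ ^ r * a) Q.- ι k Q.* ι N
   val-eq r t o = proj₁ rq , trans (Q.solve 2 (λ x y → x Q.:= (x Q.:+ y) Q.:- y) refl (ι (xr r t)) (ι (proj₁ rq) Q.* ι N))
     (cong (Q._- ι (proj₁ rq) Q.* ι N) (trans (sym (trans (cong ι (proj₂ rq)) (trans (Q.ι-+ (xr r t) _) (cong (ι (xr r t) Q.+_) (Q.ι-* (proj₁ rq) N))))) (trans (cong ι (*-assoc t (κ ^ r) a)) (Q.ι-* t (κ ^ r * a)))))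
    where
    rq = RN.res-quot (t * κ ^ r * a) (n≢0⇒n>0 (∤⇒≢0 (∤-* (∤-* (p∤t o) (p∤^ r (ν≥1⇒p∤κ ν≥1))) p∤a)))

   -- If p^(m+1) divides N, then x is t κ^r a modulo p^(m+1) and inherits the congruence. Otherwise
   -- N divides p^(m+1) D, modulo which t₁ and t₂ already agree, and the two residues coincide.
   x-dif : ∀ r m t₁ t₂ → Ω t₁ → Ω t₂ → ModEq (p ^ suc m) t₁ t₂ → Dv (suc m) (ι (xr r t₁) Q.- ι (xr r t₂))
   x-dif r m t₁ t₂ o₁ o₂ h = cases (factor N N≥1)
    where
    cases : (Σ ℕ λ k → Σ ℕ λ N' → N ≡ p ^ k * N' × ¬ p ∣ N') → Dv (suc m) (ι (xr r t₁) Q.- ι (xr r t₂))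
    cases (k , N' , e , nd) with suc m ≤? k
    ... | yes le = subst (Dv (suc m)) (sym eq) (Dv-- (Dv-*0 (ModEq⇒Dv {suc m} {t₁} {t₂} h) (Dv-ι (κ ^ r * a)))
        (subst (Dv (suc m)) (Q.*-comm (ι N) _) (Dv-*0 (Dv-ι∣ {suc m} pN) (Dv-- (Dv-ι v1) (Dv-ι v2)))))
     where
     v1 = proj₁ (val-eq r t₁ o₁)
     v2 = proj₁ (val-eq r t₂ o₂)
     pN : p ^ suc m ∣ N
     pN = subst (p ^ suc m ∣_) (sym e) (∣m⇒∣m*n N' (divides (p ^ (k ∸ suc m)) (trans (cong (p ^_) (sym (m∸n+n≡m le))) (^-distribˡ-+-* p (k ∸ suc m) (suc m)))))
     eq : ι (xr r t₁) Q.- ι (xr r t₂) ≡ (ι t₁ Q.- ι t₂) Q.* ι (κ ^ r * a) Q.- (ι v1 Q.- ι v2) Q.* ι N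
     eq = trans (cong₂ Q._-_ (proj₂ (val-eq r t₁ o₁)) (proj₂ (val-eq r t₂ o₂))) (Q.solve 6 (λ t s K n u v → (t Q.:* K Q.:- u Q.:* n) Q.:- (s Q.:* K Q.:- v Q.:* n) Q.:= (t Q.:- s) Q.:* K Q.:- (u Q.:- v) Q.:* n) refl (ι t₁) (ι t₂) (ι (κ ^ r * a)) (ι N) (ι v1) (ι v2))
    ... | no ¬le = subst (λ z → Dv (suc m) (ι (xr r t₁) Q.- ι z)) same (subst (Dv (suc m)) (sym (Q.-‿inverse (ι (xr r t₁)))) Dv-0)
     where
     Dmod : ModEq D t₁ t₂
     Dmod = subst (D ∣_) (cong ℤ.∣_∣ (trans (sym (ℤ-telescope (ℤ.+ t₁) (ℤ.+ b) (ℤ.+ t₂))) refl)) (ℤD-sub {D} {ℤ.+ t₁ ℤ.- ℤ.+ b} {ℤ.+ t₂ ℤ.- ℤ.+ b} (proj₂ (proj₂ (proj₂ o₁))) (proj₂ (proj₂ (proj₂ o₂))))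
      where
      ℤ-telescope : ∀ x y z → x ℤ.- z ≡ (x ℤ.- y) ℤ.- (z ℤ.- y)
      ℤ-telescope x y z = solve-ℤ x y z
       where
       open import Data.Integer.Solver using () renaming (module +-*-Solver to ZS)
       solve-ℤ : ∀ x y z → x ℤ.- z ≡ (x ℤ.- y) ℤ.- (z ℤ.- y)
       solve-ℤ = ZS.solve 3 (λ x y z → x ZS.:- z ZS.:= (x ZS.:- y) ZS.:- (z ZS.:- y)) refl
      ℤD-sub : ∀ {d u v} → d ∣ ℤ.∣ u ∣ → d ∣ ℤ.∣ v ∣ → d ∣ ℤ.∣ u ℤ.- v ∣
      ℤD-sub {d} {u} {v} du dv = ZSg.∣⇒∣ᵤ {ℤ.+ d} {u ℤ.- v} (ZSg.∣m∣n⇒∣m-n (ZSg.∣ᵤ⇒∣ {ℤ.+ d} {u} du) (ZSg.∣ᵤ⇒∣ {ℤ.+ d} {v} dv))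
     N∣ : N ∣ p ^ suc m * D
     N∣ = subst (_∣ p ^ suc m * D) (sym e) (*-pres-∣ (divides (p ^ (suc m ∸ k)) (trans (cong (p ^_) (sym (m∸n+n≡m (<⇒≤ (≰⇒> ¬le))))) (^-distribˡ-+-* p (suc m ∸ k) k))) (coprime-∣D nd (∣-trans (divides (p ^ k) e) N∣d)))
     both : p ^ suc m * D ∣ ℤ.∣ ℤ.+ t₁ ℤ.- ℤ.+ t₂ ∣
     both = go Dmod
      where
      go : D ∣ ℤ.∣ ℤ.+ t₁ ℤ.- ℤ.+ t₂ ∣ → p ^ suc m * D ∣ ℤ.∣ ℤ.+ t₁ ℤ.- ℤ.+ t₂ ∣
      go (divides u eu) = subst (p ^ suc m * D ∣_) (sym eu) (*-monoˡ-∣ D (Cop.coprime-divisor (Cop.sym (Coprime-^ (suc m) p∤D)) (subst (p ^ suc m ∣_) (trans eu (*-comm u D)) h)))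
     Nmod : ModEq N t₁ t₂
     Nmod = ∣-trans N∣ both
     same : xr r t₁ ≡ xr r t₂
     same with ModEq⇒∣ {N} {t₁} {t₂} Nmod
     ... | u , v , eq = xr-N r t₁ t₂ u v eq

   nonP : NonP
   nonP = record
    { N = N ; x = xr ; p∣N = p∣N ; x≥1 = λ r t → RN.res≥1 _ ; x-unit = x-unit′
    ; x-mem = λ r → mkM (λ t _ → Dv-ι _) (x-dif r)
    ; x-cong = λ r t o → subst (Dv 1) (sym (eqc r t o)) (Dv-- (Dv-weaken ν≥1 (Dv-*0 (Dv-ι∣ {ν} ∣-refl) (Dv-ι (t * (k₁ * (κ ^ r * a)))))) (Dv-- (dN _) (dN _))) }
    where
    dN : ∀ k → Dv 1 (ι k Q.* ι N)
    dN k = Dv-* (Dv-ι k) (Dv-ι∣ {1} (subst (_∣ N) (sym (*-identityʳ p)) p∣N))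
    eqc : ∀ r t o → ι (xr (suc r) t) Q.- ι (xr r t) ≡ ι (p ^ ν) Q.* ι (t * (k₁ * (κ ^ r * a))) Q.- (ι (proj₁ (val-eq (suc r) t o)) Q.* ι N Q.- ι (proj₁ (val-eq r t o)) Q.* ι N)
    eqc r t o = trans (cong₂ Q._-_ (proj₂ (val-eq (suc r) t o)) (proj₂ (val-eq r t o)))
     (trans (Q.solve 4 (λ u v x y → (u Q.:- x) Q.:- (v Q.:- y) Q.:= (u Q.:- v) Q.:- (x Q.:- y)) refl (ι t Q.* ι (κ ^ suc r * a)) (ι t Q.* ι (κ ^ r * a)) (ι (proj₁ (val-eq (suc r) t o)) Q.* ι N) (ι (proj₁ (val-eq r t o)) Q.* ι N))
      (cong (Q._- (ι (proj₁ (val-eq (suc r) t o)) Q.* ι N Q.- ι (proj₁ (val-eq r t o)) Q.* ι N))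
       (trans (cong (Q._- ι t Q.* ι (κ ^ r * a)) (trans (sym (Q.ι-* t _)) (trans (cong ι kk) (Q.ι-+ (t * (κ ^ r * a)) _))))
        (trans (cong (λ z → (z Q.+ ι (p ^ ν * (t * (k₁ * (κ ^ r * a))))) Q.- ι t Q.* ι (κ ^ r * a)) (Q.ι-* t _))
         (trans (Q.solve 2 (λ x y → (x Q.:+ y) Q.:- x Q.:= y) refl (ι t Q.* ι (κ ^ r * a)) _) (Q.ι-* (p ^ ν) _))))))
     where
     kk : t * (κ ^ suc r * a) ≡ t * (κ ^ r * a) + p ^ ν * (t * (k₁ * (κ ^ r * a)))
     kk = trans (cong (λ z → t * (z * κ ^ r * a)) κ-ν) (solve 5 (λ t q k K a → t :* ((con 1 :+ q :* k) :* K :* a) := t :* (K :* a) :+ q :* (t :* (k :* (K :* a)))) refl t (p ^ ν) k₁ (κ ^ r) a)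

  intP : ¬ p ∣ N → IntP
  intP nd = mkInt N a N≥1 a≥1 nd (coprime-∣D nd N∣d)

 fromDec : (g : Raw) → Dec (p ∣ Raw.N g) → Param
 fromDec g (yes d) = non (RawP.NonCase.nonP g d)
 fromDec g (no nd) = int (RawP.intP g nd)

 toParam : Raw → Param
 toParam g = fromDec g (p∣?_ (Raw.N g))

-- Hypothesis H averaged over residue classes.

module Averaging (p : ℕ) (pp : Prime p) (ν D b : ℕ) (D≥1 : 1 ℕ.≤ D) (b≥1 : 1 ℕ.≤ b) (D-p : Cop.Coprime D p) (b-D : Cop.Coprime b D) where
 open import Data.Nat.Base using (_+_; _*_; _∸_; _^_; _≤_; _<_)

 open Reduced p pp ν D b D≥1 b≥1 D-p b-D
 open Q using (ι; inv; 1#; _↑_)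
 open Sums
 open Padic p pp
 open Filt Ω
 open UnitProducts using (Π-const)
 open Fermat p pp using (<p⇒∤)
 open Parameters p pp Ω using (IntP; NonP; Param; int; non; p∣?_; R; fac; γ; γ-dwork; shift; fac≢0; UnitQ-≡)
 open SignedProducts p pp Ω
 open Digit p pp Ω using (nzp; p>0; p^>0; cc; md; md<; b2n; bad; Bad∈; mkBad; bad⇒; dig%; dig/; γ-unit; module Levels)
 open Counting p pp Ω
 open import Data.Nat.Properties
 open import Data.Nat.DivMod
 open import Data.Nat.Divisibility
 open import Data.List.Base using (_++_; map)
 open import Data.List.Membership.Propositional.Properties using (∈-++⁻; ∈-++⁺ˡ; ∈-++⁺ʳ)
 open +-*-Solver

 vT : IntP → ℕ → ℕ → ℕ → ℕ
 vT q r n L = #< L (λ l → wc q r (suc l) n)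

 vTP : Param → ℕ → ℕ → ℕ → ℕ
 vTP (int q) r n L = vT q r n L
 vTP (non q) r n L = 0

 isI isN : Param → ℕ
 isI (int _) = 1
 isI (non _) = 0
 isN (int _) = 0
 isN (non _) = 1

 sumL : ∀ {A : Set} → List A → (A → ℕ) → ℕ
 sumL [] f = 0
 sumL (g ∷ gs) f = f g + sumL gs f

 sumL-ext : ∀ {A : Set} (gs : List A) {f f'} → (∀ g → f g ≡ f' g) → sumL gs f ≡ sumL gs f'
 sumL-ext [] e = refl
 sumL-ext (g ∷ gs) e = cong₂ _+_ (e g) (sumL-ext gs e)

 sumL-+ : ∀ {A : Set} (gs : List A) f f' → sumL gs (λ g → f g + f' g) ≡ sumL gs f + sumL gs f'
 sumL-+ [] f f' = refl
 sumL-+ (g ∷ gs) f f' = trans (cong (f g + f' g +_) (sumL-+ gs f f')) (solve 4 (λ a b c d → (a :+ b) :+ (c :+ d) := (a :+ c) :+ (b :+ d)) refl (f g) (f' g) (sumL gs f) (sumL gs f'))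

 sumL-* : ∀ {A : Set} (gs : List A) c f → sumL gs (λ g → c * f g) ≡ c * sumL gs f
 sumL-* [] c f = sym (*-zeroʳ c)
 sumL-* (g ∷ gs) c f = trans (cong (c * f g +_) (sumL-* gs c f)) (sym (*-distribˡ-+ c (f g) _))

 sumL-# : ∀ {A : Set} (gs : List A) n (f : ℕ → A → ℕ) → #< n (λ i → sumL gs (f i)) ≡ sumL gs (λ g → #< n (λ i → f i g))
 sumL-# [] n f = #-0 n (λ _ _ → refl)
 sumL-# (g ∷ gs) n f = trans (#-+ n _ _) (cong (#< n (λ i → f i g) +_) (sumL-# gs n f))

 sumL-cong : ∀ {A : Set} (gs : List A) {f f' : A → ℕ} → (∀ {g} → g ∈ gs → f g ≡ f' g) → sumL gs f ≡ sumL gs f'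
 sumL-cong [] e = refl
 sumL-cong (g ∷ gs) e = cong₂ _+_ (e (here refl)) (sumL-cong gs (λ i → e (there i)))

 Φ : ℕ
 Φ = p ^ ν * (p ∸ 1)

 pm1 : p ≡ suc (p ∸ 1)
 pm1 = sym (m+[n∸m]≡n p>0)

 #-residues : #< p p∤ind ≡ p ∸ 1
 #-residues = +-cancelʳ-≡ 1 _ _ (trans (cong (#< p p∤ind +_) (sym one)) (trans (sym (#-+ p p∤ind (λ i → 1 ∸ p∤ind i))) (trans (#-ext p (λ i → comb i)) (trans (#-const p 1) (trans (*-identityʳ p) (trans pm1 (+-comm 1 _)))))))
  where
  one : #< p (λ i → 1 ∸ p∤ind i) ≡ 1
  one = trans (#-single p 0 _ p>0 (λ i il ne → cong (1 ∸_) (p∤ind-∤ (<p⇒∤ (n≢0⇒n>0 ne) il)))) (cong (1 ∸_) (p∤ind-∣ (p ∣0)))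
  comb : ∀ i → p∤ind i + (1 ∸ p∤ind i) ≡ 1
  comb i with p ∣? i
  ... | yes d = cong (λ z → z + (1 ∸ z)) (p∤ind-∣ d)
  ... | no nd = cong (λ z → z + (1 ∸ z)) (p∤ind-∤ nd)

 #-units : ∀ c → #< (p ^ suc ν) (λ i → p∤ind (c + i * D)) ≡ Φ
 #-units c = begin
  #< (p ^ suc ν) (λ i → F (i * D))   ≡⟨ #-affine (p ^ suc ν) F D D≥1 (p^>0 (suc ν)) (Coprime-^ (suc ν) p∤D) (λ i → trans (cong F (trans (+-comm (p ^ suc ν) i) (cong (i +_) (*-comm p (p ^ ν))))) (per-+ p F per (p ^ ν) i)) ⟩
  #< (p ^ suc ν) F                   ≡⟨ cong (λ z → #< z F) (*-comm p (p ^ ν)) ⟩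
  #< (p ^ ν * p) F                   ≡⟨ #-periods (p ^ ν) p F per ⟩
  p ^ ν * #< p F                     ≡⟨ cong (p ^ ν *_) (#-shift p p∤ind per₀ c) ⟩
  p ^ ν * #< p p∤ind                 ≡⟨ cong (p ^ ν *_) #-residues ⟩
  Φ                                  ∎
  where
  open ≡-Reasoning
  F : ℕ → ℕ
  F i = p∤ind (c + i)
  per₀ : ∀ i → p∤ind (p + i) ≡ p∤ind i
  per₀ i = trans (cong p∤ind (+-comm p i)) (p∤ind-+ i p ∣-refl)
  per : ∀ i → F (p + i) ≡ F i
  per i = trans (cong p∤ind (solve 3 (λ c p i → c :+ (p :+ i) := (c :+ i) :+ p) refl c p i)) (p∤ind-+ (c + i) p ∣-refl)

 -- The class of b κ^s modulo D, to be sampled at p^(ν+1) points: one power of p more than in d, so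
 -- that the points prime to p have proportion (p-1)/p even for ν = 0.
 aa : ℕ → ℕ → ℕ
 aa s i = b * κ ^ s + i * D

 p^∣⇒≤ : ∀ k → p ^ k ∣ p ^ ν * D → k ≤ ν
 p^∣⇒≤ k d = ≮⇒≥ λ lt → <⇒≱ (^-monoʳ-< p 1<p lt) (∣⇒≤ {{ℕ.>-nonZero (p^>0 ν)}} (Cop.coprime-divisor (Cop.sym (Coprime-^ k p∤D)) (subst (p ^ k ∣_) (*-comm (p ^ ν) D) d)))

 avg-general : ∀ (q : IntP) (k' : ℕ) (k≤ : suc k' ≤ suc ν) (D' ag : ℕ) → ¬ p ∣ D' → ¬ p ∣ ag → 1 ≤ ag → 1 ≤ IntP.N q →
  (∀ {{_ : NonZero (IntP.N q)}} s → IntP.x q s ≡ res (IntP.N q) (b * κ ^ s * ag)) →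
  ∀ N₀ D₀ {{_ : NonZero N₀}} → N₀ ≡ p ^ suc k' * IntP.N q → D₀ ≡ IntP.N q * D' → ∀ r n L → n * N₀ < p ^ suc L →
  #< L (λ l → #< (p ^ suc ν) (λ i → p∤ind (b * κ ^ (r + suc l) + i * D₀) * cnt (res N₀ ((b * κ ^ (r + suc l) + i * D₀) * ag)) N₀ (suc l) n)) ≡ p ^ ν * n
 avg-general q k' k≤ D' ag nd na a≥1 N'≥1 xe N₀ D₀ {{nz0}} refl refl r n L h =
  Avg.avg-sum q k' ν k≤ D' ag b κ nd na (λ s → *-mono-≤ (*-mono-≤ b≥1 (κ^≥1 s)) a≥1) {{ℕ.>-nonZero N'≥1}} {{nz0}} (λ s → xe {{ℕ.>-nonZero N'≥1}} s) r n L h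

 Sg : Raw → ℕ → ℕ → ℕ → ℕ
 Sg g r n l = #< (p ^ suc ν) (λ i → p∤ind (aa (r + suc l) i) * cnt (res N (aa (r + suc l) i * a)) N (suc l) n)
  where
  open Raw g
  instance
   nzN : NonZero N
   nzN = ℕ.>-nonZero N≥1

 -- The average of a parameter's counts, divided by p^ν: (p-1) times the valuation of its Pochhammer
 -- product if it is p-integral, and n otherwise.
 contr : Param → ℕ → ℕ → ℕ → ℕ
 contr g r n L = (p ∸ 1) * vTP g r n L + isN g * n

 res-level : ∀ (g : Raw) → (N∣D : Raw.N g ∣ D) → ∀ s i → res (Raw.N g) {{ℕ.>-nonZero (Raw.N≥1 g)}} (aa s i * Raw.a g) ≡ res (Raw.N g) {{ℕ.>-nonZero (Raw.N≥1 g)}} (b * κ ^ s * Raw.a g)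
 res-level g (divides D'' e) s i = trans (cong (res N) (trans (cong (λ d → (b * κ ^ s + i * d) * a) e) (solve 5 (λ B i d n a → (B :+ i :* (d :* n)) :* a := B :* a :+ (i :* d :* a) :* n) refl (b * κ ^ s) i D'' N a))) (Res.res-+ N (b * κ ^ s * a) (i * D'' * a))
  where
  open Raw g
  instance
   nzN : NonZero N
   nzN = ℕ.>-nonZero N≥1

 -- The residue of a p-integral parameter does not depend on i, so its count is multiplied by the
 -- number `Φ` of sampled units; for the others the telescoping average applies.
 Sg-sum : ∀ g r n L → n * Raw.N g < p ^ suc L → #< L (Sg g r n) ≡ p ^ ν * contr (toParam g) r n L
 Sg-sum g r n L h with p∣?_ (Raw.N g)
 ... | no nd = trans (#-ext L (λ l → trans (#-ext (p ^ suc ν) (λ i → trans (cong (λ z → p∤ind (aa (r + suc l) i) * cnt z N (suc l) n) (res-level g (coprime-∣D nd N∣d) (r + suc l) i)) (trans (cong (p∤ind (aa (r + suc l) i) *_) (wc-count q r (suc l) n (suc n) (≤-trans (wc-≤n q r (suc l) n) (n≤1+n n)))) (*-comm _ (wc q r (suc l) n)))))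
     (trans (#-*ˡ (p ^ suc ν) (wc q r (suc l) n) _) (trans (cong (wc q r (suc l) n *_) (#-units (b * κ ^ (r + suc l)))) (*-comm _ Φ)))))
    (trans (#-*ˡ L Φ _) (trans (*-assoc (p ^ ν) (p ∸ 1) _) (cong (p ^ ν *_) (sym (+-identityʳ _)))))
  where
  open Raw g
  q = RawP.intP g nd
 ... | yes d = trans (go (factor N N≥1)) (cong (p ^ ν *_) (sym (trans (cong (_+ 1 * n) (*-zeroʳ (p ∸ 1))) (*-identityˡ n))))
  where
  open Raw g
  instance
   nzN : NonZero N
   nzN = ℕ.>-nonZero N≥1
  go : (Σ ℕ λ k → Σ ℕ λ N' → N ≡ p ^ k * N' × ¬ p ∣ N') → #< L (Sg g r n) ≡ p ^ ν * n
  go (zero , N' , e , nd) = ⊥-elim (nd (subst (p ∣_) (trans e (+-identityʳ N')) d))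
  go (suc k' , N' , e , nd) = avg-general q k' (s≤s (<⇒≤ (p^∣⇒≤ (suc k') (∣-trans (divides N' (trans e (*-comm (p ^ suc k') N'))) N∣d)))) (quotient N'∣D) a
    (λ pd → p∤D (subst (p ∣_) (sym (_∣_.equality N'∣D)) (∣m⇒∣m*n N' pd))) (RawP.NonCase.p∤a g d) a≥1 N'≥1 (λ s → refl) N D e (trans (_∣_.equality N'∣D) (*-comm (quotient N'∣D) N')) r n L h
   where
   N'≥1 : 1 ≤ N'
   N'≥1 = n≢0⇒n>0 (∤⇒≢0 nd)
   N'∣D : N' ∣ D
   N'∣D = coprime-∣D nd (∣-trans (divides (p ^ suc k') e) N∣d)
   q = mkInt N' a N'≥1 a≥1 nd N'∣D

 int-injective : ∀ {q q'} → int q ≡ int q' → q ≡ q'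
 int-injective refl = refl

 indR : ℕ → ℕ → ℕ → Raw → ℕ
 indR s q m g = le (res N (s * a) * q) (m * N)
  where
  open Raw g
  instance
   nzN : NonZero N
   nzN = ℕ.>-nonZero N≥1

 fromDec-int : ∀ g {q} d → int q ≡ fromDec g d → Σ (¬ p ∣ Raw.N g) λ nd → q ≡ RawP.intP g nd
 fromDec-int g (no nd) eq = nd , int-injective eq
 fromDec-int g (yes d) ()

 toParam-int : ∀ g {q} → int q ≡ toParam g → Σ (¬ p ∣ Raw.N g) λ nd → q ≡ RawP.intP g nd
 toParam-int g eq = fromDec-int g (p∣?_ (Raw.N g)) eq

 below-scaled : ∀ q r l m X → X ≡ IntP.x q (r + l) → cc q r l < m → X * p ^ l ≤ m * IntP.N q
 below-scaled q r l m X refl h = subst (_≤ m * IntP.N q) (sym (trans (*-comm (IntP.x q (r + l)) (p ^ l)) (cc-x q r l))) (c<⇒ q r h)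

 int-fields : ∀ g {q} → int q ≡ toParam g → Raw.N g ∣ D × IntP.N q ≡ Raw.N g × (∀ s → IntP.x q s ≡ res (Raw.N g) {{ℕ.>-nonZero (Raw.N≥1 g)}} (b * κ ^ s * Raw.a g))
 int-fields g eq = go (toParam-int g eq)
  where
  go : ∀ {q} → (Σ (¬ p ∣ Raw.N g) λ nd → q ≡ RawP.intP g nd) → Raw.N g ∣ D × IntP.N q ≡ Raw.N g × (∀ s → IntP.x q s ≡ res (Raw.N g) {{ℕ.>-nonZero (Raw.N≥1 g)}} (b * κ ^ s * Raw.a g))
  go (nd , refl) = coprime-∣D nd (Raw.N∣d g) , refl , λ s → refl

 below⇒ind : ∀ g {q} → int q ≡ toParam g → ∀ r l m i → cc q r l < m → indR (aa (r + l) i) (p ^ l) m g ≡ 1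
 below⇒ind g {q} eq r l m i less = le-yes (subst (λ n → _ ≤ m * n) (proj₁ (proj₂ F)) (below-scaled q r l m _ (trans (res-level g (proj₁ F) (r + l) i) (sym (proj₂ (proj₂ F) (r + l)))) less))
  where F = int-fields g eq

 sg : List Raw → List Raw → Signed
 sg αs βs = map (λ g → true , toParam g) αs ++ map (λ g → false , toParam g) βs

 ∈-map : ∀ {A B : Set} (f : A → B) xs {y} → y ∈ map f xs → Σ A λ x → x ∈ xs × y ≡ f x
 ∈-map f (x ∷ xs) (here e) = x , here refl , e
 ∈-map f (x ∷ xs) (there i) with ∈-map f xs i
 ... | x' , i' , e = x' , there i' , e

 ∈-sg : ∀ αs βs {σ g} → (σ , g) ∈ sg αs βs → Σ Raw λ x → x ∈ αs ++ βs × g ≡ toParam x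
 ∈-sg αs βs i with ∈-++⁻ (map (λ g → true , toParam g) αs) i
 ... | inj₁ j = proj₁ (∈-map _ αs j) , ∈-++⁺ˡ (proj₁ (proj₂ (∈-map _ αs j))) , cong proj₂ (proj₂ (proj₂ (∈-map _ αs j)))
 ... | inj₂ j = proj₁ (∈-map _ βs j) , ∈-++⁺ʳ αs (proj₁ (proj₂ (∈-map _ βs j))) , cong proj₂ (proj₂ (proj₂ (∈-map _ βs j)))

 -- Hypothesis H in natural numbers, `indR s q m g` being the test ⟨s x⟩ ≤ m/q for the parameter x.
 -- `strong` is H itself, available once some parameter passes the test; `weak` also covers the case
 -- where none does.
 record HNat (αs βs : List Raw) : Set where
  field
   weak : ∀ s → Cop.Coprime s (p ^ ν * D) → ∀ m q → m < q → sumL βs (indR s q m) ≤ sumL αs (indR s q m)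
   strong : ∀ s → Cop.Coprime s (p ^ ν * D) → ∀ m q → m < q → ∀ g → g ∈ αs ++ βs → indR s q m g ≡ 1 → suc (sumL βs (indR s q m)) ≤ sumL αs (indR s q m)

 module Average (αs βs : List Raw) (same-length : sumL αs (λ _ → 1) ≡ sumL βs (λ _ → 1)) (hn : HNat αs βs) where
  ps : Signed
  ps = sg αs βs
  open Levels ps

  private
   cntR : ℕ → ℕ → ℕ → Raw → ℕ
   cntR s l n g = cnt (res N (s * a)) N l n
    where
    open Raw g
    instance
     nzN : NonZero N
     nzN = ℕ.>-nonZero N≥1

   cntR-dec : ∀ s l n g → cntR s l n g ≡ proj₁ (md-quot l n) * 1 + indR s (p ^ l) (md l n) g
   cntR-dec s l n g = trans (cong (cnt (res N (s * a)) N l) (proj₂ (md-quot l n))) (trans (cnt-dec {res N (s * a)} {N} (Res.res≥1 N (s * a)) (Res.res≤N N (s * a)) l (md l n) (proj₁ (md-quot l n)) (md< l n)) (cong (_+ indR s (p ^ l) (md l n) g) (sym (*-identityʳ (proj₁ (md-quot l n))))))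
    where
    open Raw g
    instance
     nzN : NonZero N
     nzN = ℕ.>-nonZero N≥1

   -- The full periods cancel by equality of lengths and the indicator inequality remains, at m/q =
   -- (n mod p^l)/p^l. Positivity of the level says that some γ_(r+l) passes the test, which gives
   -- the strict form.
   level : ∀ r l n i → ¬ p ∣ aa (r + l) i → sumL βs (cntR (aa (r + l) i) l n) + b2n (pos r l n) ≤ sumL αs (cntR (aa (r + l) i) l n)
   level r l n i nd = ≤-trans (≤-reflexive (cong (_+ b2n (pos r l n)) (dec βs))) (≤-trans (≤-reflexive (+-assoc (Q' * sumL βs (λ _ → 1)) _ _)) (≤-trans (+-mono-≤ (≤-reflexive (cong (Q' *_) (sym same-length))) main) (≤-reflexive (sym (dec αs)))))
    where
    s = aa (r + l) i
    Q' = proj₁ (md-quot l n)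
    dec : ∀ gs → sumL gs (cntR s l n) ≡ Q' * sumL gs (λ _ → 1) + sumL gs (indR s (p ^ l) (md l n))
    dec gs = trans (sumL-ext gs (cntR-dec s l n)) (trans (sumL-+ gs _ _) (cong (_+ sumL gs (indR s (p ^ l) (md l n))) (sumL-* gs Q' (λ _ → 1))))
    cop-s : Cop.Coprime s (p ^ ν * D)
    cop-s = coprime-* (Coprime-^ ν nd) (λ {e} (es , eD) → κ^b (∣m+n∣m⇒∣n (subst (e ∣_) (+-comm (b * κ ^ (r + l)) (i * D)) es) (∣n⇒∣m*n i eD) , eD))
     where
     κ^b : Cop.Coprime (b * κ ^ (r + l)) D
     κ^b = coprime-*ˡ b-D (κ^-D (r + l))
    main : sumL βs (indR s (p ^ l) (md l n)) + b2n (pos r l n) ≤ sumL αs (indR s (p ^ l) (md l n))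
    main with pos r l n in e
    ... | false = ≤-trans (≤-reflexive (+-identityʳ _)) (HNat.weak hn s cop-s (md l n) (p ^ l) (md< l n))
    ... | true = ≤-trans (≤-reflexive (+-comm _ 1)) (bd (bad⇒ ps r l (md l n) e))
     where
     bd : Bad∈ ps r l (md l n) → suc (sumL βs (indR s (p ^ l) (md l n))) ≤ sumL αs (indR s (p ^ l) (md l n))
     bd (mkBad i∈ less) = HNat.strong hn s cop-s (md l n) (p ^ l) (md< l n) (proj₁ (∈-sg αs βs i∈)) (proj₁ (proj₂ (∈-sg αs βs i∈))) (below⇒ind _ (proj₂ (proj₂ (∈-sg αs βs i∈))) r l (md l n) i less)

   weighted : ∀ r l n i → sumL βs (λ g → p∤ind (aa (r + l) i) * cntR (aa (r + l) i) l n g) + p∤ind (aa (r + l) i) * b2n (pos r l n) ≤ sumL αs (λ g → p∤ind (aa (r + l) i) * cntR (aa (r + l) i) l n g)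
   weighted r l n i with p ∣? aa (r + l) i
   ... | yes d rewrite p∤ind-∣ d = ≤-reflexive (trans (+-identityʳ _) (trans (sumL-* βs 0 (cntR (aa (r + l) i) l n)) (sym (sumL-* αs 0 (cntR (aa (r + l) i) l n)))))
   ... | no nd rewrite p∤ind-∤ nd = ≤-trans (≤-reflexive (cong₂ _+_ (sumL-ext βs (λ g → *-identityˡ (cntR (aa (r + l) i) l n g))) (*-identityˡ (b2n (pos r l n))))) (≤-trans (level r l n i nd) (≤-reflexive (sumL-ext αs (λ g → sym (*-identityˡ (cntR (aa (r + l) i) l n g))))))

  -- The levelwise inequalities summed over levels and over sampled units. A positive level is
  -- counted once for each unit, `Φ` times in all; after division by p^ν this is the factor p - 1 in
  -- front of `gL`.
  averaged : ∀ r n L → (∀ g → g ∈ αs ++ βs → n * Raw.N g < p ^ suc L) →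
   sumL βs (λ g → contr (toParam g) r n L) + (p ∸ 1) * gL L r n ≤ sumL αs (λ g → contr (toParam g) r n L)
  averaged r n L big = *-cancelˡ-≤ (p ^ ν) {{ℕ.>-nonZero (p^>0 ν)}} (begin
   p ^ ν * (sumL βs C + (p ∸ 1) * gL L r n)                ≡⟨ trans (*-distribˡ-+ (p ^ ν) _ _) (cong₂ _+_ (sym (sumL-* βs (p ^ ν) C)) (sym (*-assoc (p ^ ν) (p ∸ 1) _))) ⟩
   sumL βs (λ g → p ^ ν * C g) + Φ * gL L r n              ≡⟨ cong₂ _+_ (sumL-cong βs (λ {g} i → sym (Sg-sum g r n L (big g (∈-++⁺ʳ αs i))))) (trans (sym (#-*ˡ L Φ _)) (#-ext L (λ l → trans (*-comm Φ _) (trans (cong (b2n (pos r (suc l) n) *_) (sym (#-units (b * κ ^ (r + suc l))))) (trans (sym (#-*ˡ (p ^ suc ν) (b2n (pos r (suc l) n)) _)) (#-ext (p ^ suc ν) (λ i → *-comm _ (p∤ind (aa (r + suc l) i))))))))) ⟩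
   sumL βs (λ g → #< L (Sg g r n)) + #< L (λ l → #< (p ^ suc ν) (λ i → W i l))
    ≡⟨ cong (_+ #< L (λ l → #< (p ^ suc ν) (λ i → W i l))) (sym (sumL-# βs L (λ l g → Sg g r n l))) ⟩
   #< L (λ l → sumL βs (λ g → Sg g r n l)) + #< L (λ l → #< (p ^ suc ν) (λ i → W i l))
    ≡⟨ trans (sym (#-+ L _ _)) (#-ext L (λ l → trans (cong (_+ #< (p ^ suc ν) (λ i → W i l)) (sym (sumL-# βs (p ^ suc ν) _))) (sym (#-+ (p ^ suc ν) _ _)))) ⟩
   #< L (λ l → #< (p ^ suc ν) (λ i → sumL βs (λ g → p∤ind (aa (r + suc l) i) * cntR (aa (r + suc l) i) (suc l) n g) + W i l))
    ≤⟨ #-mono L (λ l _ → #-mono (p ^ suc ν) (λ i _ → weighted r (suc l) n i)) ⟩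
   #< L (λ l → #< (p ^ suc ν) (λ i → sumL αs (λ g → p∤ind (aa (r + suc l) i) * cntR (aa (r + suc l) i) (suc l) n g)))
    ≡⟨ trans (#-ext L (λ l → sumL-# αs (p ^ suc ν) _)) (sumL-# αs L (λ l g → Sg g r n l)) ⟩
   sumL αs (λ g → #< L (Sg g r n))                         ≡⟨ sumL-cong αs (λ {g} i → Sg-sum g r n L (big g (∈-++⁺ˡ i))) ⟩
   sumL αs (λ g → p ^ ν * C g)                             ≡⟨ sumL-* αs (p ^ ν) C ⟩
   p ^ ν * sumL αs C                                       ∎)
   where
   open ≤-Reasoning
   C : Raw → ℕ
   C g = contr (toParam g) r n L
   W : ℕ → ℕ → ℕ
   W i l = p∤ind (aa (r + suc l) i) * b2n (pos r (suc l) n)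

-- Valuations of the coefficients.

module Valuations (p : ℕ) (pp : Prime p) (ν D b : ℕ) (D≥1 : 1 ℕ.≤ D) (b≥1 : 1 ℕ.≤ b) (D-p : Cop.Coprime D p) (b-D : Cop.Coprime b D) where
 open import Data.Nat.Base using (_+_; _*_; _∸_; _^_; _≤_; _<_)

 open Reduced p pp ν D b D≥1 b≥1 D-p b-D
 open Averaging p pp ν D b D≥1 b≥1 D-p b-D
 open Q using (ι; inv; 1#; _↑_)
 open Sums
 open Padic p pp
 open Filt Ω
 open Fermat p pp using (<p⇒∤; ¬UnitQ-Dv)
 open Parameters p pp Ω using (IntP; NonP; Param; int; non; p∣?_; R; fac; γ; γ+; fac≢0; UnitQ-≡; N≢0)
 open SignedProducts p pp Ω
 open Digit p pp Ω using (nzp; p>0; p^>0; cc; cc<; md; md<; md-small; b2n; bad; Bad∈; mkBad; bad⇒; ⇒bad; dig%; dig/; γ-unit; Digits; Digits-md; Ord; ord; module Levels)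
 open Ratios p pp Ω using (prodS-Σ)
 open Harmonic p pp Ω using (s<p^s; M-divide; M-sumS; hterm; hterm-non; harm; Hs)
 open Counting p pp Ω
 open import Data.Nat.Properties
 open import Data.Nat.DivMod
 open import Data.Nat.Divisibility
 open import Data.List.Base using (_++_)
 open import Data.List.Membership.Propositional.Properties using (∈-++⁻)
 open +-*-Solver

 qt : ℕ → ℕ → ℕ
 qt zero n = n
 qt (suc l) n = qt l (n / p)

 md-qt : ∀ l n → n ≡ md l n + qt l n * p ^ l
 md-qt zero n = sym (*-identityʳ n)
 md-qt (suc l) n = trans (m≡m%n+[m/n]*n n p) (trans (cong (λ z → n % p + z * p) (md-qt l (n / p))) (solve 5 (λ a m Q q p → a :+ (m :+ Q :* q) :* p := a :+ m :* p :+ Q :* (p :* q)) refl (n % p) (md l (n / p)) (qt l (n / p)) (p ^ l) p))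

 module _ (q : IntP) (r l : ℕ) where
  private
   C = cc q r l
   P = p ^ l

  wc-unique : ∀ n w → (∀ j → j < w → C + j * P < n) → (∀ j → w ≤ j → n ≤ C + j * P) → wc q r l n ≡ w
  wc-unique n w h1 h2 = ≤-antisym (≮⇒≥ λ lt → <⇒≱ (wc-< q r l n w lt) (h2 w ≤-refl)) (≮⇒≥ λ lt → <⇒≱ (h1 _ lt) (wc-≥ q r l n (wc q r l n) ≤-refl))

  wc-md : ∀ n → wc q r l n ≡ qt l n + le (suc C) (md l n)
  wc-md n with suc C ≤? md l n
  ... | yes c<m = trans (wc-unique n (qt l n + 1) (λ j h → ≤-trans (+-mono-≤ c<m (*-monoˡ-≤ P (≤-pred (subst (j <_) (+-comm _ 1) h)))) (≤-reflexive (sym (md-qt l n))))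
     (λ j h → ≤-trans (≤-reflexive (md-qt l n)) (≤-trans (+-monoˡ-≤ (qt l n * P) (<⇒≤ (md< l n))) (≤-trans (*-monoˡ-≤ P (subst (_≤ j) (+-comm _ 1) h)) (m≤n+m (j * P) C))))) (cong (qt l n +_) (sym (le-yes c<m)))
  ... | no c≮m = trans (wc-unique n (qt l n) (λ j h → ≤-trans (+-monoˡ-≤ (j * P) (cc< q r l)) (≤-trans (*-monoˡ-≤ P h) (≤-trans (m≤n+m _ (md l n)) (≤-reflexive (sym (md-qt l n))))))
     (λ j h → ≤-trans (≤-reflexive (md-qt l n)) (+-mono-≤ (≤-pred (≰⇒> c≮m)) (*-monoˡ-≤ P h)))) (trans (sym (+-identityʳ _)) (cong (qt l n +_) (sym (le-no (≰⇒> c≮m)))))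

  wc-at : ∀ n w → n ≡ C + w * P → wc q r l n ≡ w
  wc-at n w refl = wc-unique n w (λ j h → +-monoʳ-< C (*-monoˡ-< P {{ℕ.>-nonZero (p^>0 l)}} h)) (λ j h → +-monoʳ-≤ C (*-monoˡ-≤ P h))

  wc-step-in : ∀ n w → n ≡ C + w * P → wc q r l (suc n) ≡ wc q r l n + 1
  wc-step-in n w e = trans (wc-unique (suc n) (suc w) (λ j h → s≤s (≤-trans (+-monoʳ-≤ C (*-monoˡ-≤ P (≤-pred h))) (≤-reflexive (sym e))))
    (λ j h → ≤-trans (≤-reflexive (cong suc e)) (+-monoʳ-< C (*-monoˡ-< P {{ℕ.>-nonZero (p^>0 l)}} h)))) (trans (+-comm 1 w) (cong (_+ 1) (sym (wc-at n w e))))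

  wc-step-out : ∀ n → (∀ j → n ≢ C + j * P) → wc q r l (suc n) ≡ wc q r l n
  wc-step-out n h = wc-unique (suc n) (wc q r l n) (λ j l' → m<n⇒m<1+n (wc-< q r l n j l')) (λ j l' → ≤∧≢⇒< (wc-≥ q r l n j l') (h j))

 module _ (q : IntP) (r n : ℕ) (o : Ord q r n) where
  open Ord o
  open IntP q using (N; x; x≥1)

  ord-in : ∀ l → l ≤ f → n ≡ cc q r l + qt l n * p ^ l
  ord-in l le = trans (md-qt l n) (cong (_+ qt l n * p ^ l) (Digits-md digits l le))

  ord-out : ∀ l → f < l → ∀ j → n ≢ cc q r l + j * p ^ l
  ord-out l f<l j e = ¬UnitQ-Dv υ-unit (Dv-cancel f (subst (Dv (f + 1)) val≡ (Dv-weaken (subst (_≤ l) (+-comm 1 f) f<l) dv)))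
   where
   dv : Dv l (γ q r Q.+ ι n)
   dv = subst (Dv l) (sym (γ+ q r n)) (Dv-*0 (Dv-ι∣ {l} (divides (x (r + l) + j * N) (trans (cong (λ z → x r + z * N) e) (sym (cc-xj q r l j))))) (Z⇒Dv (Z-inv (IntP.p∤N q))))

  ord-≤ : ∀ {L} → suc n * N < p ^ suc L → f ≤ L
  ord-≤ {L} h = ≮⇒≥ λ lt → <⇒≱ h (≤-trans (^-monoʳ-≤ p lt) (≤-trans (≤-trans (≤-reflexive (sym (*-identityˡ (p ^ f)))) (*-monoˡ-≤ (p ^ f) (≤-trans (x≥1 (r + f)) (m≤m+n _ (qt f n * N)))))
    (≤-trans (≤-reflexive (trans (cc-xj q r f (qt f n)) (cong (λ z → x r + z * N) (sym (ord-in f ≤-refl))))) (+-monoˡ-≤ (n * N) (IntP.x≤N q r)))))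

  vT-step : ∀ {L} → f ≤ L → vT q r (suc n) L ≡ vT q r n L + f
  vT-step {L} fL = trans (#-ext L level) (trans (#-+ L _ _) (cong (vT q r n L +_) (count-thr L f (λ l → le (suc l) f) (λ l lt → le-yes lt) (λ l ge → le-no (s≤s ge)) fL)))
   where
   level : ∀ l → wc q r (suc l) (suc n) ≡ wc q r (suc l) n + le (suc l) f
   level l with suc l ≤? f
   ... | yes a = trans (wc-step-in q r (suc l) n (qt (suc l) n) (ord-in (suc l) a)) (cong (wc q r (suc l) n +_) (sym (le-yes a)))
   ... | no a = trans (wc-step-out q r (suc l) n (ord-out (suc l) (≰⇒> a))) (trans (sym (+-identityʳ _)) (cong (wc q r (suc l) n +_) (sym (le-no (≰⇒> a)))))

 -- Legendre's formula for Pochhammer products, one factor at a time; nN < p^(L+1) ensures that no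
 -- level above L contributes.
 R-val : ∀ q r n L t → n * IntP.N q < p ^ suc L → Σ ℚ λ υ → UnitQ υ × R (int q) r 0 n t ≡ υ Q.* π ↑ vT q r n L
 R-val q r zero L t h = 1# , UnitQ-1 , sym (trans (Q.*-idˡ _) (cong (π ↑_) (#-0 L (λ l _ → wc-0 q r (suc l) 0 (p^>0 (suc l))))))
 R-val q r (suc n) L t h = proj₁ rec Q.* Ord.υ o , UnitQ-* (proj₁ (proj₂ rec)) (Ord.υ-unit o) ,
   trans (cong₂ Q._*_ (proj₂ (proj₂ rec)) (Ord.val≡ o)) (trans (Q.solve 4 (λ a b c d → (a Q.:* b) Q.:* (c Q.:* d) Q.:= (a Q.:* d) Q.:* (b Q.:* c)) refl (proj₁ rec) (π ↑ vT q r n L) (π ↑ Ord.f o) (Ord.υ o))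
    (cong (proj₁ rec Q.* Ord.υ o Q.*_) (trans (sym (Q.↑-+ π (vT q r n L) (Ord.f o))) (cong (π ↑_) (sym (vT-step q r n o (ord-≤ q r n o {L} h)))))))
  where
  o = ord q r n
  rec = R-val q r n L t (≤-trans (s≤s (*-monoˡ-≤ (IntP.N q) (n≤1+n n))) h)

 non-unit : ∀ q r n → U suc (R (non q) r 0 n)
 non-unit q r n = U-Π n (λ i _ → facU i)
  where
  facU : ∀ i → U suc (fac (non q) r i)
  facU i = mkU (M-+ (NonP.x-mem q r) (M-const (Dv-ι _))) (λ t o → UnitQ-≡ (UnitQ-ι (NonP.x-unit q r t o))
    (subst (Dv 1) (Q.solve 2 (λ a b → b Q.:= (a Q.:+ b) Q.:- a) refl (ι (NonP.x q r t)) (ι (i * NonP.N q))) (Dv-ι∣ {1} (subst (_∣ (i * NonP.N q)) (sym (*-identityʳ p)) (∣n⇒∣m*n i (NonP.p∣N q))))))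

 data HasN : Param → ℕ → Set where
  int : ∀ {q} → HasN (int q) (IntP.N q)
  non : ∀ {q} → HasN (non q) (NonP.N q)

 Rπ : ∀ {g N} → HasN g N → ∀ r n L → n * N < p ^ suc L → Σ (ℕ → ℚ) λ Y → U suc Y × (∀ t → Ω t → R g r 0 n t ≡ Y t Q.* π ↑ vTP g r n L)
 Rπ (int {q}) r n L h = (λ _ → proj₁ v) , U-const (proj₁ (proj₂ v)) , λ t _ → proj₂ (proj₂ v)
  where v = R-val q r n L 0 h
 Rπ (non {q}) r n L h = R (non q) r 0 n , non-unit q r n , λ t _ → sym (Q.*-idʳ _)

 hasN-fromDec : ∀ g d → HasN (fromDec g d) (Raw.N g)
 hasN-fromDec g (yes d) = non
 hasN-fromDec g (no nd) = int

 hasN : ∀ g → HasN (toParam g) (Raw.N g)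
 hasN g = hasN-fromDec g (p∣?_ (Raw.N g))

 sumP : List Raw → (Param → ℕ) → ℕ
 sumP gs f = sumL gs (λ g → f (toParam g))

 prodS-sg : ∀ x αs βs (e : Param → ℕ) → prodS (sg αs βs) (λ g → x ↑ e g) ≡ x ↑ sumP αs e Q.* inv (x ↑ sumP βs e)
 prodS-sg x [] [] e = sym (trans (Q.*-idˡ _) (sym (Q.inv-unique 1# 1# (Q.*-idˡ 1#))))
 prodS-sg x [] (g ∷ βs) e = trans (cong (inv (x ↑ e (toParam g)) Q.*_) (prodS-sg x [] βs e)) (trans (Q.solve 3 (λ a o b → a Q.:* (o Q.:* b) Q.:= o Q.:* (a Q.:* b)) refl _ 1# _)
   (cong (1# Q.*_) (sym (trans (cong inv (Q.↑-+ x (e (toParam g)) _)) (Q.inv-* _ _)))))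
 prodS-sg x (g ∷ αs) βs e = trans (cong (x ↑ e (toParam g) Q.*_) (prodS-sg x αs βs e)) (trans (sym (Q.*-assoc _ _ _)) (cong (Q._* inv (x ↑ sumP βs e)) (sym (Q.↑-+ x (e (toParam g)) _))))

 sumL-∈ : ∀ {A : Set} (gs : List A) (f : A → ℕ) {g} → g ∈ gs → f g ≤ sumL gs f
 sumL-∈ (g ∷ gs) f (here refl) = m≤m+n _ _
 sumL-∈ (g ∷ gs) f (there i) = ≤-trans (sumL-∈ gs f i) (m≤n+m _ (f g))

 sumL-mono : ∀ {A : Set} (gs : List A) {f f' : A → ℕ} → (∀ {g} → g ∈ gs → f g ≤ f' g) → sumL gs f ≤ sumL gs f'
 sumL-mono [] h = z≤n
 sumL-mono (g ∷ gs) h = +-mono-≤ (h (here refl)) (sumL-mono gs (λ i → h (there i)))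

 indP : Param → ℕ → ℕ → ℕ → ℕ
 indP (int q) r l n = le (suc (cc q r l)) (md l n)
 indP (non q) r l n = 0

 vTP-levels : ∀ g r n L → vTP g r n L ≡ isI g * #< L (λ l → qt (suc l) n) + #< L (λ l → indP g r (suc l) n)
 vTP-levels (int q) r n L = trans (#-ext L (λ l → wc-md q r (suc l) n)) (trans (#-+ L _ _) (cong (_+ #< L (λ l → indP (int q) r (suc l) n)) (sym (*-identityˡ _))))
 vTP-levels (non q) r n L = sym (#-0 L (λ _ _ → refl))

 -- (p-1) times the valuation of n! is n minus the digit sum of n, and a positive n has digit sum at
 -- least 1.
 legendre : ∀ L n → 1 ≤ n → (p ∸ 1) * #< L (λ l → qt (suc l) n) + 1 ≤ n
 legendre zero n h = ≤-trans (≤-reflexive (cong (_+ 1) (*-zeroʳ (p ∸ 1)))) h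
 legendre (suc L) n h with n / p in e
 ... | zero = ≤-trans (≤-reflexive (cong (_+ 1) (trans (cong ((p ∸ 1) *_) (#-0 (suc L) (λ l _ → qt0 l))) (*-zeroʳ (p ∸ 1))))) h
  where
  qt0 : ∀ l → qt l 0 ≡ 0
  qt0 zero = refl
  qt0 (suc l) = trans (cong (qt l) (0/n≡0 p)) (qt0 l)
 ... | suc k = begin
  (p ∸ 1) * #< (suc L) (λ l → qt l (suc k)) + 1                  ≡⟨ cong (λ z → (p ∸ 1) * z + 1) (#-first L (λ l → qt l (suc k))) ⟩
  (p ∸ 1) * (suc k + #< L (λ l → qt (suc l) (suc k))) + 1        ≡⟨ trans (cong (_+ 1) (*-distribˡ-+ (p ∸ 1) (suc k) (#< L (λ l → qt (suc l) (suc k))))) (+-assoc ((p ∸ 1) * suc k) ((p ∸ 1) * #< L (λ l → qt (suc l) (suc k))) 1) ⟩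
  (p ∸ 1) * suc k + ((p ∸ 1) * #< L (λ l → qt (suc l) (suc k)) + 1) ≤⟨ +-monoʳ-≤ ((p ∸ 1) * suc k) (legendre L (suc k) (s≤s z≤n)) ⟩
  (p ∸ 1) * suc k + suc k                                        ≡⟨ trans (+-comm _ (suc k)) (trans (cong (_* suc k) (sym pm1)) (*-comm p (suc k))) ⟩
  suc k * p                                                      ≡⟨ cong (_* p) e ⟨
  n / p * p                                                      ≤⟨ m/n*n≤m n p ⟩
  n                                                              ∎
  where open ≤-Reasoning

 top-power : ∀ n → 1 ≤ n → Σ ℕ λ m → p ^ m ≤ n × n < p ^ suc m
 top-power n h = go n (s<p^s n)
  where
  go : ∀ s → n < p ^ s → Σ ℕ λ m → p ^ m ≤ n × n < p ^ suc m
  go zero l = ⊥-elim (<⇒≱ l h)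
  go (suc s) l with p ^ s ≤? n
  ... | yes a = s , a , l
  ... | no a = go s (≰⇒> a)

 bernoulli : ∀ m → (p ∸ 1) * m + 1 ≤ p ^ m
 bernoulli zero = ≤-reflexive (cong (_+ 1) (*-zeroʳ (p ∸ 1)))
 bernoulli (suc m) = ≤-trans (≤-reflexive (trans (cong (_+ 1) (*-suc (p ∸ 1) m)) (+-assoc (p ∸ 1) _ 1)))
  (≤-trans (+-mono-≤ (≤-trans (≤-reflexive (sym (*-identityʳ (p ∸ 1)))) (*-monoʳ-≤ (p ∸ 1) (p^>0 m))) (bernoulli m)) (≤-reflexive (trans (+-comm ((p ∸ 1) * p ^ m) (p ^ m)) (cong (_* p ^ m) (sym pm1)))))

 #-extend : ∀ {L L'} (f : ℕ → ℕ) → L ≤ L' → #< L f ≤ #< L' f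
 #-extend {L} {L'} f h = ≤-trans (m≤m+n _ _) (≤-reflexive (trans (sym (#-split L (L' ∸ L) f)) (cong (λ k → #< k f) (m+[n∸m]≡n h))))

 qt≥1 : ∀ {m n} → p ^ m ≤ n → m ≤ #< m (λ l → qt (suc l) n)
 qt≥1 {m} {n} h = ≤-trans (≤-reflexive (sym (trans (#-const m 1) (*-identityʳ m)))) (#-mono m (λ l lt → n≢0⇒n>0 (λ e → <⇒≱ (≤-trans (md< (suc l) n) (^-monoʳ-≤ p lt)) (≤-trans h (≤-reflexive (trans (md-qt (suc l) n) (trans (cong (λ z → md (suc l) n + z * p ^ suc l) e) (+-identityʳ _))))))))

 module Valuation (αs βs : List Raw) (e₁ e₂ : ℕ) (cu : ℚ) (cu-unit : UnitQ cu) where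

  ps : Signed
  ps = sg αs βs
  open Levels ps

  c : ℚ
  c = π ↑ e₁ Q.* inv (π ↑ e₂) Q.* cu

  A : ℕ → ℕ → ℕ → ℚ
  A r n t = c ↑ n Q.* prodS ps (λ g → R g r 0 n t)

  V : List Raw → ℕ → ℕ → ℕ → ℕ
  V gs r n L = sumP gs (λ g → vTP g r n L)

  -- Once L is at least n times the sum of all denominators, p^(L+1) exceeds nN for each of them,
  -- and every contributing level is in sight.
  level : ℕ → ℕ
  level n = n * sumL (αs ++ βs) Raw.N

  level-big : ∀ {n L} → level n ≤ L → ∀ g → g ∈ αs ++ βs → n * Raw.N g < p ^ suc L
  level-big {n} {L} h g i = ≤-trans (s≤s (≤-trans (*-monoʳ-≤ n (sumL-∈ (αs ++ βs) Raw.N i)) h)) (≤-trans (s<p^s L) (^-monoʳ-≤ p (n≤1+n L)))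

  A-π : ∀ r n {L} → level n ≤ L → Σ (ℕ → ℚ) λ Y → U suc Y × (∀ t → Ω t → A r n t ≡ Y t Q.* (π ↑ (e₁ * n + V αs r n L) Q.* inv (π ↑ (e₂ * n + V βs r n L))))
  A-π r n {L} h = (λ t → cu ↑ n Q.* Y t) , U-* (U-const (UnitQ-↑ n cu-unit)) (proj₁ (proj₂ tot)) , λ t o →
    trans (cong₂ Q._*_ cn (trans (proj₂ (proj₂ tot) t o) (cong (Y t Q.*_) (prodS-sg π αs βs (λ g → vTP g r n L)))))
     (trans (Q.solve 6 (λ a b u y v w → ((a Q.:* b) Q.:* u) Q.:* (y Q.:* (v Q.:* w)) Q.:= (u Q.:* y) Q.:* ((a Q.:* v) Q.:* (b Q.:* w))) refl (π ↑ (e₁ * n)) (inv (π ↑ (e₂ * n))) (cu ↑ n) (Y t) (π ↑ V αs r n L) (inv (π ↑ V βs r n L)))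
      (cong (cu ↑ n Q.* Y t Q.*_) (cong₂ Q._*_ (sym (Q.↑-+ π (e₁ * n) _)) (trans (sym (Q.inv-* _ _)) (cong inv (sym (Q.↑-+ π (e₂ * n) _)))))))
   where
   tot = prodS-Σ ps {λ g t → R g r 0 n t} {λ g t → π ↑ vTP g r n L} (λ {_} {g} i → Rπ {g} (subst (λ z → HasN z (Raw.N (proj₁ (∈-sg αs βs i)))) (sym (proj₂ (proj₂ (∈-sg αs βs i)))) (hasN (proj₁ (∈-sg αs βs i)))) r n L (level-big {n} {L} h (proj₁ (∈-sg αs βs i)) (proj₁ (proj₂ (∈-sg αs βs i)))))
   Y = proj₁ tot
   cn : c ↑ n ≡ π ↑ (e₁ * n) Q.* inv (π ↑ (e₂ * n)) Q.* cu ↑ n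
   cn = trans (Q.*-↑ (π ↑ e₁ Q.* inv (π ↑ e₂)) cu n) (cong (Q._* cu ↑ n) (trans (Q.*-↑ (π ↑ e₁) (inv (π ↑ e₂)) n)
     (cong₂ Q._*_ (trans (sym (Q.↑-* π n e₁)) (cong (π ↑_) (*-comm n e₁))) (trans (sym (Q.inv-↑ (π ↑ e₂) n)) (cong inv (trans (sym (Q.↑-* π n e₂)) (cong (π ↑_) (*-comm n e₂))))))))

  A-M : ∀ {r n k L} → level n ≤ L → e₂ * n + V βs r n L + k ≤ e₁ * n + V αs r n L → M₀ k (A r n)
  A-M {r} {n} {k} {L} h le = M-resp (λ t o → sym (trans (proj₂ (proj₂ a) t o) (Q.*-comm _ _))) (M-*0 (M-const dv) (mem (proj₁ (proj₂ a))))
   where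
   a = A-π r n h
   v = e₂ * n + V βs r n L
   i = e₁ * n + V αs r n L ∸ (v + k)
   dv : Dv k (π ↑ (e₁ * n + V αs r n L) Q.* inv (π ↑ v))
   dv = subst (Dv k) (sym (trans (cong (λ z → π ↑ z Q.* inv (π ↑ v)) (trans (sym (m+[n∸m]≡n le)) (+-assoc v k i))) (trans (cong (Q._* inv (π ↑ v)) (Q.↑-+ π v (k + i)))
    (trans (Q.solve 3 (λ v k i → (v Q.:* k) Q.:* i Q.:= (v Q.:* i) Q.:* k) refl (π ↑ v) (π ↑ (k + i)) (inv (π ↑ v))) (trans (cong (Q._* π ↑ (k + i)) (Q.inv-r {π ↑ v} (Q.↑-≢0 v π≢0))) (Q.*-idˡ _)))))) (Dv-weaken (m≤m+n k i) (Dv-π₀ (k + i)))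

  -- a digit match of length f beyond the top power m of n forces the levels in between to be positive
  level-split : ∀ {σ q} → (σ , int q) ∈ ps → ∀ r n k f → k < n → Digits q r f k → Σ ℕ λ m → p ^ m ≤ n × (∀ L → f ≤ L → f ≤ m + gL L r n)
  level-split {σ} {q} i r n k f k<n d = m , proj₁ (proj₂ tp) , λ L fL → go L fL
   where
   tp = top-power n (≤-trans (s≤s z≤n) k<n)
   m = proj₁ tp
   posi : ∀ l → m ≤ l → l < f → pos r (suc l) n ≡ true
   posi l ml lf = ⇒bad ps r (suc l) _ i (subst₂ _<_ (trans (sym (md-small (suc l) k (<-trans k<n n<))) (Digits-md d (suc l) lf)) (sym (md-small (suc l) n n<)) k<n)
    where
    n< : n < p ^ suc l
    n< = ≤-trans (proj₂ (proj₂ tp)) (^-monoʳ-≤ p (s≤s ml))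
   go : ∀ L → f ≤ L → f ≤ m + gL L r n
   go L fL with f ≤? m
   ... | yes a = ≤-trans a (m≤m+n m _)
   ... | no a = ≤-trans (≤-reflexive (sym (m+[n∸m]≡n m≤f))) (+-monoʳ-≤ m (≤-trans (≤-reflexive (sym (trans (#-cong (f ∸ m) (λ l lt → cong b2n (posi (m + l) (m≤m+n m l) (subst (m + l <_) (m+[n∸m]≡n m≤f) (+-monoʳ-< m lt))))) (trans (#-const (f ∸ m) 1) (*-identityʳ _)))))
      (≤-trans (m≤n+m _ (#< m (λ l → b2n (pos r (suc l) n)))) (≤-trans (≤-reflexive (trans (sym (#-split m (f ∸ m) (λ l → b2n (pos r (suc l) n)))) (cong (λ z → gL z r n) (m+[n∸m]≡n m≤f)))) (#-extend (λ l → b2n (pos r (suc l) n)) fL)))))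
    where
    m≤f : m ≤ f
    m≤f = <⇒≤ (≰⇒> a)

  -- A termwise bound without cancellation: A_r(n) absorbs the pole of every summand with k < n.
  -- Summands of the non-integral parameters bring a factor p themselves, so E - 1 suffices for
  -- them.
  A-H : ∀ {lev} (emb : ∀ {k f} → M₀ k f → M lev k f) E → 1 ≤ E → ∀ r n → (∀ {σ q} → (σ , int q) ∈ ps → ∀ k → k < n → (o : Ord q r k) → M₀ (Ord.f o + E) (A r n)) → (1 ≤ n → M₀ (E ∸ 1) (A r n)) →
   M lev E (λ t → A r n t Q.* Hs ps r n t)
  A-H emb E E≥1 r n hInt hNon = emb (M-sumS ps (A r n) {λ g t → harm g r n t} (λ {_} {g} i → M-resp (λ t _ → Σ-*ˡ n (A r n t) (λ k → hterm g r k t)) (M-Σ n (λ k l → term g i k l))))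
   where
   term : ∀ {σ} g → (σ , g) ∈ ps → ∀ k → k < n → M₀ E (λ t → A r n t Q.* hterm g r k t)
   term (int q) i k l = M-divide (Ord.f o) (Ord.υ-unit o) (Ord.val≡ o) (hInt i k l o)
    where o = ord q r k
   term (non q) i k l = M-weaken (≤-reflexive (sym (m∸n+n≡m E≥1))) (M-* (hNon (≤-trans (s≤s z≤n) l)) (hterm-non q r k))

  module Balanced (same-length : sumL αs (λ _ → 1) ≡ sumL βs (λ _ → 1)) (φ : ℕ)
   (balance : (p ∸ 1) * e₁ + sumP αs isI ≡ (p ∸ 1) * e₂ + sumP βs isI + φ) where

   int+non : ∀ gs → sumP gs isI + sumP gs isN ≡ sumL gs (λ _ → 1)
   int+non gs = trans (sym (sumL-+ gs _ _)) (sumL-ext gs (λ g → one (toParam g)))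
    where
    one : ∀ g → isI g + isN g ≡ 1
    one (int _) = refl
    one (non _) = refl

   module Averaged (hn : HNat αs βs) where
    open Average αs βs same-length hn using (averaged)

    -- `averaged` with the exponents of the constant added. The n contributed by each non-integral
    -- parameter is traded for (p-1)(e₁ - e₂)n through `balance`, equal lengths converting counts of
    -- non-integral parameters into counts of integral ones; what is left over is φ n.
    V-avg : ∀ r n L → level n ≤ L → (p ∸ 1) * (e₂ * n + V βs r n L + gL L r n) + φ * n ≤ (p ∸ 1) * (e₁ * n + V αs r n L)
    V-avg r n L h = +-cancelʳ-≤ (nα * n) _ _ (begin
      P * (e₂ * n + Vβ + G) + φ * n + nα * n          ≡⟨ solve 7 (λ P e n v g x y → P :* (e :* n :+ v :+ g) :+ x :+ y := (P :* e :* n :+ x :+ y) :+ (P :* v :+ P :* g)) refl P e₂ n Vβ G (φ * n) (nα * n) ⟩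
      (P * e₂ * n + φ * n + nα * n) + (P * Vβ + P * G) ≡⟨ cong (_+ (P * Vβ + P * G)) bal ⟩
      (P * e₁ * n + nβ * n) + (P * Vβ + P * G)         ≡⟨ solve 4 (λ a b c d → (a :+ b) :+ (c :+ d) := a :+ ((c :+ b) :+ d)) refl (P * e₁ * n) (nβ * n) (P * Vβ) (P * G) ⟩
      P * e₁ * n + (P * Vβ + nβ * n + P * G)           ≤⟨ +-monoʳ-≤ (P * e₁ * n) av ⟩
      P * e₁ * n + (P * Vα + nα * n)                   ≡⟨ solve 5 (λ P e n v x → P :* e :* n :+ (P :* v :+ x) := P :* (e :* n :+ v) :+ x) refl P e₁ n Vα (nα * n) ⟩
      P * (e₁ * n + Vα) + nα * n                       ∎)
     where
     open ≤-Reasoning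
     P = p ∸ 1
     Vα = V αs r n L
     Vβ = V βs r n L
     G = gL L r n
     nα = sumP αs isN
     nβ = sumP βs isN
     contr-sum : ∀ gs → sumL gs (λ g → contr (toParam g) r n L) ≡ P * V gs r n L + sumP gs isN * n
     contr-sum gs = trans (sumL-+ gs _ _) (cong₂ _+_ (sumL-* gs P _) (trans (sumL-ext gs (λ g → *-comm _ n)) (trans (sumL-* gs n _) (*-comm n _))))
     av : P * Vβ + nβ * n + P * G ≤ P * Vα + nα * n
     av = subst₂ _≤_ (cong (_+ P * G) (contr-sum βs)) (contr-sum αs) (averaged r n L (level-big {n} {L} h))
     bal₁ : P * e₂ + φ + nα ≡ P * e₁ + nβ
     bal₁ = +-cancelʳ-≡ (sumP αs isI + sumP βs isI) _ _ (begin-equality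
      P * e₂ + φ + nα + (sumP αs isI + sumP βs isI)        ≡⟨ solve 5 (λ a f n i j → a :+ f :+ n :+ (i :+ j) := (a :+ j :+ f) :+ (i :+ n)) refl (P * e₂) φ nα (sumP αs isI) (sumP βs isI) ⟩
      (P * e₂ + sumP βs isI + φ) + (sumP αs isI + nα)      ≡⟨ cong₂ _+_ (sym balance) (trans (int+non αs) (trans same-length (sym (int+non βs)))) ⟩
      (P * e₁ + sumP αs isI) + (sumP βs isI + nβ)          ≡⟨ solve 4 (λ a i j n → (a :+ i) :+ (j :+ n) := a :+ n :+ (i :+ j)) refl (P * e₁) (sumP αs isI) (sumP βs isI) nβ ⟩
      P * e₁ + nβ + (sumP αs isI + sumP βs isI)            ∎)
     bal : P * e₂ * n + φ * n + nα * n ≡ P * e₁ * n + nβ * n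
     bal = trans (sym (trans (*-distribʳ-+ n (P * e₂ + φ) nα) (cong (_+ nα * n) (*-distribʳ-+ n (P * e₂) φ)))) (trans (cong (_* n) bal₁) (*-distribʳ-+ n (P * e₁) nβ))

    private
     pm1≢0 : NonZero (p ∸ 1)
     pm1≢0 = ℕ.>-nonZero (m<n⇒0<n∸m 1<p)

    A-avg : ∀ r n L → M₀ (gL L r n) (A r n)
    A-avg r n L = M-weaken (#-extend {L} {L'} (λ l → b2n (pos r (suc l) n)) (m≤m+n L _)) (A-M {r} {n} {gL L' r n} {L'} (m≤n+m _ L)
      (*-cancelˡ-≤ (p ∸ 1) {{pm1≢0}} (≤-trans (m≤m+n _ (φ * n)) (V-avg r n L' (m≤n+m _ L)))))
     where L' = L + level n

    -- With p^m the top power of p not exceeding n, a pole of order f is covered beyond m by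
    -- positive levels and up to m by φ n, since φ n ≥ p^m exceeds (p-1)m. The strict inequality
    -- yields the additional factor p.
    A-ord : 1 ≤ φ → ∀ {σ q} → (σ , int q) ∈ ps → ∀ r n k → k < n → (o : Ord q r k) → M₀ (Ord.f o + 1) (A r n)
    A-ord φ≥1 i r n k k<n o = A-M {r} {n} {f + 1} {L'} (m≤n+m _ f) (≤-trans (≤-reflexive (trans (sym (+-assoc X f 1)) (+-comm (X + f) 1))) (*-cancelˡ-< (p ∸ 1) _ _ (begin-strict
      (p ∸ 1) * (X + f)                                  ≤⟨ *-monoʳ-≤ (p ∸ 1) (+-monoʳ-≤ X (proj₂ (proj₂ ls) L' (m≤m+n f _))) ⟩
      (p ∸ 1) * (X + (m + gL L' r n))                    ≡⟨ solve 4 (λ P x m g → P :* (x :+ (m :+ g)) := P :* (x :+ g) :+ P :* m) refl (p ∸ 1) X m (gL L' r n) ⟩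
      (p ∸ 1) * (X + gL L' r n) + (p ∸ 1) * m            <⟨ +-monoʳ-< _ (≤-trans (≤-reflexive (+-comm 1 _)) (≤-trans (bernoulli m) (≤-trans (proj₁ (proj₂ ls)) (≤-trans (≤-reflexive (sym (*-identityˡ n))) (*-monoˡ-≤ n φ≥1))))) ⟩
      (p ∸ 1) * (X + gL L' r n) + φ * n                  ≤⟨ V-avg r n L' (m≤n+m _ f) ⟩
      (p ∸ 1) * (e₁ * n + V αs r n L')                   ∎)))
     where
     open ≤-Reasoning
     f = Ord.f o
     L' = f + level n
     X = e₂ * n + V βs r n L'
     ls = level-split i r n k f k<n (Ord.digits o)
     m = proj₁ ls

   module IntegerDenominators (e : ℕ) (e-eq : e₁ ≡ e₂ + e) (β-int : ∀ g → g ∈ βs → Raw.N g ≡ 1) where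
    private
     -- An integer parameter reduces to 1, and the residue of -1 modulo p^l is p^l - 1, the largest
     -- one; so integral β never make a level positive.
     bound-β : ∀ {q} r l → IntP.N q ≡ 1 → ∀ n → md l n ≤ cc q r l
     bound-β {q} r l N1 n = ≤-pred (subst (md l n <_) eq (md< l n))
      where
      x1 : ∀ r → IntP.x q r ≡ 1
      x1 r = ≤-antisym (subst (IntP.x q r ≤_) N1 (IntP.x≤N q r)) (IntP.x≥1 q r)
      eq : p ^ l ≡ suc (cc q r l)
      eq = trans (sym (*-identityʳ _)) (trans (cong (p ^ l *_) (sym (x1 (r + l)))) (trans (cc-x q r l) (cong₂ _+_ (x1 r) (trans (cong (cc q r l *_) N1) (*-identityʳ _)))))

     ind-β : ∀ {g N} → HasN g N → N ≡ 1 → ∀ r l n → indP g r l n ≡ 0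
     ind-β (int {q}) N1 r l n = le-no (s≤s (bound-β {q} r l N1 n))
     ind-β non N1 r l n = refl

     S : ℕ → ℕ → ℕ
     S L n = #< L (λ l → qt (suc l) n)

     V-levels : ∀ gs r n L → V gs r n L ≡ sumP gs isI * S L n + #< L (λ l → sumP gs (λ g → indP g r (suc l) n))
     V-levels gs r n L = trans (sumL-ext gs (λ g → vTP-levels (toParam g) r n L)) (trans (sumL-+ gs _ _)
      (cong₂ _+_ (trans (sumL-ext gs (λ g → *-comm _ (S L n))) (trans (sumL-* gs (S L n) _) (*-comm (S L n) _))) (sym (sumL-# gs L _))))

     pos-ind : ∀ r l n → b2n (pos r l n) ≤ sumP αs (λ g → indP g r l n)
     pos-ind r l n with pos r l n in eq
     ... | false = z≤n
     ... | true = go (bad⇒ ps r l (md l n) eq)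
      where
      go : Bad∈ ps r l (md l n) → 1 ≤ sumP αs (λ g → indP g r l n)
      go (mkBad {q = q} i less) with ∈-++⁻ αs (proj₁ (proj₂ (∈-sg αs βs i)))
      ... | inj₁ a = ≤-trans (≤-reflexive (sym (trans (cong (λ g → indP g r l n) (sym (proj₂ (proj₂ (∈-sg αs βs i))))) (le-yes less)))) (sumL-∈ αs (λ g → indP (toParam g) r l n) a)
      ... | inj₂ a = ⊥-elim (<⇒≱ less (bound-β {q} r l (trans (proj₁ (proj₂ (int-fields (proj₁ (∈-sg αs βs i)) (proj₂ (proj₂ (∈-sg αs βs i)))))) (β-int _ a)) n))

     -- Legendre's bound n ≥ (p-1)S + 1 splits e n into the constant gain e and (p-1)e S. The
     -- latter, together with the numbers of integral parameters, gives φ S.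
     V-bound : ∀ r n L → 1 ≤ n → e₂ * n + V βs r n L + (e + φ * S L n + gL L r n) ≤ e₁ * n + V αs r n L
     V-bound r n L n≥1 = begin
      e₂ * n + V βs r n L + (e + φ * s + G)       ≡⟨ cong (λ z → e₂ * n + z + (e + φ * s + G)) (trans (V-levels βs r n L) (trans (cong (Iβ * s +_) (#-0 L (λ l _ → trans (sumL-cong βs (λ {g} i → ind-β {toParam g} (hasN g) (β-int g i) r (suc l) n)) (trans (sumL-ext βs (λ _ → refl)) (sumL-* βs 0 (λ _ → 0)))))) (+-identityʳ _))) ⟩
      e₂ * n + Iβ * s + (e + φ * s + G)           ≡⟨ solve 6 (λ a i s e f g → a :+ i :* s :+ (e :+ f :* s :+ g) := (a :+ e) :+ (i :+ f) :* s :+ g) refl (e₂ * n) Iβ s e φ G ⟩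
      (e₂ * n + e) + (Iβ + φ) * s + G             ≡⟨ cong (λ z → (e₂ * n + e) + z * s + G) (sym bal) ⟩
      (e₂ * n + e) + (P * e + Iα) * s + G         ≡⟨ solve 6 (λ a e P i s g → (a :+ e) :+ (P :* e :+ i) :* s :+ g := a :+ e :* (P :* s :+ con 1) :+ (i :* s :+ g)) refl (e₂ * n) e P Iα s G ⟩
      e₂ * n + e * (P * s + 1) + (Iα * s + G)     ≤⟨ +-mono-≤ (+-monoʳ-≤ (e₂ * n) (*-monoʳ-≤ e (legendre L n n≥1))) (+-monoʳ-≤ (Iα * s) (#-mono L (λ l _ → pos-ind r (suc l) n))) ⟩
      e₂ * n + e * n + (Iα * s + #< L (λ l → sumP αs (λ g → indP g r (suc l) n))) ≡⟨ cong₂ _+_ (trans (sym (*-distribʳ-+ n e₂ e)) (cong (_* n) (sym e-eq))) (sym (V-levels αs r n L)) ⟩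
      e₁ * n + V αs r n L                         ∎
      where
      open ≤-Reasoning
      P = p ∸ 1
      s = S L n
      G = gL L r n
      Iα = sumP αs isI
      Iβ = sumP βs isI
      bal : P * e + Iα ≡ Iβ + φ
      bal = +-cancelˡ-≡ (P * e₂) _ _ (trans (sym (+-assoc (P * e₂) _ _)) (trans (cong (_+ Iα) (trans (sym (*-distribˡ-+ P e₂ e)) (cong (P *_) (sym e-eq)))) (trans balance (+-assoc (P * e₂) Iβ φ))))

    A-int-β : ∀ r n L → 1 ≤ n → M₀ (gL L r n + e) (A r n)
    A-int-β r n L n≥1 = M-weaken (+-monoˡ-≤ e (#-extend {L} {L'} (λ l → b2n (pos r (suc l) n)) (m≤m+n L _)))
      (A-M {r} {n} {gL L' r n + e} {L'} (m≤n+m _ L) (≤-trans (+-monoʳ-≤ (e₂ * n + V βs r n L') (≤-trans (≤-reflexive (+-comm _ e)) (+-monoˡ-≤ (gL L' r n) (m≤m+n e _)))) (V-bound r n L' n≥1)))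
     where L' = L + level n

    A-int-β-ord : 1 ≤ φ → ∀ {σ q} → (σ , int q) ∈ ps → ∀ r n k → k < n → (o : Ord q r k) → M₀ (Ord.f o + e) (A r n)
    A-int-β-ord φ≥1 i r n k k<n o = A-M {r} {n} {f + e} {L'} (m≤n+m _ (f + m)) (≤-trans (+-monoʳ-≤ (e₂ * n + V βs r n L')
      (≤-trans (+-monoˡ-≤ e (≤-trans (proj₂ (proj₂ ls) L' (≤-trans (m≤m+n f m) (m≤m+n _ _))) (+-monoˡ-≤ (gL L' r n) (≤-trans (qt≥1 {m} (proj₁ (proj₂ ls))) (≤-trans (#-extend {m} {L'} (λ l → qt (suc l) n) (≤-trans (m≤n+m m f) (m≤m+n _ _))) (≤-trans (≤-reflexive (sym (*-identityˡ _))) (*-monoˡ-≤ (S L' n) φ≥1)))))))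
       (≤-reflexive (solve 3 (λ a g e → a :+ g :+ e := e :+ a :+ g) refl (φ * S L' n) (gL L' r n) e)))) (V-bound r n L' (≤-trans (s≤s z≤n) k<n)))
     where
     f = Ord.f o
     ls = level-split i r n k f k<n (Ord.digits o)
     m = proj₁ ls
     L' = f + m + level n

-- Formal power series: quotients and the substitution of z^p for z.

module SeriesQuotient (p : ℕ) (pp : Prime p) (Ω : ℕ → Set) where
 open import Data.Nat.Base using (_≤_; _<_; _∸_) renaming (_+_ to _∔_; _*_ to _·_)

 open Q
 open Sums
 open Convolution
 open Padic p pp
 open Filt Ω
 open Digit p pp Ω using (nzp; p>0; dig%; dig/)
 import Defs
 open import Data.Nat.DivMod using (_/_; _%_; m≡m%n+[m/n]*n; m%n<n)
 open import Relation.Nullary.Decidable using (dec-true; dec-false)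

 Σ-single : ∀ n i f → i < n → (∀ j → j < n → j ≢ i → f j ≡ 0#) → Σ< n f ≡ f i
 Σ-single (suc n) i f l h with i Nat.≟ n
 ... | yes refl = trans (cong₂ _+_ (Σ-0 n (λ j jl → h j (Nat.m<n⇒m<1+n jl) (Nat.<⇒≢ jl))) refl) (+-idˡ (f i))
 ... | no ne = trans (cong₂ _+_ (Σ-single n i f (Nat.≤∧≢⇒< (Nat.≤-pred l) ne) (λ j jl → h j (Nat.m<n⇒m<1+n jl))) (h n Nat.≤-refl (λ e → ne (sym e)))) (+-idʳ (f i))

 -- sp X is the series X(z^p).
 spv : (ℕ → ℚ) → ℕ → ℕ → ℚ
 spv X zero j = X j
 spv X (suc _) j = 0#

 sp : (ℕ → ℚ) → ℕ → ℚ
 sp X n = spv X (n % p) (n / p)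

 sp-at : ∀ X v j → v < p → sp X (v ∔ j · p) ≡ spv X v j
 sp-at X v j l = cong₂ (spv X) (dig% v j l) (dig/ v j l)

 spv-ext : ∀ {X X'} → (∀ j → X j ≡ X' j) → ∀ v j → spv X v j ≡ spv X' v j
 spv-ext e zero j = e j
 spv-ext e (suc v) j = refl

 digits-ind : ∀ (P : ℕ → Set) → (∀ v j → v < p → P (v ∔ j · p)) → ∀ n → P n
 digits-ind P h n = subst P (sym (m≡m%n+[m/n]*n n p)) (h (n % p) (n / p) (m%n<n n p))

 quot : (ℕ → ℚ) → (ℕ → ℚ) → ℕ → ℚ
 quot = Defs.SerDiv.quot

 opaque
  unfolding _+_
  sumZip-conv : ∀ f g j n → Defs.SerDiv.sumZip f g j (Defs.SerDiv.qs f g n) ≡ conv (λ i → f (suc (j ∔ i))) (quot f g) n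
  sumZip-conv f g j zero = trans (+-idʳ _) (trans (cong (λ k → f (suc k) * quot f g 0) (sym (Nat.+-identityʳ j))) (sym (+-idˡ _)))
  sumZip-conv f g j (suc n) = sym (trans (conv-suc (λ i → f (suc (j ∔ i))) (quot f g) n)
   (cong₂ _+_ (cong (λ k → f (suc k) * quot f g (suc n)) (Nat.+-identityʳ j))
    (trans (conv-ext (λ i → cong (λ k → f (suc k)) (Nat.+-suc j i)) (λ _ → refl) n) (sym (sumZip-conv f g (suc j) n)))))

  quot-0 : ∀ f g → quot f g 0 ≡ g 0 * inv (f 0)
  quot-0 f g = refl

  quot-suc : ∀ f g n → quot f g (suc n) ≡ (g (suc n) - conv (λ i → f (suc i)) (quot f g) n) * inv (f 0)
  quot-suc f g n = cong (λ z → (g (suc n) - z) * inv (f 0)) (sumZip-conv f g 0 n)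

 conv-quot : ∀ f g → f 0 ≢ 0# → ∀ n → conv f (quot f g) n ≡ g n
 conv-quot f g ne zero = trans (+-idˡ _) (trans (cong (f 0 *_) (quot-0 f g)) (trans (solve 3 (λ f g i → f :* (g :* i) := (f :* i) :* g) refl (f 0) (g 0) (inv (f 0))) (trans (cong (_* g 0) (inv-r {f 0} ne)) (*-idˡ (g 0)))))
 conv-quot f g ne (suc n) = trans (conv-suc f (quot f g) n) (trans (cong (λ z → f 0 * z + s) (quot-suc f g n))
   (trans (solve 4 (λ f g i s → f :* ((g :- s) :* i) :+ s := (f :* i) :* (g :- s) :+ s) refl (f 0) (g (suc n)) (inv (f 0)) s)
    (trans (cong (λ z → z * (g (suc n) - s) + s) (inv-r {f 0} ne)) (solve 2 (λ g s → :1 :* (g :- s) :+ s := g) refl (g (suc n)) s))))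
  where s = conv (λ i → f (suc i)) (quot f g) n

 -- The summation loop inside subPowSer is local to its definition; the meta-variable is solved by it.
 mutual
  partialSum : ℚ → (ℕ → ℚ) → ℕ → ℕ → ℚ
  partialSum = _

  private
   partialSum-link : ∀ c s n → Defs.subPowSer c p s (suc n) ≡
    (if does ((suc n · p) Nat.≟ suc n) then Defs.powQ c (suc n) ℚ.* s (suc n) else ℚ.0ℚ) ℚ.+ ((if does ((n · p) Nat.≟ suc n) then Defs.powQ c n ℚ.* s n else ℚ.0ℚ) ℚ.+ partialSum c s (suc n) n)
   partialSum-link c s n with suc n
   ... | _ = refl

 opaque
  unfolding _+_
  term : ℚ → (ℕ → ℚ) → ℕ → ℕ → ℚ
  term c s n m = if does ((m · p) Nat.≟ n) then c ↑ m * s m else 0#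

  sum-rec : ∀ (go t : ℕ → ℚ) → go 0 ≡ 0# → (∀ m → go (suc m) ≡ t m + go m) → ∀ k → go k ≡ Σ< k t
  sum-rec go t z s zero = z
  sum-rec go t z s (suc k) = trans (s k) (trans (cong (λ y → t k + y) (sum-rec go t z s k)) (+-comm (t k) _))

  subPow-Σ : ∀ c s n → Defs.subPowSer c p s n ≡ Σ< (suc n) (term c s n)
  subPow-Σ c s n = sum-rec (partialSum c s n) (term c s n) refl (λ m → cong (λ y → (if does ((m · p) Nat.≟ n) then y * s m else 0#) + partialSum c s n m) (powQ≡↑ c m)) (suc n)

  term-yes : ∀ c s n m → m · p ≡ n → term c s n m ≡ c ↑ m * s m
  term-yes c s n m e = cong (λ b → if b then c ↑ m * s m else 0#) (dec-true ((m · p) Nat.≟ n) e)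

  term-no : ∀ c s n m → m · p ≢ n → term c s n m ≡ 0#
  term-no c s n m e = cong (λ b → if b then c ↑ m * s m else 0#) (dec-false ((m · p) Nat.≟ n) e)

 subPow-sp : ∀ c s n → Defs.subPowSer c p s n ≡ sp (λ m → c ↑ m * s m) n
 subPow-sp c s = digits-ind _ go
  where
  cancel : ∀ {m j} → m · p ≡ j · p → m ≡ j
  cancel {m} {j} e = Nat.*-cancelʳ-≡ m j p e
  go : ∀ v j → v < p → Defs.subPowSer c p s (v ∔ j · p) ≡ sp (λ m → c ↑ m * s m) (v ∔ j · p)
  go zero j l = trans (subPow-Σ c s _) (trans (Σ-single (suc (j · p)) j _ (s≤s (Nat.m≤m*n j p)) (λ m _ ne → term-no c s (j · p) m (λ e → ne (cancel {m} {j} e))))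
   (trans (term-yes c s (j · p) j refl) (sym (sp-at (λ m → c ↑ m * s m) 0 j l))))
  go (suc v) j l = trans (subPow-Σ c s _) (trans (Σ-0 (suc (suc v ∔ j · p)) (λ m _ → term-no c s _ m (λ e → ne m e))) (sym (sp-at (λ m → c ↑ m * s m) (suc v) j l)))
   where
   ne : ∀ m → m · p ≢ suc v ∔ j · p
   ne m e with trans (sym (dig% 0 m p>0)) (trans (cong (_% p) e) (dig% (suc v) j l))
   ... | ()

 conv-sp : ∀ X g a K → a < p → conv (sp X) g (a ∔ K · p) ≡ conv X (λ j → g (a ∔ j · p)) K
 conv-sp X g a K al = begin
  Σ< (suc n) f                                         ≡⟨ cong (λ k → Σ< k f) (trans (cong suc (Nat.+-comm a (K · p))) (sym (Nat.+-suc (K · p) a))) ⟩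
  Σ< (K · p ∔ suc a) f                                 ≡⟨ Σ-split (K · p) (suc a) f ⟩
  Σ< (K · p) f + Σ< (suc a) (λ v → f (K · p ∔ v))      ≡⟨ cong₂ _+_ (trans (Σ-block K p f) (Σ-cong K (λ j jl → trans (row p j Nat.≤-refl p>0) (padeq j (Nat.<⇒≤ jl)))))
                                 (trans (Σ-ext (suc a) (λ v → cong f (Nat.+-comm (K · p) v))) (trans (row (suc a) K al (s≤s z≤n)) (padeq K Nat.≤-refl))) ⟩
  conv X (λ j → g (a ∔ j · p)) K                       ∎
  where
  open ≡-Reasoning
  n = a ∔ K · p
  f : ℕ → ℚ
  f i = sp X i * pad g n i
  row : ∀ m j → m ≤ p → 0 < m → Σ< m (λ v → f (v ∔ j · p)) ≡ X j * pad g n (j · p)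
  row m j le m>0 = trans (Σ-single m 0 _ m>0 (λ v vl ne → zr v vl ne)) (cong (_* pad g n (j · p)) (sp-at X 0 j p>0))
   where
   zr : ∀ v → v < m → v ≢ 0 → f (v ∔ j · p) ≡ 0#
   zr zero vl ne = ⊥-elim (ne refl)
   zr (suc v) vl ne = trans (cong (_* pad g n (suc v ∔ j · p)) (sp-at X (suc v) j (Nat.≤-trans vl le))) (*-0ˡ _)
  padeq : ∀ j → j ≤ K → X j * pad g n (j · p) ≡ X j * pad (λ j → g (a ∔ j · p)) K j
  padeq j le = cong (X j *_) (trans (cong (λ k → pad g k (j · p)) e) (trans (pad-≤ g (j · p) (a ∔ i · p)) (trans (sym (pad-≤ (λ j → g (a ∔ j · p)) j i)) (cong (λ k → pad (λ j → g (a ∔ j · p)) k j) ji))))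
   where
   i = K ∸ j
   ji : j ∔ i ≡ K
   ji = Nat.m+[n∸m]≡n le
   e : n ≡ j · p ∔ (a ∔ i · p)
   e = trans (cong (λ k → a ∔ k · p) (sym ji)) (S.solve 4 (λ a j i p → a S.:+ (j S.:+ i) S.:* p S.:= j S.:* p S.:+ (a S.:+ i S.:* p)) refl a j i p)
    where
    module S = +-*-Solver

 conv-0 : ∀ X K → conv X (λ _ → 0#) K ≡ 0#
 conv-0 X K = Σ-0 (suc K) (λ j _ → trans (cong (X j *_) (pad0 K j)) (*-0ʳ (X j)))
  where
  pad0 : ∀ K j → pad (λ _ → 0#) K j ≡ 0#
  pad0 K zero = refl
  pad0 zero (suc j) = refl
  pad0 (suc K) (suc j) = pad0 K j

 sp-conv : ∀ X Y n → conv (sp X) (sp Y) n ≡ sp (conv X Y) n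
 sp-conv X Y = digits-ind _ go
  where
  go : ∀ v j → v < p → conv (sp X) (sp Y) (v ∔ j · p) ≡ sp (conv X Y) (v ∔ j · p)
  go v j l = trans (conv-sp X (sp Y) v j l) (trans (conv-ext (λ _ → refl) (λ i → sp-at Y v i l) j) (trans (cs v) (sym (sp-at (conv X Y) v j l))))
   where
   cs : ∀ v → conv X (λ i → spv Y v i) j ≡ spv (conv X Y) v j
   cs zero = refl
   cs (suc v) = conv-0 X j

 M-pad : ∀ {lev k} {L : ℕ → ℕ → ℚ} n j → (∀ i → i ≤ n → M lev k (L i)) → M lev k (λ t → pad (λ i → L i t) n j)
 M-pad n zero h = h n Nat.≤-refl
 M-pad zero (suc j) h = M-0
 M-pad (suc n) (suc j) h = M-pad n j (λ i l → h i (Nat.m≤n⇒m≤1+n l))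

 M-conv : ∀ {lev i k} {B L : ℕ → ℕ → ℚ} n → (∀ j → j ≤ n → M lev i (B j)) → (∀ j → j ≤ n → M lev k (L j)) → M lev (i ∔ k) (λ t → conv (λ j → B j t) (λ j → L j t) n)
 M-conv n hB hL = M-Σ (suc n) (λ j l → M-* (hB j (Nat.≤-pred l)) (M-pad n j hL))

 -- With constant term 1 the coefficients of the quotient are solved for one after another, and
 -- nothing is ever divided.
 M-divide-series : ∀ {lev k} {B L : ℕ → ℕ → ℚ} → (∀ t → Ω t → B 0 t ≡ 1#) → (∀ n → M lev 0 (B n)) →
  (∀ n → M lev k (λ t → conv (λ i → B i t) (λ i → L i t) n)) → ∀ n i → i ≤ n → M lev k (L i)
 M-divide-series {B = B} {L} b0 hB hc zero zero z≤n = M-resp (λ t o → trans (+-idˡ _) (trans (cong (_* L 0 t) (b0 t o)) (*-idˡ _))) (hc 0)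
 M-divide-series {lev} {k} {B} {L} b0 hB hc (suc n) i le with i Nat.≟ suc n
 ... | no ne = M-divide-series b0 hB hc n i (Nat.≤-pred (Nat.≤∧≢⇒< le ne))
 ... | yes refl = M-resp (λ t o → trans (cong (_- rest t) (trans (conv-suc (λ i → B i t) (λ i → L i t) n) (cong (λ z → z * L (suc n) t + rest t) (b0 t o))))
    (solve 2 (λ l r → (:1 :* l :+ r) :- r := l) refl (L (suc n) t) (rest t)))
   (M-- (hc (suc n)) (M-conv n (λ j _ → hB (suc j)) (M-divide-series b0 hB hc n)))
  where
  rest : ℕ → ℚ
  rest t = conv (λ i → B (suc i) t) (λ i → L i t) n

 M-sp : ∀ {lev k} {X : ℕ → ℕ → ℚ} → (∀ n → M lev k (X n)) → ∀ n → M lev k (λ t → sp (λ i → X i t) n)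
 M-sp {X = X} h n = go (n % p)
  where
  go : ∀ v → M _ _ (λ t → spv (λ i → X i t) v (n / p))
  go zero = h (n / p)
  go (suc v) = M-0

 -- Multiply the difference by A₀(z) A₁(z^p): each W then meets its own A and becomes X. Splitting
 -- the index as a + K p turns the result into the convolutions in K that are assumed divisible.
 logDifference : ∀ {lev k} (A₀ A₁ X₀ X₁ W₀ W₁ : ℕ → ℕ → ℚ) →
  (∀ t → Ω t → A₀ 0 t ≡ 1#) → (∀ t → Ω t → A₁ 0 t ≡ 1#) → (∀ n → M lev 0 (A₀ n)) → (∀ n → M lev 0 (A₁ n)) →
  (∀ n t → Ω t → conv (λ i → A₀ i t) (λ i → W₀ i t) n ≡ X₀ n t) → (∀ n t → Ω t → conv (λ i → A₁ i t) (λ i → W₁ i t) n ≡ X₁ n t) →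
  (∀ a K → a < p → M lev k (λ t → conv (λ j → A₁ j t) (λ j → π * X₀ (a ∔ j · p) t) K - conv (λ j → X₁ j t) (λ j → A₀ (a ∔ j · p) t) K)) →
  ∀ n → M lev k (λ t → sp (λ i → W₁ i t) n - π * W₀ n t)
 logDifference {lev} {k} A₀ A₁ X₀ X₁ W₀ W₁ a0 a1 hA₀ hA₁ e₀ e₁ hY n = M-divide-series {B = B} {L} b0 hB hc n n Nat.≤-refl
  where
  a₁ B L : ℕ → ℕ → ℚ
  a₁ n t = sp (λ i → A₁ i t) n
  B n t = conv (λ i → a₁ i t) (λ i → A₀ i t) n
  L n t = sp (λ i → W₁ i t) n - π * W₀ n t
  b0 : ∀ t → Ω t → B 0 t ≡ 1#
  b0 t o = trans (+-idˡ _) (trans (cong₂ _*_ (trans (sp-at (λ i → A₁ i t) 0 0 p>0) (a1 t o)) (a0 t o)) (*-idˡ 1#))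
  hB : ∀ n → M lev 0 (B n)
  hB n = M-conv n (λ j _ → M-sp hA₁ j) (λ j _ → hA₀ j)
  eq : ∀ n t → Ω t → conv (λ i → B i t) (λ i → L i t) n ≡ conv (sp (λ i → X₁ i t)) (λ i → A₀ i t) n - conv (λ i → a₁ i t) (λ i → π * X₀ i t) n
  eq n t o = begin
   conv (conv a A) (λ i → w i - π * W₀ i t) n
    ≡⟨ trans (conv-ext (λ _ → refl) (λ i → solve 3 (λ w p v → w :- p :* v := w :+ :- p :* v) refl (w i) π (W₀ i t)) n) (conv-+ʳ (conv a A) w (λ i → - π * W₀ i t) n) ⟩
   conv (conv a A) w n + conv (conv a A) (λ i → - π * W₀ i t) n
    ≡⟨ cong₂ _+_ (trans (conv-ext (conv-comm a A) (λ _ → refl) n) (trans (conv-assoc A a w n) (conv-ext (λ _ → refl) (λ i → trans (sp-conv (λ j → A₁ j t) (λ j → W₁ j t) i) (spv-ext (λ j → e₁ j t o) (i % p) (i / p))) n)))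
       (trans (conv-*ʳ (- π) (conv a A) (λ i → W₀ i t) n) (cong (- π *_) (trans (conv-assoc a A (λ i → W₀ i t) n) (conv-ext (λ _ → refl) (λ i → e₀ i t o) n)))) ⟩
   conv A (sp (λ i → X₁ i t)) n + - π * conv a (λ i → X₀ i t) n
    ≡⟨ cong₂ _+_ (conv-comm A _ n) (trans (neg-*ˡ π _) (cong -_ (sym (conv-*ʳ π a (λ i → X₀ i t) n)))) ⟩
   conv (sp (λ i → X₁ i t)) A n - conv a (λ i → π * X₀ i t) n ∎
   where
   open ≡-Reasoning
   a A w : ℕ → ℚ
   a i = a₁ i t
   A i = A₀ i t
   w = sp (λ i → W₁ i t)
  hc : ∀ n → M lev k (λ t → conv (λ i → B i t) (λ i → L i t) n)
  hc = digits-ind _ (λ v j l → M-resp (λ t o → sym (trans (eq (v ∔ j · p) t o) (trans (cong₂ _-_ (conv-sp (λ i → X₁ i t) (λ i → A₀ i t) v j l) (conv-sp (λ i → A₁ i t) (λ i → π * X₀ i t) v j l)) (solve 2 (λ x y → x :- y := :- (y :- x)) refl _ _)))) (M-neg (hY v j l)))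

-- Counts and denominators of a list of parameters.

module Counts (p : ℕ) where
 open import Data.Nat.Base using (_+_; _*_)

 open Q using (ι; ιz; inv; 1#; 0#)
 open import Data.Nat.Divisibility
 open import Data.List.Base using (length; filter)
 open import Relation.Nullary using (¬?)

 scaleDec : ∀ x → Dec (p ∣ ↧ₙ x) → ℚ
 scaleDec x (yes _) = ι (↧ₙ x)
 scaleDec x (no _) = 1#

 -- Clearing the denominators divisible by p multiplies the n-th Pochhammer product of the list by
 -- the n-th power of this number; the constant C is renormalised accordingly.
 prodScale : List ℚ → ℚ
 prodScale [] = 1#
 prodScale (x ∷ l) = scaleDec x (p ∣? ↧ₙ x) Q.* prodScale l

 prodScale≢0 : ∀ l → prodScale l ≢ 0#
 prodScale≢0 [] = Q.1≢0
 prodScale≢0 (x ∷ l) = Q.*-≢0 (go x (p ∣? ↧ₙ x)) (prodScale≢0 l)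
  where
  go : ∀ x d → scaleDec x d ≢ 0#
  go x (yes _) = Q.ι≢0 λ ()
  go x (no _) = Q.1≢0

 integralCount : List ℚ → ℕ
 integralCount l = length (filter (λ q → ¬? (p ∣? ↧ₙ q)) l)

 bit : Bool → ℕ
 bit true = 1
 bit false = 0

 integralCount-∷ : ∀ x l → integralCount (x ∷ l) ≡ bit (not (does (p ∣? ↧ₙ x))) + integralCount l
 integralCount-∷ x l with does (p ∣? ↧ₙ x)
 ... | true = refl
 ... | false = refl

-- Fractional parts, the order ⪯ and hypothesis H in natural numbers.

module Fractional (p : ℕ) (pp : Prime p) (ν D b : ℕ) (D≥1 : 1 ℕ.≤ D) (b≥1 : 1 ℕ.≤ b) (D-p : Cop.Coprime D p) (b-D : Cop.Coprime b D) where
 open import Data.Nat.Base using (_+_; _*_; _∸_; _^_; _≤_; _<_)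
 open import Defs using (frac; _⪯_; _⪯?_; _≺_)

 open Reduced p pp ν D b D≥1 b≥1 D-p b-D
 open Averaging p pp ν D b D≥1 b≥1 D-p b-D
 open Digit p pp Ω using (p^>0; b2n)
 open Counting p pp Ω
 open Valuations p pp ν D b D≥1 b≥1 D-p b-D using (sumL-∈)
 open Q using (ι; ιz; inv; 0#; 1#)
 import Defs
 open import Data.Nat.Properties
 open import Data.Nat.Divisibility
 import Data.Integer.DivMod as ℤD
 open import Data.Rational.Base using (floor; ceiling)
 open import Data.Vec.Base using (Vec; toList)
 open import Data.List.Base using (_++_; filter; length)
 open import Data.List.Membership.Propositional.Properties using (∈-++⁻; ∈-++⁺ˡ; ∈-++⁺ʳ; ∈-map⁺)
 open import Data.List.Relation.Unary.All using (All; []; _∷_)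
 open +-*-Solver

 infixl 9 _/ᵘ_
 _/ᵘ_ : ℕ → ℕ → ℚ
 k /ᵘ N = ι k Q.* inv (ι N)

 ι-pos≢0 : ∀ {n} → 1 ≤ n → ι n ≢ 0#
 ι-pos≢0 (s≤s _) = Q.ι≢0 λ ()

 /ᵘ-cancel : ∀ k {N} → 1 ≤ N → k /ᵘ N Q.* ι N ≡ ι k
 /ᵘ-cancel k {N} h = trans (Q.*-assoc (ι k) (inv (ι N)) (ι N)) (trans (cong (ι k Q.*_) (Q.inv-l {ι N} (ι-pos≢0 h))) (Q.*-idʳ (ι k)))

 /ᵘ-+ : ∀ k m {N} → 1 ≤ N → (k + m * N) /ᵘ N ≡ k /ᵘ N Q.+ ι m
 /ᵘ-+ k m {N} h = trans (cong (Q._* inv (ι N)) (trans (Q.ι-+ k (m * N)) (cong (ι k Q.+_) (Q.ι-* m N)))) (trans (Q.solve 4 (λ k m n i → (k Q.:+ m Q.:* n) Q.:* i Q.:= k Q.:* i Q.:+ m Q.:* (n Q.:* i)) refl (ι k) (ι m) (ι N) (inv (ι N)))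
  (cong (k /ᵘ N Q.+_) (trans (cong (ι m Q.*_) (Q.inv-r {ι N} (ι-pos≢0 h))) (Q.*-idʳ (ι m)))))

 ↧≥1 : ∀ z → 1 ≤ ↧ₙ z
 ↧≥1 (mkℚ n d c) = s≤s z≤n

 floor-spec : ∀ y → Σ ℕ λ rm → rm < ↧ₙ y × ↥ y ≡ ℤ.+ rm ℤ.+ floor y ℤ.* ℤ.+ ↧ₙ y
 floor-spec (mkℚ n d c) = n ℤD.% (ℤ.+ suc d) , ℤD.n%d<d n (ℤ.+ suc d) , ℤD.a≡a%n+[a/n]*n n (ℤ.+ suc d)

 ceiling-floor : ∀ z → ceiling z ≡ ℤ.- floor (ℚ.- z)
 ceiling-floor (mkℚ n d c) = refl

 ceiling-spec : ∀ z → Σ ℕ λ rm → rm < ↧ₙ z × ιz (ceiling z) Q.* ι (↧ₙ z) ≡ z Q.* ι (↧ₙ z) Q.+ ι rm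
 ceiling-spec z = rm , subst (rm <_) dn (proj₁ (proj₂ fs)) , (begin
   ιz (ceiling z) Q.* ι N                      ≡⟨ cong (Q._* ι N) (trans (cong ιz (ceiling-floor z)) (Q.ιz-neg fl)) ⟩
   (Q.- ιz fl) Q.* ι N                         ≡⟨ Q.solve 3 (λ f n r → (Q.:- f) Q.:* n Q.:= (Q.:- (r Q.:+ f Q.:* n)) Q.:+ r) refl (ιz fl) (ι N) (ι rm) ⟩
   (Q.- (ι rm Q.+ ιz fl Q.* ι N)) Q.+ ι rm     ≡⟨ cong (λ e → (Q.- e) Q.+ ι rm) (sym eqn) ⟩
   (Q.- (Q.- ιz (↥ z))) Q.+ ι rm               ≡⟨ cong (Q._+ ι rm) (Q.solve 1 (λ x → Q.:- (Q.:- x) Q.:= x) refl (ιz (↥ z))) ⟩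
   ιz (↥ z) Q.+ ι rm                           ≡⟨ cong (Q._+ ι rm) (sym (Q.↧-clear z)) ⟩
   z Q.* ι N Q.+ ι rm                          ∎)
  where
  open ≡-Reasoning
  N = ↧ₙ z
  fs = floor-spec (ℚ.- z)
  rm = proj₁ fs
  fl = floor (ℚ.- z)
  dn : ↧ₙ (ℚ.- z) ≡ N
  dn = cong ℤ.∣_∣ (ℚₚ.↧-neg z)
  eqn : Q.- ιz (↥ z) ≡ ι rm Q.+ ιz fl Q.* ι N
  eqn = trans (sym (Q.ιz-neg (↥ z))) (trans (cong ιz (trans (sym (ℚₚ.↥-neg z)) (trans (proj₂ (proj₂ fs)) (cong (λ e → ℤ.+ rm ℤ.+ fl ℤ.* ℤ.+ e) dn))))
   (trans (Q.ιz-+ (ℤ.+ rm) (fl ℤ.* ℤ.+ N)) (cong (ι rm Q.+_) (Q.ιz-* fl (ℤ.+ N)))))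

 opaque
  unfolding Q._+_
  frac≡ : ∀ z → frac z ≡ z Q.- ιz (ceiling z) Q.+ 1#
  frac≡ z = refl

  *-monoʳ-ι : ∀ n {x y} → x ℚ.≤ y → x Q.* ι n ℚ.≤ y Q.* ι n
  *-monoʳ-ι n h = ℚₚ.*-monoʳ-≤-nonNeg (ι n) {{ℚ.nonNegative (Q.ι-mono-≤ {0} {n} z≤n)}} h

  *-cancelʳ-ι : ∀ {n x y} → 1 ≤ n → x Q.* ι n ℚ.≤ y Q.* ι n → x ℚ.≤ y
  *-cancelʳ-ι {n} h = ℚₚ.*-cancelʳ-≤-pos (ι n) {{ℚ.positive (Q.ι-mono-< {0} {n} h)}}

  +-mono-≤ℚ : ∀ {x y u v} → x ℚ.≤ y → u ℚ.≤ v → x Q.+ u ℚ.≤ y Q.+ v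
  +-mono-≤ℚ = ℚₚ.+-mono-≤

  neg-anti : ∀ {x y} → x ℚ.≤ y → Q.- y ℚ.≤ Q.- x
  neg-anti = ℚₚ.neg-antimono-≤

 ℤ-split : ∀ v → Σ ℕ λ i → Σ ℕ λ j → ιz v Q.+ ι i ≡ ι j
 ℤ-split (ℤ.+ n) = 0 , n , Q.+-idʳ _
 ℤ-split ℤ.-[1+ n ] = suc n , 0 , trans (cong (Q._+ ι (suc n)) (Q.ιz-neg (ℤ.+ suc n))) (Q.solve 1 (λ x → (Q.:- x) Q.:+ x Q.:= Q.:0) refl (ι (suc n)))

 frac-form : ∀ z → Σ ℕ λ k → 1 ≤ k × k ≤ ↧ₙ z × frac z ≡ k /ᵘ ↧ₙ z
 frac-form z = N ∸ rm , m<n⇒0<n∸m rm<N , m∸n≤m N rm , Q.*-cancel (ι N) (ι-pos≢0 (↧≥1 z)) (begin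
   ι N Q.* frac z                                  ≡⟨ cong (ι N Q.*_) (frac≡ z) ⟩
   ι N Q.* (z Q.- ιz (ceiling z) Q.+ 1#)           ≡⟨ Q.solve 4 (λ n z c o → n Q.:* ((z Q.:- c) Q.:+ Q.:1) Q.:= (z Q.:* n Q.:- c Q.:* n) Q.:+ n) refl (ι N) z (ιz (ceiling z)) 1# ⟩
   (z Q.* ι N Q.- ιz (ceiling z) Q.* ι N) Q.+ ι N  ≡⟨ cong₂ (λ x y → (z Q.* ι N Q.- x) Q.+ y) eq (trans (cong ι (sym (m∸n+n≡m (<⇒≤ rm<N)))) (Q.ι-+ (N ∸ rm) rm)) ⟩
   (z Q.* ι N Q.- (z Q.* ι N Q.+ ι rm)) Q.+ (ι (N ∸ rm) Q.+ ι rm) ≡⟨ Q.solve 3 (λ a r k → (a Q.:- (a Q.:+ r)) Q.:+ (k Q.:+ r) Q.:= k) refl (z Q.* ι N) (ι rm) (ι (N ∸ rm)) ⟩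
   ι (N ∸ rm)                                      ≡⟨ trans (sym (/ᵘ-cancel (N ∸ rm) (↧≥1 z))) (Q.*-comm _ (ι N)) ⟩
   ι N Q.* (N ∸ rm) /ᵘ N                           ∎)
  where
  open ≡-Reasoning
  N = ↧ₙ z
  rm = proj₁ (ceiling-spec z)
  rm<N = proj₁ (proj₂ (ceiling-spec z))
  eq = proj₂ (proj₂ (ceiling-spec z))

 frac-shift : ∀ z → Σ ℕ λ i → Σ ℕ λ j → z Q.+ ι i ≡ frac z Q.+ ι j
 frac-shift z = 1 + i , j , trans (cong (z Q.+_) (Q.ι-+ 1 i)) (trans (Q.solve 4 (λ z c i o → z Q.:+ (Q.:1 Q.:+ i) Q.:= ((z Q.:- c) Q.:+ Q.:1) Q.:+ (c Q.:+ i)) refl z (ιz (ceiling z)) (ι i) 1#)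
   (cong₂ Q._+_ (sym (frac≡ z)) (proj₂ (proj₂ (ℤ-split (ceiling z))))))
  where
  i = proj₁ (ℤ-split (ceiling z))
  j = proj₁ (proj₂ (ℤ-split (ceiling z)))

 shift-≤ : ∀ {k N k' N'} s s' → 1 ≤ k → k' ≤ N' → 1 ≤ N' → k' * N + s * (N * N') ≡ k * N' + s' * (N * N') → s' ≤ s
 shift-≤ {k} {N} {k'} {N'} s s' k≥1 k'≤ N'≥1 e = ≮⇒≥ λ lt → <⇒≱ (begin-strict
   k' * N + s * (N * N')              ≤⟨ +-monoˡ-≤ _ (≤-trans (*-monoˡ-≤ N k'≤) (≤-reflexive (*-comm N' N))) ⟩
   suc s * (N * N')                   ≤⟨ *-monoˡ-≤ (N * N') lt ⟩
   s' * (N * N')                      <⟨ +-monoˡ-≤ _ (*-mono-≤ k≥1 N'≥1) ⟩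
   k * N' + s' * (N * N')             ∎) (≤-reflexive (sym e))
  where open ≤-Reasoning

 -- After cross-multiplication the integer parts must agree by size, both fractions lying in (0,1].
 -- Natural shifts on both sides of the equation avoid subtraction.
 frac-unique : ∀ z {k N} i j → 1 ≤ k → k ≤ N → z Q.+ ι i ≡ k /ᵘ N Q.+ ι j → frac z ≡ k /ᵘ N
 frac-unique z {k} {N} i j k≥1 k≤N e = trans fe (Q.*-cancel (ι (N * N')) (ι-pos≢0 (*-mono-≤ N≥1 N'≥1)) (trans (clear′ k' N'≥1) (trans (cong ι main) (sym (clear k N≥1)))))
  where
  k' = proj₁ (frac-form z)
  N' = ↧ₙ z
  N≥1 = ≤-trans k≥1 k≤N
  N'≥1 = ↧≥1 z
  k'≥1 = proj₁ (proj₂ (frac-form z))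
  k'≤ = proj₁ (proj₂ (proj₂ (frac-form z)))
  fe = proj₂ (proj₂ (proj₂ (frac-form z)))
  i' = proj₁ (frac-shift z)
  j' = proj₁ (proj₂ (frac-shift z))
  e' = proj₂ (proj₂ (frac-shift z))
  clear : ∀ k → 1 ≤ N → ι (N * N') Q.* k /ᵘ N ≡ ι (k * N')
  clear k h = trans (cong (Q._* k /ᵘ N) (Q.ι-* N N')) (trans (Q.solve 3 (λ n m x → (n Q.:* m) Q.:* x Q.:= (x Q.:* n) Q.:* m) refl (ι N) (ι N') (k /ᵘ N)) (trans (cong (Q._* ι N') (/ᵘ-cancel k h)) (sym (Q.ι-* k N'))))
  clear′ : ∀ k → 1 ≤ N' → ι (N * N') Q.* k /ᵘ N' ≡ ι (k * N)
  clear′ k h = trans (cong (Q._* k /ᵘ N') (Q.ι-* N N')) (trans (Q.solve 3 (λ n m x → (n Q.:* m) Q.:* x Q.:= (x Q.:* m) Q.:* n) refl (ι N) (ι N') (k /ᵘ N')) (trans (cong (Q._* ι N) (/ᵘ-cancel k h)) (sym (Q.ι-* k N))))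
  cross : k' /ᵘ N' Q.+ ι (j' + i) ≡ k /ᵘ N Q.+ ι (j + i')
  cross = begin
   k' /ᵘ N' Q.+ ι (j' + i)          ≡⟨ cong₂ Q._+_ (sym fe) (Q.ι-+ j' i) ⟩
   frac z Q.+ (ι j' Q.+ ι i)        ≡⟨ Q.+-assoc (frac z) (ι j') (ι i) ⟨
   (frac z Q.+ ι j') Q.+ ι i        ≡⟨ cong (Q._+ ι i) (sym e') ⟩
   (z Q.+ ι i') Q.+ ι i             ≡⟨ Q.solve 3 (λ z a b → (z Q.:+ a) Q.:+ b Q.:= (z Q.:+ b) Q.:+ a) refl z (ι i') (ι i) ⟩
   (z Q.+ ι i) Q.+ ι i'             ≡⟨ cong (Q._+ ι i') e ⟩
   (k /ᵘ N Q.+ ι j) Q.+ ι i'        ≡⟨ trans (Q.+-assoc (k /ᵘ N) (ι j) (ι i')) (cong (k /ᵘ N Q.+_) (sym (Q.ι-+ j i'))) ⟩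
   k /ᵘ N Q.+ ι (j + i')            ∎
   where open ≡-Reasoning
  nat : k' * N + (j' + i) * (N * N') ≡ k * N' + (j + i') * (N * N')
  nat = Q.ι-injective (trans (expand k' N (j' + i) (clear′ k' N'≥1)) (trans (cong (ι (N * N') Q.*_) cross) (sym (expand k N' (j + i') (clear k N≥1)))))
   where
   expand : ∀ k M s {y} → ι (N * N') Q.* y ≡ ι (k * M) → ι (k * M + s * (N * N')) ≡ ι (N * N') Q.* (y Q.+ ι s)
   expand k M s {y} h = trans (Q.ι-+ (k * M) _) (trans (cong₂ Q._+_ (sym h) (trans (Q.ι-* s (N * N')) (Q.*-comm (ι s) _))) (sym (Q.*-distribˡ (ι (N * N')) y (ι s))))
  same : j + i' ≡ j' + i
  same = ≤-antisym (shift-≤ {k} {N} {k'} {N'} (j' + i) (j + i') k≥1 k'≤ N'≥1 nat)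
   (shift-≤ {k'} {N'} {k} {N} (j + i') (j' + i) k'≥1 k≤N N≥1 (subst (λ z → k * N' + (j + i') * z ≡ k' * N + (j' + i) * z) (*-comm N N') (sym nat)))
  main : k' * N ≡ k * N'
  main = +-cancelʳ-≡ ((j' + i) * (N * N')) _ _ (trans nat (cong (λ s → k * N' + s * (N * N')) same))

 -- An integer is added to make the numerator positive; the denominator and the class modulo 1,
 -- hence all ⟨s x⟩ for natural s, are unchanged.
 lift : ∀ x → Σ ℕ λ a → Σ ℕ λ i → 1 ≤ a × Cop.Coprime a (↧ₙ x) × x Q.+ ι i ≡ a /ᵘ ↧ₙ x
 lift x@(mkℚ (ℤ.+ n) d c) = n + suc d , 1 , ≤-trans (s≤s z≤n) (m≤n+m (suc d) n) ,
   (λ {e} (ea , eN) → Cop.recompute c (∣m+n∣m⇒∣n (subst (e ∣_) (+-comm n (suc d)) ea) eN , eN)) ,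
   sym (trans (cong (_/ᵘ suc d) (cong (n +_) (sym (*-identityˡ (suc d))))) (trans (/ᵘ-+ n 1 (s≤s z≤n)) (cong (Q._+ 1#) (Q.*-cancel (ι (suc d)) (ι-pos≢0 (s≤s z≤n)) (trans (Q.*-comm (ι (suc d)) (n /ᵘ suc d)) (trans (/ᵘ-cancel n (s≤s z≤n)) (trans (sym (Q.↧-clear x)) (Q.*-comm x _))))))))
 lift x@(mkℚ ℤ.-[1+ n ] d c) = d * suc n + suc d , suc n + 1 , ≤-trans (s≤s z≤n) (m≤n+m (suc d) (d * suc n)) ,
   (λ {e} (ea , eN) → Cop.recompute c (∣m+n∣m⇒∣n (subst (e ∣_) (+-comm (suc n) (d * suc n)) (∣m⇒∣m*n (suc n) eN)) (∣m+n∣m⇒∣n (subst (e ∣_) (+-comm (d * suc n) (suc d)) ea) eN) , eN)) ,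
   Q.*-cancel (ι N) (ι-pos≢0 (s≤s z≤n)) (begin
    ι N Q.* (x Q.+ ι (suc n + 1))                      ≡⟨ trans (Q.*-distribˡ (ι N) x _) (cong₂ Q._+_ (trans (Q.*-comm (ι N) x) (trans (Q.↧-clear x) (Q.ιz-neg (ℤ.+ suc n)))) (sym (Q.ι-* N (suc n + 1)))) ⟩
    (Q.- ι (suc n)) Q.+ ι (N * (suc n + 1))            ≡⟨ cong ((Q.- ι (suc n)) Q.+_) (trans (cong ι (solve 2 (λ d n → (con 1 :+ d) :* (n :+ con 1) := n :+ (d :* n :+ (con 1 :+ d))) refl d (suc n))) (Q.ι-+ (suc n) _)) ⟩
    (Q.- ι (suc n)) Q.+ (ι (suc n) Q.+ ι (d * suc n + suc d)) ≡⟨ Q.solve 2 (λ a b → (Q.:- a) Q.:+ (a Q.:+ b) Q.:= b) refl (ι (suc n)) (ι (d * suc n + suc d)) ⟩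
    ι (d * suc n + suc d)                              ≡⟨ trans (sym (/ᵘ-cancel (d * suc n + suc d) (s≤s z≤n))) (Q.*-comm _ (ι N)) ⟩
    ι N Q.* (d * suc n + suc d) /ᵘ N                   ∎)
  where
  open ≡-Reasoning
  N = suc d

 num drop : ℚ → ℕ
 num x = proj₁ (lift x)
 drop x = proj₁ (proj₂ (lift x))

 mkRaw : (x : ℚ) → ↧ₙ x ∣ p ^ ν * D → Raw
 mkRaw x h = record { N = ↧ₙ x ; a = num x ; N≥1 = ↧≥1 x ; a≥1 = proj₁ (proj₂ (proj₂ (lift x))) ; N∣d = h ; cop = proj₁ (proj₂ (proj₂ (proj₂ (lift x)))) }

 resR : Raw → ℕ → ℕ
 resR g s = res (Raw.N g) {{ℕ.>-nonZero (Raw.N≥1 g)}} (s * Raw.a g)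

 scaled-lift : ∀ x s → ι s Q.* x Q.+ ι (s * drop x) ≡ (s * num x) /ᵘ ↧ₙ x
 scaled-lift x s = trans (cong (ι s Q.* x Q.+_) (Q.ι-* s (drop x))) (trans (sym (Q.*-distribˡ (ι s) x _)) (trans (cong (ι s Q.*_) (proj₂ (proj₂ (proj₂ (proj₂ (lift x)))))) (trans (sym (Q.*-assoc (ι s) _ _)) (cong (Q._* inv (ι (↧ₙ x))) (sym (Q.ι-* s (num x)))))))

 opaque
  unfolding Q._+_
  fromℕ* : ∀ s x → Defs.fromℕ s ℚ.* x ≡ ι s Q.* x
  fromℕ* s x = refl

 frac-scale : ∀ x h s → 1 ≤ s → frac (Defs.fromℕ s ℚ.* x) ≡ resR (mkRaw x h) s /ᵘ ↧ₙ x
 frac-scale x h s s≥1 = trans (cong frac (fromℕ* s x)) (frac-unique (ι s Q.* x) (s * drop x) (proj₁ rq) (Res.res≥1 N {{nzN}} (s * num x)) (Res.res≤N N {{nzN}} (s * num x))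
   (trans (scaled-lift x s) (trans (cong (_/ᵘ N) (proj₂ rq)) (/ᵘ-+ (resR (mkRaw x h) s) (proj₁ rq) (↧≥1 x)))))
  where
  N = ↧ₙ x
  nzN : NonZero N
  nzN = ℕ.>-nonZero (↧≥1 x)
  rq = Res.res-quot N {{nzN}} (s * num x) (*-mono-≤ s≥1 (proj₁ (proj₂ (proj₂ (lift x)))))

 Div : ℚ → Set
 Div x = ↧ₙ x ∣ p ^ ν * D

 raws : ∀ l → All Div l → List Raw
 raws [] [] = []
 raws (x ∷ l) (h ∷ hs) = mkRaw x h ∷ raws l hs

 /ᵘ-clear : ∀ k {N} q → 1 ≤ N → k /ᵘ N Q.* ι (N * q) ≡ ι (k * q)
 /ᵘ-clear k {N} q h = trans (cong (k /ᵘ N Q.*_) (Q.ι-* N q)) (trans (sym (Q.*-assoc (k /ᵘ N) (ι N) (ι q))) (trans (cong (Q._* ι q) (/ᵘ-cancel k h)) (sym (Q.ι-* k q))))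

 /ᵘ-≤⇒ : ∀ {k N m q} → 1 ≤ N → 1 ≤ q → k /ᵘ N ℚ.≤ m /ᵘ q → k * q ≤ m * N
 /ᵘ-≤⇒ {k} {N} {m} {q} hN hq h = Q.ι-cancel-≤ (subst₂ ℚ._≤_ (/ᵘ-clear k q hN) (trans (cong (λ z → m /ᵘ q Q.* ι z) (*-comm N q)) (/ᵘ-clear m N hq)) (*-monoʳ-ι (N * q) h))

 /ᵘ-≤ : ∀ {k N m q} → 1 ≤ N → 1 ≤ q → k * q ≤ m * N → k /ᵘ N ℚ.≤ m /ᵘ q
 /ᵘ-≤ {k} {N} {m} {q} hN hq h = *-cancelʳ-ι {N * q} (*-mono-≤ hN hq) (subst₂ ℚ._≤_ (sym (/ᵘ-clear k q hN)) (sym (trans (cong (λ z → m /ᵘ q Q.* ι z) (*-comm N q)) (/ᵘ-clear m N hq))) (Q.ι-mono-≤ h))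

 below : ∀ {θ e u} B i → θ ℚ.≤ 1# → 0# ℚ.≤ u → e Q.+ ι i ≡ u → 1 + i ≤ B → θ Q.- ι B ℚ.≤ e
 below {θ} {e} {u} B i hθ hu eq hB = ℚₚ.≤-trans (+-mono-≤ℚ hθ (neg-anti (Q.ι-mono-≤ hB))) (subst₂ ℚ._≤_ lhs rhs (+-mono-≤ℚ hu (ℚₚ.≤-refl {Q.- ι i})))
  where
  lhs : 0# Q.+ (Q.- ι i) ≡ 1# Q.+ (Q.- ι (1 + i))
  lhs = trans (Q.solve 1 (λ i → Q.:0 Q.:+ (Q.:- i) Q.:= Q.:1 Q.:+ (Q.:- (Q.:1 Q.:+ i))) refl (ι i)) (cong (λ z → 1# Q.+ (Q.- z)) (sym (Q.ι-+ 1 i)))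
  rhs : u Q.+ (Q.- ι i) ≡ e
  rhs = trans (cong (Q._+ (Q.- ι i)) (sym eq)) (Q.solve 2 (λ e i → (e Q.:+ i) Q.:+ (Q.:- i) Q.:= e) refl e (ι i))

 /ᵘ≥0 : ∀ k N → 1 ≤ N → 0# ℚ.≤ k /ᵘ N
 /ᵘ≥0 k N h = subst (ℚ._≤ k /ᵘ N) (Q.*-0ˡ (inv (ι 1))) (/ᵘ-≤ {0} {1} {k} {N} ≤-refl h z≤n)

 /ᵘ≤1 : ∀ {k N} → 1 ≤ N → k ≤ N → k /ᵘ N ℚ.≤ 1#
 /ᵘ≤1 {k} {N} h le′ = subst (k /ᵘ N ℚ.≤_) (Q.inv-r {1#} Q.1≢0) (/ᵘ-≤ {k} {N} {1} {1} h ≤-refl (subst₂ _≤_ (sym (*-identityʳ k)) (sym (*-identityˡ N)) le′))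

 ⪯-trans : ∀ {x y z} → x ⪯ y → y ⪯ z → x ⪯ z
 ⪯-trans (inj₁ a) (inj₁ c) = inj₁ (ℚₚ.<-trans a c)
 ⪯-trans {x} (inj₁ a) (inj₂ (e , _)) = inj₁ (subst (frac x ℚ.<_) e a)
 ⪯-trans {z = z} (inj₂ (e , _)) (inj₁ c) = inj₁ (subst (ℚ._< frac z) (sym e) c)
 ⪯-trans (inj₂ (e , l)) (inj₂ (e' , l')) = inj₂ (trans e e' , ℚₚ.≤-trans l' l)

 ⪯-total : ∀ x y → ¬ (x ⪯ y) → y ⪯ x
 ⪯-total x y n with ℚₚ.<-cmp (frac x) (frac y)
 ... | tri< a _ _ = ⊥-elim (n (inj₁ a))
 ... | tri> _ _ c = inj₁ c
 ... | tri≈ _ e _ with y ℚₚ.≤? x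
 ... | yes l = ⊥-elim (n (inj₂ (e , l)))
 ... | no l = inj₂ (sym e , ℚₚ.<⇒≤ (ℚₚ.≰⇒> l))

 choose-⪯ : ∀ {y m x} (d : Dec (y ⪯ m)) → (m ⪯ x) ⊎ (y ⪯ x) → (if does d then y else m) ⪯ x
 choose-⪯ {y} {m} {x} (yes h) (inj₁ c) = ⪯-trans {y} {m} {x} h c
 choose-⪯ (yes h) (inj₂ c) = c
 choose-⪯ (no h) (inj₁ c) = c
 choose-⪯ {y} {m} {x} (no h) (inj₂ c) = ⪯-trans {m} {y} {x} (⪯-total y m h) c

 minFrom-⪯ : ∀ {r} (α β : Vec ℚ r) m l x e → e ∈ m ∷ l → e ⪯ x → Defs.minFrom α β m l ⪯ x
 minFrom-⪯ α β m [] x e (here refl) h = h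
 minFrom-⪯ α β m (y ∷ l) x e (here refl) h = minFrom-⪯ α β _ l x _ (here refl) (choose-⪯ {y} {m} {x} (y ⪯? m) (inj₁ h))
 minFrom-⪯ α β m (y ∷ l) x e (there (here refl)) h = minFrom-⪯ α β _ l x _ (here refl) (choose-⪯ {y} {m} {x} (y ⪯? m) (inj₂ h))
 minFrom-⪯ α β m (y ∷ l) x e (there (there i)) h = minFrom-⪯ α β _ l x e (there i) h

 mαβ-⪯ : ∀ {r} (α β : Vec ℚ r) a x e → e ∈ Defs.scaleList α β a (Defs.allParams α β) → e ⪯ x → Defs.mαβ α β a ⪯ x
 mαβ-⪯ α β a x e i h with Defs.scaleList α β a (Defs.allParams α β)
 ... | y ∷ l = minFrom-⪯ α β y l x e i h

 length-filter-∷ : ∀ {A : Set} {P : A → Set} (P? : ∀ e → Dec (P e)) y l → length (filter P? (y ∷ l)) ≡ b2n (does (P? y)) + length (filter P? l)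
 length-filter-∷ P? y l with does (P? y)
 ... | true = refl
 ... | false = refl

 dec-le : ∀ {A : Set} (d : Dec A) {a b} → (A → a ≤ b) → (a ≤ b → A) → b2n (does d) ≡ le a b
 dec-le (yes c) f g = sym (le-yes (f c))
 dec-le (no c) f g = sym (le-no (≰⇒> λ l → c (g l)))

 ∈-raws : ∀ l hs {g} → g ∈ raws l hs → Σ ℚ λ x → x ∈ l × Σ (Div x) λ h → g ≡ mkRaw x h
 ∈-raws (x ∷ l) (h ∷ hs) (here refl) = x , here refl , h , refl
 ∈-raws (x ∷ l) (h ∷ hs) (there i) = proj₁ rec , there (proj₁ (proj₂ rec)) , proj₂ (proj₂ rec)
  where rec = ∈-raws l hs i

 module FromH {r} (α β : Vec ℚ r) (dEq : Defs.dαβ α β ≡ p ^ ν * D) (H : Defs.Hαβ α β) (hα : All Div (toList α)) (hβ : All Div (toList β)) where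
  private
   αs = raws (toList α) hα
   βs = raws (toList β) hβ
   d = p ^ ν * D
   d≥1 : 1 ≤ d
   d≥1 = *-mono-≤ (p^>0 ν) D≥1

   module Level (s : ℕ) (cop : Cop.Coprime s d) (m q : ℕ) (m≥1 : 1 ≤ m) (m<q : m < q) where
    instance
     nzd : NonZero d
     nzd = ℕ.>-nonZero d≥1
    a : ℕ
    a = res d s
    a≥1 : 1 ≤ a
    a≥1 = Res.res≥1 d s
    rq : Σ ℕ λ k → s + 1 * d ≡ res d (s + 1 * d) + k * d
    rq = Res.res-quot d (s + 1 * d) (≤-trans d≥1 (≤-trans (≤-reflexive (sym (*-identityˡ d))) (m≤n+m (1 * d) s)))
    s≡a : s + 1 * d ≡ a + proj₁ rq * d
    s≡a = trans (proj₂ rq) (cong (_+ proj₁ rq * d) (Res.res-+ d s 1))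
    a-cop : Cop.Coprime a d
    a-cop {e} (ea , ed) = cop (∣m+n∣m⇒∣n (subst (e ∣_) (trans (sym s≡a) (+-comm s (1 * d))) (∣m∣n⇒∣m+n ea (∣n⇒∣m*n (proj₁ rq) ed))) (∣n⇒∣m*n 1 ed) , ed)
    resR-a : ∀ g → resR g s ≡ resR g a
    resR-a g = Res.res-cong N {{ℕ.>-nonZero N≥1}} (s * ag) (a * ag) (1 * Q' * ag) (k * Q' * ag) (trans (fold s 1) (trans (cong (_* ag) (subst (λ z → s + 1 * z ≡ a + k * z) (_∣_.equality N∣d) s≡a)) (sym (fold a k))))
     where
     open Raw g using (N; N≥1; N∣d)
     ag = Raw.a g
     Q' = quotient N∣d
     k = proj₁ rq
     fold : ∀ s k → s * ag + k * Q' * ag * N ≡ (s + k * (Q' * N)) * ag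
     fold s k = solve 5 (λ s g k q n → s :* g :+ k :* q :* g :* n := (s :+ k :* (q :* n)) :* g) refl s ag k Q' N

    q≥1 : 1 ≤ q
    q≥1 = ≤-trans (s≤s z≤n) m<q
    total : List ℚ
    total = toList α ++ toList β
    -- Among equal fractional parts ⪯ orders by decreasing value. Subtracting an integer B that
    -- outweighs all the integer shifts makes x at most every a y, so ties count, and a y ⪯ x
    -- becomes ⟨a y⟩ ≤ m/q.
    B : ℕ
    B = 1 + a * sumL total drop
    θ x : ℚ
    θ = m /ᵘ q
    x = θ Q.- ι B
    frac-x : frac x ≡ θ
    frac-x = frac-unique x B 0 m≥1 (<⇒≤ m<q) (Q.solve 2 (λ t b → (t Q.:- b) Q.:+ b Q.:= t Q.:+ Q.:0) refl θ (ι B))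
    x≤ : ∀ {y} → y ∈ total → x ℚ.≤ Defs.fromℕ a ℚ.* y
    x≤ {y} i = subst (x ℚ.≤_) (sym (fromℕ* a y)) (below {θ} {ι a Q.* y} {(a * num y) /ᵘ ↧ₙ y} B (a * drop y) (/ᵘ≤1 q≥1 (<⇒≤ m<q)) (/ᵘ≥0 (a * num y) (↧ₙ y) (↧≥1 y)) (scaled-lift y a) (s≤s (*-monoʳ-≤ a (sumL-∈ total drop i))))
    ⪯⇒ : ∀ {y} → y ∈ total → (h : Div y) → (Defs.fromℕ a ℚ.* y) ⪯ x → resR (mkRaw y h) s * q ≤ m * ↧ₙ y
    ⪯⇒ {y} i h c = /ᵘ-≤⇒ {resR (mkRaw y h) s} {↧ₙ y} {m} {q} (↧≥1 y) q≥1 (subst₂ ℚ._≤_ (trans (frac-scale y h a a≥1) (cong (_/ᵘ ↧ₙ y) (sym (resR-a (mkRaw y h))))) frac-x (le⪯ c))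
     where
     le⪯ : ∀ {u v} → u ⪯ v → frac u ℚ.≤ frac v
     le⪯ (inj₁ l) = ℚₚ.<⇒≤ l
     le⪯ (inj₂ (e , _)) = ℚₚ.≤-reflexive e
    ⇒⪯ : ∀ {y} → y ∈ total → (h : Div y) → resR (mkRaw y h) s * q ≤ m * ↧ₙ y → (Defs.fromℕ a ℚ.* y) ⪯ x
    ⇒⪯ {y} i h c = go (ℚₚ.<-cmp (frac e) (frac x))
     where
     e = Defs.fromℕ a ℚ.* y
     fr : (frac e) ℚ.≤ (frac x)
     fr = subst₂ ℚ._≤_ (sym (trans (frac-scale y h a a≥1) (cong (_/ᵘ ↧ₙ y) (sym (resR-a (mkRaw y h)))))) (sym frac-x) (/ᵘ-≤ {resR (mkRaw y h) s} {↧ₙ y} {m} {q} (↧≥1 y) q≥1 c)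
     go : Tri ((frac e) ℚ.< (frac x)) (frac e ≡ frac x) ((frac x) ℚ.< (frac e)) → e ⪯ x
     go (tri< l _ _) = inj₁ l
     go (tri≈ _ eq _) = inj₂ (eq , x≤ i)
     go (tri> _ _ l) = ⊥-elim (ℚₚ.<-irrefl refl (ℚₚ.<-≤-trans l fr))
    count : ∀ l hs → (∀ {y} → y ∈ l → y ∈ total) → Defs.countBelow α β (Defs.scaleList α β a l) x ≡ sumL (raws l hs) (indR s q m)
    count [] [] sub = refl
    count (y ∷ l) (h ∷ hs) sub = trans (length-filter-∷ (λ e → e ⪯? x) (Defs.fromℕ a ℚ.* y) (Defs.scaleList α β a l))
     (cong₂ _+_ (dec-le ((Defs.fromℕ a ℚ.* y) ⪯? x) (⪯⇒ (sub (here refl)) h) (⇒⪯ (sub (here refl)) h)) (count l hs (λ i → sub (there i))))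
    -- ⟨a⟩ = 1 is the largest fractional part; the bound x ≺ a of hypothesis H is the reason for
    -- restricting to m < q.
    x≺a : x ≺ Defs.fromℕ a
    x≺a = inj₁ fx< , λ e → ℚₚ.<-irrefl (cong frac e) fx<
     where
     fa : frac (Defs.fromℕ a) ≡ 1 /ᵘ 1
     fa = frac-unique (Defs.fromℕ a) {1} {1} 1 a ≤-refl ≤-refl (trans (cong (Q._+ 1#) (sym (Q.ιz≡ (ℤ.+ a)))) (trans (Q.+-comm (ι a) 1#) (cong (Q._+ ι a) (sym (Q.inv-r {1#} Q.1≢0)))))
     fx< : frac x ℚ.< frac (Defs.fromℕ a)
     fx< = subst₂ ℚ._<_ (sym frac-x) (sym fa) (ℚₚ.≰⇒> λ le′ → <⇒≱ m<q (subst₂ _≤_ (*-identityˡ q) (*-identityʳ m) (/ᵘ-≤⇒ {1} {1} {m} {q} ≤-refl q≥1 le′)))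
    conclude : ∀ {y} → y ∈ total → (h : Div y) → resR (mkRaw y h) s * q ≤ m * ↧ₙ y → suc (sumL βs (indR s q m)) ≤ sumL αs (indR s q m)
    conclude {y} i h c = ≰⇒> λ le′ → absurd (ℤₚ.≤-trans (H a a≥1 (subst (a ≤_) (sym dEq) (Res.res≤N d s)) (subst (Cop.Coprime a) (sym dEq) a-cop) x (mαβ-⪯ α β a x _ (∈-map⁺ (λ e → Defs.fromℕ a ℚ.* e) i) (⇒⪯ i h c)) x≺a)
      (subst₂ (λ u v → ℤ.+ u ℤ.- ℤ.+ v ℤ.≤ ℤ.+ 0) (sym (count (toList α) hα ∈-++⁺ˡ)) (sym (count (toList β) hβ (∈-++⁺ʳ (toList α)))) (ℤₚ.i≤j⇒i-j≤0 (ℤ.+≤+ le′))))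
     where
     absurd : ¬ (ℤ.+ 1 ℤ.≤ ℤ.+ 0)
     absurd (ℤ.+≤+ ())

   le⇒ : ∀ {a b} → le a b ≡ 1 → a ≤ b
   le⇒ {a} {b} e with a ≤? b
   ... | yes l = l
   ... | no n = ⊥-elim (1≢0 (trans (sym e) (le-no (≰⇒> n))))
    where
    1≢0 : ¬ (1 ≡ 0)
    1≢0 ()

   strong : ∀ s → Cop.Coprime s d → ∀ m q → m < q → ∀ g → g ∈ αs ++ βs → indR s q m g ≡ 1 → suc (sumL βs (indR s q m)) ≤ sumL αs (indR s q m)
   strong s cop m q m<q g i e = go (∈-++⁻ αs i)
    where
    fin : (Σ ℚ λ x → x ∈ (toList α ++ toList β) × Σ (Div x) λ h → g ≡ mkRaw x h) → suc (sumL βs (indR s q m)) ≤ sumL αs (indR s q m)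
    fin (y , iy , h , refl) = Level.conclude s cop m q (m≥1 m (le⇒ e)) m<q iy h (le⇒ e)
     where
     m≥1 : ∀ m → resR (mkRaw y h) s * q ≤ m * ↧ₙ y → 1 ≤ m
     m≥1 zero l = ⊥-elim (<⇒≱ (*-mono-≤ (Res.res≥1 (↧ₙ y) {{ℕ.>-nonZero (↧≥1 y)}} (s * num y)) (≤-trans (s≤s z≤n) m<q)) l)
     m≥1 (suc m) l = s≤s z≤n
    go : g ∈ αs ⊎ g ∈ βs → suc (sumL βs (indR s q m)) ≤ sumL αs (indR s q m)
    go (inj₁ j) = fin (proj₁ w , ∈-++⁺ˡ (proj₁ (proj₂ w)) , proj₂ (proj₂ w))
     where w = ∈-raws (toList α) hα j
    go (inj₂ j) = fin (proj₁ w , ∈-++⁺ʳ (toList α) (proj₁ (proj₂ w)) , proj₂ (proj₂ w))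
     where w = ∈-raws (toList β) hβ j

   sumL-zero : ∀ {gs} (f : Raw → ℕ) → ¬ (Σ Raw λ g → g ∈ gs × f g ≢ 0) → sumL gs f ≡ 0
   sumL-zero {[]} f h = refl
   sumL-zero {g ∷ gs} f h with f g in e
   ... | zero = sumL-zero f (λ (g' , i , ne) → h (g' , there i , ne))
   ... | suc _ = ⊥-elim (h (g , here refl , λ e' → case (trans (sym e) e')))
    where
    case : ∀ {n} → ¬ (suc n ≡ 0)
    case ()

   -- A violation would require a positive count among the β, and the parameter counted there
   -- triggers the strict inequality.
   weak : ∀ s → Cop.Coprime s d → ∀ m q → m < q → sumL βs (indR s q m) ≤ sumL αs (indR s q m)
   weak s cop m q m<q = ≮⇒≥ λ lt → <⇒≱ lt (≤-trans (≤-reflexive (sumL-zero (indR s q m) (λ (g , i , ne) → <⇒≱ lt (<⇒≤ (strong s cop m q m<q g (∈-++⁺ʳ αs i) (one g ne)))))) z≤n)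
    where
    one : ∀ g → indR s q m g ≢ 0 → indR s q m g ≡ 1
    one g ne with resR g s * q ≤? m * Raw.N g
    ... | yes l = le-yes l
    ... | no l = ⊥-elim (ne (le-no (≰⇒> l)))

  hnat : HNat αs βs
  hnat = record { weak = weak ; strong = strong }

-- The coefficients of F and G as signed products and harmonic sums.

module Coefficient (p : ℕ) (pp : Prime p) (ν D b : ℕ) (D≥1 : 1 ℕ.≤ D) (b≥1 : 1 ℕ.≤ b) (D-p : Cop.Coprime D p) (b-D : Cop.Coprime b D) where
 open import Data.Nat.Base using (_≤_; _∸_; _^_) renaming (_+_ to _∔_; _*_ to _·_)
 open import Defs using (frac; fracMul; prodPoch; sumH; Fser; Gser)

 open Q
 open Sums
 open Convolution
 open Reduced p pp ν D b D≥1 b≥1 D-p b-D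
 open Averaging p pp ν D b D≥1 b≥1 D-p b-D
 open Fractional p pp ν D b D≥1 b≥1 D-p b-D
 open Counting p pp Ω using (res; module Res)
 open UnitProducts using (Π-const)
 open Parameters p pp Ω using (Param; int; non; p∣?_; R; fac; fac≢0)
 open SignedProducts p pp Ω
 open Harmonic p pp Ω using (hterm; harm; Hs; pm; sumS)
 open SeriesQuotient p pp Ω using (quot; conv-quot)
 open import Data.Nat.Divisibility using (_∣_)
 open import Data.List.Relation.Unary.All using (All; []; _∷_)

 opaque
  unfolding _+_
  poch-Π : ∀ y n → Defs.poch y n ≡ Π< n (λ k → y + ι k)
  poch-Π y zero = refl
  poch-Π y (suc n) = cong (λ z → z * (y + ι n)) (poch-Π y n)

  Hx-Σ : ∀ y n → Defs.Hx y n ≡ Σ< n (λ k → inv (y + ι k))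
  Hx-Σ y zero = refl
  Hx-Σ y (suc n) = cong (λ z → z + inv (y + ι n)) (Hx-Σ y n)

  prodPoch-[] : ∀ n → prodPoch [] n ≡ 1#
  prodPoch-[] n = refl

  prodPoch-∷ : ∀ x l n → prodPoch (x ∷ l) n ≡ Defs.poch x n * prodPoch l n
  prodPoch-∷ x l n = refl

  sumH-[] : ∀ n → sumH [] n ≡ 0#
  sumH-[] n = refl

  sumH-∷ : ∀ x l n → sumH (x ∷ l) n ≡ Defs.Hx x n + sumH l n
  sumH-∷ x l n = refl

  Fser≡ : ∀ γ δ n → Fser γ δ n ≡ prodPoch γ n * inv (prodPoch δ n)
  Fser≡ γ δ n = refl

  Gser≡ : ∀ γ δ n → Gser γ δ n ≡ Fser γ δ n * (sumH γ n - sumH δ n)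
  Gser≡ γ δ n = refl

 scaleD : ∀ (g : Raw) → Dec (p ∣ Raw.N g) → ℚ
 scaleD g (yes _) = ι (Raw.N g)
 scaleD g (no _) = 1#

 scaleD≢0 : ∀ g d → scaleD g d ≢ 0#
 scaleD≢0 g (yes _) = ι-pos≢0 (Raw.N≥1 g)
 scaleD≢0 g (no _) = 1≢0

 scaleR : Raw → ℚ
 scaleR g = scaleD g (p∣?_ (Raw.N g))

 multiplier : ℕ → ℕ → ℕ
 multiplier r t = t · κ ^ r

 multiplier≥1 : ∀ r t → Ω t → 1 ≤ multiplier r t
 multiplier≥1 r t o = Nat.*-mono-≤ (proj₁ o) (κ^≥1 r)

 value : ℕ → ℕ → ℚ → ℚ
 value r t x = frac (Defs.fromℕ (multiplier r t) ℚ.* x)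

 -- Links the factors built from residues to those of the Pochhammer symbols. For N prime to p the
 -- residue is stored at b instead of t, which agrees because N divides D.
 fac-scaled : ∀ x h d r k t → Ω t → fac (fromDec (mkRaw x h) d) r k t ≡ (value r t x + ι k) * scaleD (mkRaw x h) d
 fac-scaled x h (no nd) r k t o = sym (trans (*-idʳ _) (cong (λ z → z + ι k) (trans (frac-scale x h (multiplier r t) (multiplier≥1 r t o))
   (cong (λ z → ι z * inv (ι (↧ₙ x))) (RawP.xr-D (mkRaw x h) (coprime-∣D nd h) r t b (proj₂ (proj₂ (proj₂ o))))))))
 fac-scaled x h (yes d) r k t o = sym (trans (cong (λ z → (z + ι k) * ι (↧ₙ x)) (frac-scale x h (multiplier r t) (multiplier≥1 r t o)))
   (trans (*-distribʳ (ι (↧ₙ x)) _ (ι k)) (cong₂ _+_ (/ᵘ-cancel (resR (mkRaw x h) (multiplier r t)) (↧≥1 x)) (sym (ι-* k (↧ₙ x))))))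

 hterm-scaled : ∀ x h d r k t → Ω t → hterm (fromDec (mkRaw x h) d) r k t ≡ inv (value r t x + ι k)
 hterm-scaled x h d@(no nd) r k t o = cong inv (trans (fac-scaled x h d r k t o) (*-idʳ _))
 hterm-scaled x h d@(yes _) r k t o = trans (cong (λ z → ι N * inv z) (fac-scaled x h d r k t o)) (trans (cong (ι N *_) (inv-* (value r t x + ι k) (ι N)))
   (trans (solve 3 (λ n v i → n :* (v :* i) := v :* (n :* i)) refl (ι N) (inv (value r t x + ι k)) (inv (ι N))) (trans (cong (inv (value r t x + ι k) *_) (inv-r {ι N} (ι-pos≢0 (↧≥1 x)))) (*-idʳ _))))
  where N = ↧ₙ x

 R-poch : ∀ x h r n t → Ω t → R (toParam (mkRaw x h)) r 0 n t ≡ Defs.poch (value r t x) n * scaleR (mkRaw x h) ↑ n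
 R-poch x h r n t o = trans (Π-ext n (λ k → fac-scaled x h (p∣?_ (↧ₙ x)) r k t o)) (trans (Π-* n (λ k → value r t x + ι k) (λ _ → scaleR (mkRaw x h)))
  (cong₂ _*_ (sym (poch-Π (value r t x) n)) (Π-const p pp Ω n (scaleR (mkRaw x h)))))

 harm-Hx : ∀ x h r n t → Ω t → harm (toParam (mkRaw x h)) r n t ≡ Defs.Hx (value r t x) n
 harm-Hx x h r n t o = trans (Σ-ext n (λ k → hterm-scaled x h (p∣?_ (↧ₙ x)) r k t o)) (sym (Hx-Σ (value r t x) n))

 prodR : List Raw → (Raw → ℚ) → ℚ
 prodR [] f = 1#
 prodR (g ∷ gs) f = f g * prodR gs f

 sumR : List Raw → (Raw → ℚ) → ℚ
 sumR [] f = 0#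
 sumR (g ∷ gs) f = f g + sumR gs f

 prodR≢0 : ∀ gs {f} → (∀ g → f g ≢ 0#) → prodR gs f ≢ 0#
 prodR≢0 [] h = 1≢0
 prodR≢0 (g ∷ gs) h = *-≢0 (h g) (prodR≢0 gs h)

 prodS-split : ∀ αs βs (f : Param → ℚ) → prodS (sg αs βs) f ≡ prodR αs (λ g → f (toParam g)) * inv (prodR βs (λ g → f (toParam g)))
 prodS-split [] [] f = sym (trans (*-idˡ _) (sym (inv-unique 1# 1# (*-idˡ 1#))))
 prodS-split [] (g ∷ βs) f = trans (cong (inv (f (toParam g)) *_) (prodS-split [] βs f)) (trans (solve 3 (λ a o b → a :* (o :* b) := o :* (a :* b)) refl _ 1# _) (cong (1# *_) (sym (inv-* (f (toParam g)) _))))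
 prodS-split (g ∷ αs) βs f = trans (cong (f (toParam g) *_) (prodS-split αs βs f)) (sym (*-assoc _ _ _))

 sumS-split : ∀ αs βs (f : Param → ℚ) → sumS (sg αs βs) f ≡ sumR αs (λ g → f (toParam g)) - sumR βs (λ g → f (toParam g))
 sumS-split [] [] f = sym (-‿inverse 0#)
 sumS-split [] (g ∷ βs) f = trans (cong (λ z → (- f (toParam g)) + z) (sumS-split [] βs f)) (solve 3 (λ a o b → :- a :+ (o :- b) := o :- (a :+ b)) refl (f (toParam g)) 0# _)
 sumS-split (g ∷ αs) βs f = trans (cong (f (toParam g) +_) (sumS-split αs βs f)) (sym (+-assoc _ _ _))

 prodR-poch : ∀ l hs r n t → Ω t → prodR (raws l hs) (λ g → R (toParam g) r 0 n t) ≡ prodPoch (fracMul (multiplier r t) l) n * prodR (raws l hs) scaleR ↑ n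
 prodR-poch [] [] r n t o = sym (trans (cong₂ _*_ (prodPoch-[] n) (1↑ n)) (*-idˡ 1#))
 prodR-poch (x ∷ l) (h ∷ hs) r n t o = trans (cong₂ _*_ (R-poch x h r n t o) (prodR-poch l hs r n t o))
  (trans (solve 4 (λ a b c d → (a :* b) :* (c :* d) := (a :* c) :* (b :* d)) refl (Defs.poch (value r t x) n) (scaleR (mkRaw x h) ↑ n) (prodPoch (fracMul (multiplier r t) l) n) (prodR (raws l hs) scaleR ↑ n))
   (cong₂ _*_ (sym (prodPoch-∷ (value r t x) (fracMul (multiplier r t) l) n)) (sym (*-↑ (scaleR (mkRaw x h)) (prodR (raws l hs) scaleR) n))))

 sumR-harm : ∀ l hs r n t → Ω t → sumR (raws l hs) (λ g → harm (toParam g) r n t) ≡ sumH (fracMul (multiplier r t) l) n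
 sumR-harm [] [] r n t o = sym (sumH-[] n)
 sumR-harm (x ∷ l) (h ∷ hs) r n t o = trans (cong₂ _+_ (harm-Hx x h r n t o) (sumR-harm l hs r n t o)) (sym (sumH-∷ (value r t x) (fracMul (multiplier r t) l) n))

 conv-scale : ∀ c f g n → conv (λ i → c ↑ i * f i) (λ i → c ↑ i * g i) n ≡ c ↑ n * conv f g n
 conv-scale c f g n = trans (Σ-cong (suc n) (λ j l → term j (n ∸ j) (Nat.m+[n∸m]≡n (Nat.≤-pred l)))) (Σ-*ˡ (suc n) (c ↑ n) (λ j → f j * pad g n j))
  where
  term : ∀ j i {n} → j ∔ i ≡ n → c ↑ j * f j * pad (λ i → c ↑ i * g i) n j ≡ c ↑ n * (f j * pad g n j)
  term j i refl = trans (cong (c ↑ j * f j *_) (pad-≤ (λ i → c ↑ i * g i) j i)) (trans (solve 4 (λ a f b g → (a :* f) :* (b :* g) := (a :* b) :* (f :* g)) refl (c ↑ j) (f j) (c ↑ i) (g i))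
   (cong₂ _*_ (sym (↑-+ c j i)) (cong (f j *_) (sym (pad-≤ g j i)))))

 module Coefficients (lα lβ : List ℚ) (hα : All Div lα) (hβ : All Div lβ) (C c : ℚ)
  (c≡ : c ≡ C * inv (prodR (raws lα hα) scaleR * inv (prodR (raws lβ hβ) scaleR))) where
  αs βs : List Raw
  αs = raws lα hα
  βs = raws lβ hβ
  ps : Signed
  ps = sg αs βs

  private
   wα wβ W : ℚ
   wα = prodR αs scaleR
   wβ = prodR βs scaleR
   W = wα * inv wβ
   W≢0 : W ≢ 0#
   W≢0 = *-≢0 (prodR≢0 αs (λ g → scaleD≢0 g (p∣?_ (Raw.N g)))) (inv-≢0 {wβ} (prodR≢0 βs (λ g → scaleD≢0 g (p∣?_ (Raw.N g)))))

  F G quotient : ℕ → ℕ → ℕ → ℚ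
  F r n t = Fser (fracMul (multiplier r t) lα) (fracMul (multiplier r t) lβ) n
  G r n t = Gser (fracMul (multiplier r t) lα) (fracMul (multiplier r t) lβ) n
  quotient r n t = C ↑ n * quot (λ i → F r i t) (λ i → G r i t) n

  A-F : ∀ r n t → Ω t → c ↑ n * prodS ps (λ g → R g r 0 n t) ≡ C ↑ n * F r n t
  A-F r n t o = begin
   c ↑ n * prodS ps (λ g → R g r 0 n t)
    ≡⟨ cong₂ _*_ (trans (cong (_↑ n) c≡) (*-↑ C (inv W) n)) (trans (prodS-split αs βs (λ g → R g r 0 n t)) (cong₂ (λ x y → x * inv y) (prodR-poch lα hα r n t o) (prodR-poch lβ hβ r n t o))) ⟩
   (C ↑ n * inv W ↑ n) * ((Pα * wα ↑ n) * inv (Pβ * wβ ↑ n))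
    ≡⟨ cong (λ z → (C ↑ n * inv W ↑ n) * ((Pα * wα ↑ n) * z)) (inv-* Pβ (wβ ↑ n)) ⟩
   (C ↑ n * inv W ↑ n) * ((Pα * wα ↑ n) * (inv Pβ * inv (wβ ↑ n)))
    ≡⟨ solve 6 (λ c w a x b y → (c :* w) :* ((a :* x) :* (b :* y)) := (w :* (x :* y)) :* (c :* (a :* b))) refl (C ↑ n) (inv W ↑ n) Pα (wα ↑ n) (inv Pβ) (inv (wβ ↑ n)) ⟩
   (inv W ↑ n * (wα ↑ n * inv (wβ ↑ n))) * (C ↑ n * (Pα * inv Pβ))
    ≡⟨ cong₂ _*_ one (cong (C ↑ n *_) (sym (Fser≡ (fracMul (multiplier r t) lα) (fracMul (multiplier r t) lβ) n))) ⟩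
   1# * (C ↑ n * F r n t)
    ≡⟨ *-idˡ _ ⟩
   C ↑ n * F r n t ∎
   where
   open ≡-Reasoning
   Pα = prodPoch (fracMul (multiplier r t) lα) n
   Pβ = prodPoch (fracMul (multiplier r t) lβ) n
   one : inv W ↑ n * (wα ↑ n * inv (wβ ↑ n)) ≡ 1#
   one = trans (cong (inv W ↑ n *_) (trans (cong (wα ↑ n *_) (inv-↑ wβ n)) (sym (*-↑ wα (inv wβ) n)))) (trans (sym (*-↑ (inv W) W n)) (trans (cong (_↑ n) (inv-l {W} W≢0)) (1↑ n)))

  H-G : ∀ r n t → Ω t → (c ↑ n * prodS ps (λ g → R g r 0 n t)) * Hs ps r n t ≡ C ↑ n * G r n t
  H-G r n t o = trans (cong₂ _*_ (A-F r n t o) (trans (sumS-split αs βs (λ g → harm g r n t)) (cong₂ _-_ (sumR-harm lα hα r n t o) (sumR-harm lβ hβ r n t o))))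
   (trans (*-assoc (C ↑ n) (F r n t) _) (cong (C ↑ n *_) (sym (Gser≡ (fracMul (multiplier r t) lα) (fracMul (multiplier r t) lβ) n))))

  F-0 : ∀ r t → Ω t → F r 0 t ≡ 1#
  F-0 r t o = trans (sym (*-idˡ _)) (trans (sym (A-F r 0 t o)) (trans (*-idˡ _) (prodS-1 ps)))

  quotient-conv : ∀ r n t → Ω t → conv (λ i → c ↑ i * prodS ps (λ g → R g r 0 i t)) (λ i → quotient r i t) n ≡ (c ↑ n * prodS ps (λ g → R g r 0 n t)) * Hs ps r n t
  quotient-conv r n t o = trans (conv-ext (λ i → A-F r i t o) (λ _ → refl) n) (trans (conv-scale C (λ i → F r i t) (quot (λ i → F r i t) (λ i → G r i t)) n)
   (trans (cong (C ↑ n *_) (conv-quot (λ i → F r i t) (λ i → G r i t) (λ e → 1≢0 (trans (sym (F-0 r t o)) e)) n)) (sym (H-G r n t o))))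

-- Nonnegativity of φ from the integrality of F(Cz).

module Slope (p : ℕ) (pp : Prime p) (ν D b : ℕ) (D≥1 : 1 ℕ.≤ D) (b≥1 : 1 ℕ.≤ b) (D-p : Cop.Coprime D p) (b-D : Cop.Coprime b D) where
 open import Data.Nat.Base using (_+_; _*_; _∸_; _^_; _≤_; _<_)

 open Reduced p pp ν D b D≥1 b≥1 D-p b-D
 open Averaging p pp ν D b D≥1 b≥1 D-p b-D
 open Valuations p pp ν D b D≥1 b≥1 D-p b-D
 open Q using (ι; ιz; inv; 0#; 1#; _↑_)
 open Sums
 open Padic p pp
 open Filt Ω
 open Parameters p pp Ω using (IntP; NonP; Param; int; non; p∣?_; UnitQ-neg1)
 open Digit p pp Ω using (nzp; p^>0; cc; cc<)
 open Ratios p pp Ω using (geom)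
 open Harmonic p pp Ω using (s<p^s)
 open Counting p pp Ω
 open import Data.Nat.Properties
 open import Data.Nat.Divisibility
 open +-*-Solver

 module _ (q : IntP) (r : ℕ) where
  wc-pow : ∀ l M → l ≤ M → wc q r l (p ^ M) ≡ p ^ (M ∸ l)
  wc-pow l M h = wc-unique q r l (p ^ M) (p ^ (M ∸ l))
    (λ j j< → ≤-trans (+-monoˡ-≤ (j * p ^ l) (cc< q r l)) (≤-trans (*-monoˡ-≤ (p ^ l) j<) (≤-reflexive eq)))
    (λ j j≥ → ≤-trans (≤-reflexive (sym eq)) (≤-trans (*-monoˡ-≤ (p ^ l) j≥) (m≤n+m _ (cc q r l))))
   where
   eq : p ^ (M ∸ l) * p ^ l ≡ p ^ M
   eq = trans (sym (^-distribˡ-+-* p (M ∸ l) l)) (cong (p ^_) (m∸n+n≡m h))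

  wc-high : ∀ l M → M ≤ l → wc q r l (p ^ M) ≤ 1
  wc-high l M h = ≮⇒≥ λ lt → <⇒≱ (wc-< q r l (p ^ M) 1 lt) (≤-trans (^-monoʳ-≤ p h) (≤-trans (≤-reflexive (sym (*-identityˡ (p ^ l)))) (m≤n+m _ (cc q r l))))

  sum-low : ∀ M → #< M (λ l → wc q r (suc l) (p ^ M)) ≡ geom M
  sum-low M = trans (#-cong M (λ l lt → wc-pow (suc l) M lt)) (go M)
   where
   go : ∀ M → #< M (λ l → p ^ (M ∸ suc l)) ≡ geom M
   go zero = refl
   go (suc M) = trans (#-first M (λ l → p ^ (suc M ∸ suc l))) (cong (p ^ M +_) (go M))

  vT-lower : ∀ M L → M ≤ L → geom M ≤ vT q r (p ^ M) L
  vT-lower M L h = ≤-trans (≤-reflexive (sym (sum-low M))) (#-extend (λ l → wc q r (suc l) (p ^ M)) h)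

  -- Levels up to M are exact. A higher level contains at most one index below p^M, and from level M
  -- + N + 1 on there is none, so the error is bounded independently of M.
  vT-upper : ∀ M L → vT q r (p ^ M) L ≤ geom M + IntP.N q
  vT-upper M L = ≤-trans (#-extend f (≤-trans (m≤n+m L N) (m≤n+m (N + L) M))) (≤-trans (≤-reflexive (#-split M (N + L) f)) (+-mono-≤ (≤-reflexive (sum-low M))
    (≤-trans (≤-reflexive (#-tail N (N + L) (λ i → f (M + i)) (m≤m+n N L) tail0)) (≤-trans (#-mono N (λ i _ → wc-high (suc (M + i)) M (≤-trans (m≤m+n M i) (n≤1+n _)))) (≤-reflexive (trans (#-const N 1) (*-identityʳ N)))))))
   where
   N = IntP.N q
   f : ℕ → ℕ
   f l = wc q r (suc l) (p ^ M)
   tail0 : ∀ i → N ≤ i → f (M + i) ≡ 0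
   tail0 i h = wc-0 q r (suc (M + i)) (p ^ M) (≤-trans (*-monoʳ-< (p ^ M) {{ℕ.>-nonZero (p^>0 M)}} (≤-trans (s≤s (≤-trans h (n≤1+n i))) (s<p^s (suc i)))) (≤-reflexive (trans (sym (^-distribˡ-+-* p M (suc i))) (cong (p ^_) (+-suc M i)))))

 record Decomposition (x : ℚ) : Set where
  field
   e₁ e₂ : ℕ
   unit : ℚ
   isUnit : UnitQ unit
   decomposed : x ≡ π ↑ e₁ Q.* inv (π ↑ e₂) Q.* unit

 decompose : ∀ x → x ≢ 0# → Decomposition x
 decompose x ne = go x ne (Q.↧-clear x)
  where
  signed : ∀ n d σ → UnitQ σ → (Σ ℕ λ k → Σ ℕ λ n' → suc n ≡ p ^ k * n' × ¬ p ∣ n') → (Σ ℕ λ k → Σ ℕ λ n' → suc d ≡ p ^ k * n' × ¬ p ∣ n') →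
   ∀ x → x Q.* ι (suc d) ≡ σ Q.* ι (suc n) → Decomposition x
  signed n d σ σu (k , n' , en , nn) (l , d' , ed , nd) x e = record
   { e₁ = k ; e₂ = l ; unit = σ Q.* ι n' Q.* inv (ι d') ; isUnit = UnitQ-* (UnitQ-* σu (UnitQ-ι nn)) (UnitQ-inv (UnitQ-ι nd))
   ; decomposed = Q.*-cancel (ι (suc d)) (Q.ι≢0 λ ()) chain }
   where
   pow : ∀ m k m' → suc m ≡ p ^ k * m' → ι (suc m) ≡ π ↑ k Q.* ι m'
   pow m k m' e = trans (cong ι e) (trans (Q.ι-* (p ^ k) m') (cong (Q._* ι m') (Q.ι-^ p k)))
   chain : ι (suc d) Q.* x ≡ ι (suc d) Q.* (π ↑ k Q.* inv (π ↑ l) Q.* (σ Q.* ι n' Q.* inv (ι d')))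
   chain = begin
    ι (suc d) Q.* x                     ≡⟨ trans (Q.*-comm (ι (suc d)) x) e ⟩
    σ Q.* ι (suc n)                     ≡⟨ cong (σ Q.*_) (pow n k n' en) ⟩
    σ Q.* (π ↑ k Q.* ι n')              ≡⟨ trans (sym (Q.*-idˡ _)) (sym (Q.*-idˡ _)) ⟩
    1# Q.* (1# Q.* (σ Q.* (π ↑ k Q.* ι n')))
     ≡⟨ cong₂ (λ u v → u Q.* (v Q.* (σ Q.* (π ↑ k Q.* ι n')))) (sym (Q.inv-r {π ↑ l} (Q.↑-≢0 l π≢0))) (sym (Q.inv-r {ι d'} (UnitQ.nonzero (UnitQ-ι nd)))) ⟩
    (π ↑ l Q.* inv (π ↑ l)) Q.* ((ι d' Q.* inv (ι d')) Q.* (σ Q.* (π ↑ k Q.* ι n')))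
     ≡⟨ Q.solve 7 (λ a b c i s n j → (a Q.:* i) Q.:* ((b Q.:* j) Q.:* (s Q.:* (c Q.:* n))) Q.:= (a Q.:* b) Q.:* ((c Q.:* i) Q.:* ((s Q.:* n) Q.:* j))) refl (π ↑ l) (ι d') (π ↑ k) (inv (π ↑ l)) σ (ι n') (inv (ι d')) ⟩
    (π ↑ l Q.* ι d') Q.* (π ↑ k Q.* inv (π ↑ l) Q.* (σ Q.* ι n' Q.* inv (ι d')))
     ≡⟨ cong (Q._* (π ↑ k Q.* inv (π ↑ l) Q.* (σ Q.* ι n' Q.* inv (ι d')))) (sym (pow d l d' ed)) ⟩
    ι (suc d) Q.* (π ↑ k Q.* inv (π ↑ l) Q.* (σ Q.* ι n' Q.* inv (ι d'))) ∎
    where open ≡-Reasoning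
  go : ∀ x → x ≢ 0# → x Q.* ι (↧ₙ x) ≡ ιz (↥ x) → Decomposition x
  go x@(mkℚ (ℤ.+ zero) d c) ne e = ⊥-elim (ne (Q.*-cancel (ι (suc d)) (Q.ι≢0 λ ()) (trans (Q.*-comm _ x) (trans e (sym (Q.*-0ʳ _))))))
  go x@(mkℚ (ℤ.+ suc n) d c) ne e = signed n d 1# UnitQ-1 (factor (suc n) (s≤s z≤n)) (factor (suc d) (s≤s z≤n)) x (trans e (sym (Q.*-idˡ _)))
  go x@(mkℚ ℤ.-[1+ n ] d c) ne e = signed n d (Q.- 1#) UnitQ-neg1 (factor (suc n) (s≤s z≤n)) (factor (suc d) (s≤s z≤n)) x
    (trans e (trans (Q.ιz-neg (ℤ.+ suc n)) (Q.solve 1 (λ a → Q.:- a Q.:= (Q.:- Q.:1) Q.:* a) refl (ι (suc n)))))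

 module _ (αs βs : List Raw) (e₁ e₂ : ℕ) (cu : ℚ) (cu-unit : UnitQ cu) (t : ℕ) (t∈ : Ω t) where
  open Valuation αs βs e₁ e₂ cu cu-unit

  -- Integrality at n = p^M compares the main terms geom M of both sides.
  slope-nonneg : (∀ n → Z (A 0 n t)) → (p ∸ 1) * e₂ + sumP βs isI ≤ (p ∸ 1) * e₁ + sumP αs isI
  slope-nonneg integ = ≮⇒≥ λ lt → <⇒≱ big (small lt)
   where
   P = p ∸ 1
   Iα = sumP αs isI
   Iβ = sumP βs isI
   SN = sumL αs Raw.N
   -- The error terms in the comparison are at most e₁ + SN for every exponent; `geom Y` exceeds
   -- that bound, so a wrong inequality between the leading coefficients would be visible.
   Y = suc (e₁ + SN)
   g = geom Y
   n = p ^ Y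
   L = Y + level n
   compare : e₂ * n + V βs 0 n L ≤ e₁ * n + V αs 0 n L
   compare = unit-val (e₁ * n + V αs 0 n L) (e₂ * n + V βs 0 n L) (U.unit (proj₁ (proj₂ a)) t t∈) (subst Z (proj₂ (proj₂ a) t t∈) (integ n))
    where a = A-π 0 n {L} (m≤n+m (level n) Y)
   lower : ∀ g' → isI g' * g ≤ vTP g' 0 n L
   lower (int q) = ≤-trans (≤-reflexive (*-identityˡ g)) (vT-lower q 0 Y L (m≤m+n Y _))
   lower (non q) = z≤n
   upper : ∀ {g' N} → HasN g' N → vTP g' 0 n L ≤ isI g' * g + N
   upper (int {q}) = ≤-trans (vT-upper q 0 Y L) (≤-reflexive (cong (_+ IntP.N q) (sym (*-identityˡ g))))
   upper non = z≤n
   scale : ∀ gs → sumP gs (λ g' → isI g' * g) ≡ sumP gs isI * g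
   scale gs = trans (sumL-ext gs (λ g' → *-comm (isI (toParam g')) g)) (trans (sumL-* gs g _) (*-comm g _))
   Vβ≥ : Iβ * g ≤ V βs 0 n L
   Vβ≥ = ≤-trans (≤-reflexive (sym (scale βs))) (sumL-mono βs (λ {g'} _ → lower (toParam g')))
   Vα≤ : V αs 0 n L ≤ Iα * g + SN
   Vα≤ = ≤-trans (sumL-mono αs (λ {g'} _ → upper (hasN g'))) (≤-reflexive (trans (sumL-+ αs _ _) (cong (_+ SN) (scale αs))))
   ineq : e₂ * n + Iβ * g ≤ e₁ * n + (Iα * g + SN)
   ineq = ≤-trans (+-monoʳ-≤ (e₂ * n) Vβ≥) (≤-trans compare (+-monoʳ-≤ (e₁ * n) Vα≤))
   geom-pow : ∀ s → p ^ s ≡ P * geom s + 1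
   geom-pow zero = sym (cong (_+ 1) (*-zeroʳ P))
   geom-pow (suc s) = trans (cong (_* p ^ s) pm1) (trans (cong (_+ P * p ^ s) (geom-pow s)) (solve 3 (λ P g q → P :* g :+ con 1 :+ P :* q := P :* (q :+ g) :+ con 1) refl P (geom s) (p ^ s)))
   ineq′ : (P * e₂ + Iβ) * g + e₂ ≤ (P * e₁ + Iα) * g + (e₁ + SN)
   ineq′ = subst₂ _≤_ (trans (cong (λ z → e₂ * z + Iβ * g) (geom-pow Y)) (solve 4 (λ e P g i → e :* (P :* g :+ con 1) :+ i :* g := (P :* e :+ i) :* g :+ e) refl e₂ P g Iβ))
    (trans (cong (λ z → e₁ * z + (Iα * g + SN)) (geom-pow Y)) (solve 5 (λ e P g i s → e :* (P :* g :+ con 1) :+ (i :* g :+ s) := (P :* e :+ i) :* g :+ (e :+ s)) refl e₁ P g Iα SN)) ineq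
   small : P * e₁ + Iα < P * e₂ + Iβ → g ≤ e₁ + SN
   small lt = +-cancelˡ-≤ ((P * e₁ + Iα) * g) _ _ (≤-trans (≤-trans (≤-reflexive (+-comm ((P * e₁ + Iα) * g) g)) (≤-trans (*-monoˡ-≤ g lt) (m≤m+n _ e₂))) ineq′)
   big : e₁ + SN < g
   big = ≤-trans (s<p^s (e₁ + SN)) (m≤m+n _ (geom (e₁ + SN)))

-- The numerator in the cases φ = 0 and φ > 0.

module Numerator (p : ℕ) (pp : Prime p) (ν D b : ℕ) (D≥1 : 1 ℕ.≤ D) (b≥1 : 1 ℕ.≤ b) (D-p : Cop.Coprime D p) (b-D : Cop.Coprime b D) where
 open import Data.Nat.Base using (_≤_; _<_; _∸_) renaming (_+_ to _∔_; _*_ to _·_)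

 open Q
 open Convolution
 open Reduced p pp ν D b D≥1 b≥1 D-p b-D hiding (κ)
 open Averaging p pp ν D b D≥1 b≥1 D-p b-D
 open Valuations p pp ν D b D≥1 b≥1 D-p b-D
 open Padic p pp
 open Filt Ω
 open Fermat p pp using (fermatQ; cg-*; cg-trans; cg-refl; cg-↑; Z-↑)
 open Parameters p pp Ω using (Param; int; non; R; πpow; ωval; w; w-unit; κ; flag)
 open SignedProducts p pp Ω
 open Digit p pp Ω using (p>0; module Levels)
 open Harmonic p pp Ω using (Hs; module HSum)
 open SeriesQuotient p pp Ω using (sp; M-conv; logDifference)
 open import Relation.Binary.PropositionalEquality hiding ([_])

 module Membership (αs βs : List Raw) (same-length : sumL αs (λ _ → 1) ≡ sumL βs (λ _ → 1)) (hn : HNat αs βs)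
  (e₁ e₂ φ : ℕ) (balance : (p ∸ 1) · e₁ ∔ sumP αs isI ≡ (p ∸ 1) · e₂ ∔ sumP βs isI ∔ φ) (cu : ℚ) (cu-unit : UnitQ cu) where

  open Valuation αs βs e₁ e₂ cu cu-unit
  open Balanced same-length φ balance
  open Averaged hn
  open Levels ps

  H : ℕ → ℕ → ℕ → ℚ
  H = Hs ps

  c≢0 : c ≢ 0#
  c≢0 = *-≢0 (*-≢0 (↑-≢0 e₁ π≢0) (inv-≢0 {π ↑ e₂} (↑-≢0 e₂ π≢0))) (UnitQ.nonzero cu-unit)

  A-0 : ∀ r t → A r 0 t ≡ 1#
  A-0 r t = trans (cong (1# *_) (prodS-1 ps)) (*-idˡ 1#)

  numerator : ℕ → ℕ → ℕ → ℚ
  numerator a K t = conv (λ j → A 1 j t) (λ j → π * (A 0 (a ∔ j · p) t * H 0 (a ∔ j · p) t)) K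
   - conv (λ j → A 1 j t * H 1 j t) (λ j → A 0 (a ∔ j · p) t) K

  private
   P : ℕ
   P = p ∸ 1
   Iα Iβ : ℕ
   Iα = sumP αs isI
   Iβ = sumP βs isI

  module Tight (φ0 : φ ≡ 0) where
   private
    bal : P · e₁ ∔ Iα ≡ P · e₂ ∔ Iβ
    bal = trans balance (trans (cong (P · e₂ ∔ Iβ ∔_) φ0) (Nat.+-identityʳ _))

    ĉ : ℚ
    ĉ = c ↑ P * prodS ps (λ g → πpow g 1)

    πpow-isI : ∀ g → πpow g 1 ≡ π ↑ isI g
    πpow-isI (int _) = refl
    πpow-isI (non _) = refl

    ωval-isI : ∀ g → ωval g ≡ w ↑ isI g
    ωval-isI (int _) = sym (*-idʳ w)
    ωval-isI (non _) = refl

    -- For φ = 0 the powers of p in c^(p-1) and those extracted from the blocks cancel. What remains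
    -- is a (p-1)-st power of a unit, hence 1 modulo p.
    ĉ≡ : ĉ ≡ cu ↑ P
    ĉ≡ = begin
     c ↑ P * prodS ps (λ g → πpow g 1)
      ≡⟨ cong₂ _*_ (trans (*-↑ (π ↑ e₁ * inv (π ↑ e₂)) cu P) (cong (_* cu ↑ P) (trans (*-↑ (π ↑ e₁) (inv (π ↑ e₂)) P) (cong₂ _*_ (sym (↑-* π P e₁)) (trans (sym (inv-↑ (π ↑ e₂) P)) (cong inv (sym (↑-* π P e₂))))))))
         (trans (prodS-ext ps πpow-isI) (prodS-sg π αs βs isI)) ⟩
     (π ↑ (P · e₁) * inv (π ↑ (P · e₂))) * cu ↑ P * (π ↑ Iα * inv (π ↑ Iβ))
      ≡⟨ solve 5 (λ a b u x y → (a :* b) :* u :* (x :* y) := (a :* x) :* (b :* y) :* u) refl (π ↑ (P · e₁)) (inv (π ↑ (P · e₂))) (cu ↑ P) (π ↑ Iα) (inv (π ↑ Iβ)) ⟩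
     (π ↑ (P · e₁) * π ↑ Iα) * (inv (π ↑ (P · e₂)) * inv (π ↑ Iβ)) * cu ↑ P
      ≡⟨ cong (_* cu ↑ P) (cong₂ _*_ (trans (sym (↑-+ π (P · e₁) Iα)) (cong (π ↑_) bal)) (trans (sym (inv-* (π ↑ (P · e₂)) (π ↑ Iβ))) (cong inv (sym (↑-+ π (P · e₂) Iβ))))) ⟩
     (π ↑ (P · e₂ ∔ Iβ) * inv (π ↑ (P · e₂ ∔ Iβ))) * cu ↑ P
      ≡⟨ trans (cong (_* cu ↑ P) (inv-r {π ↑ (P · e₂ ∔ Iβ)} (↑-≢0 (P · e₂ ∔ Iβ) π≢0))) (*-idˡ _) ⟩
     cu ↑ P ∎
     where open ≡-Reasoning

    ĉ-unit : UnitQ ĉ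
    ĉ-unit = subst UnitQ (sym ĉ≡) (UnitQ-↑ P cu-unit)

    ĉ-1 : Dv 1 (ĉ - 1#)
    ĉ-1 = subst (λ z → Dv 1 (z - 1#)) (sym ĉ≡) (fermatQ cu-unit)

    w-pow : ∀ k → Dv 1 (w ↑ (P · k) - 1#)
    w-pow k = subst₂ (λ x y → Dv 1 (x - y)) (trans (sym (↑-* w k P)) (cong (w ↑_) (Nat.*-comm k P))) (1↑ k) (cg-↑ k (Z-↑ P (UnitQ.integral w-unit)) (Z-ι 1) (fermatQ w-unit))

    -- φ = 0 makes the difference between the numbers of integral upper and lower parameters a
    -- multiple of p - 1, so the products `w` cancel modulo p by Fermat's theorem.
    ω-1 : Dv 1 (prodS ps ωval - 1#)
    ω-1 = subst (λ z → Dv 1 (z - 1#)) (sym (trans (prodS-ext ps ωval-isI) (trans (prodS-sg w αs βs isI) eq)))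
      (subst (λ z → Dv 1 (w ↑ (P · e₂) * inv (w ↑ (P · e₁)) - z)) (*-idˡ 1#)
       (cg-* {1} {w ↑ (P · e₂)} {1#} {inv (w ↑ (P · e₁))} {1#} (UnitQ.integral (UnitQ-↑ (P · e₂) w-unit)) (Z-ι 1) (w-pow e₂)
        (subst (λ z → Dv 1 (inv (w ↑ (P · e₁)) - z)) (sym (inv-unique 1# 1# (*-idˡ 1#))) (cg-inv (UnitQ-↑ (P · e₁) w-unit) UnitQ-1 (w-pow e₁)))))
     where
     nz : ∀ k → w ↑ k ≢ 0#
     nz k = ↑-≢0 k (UnitQ.nonzero w-unit)
     eq : w ↑ Iα * inv (w ↑ Iβ) ≡ w ↑ (P · e₂) * inv (w ↑ (P · e₁))
     eq = *-cancel (w ↑ (P · e₁) * w ↑ Iβ) (*-≢0 (nz (P · e₁)) (nz Iβ)) (begin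
      (w ↑ (P · e₁) * w ↑ Iβ) * (w ↑ Iα * inv (w ↑ Iβ))
       ≡⟨ solve 4 (λ a y x i → (a :* y) :* (x :* i) := (y :* i) :* (a :* x)) refl (w ↑ (P · e₁)) (w ↑ Iβ) (w ↑ Iα) (inv (w ↑ Iβ)) ⟩
      (w ↑ Iβ * inv (w ↑ Iβ)) * (w ↑ (P · e₁) * w ↑ Iα)
       ≡⟨ cong₂ _*_ (trans (inv-r {w ↑ Iβ} (nz Iβ)) (sym (inv-r {w ↑ (P · e₁)} (nz (P · e₁))))) (trans (sym (↑-+ w (P · e₁) Iα)) (trans (cong (w ↑_) bal) (↑-+ w (P · e₂) Iβ))) ⟩
      (w ↑ (P · e₁) * inv (w ↑ (P · e₁))) * (w ↑ (P · e₂) * w ↑ Iβ)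
       ≡⟨ solve 4 (λ a i c y → (a :* i) :* (c :* y) := (a :* y) :* (c :* i)) refl (w ↑ (P · e₁)) (inv (w ↑ (P · e₁))) (w ↑ (P · e₂)) (w ↑ Iβ) ⟩
      (w ↑ (P · e₁) * w ↑ Iβ) * (w ↑ (P · e₂) * inv (w ↑ (P · e₁))) ∎)
      where open ≡-Reasoning

   open Total ps ĉ ĉ-unit ĉ-1 ω-1 using (E-weak; E-strong)

   numerator-strong : prodS ps (λ g → κ 1 (flag g)) ≡ 1# → ∀ a K → a < p → M₁ 1 (numerator a K)
   numerator-strong κ1 a K = HSum.logNumerator ps c c≢0 (λ m → m) M₀⇒M₁ 0 0 z≤n ĉ-unit
    (λ r n L _ → M-weaken (Nat.≤-reflexive (trans (Nat.+-identityʳ _) (Nat.+-identityʳ _))) (M₀⇒M₁ (A-avg r n L)))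
    (E-strong κ1) 0 a K

   -- Of the e factors p in every A_r(n) with n ≥ 1, one pays for the precision that the block
   -- quotients lack in 𝒜; the other e - 1 are kept as ω and reappear in the conclusion.
   numerator-weak : ∀ e → 1 ≤ e → e₁ ≡ e₂ ∔ e → (∀ g → g ∈ βs → Raw.N g ≡ 1) → ∀ a K → a < p → M₀ e (numerator a K)
   numerator-weak e@(suc e′) e≥1 e-eq β-int a K = HSum.logNumerator ps c c≢0 suc (λ m → m) 1 e′ (s≤s z≤n) ĉ-unit
    (λ r n L n≥1 → M-weaken (Nat.≤-reflexive (trans (Nat.+-assoc (gL L r n) e′ 1) (cong (gL L r n ∔_) (Nat.+-comm e′ 1)))) (A-int-β r n L n≥1))
    E-weak 0 a K
    where open IntegerDenominators e e-eq β-int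

  A-val : ∀ r n → M₀ 0 (A r n)
  A-val r n = M-weaken z≤n (A-avg r n 0)

  AH⇒numerator : ∀ E → (∀ r n → M₀ E (λ t → A r n t * H r n t)) → ∀ a K → M₀ E (numerator a K)
  AH⇒numerator E h a K = M-- (M-conv K (λ j _ → A-val 1 j) (λ j _ → M-* (M-const (Dv-ι p)) (h 0 (a ∔ j · p))))
   (M-weaken (Nat.≤-reflexive (sym (Nat.+-identityʳ E))) (M-conv K (λ j _ → h 1 j) (λ j _ → A-val 0 (a ∔ j · p))))

  -- With φ > 0 each product A_r(n) H_r(n) is divisible by p on its own, and so are both
  -- convolutions.
  numerator-slack : 1 ≤ φ → ∀ a K → M₀ 1 (numerator a K)
  numerator-slack φ≥1 = AH⇒numerator 1 (λ r n → A-H (λ m → m) 1 Nat.≤-refl r n (λ i k l o → A-ord φ≥1 i r n k l o) (λ _ → A-val r n))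

  numerator-slack-β : 1 ≤ φ → ∀ e → 1 ≤ e → e₁ ≡ e₂ ∔ e → (∀ g → g ∈ βs → Raw.N g ≡ 1) → ∀ a K → M₀ e (numerator a K)
  numerator-slack-β φ≥1 e e≥1 e-eq β-int = AH⇒numerator e (λ r n → A-H (λ m → m) e e≥1 r n (λ i k l o → A-int-β-ord φ≥1 i r n k l o)
    (λ n≥1 → M-weaken (Nat.≤-trans (Nat.m∸n≤m e 1) (Nat.m≤n+m e _)) (A-int-β r n 0 n≥1)))
   where open IntegerDenominators e e-eq β-int

  module Quotients (W : ℕ → ℕ → ℕ → ℚ) (W-conv : ∀ r n t → Ω t → conv (λ i → A r i t) (λ i → W r i t) n ≡ A r n t * H r n t) where
   difference : ℕ → ℕ → ℚ
   difference n t = sp (λ i → W 1 i t) n - π * W 0 n t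

   difference-M : ∀ {lev k} (emb : ∀ {k f} → M₀ k f → M lev k f) → (∀ a K → a < p → M lev k (numerator a K)) → ∀ n → M lev k (difference n)
   difference-M emb h = logDifference (A 0) (A 1) (λ n t → A 0 n t * H 0 n t) (λ n t → A 1 n t * H 1 n t) (W 0) (W 1) (λ t _ → A-0 0 t) (λ t _ → A-0 1 t)
    (λ n → emb (A-val 0 n)) (λ n → emb (A-val 1 n)) (λ n t o → W-conv 0 n t o) (λ n t o → W-conv 1 n t o) h

-- Translation to the function algebras, signs and shifts of the statement.

module Translation (p : ℕ) (pp : Prime p) (ν D b : ℕ) (D≥1 : 1 ℕ.≤ D) (b≥1 : 1 ℕ.≤ b) (D-p : Cop.Coprime D p) (b-D : Cop.Coprime b D) where
 open import Data.Nat.Base using (_+_; _*_; _∸_; _^_; _≤_)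
 open import Defs using (ModEq)

 open Reduced p pp ν D b D≥1 b≥1 D-p b-D renaming (κ to κ₀)
 open Averaging p pp ν D b D≥1 b≥1 D-p b-D
 open Valuations p pp ν D b D≥1 b≥1 D-p b-D
 open Fractional p pp ν D b D≥1 b≥1 D-p b-D
 open Coefficient p pp ν D b D≥1 b≥1 D-p b-D
 open Counts p
 open Q using (ι; ιz; inv; 0#; 1#; _↑_)
 open Padic p pp
 open Filt Ω
 open Parameters p pp Ω using (IntP; NonP; Param; int; non; p∣?_; p≟2; 4∣?_; κ; flag)
 open SignedProducts p pp Ω
 open Digit p pp Ω using (b2n; nzp)
 open Counting p pp Ω using (res; module Res)
 import Defs
 open import Data.Nat.Properties
 open import Data.Nat.Divisibility
 open import Data.Bool.Base using (_∧_)
 open import Data.List.Base using (_++_; length; filter)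
 open import Data.List.Properties using (filter-++; length-++)
 open import Data.List.Relation.Unary.All using (All; []; _∷_)
 open import Relation.Nullary.Decidable using (dec-true; dec-false)
 open +-*-Solver

 Dv⇒Z-quotient : ∀ {k x} → Dv k x → Z (x Q.* inv (ι (p ^ k)))
 Dv⇒Z-quotient {k} (dmk q zq e) = subst Z (sym (trans (cong₂ (λ a c → a Q.* inv c) e (Q.ι-^ p k)) (trans (Q.solve 3 (λ a q i → (a Q.:* q) Q.:* i Q.:= (a Q.:* i) Q.:* q) refl (π ↑ k) q (inv (π ↑ k)))
  (trans (cong (Q._* q) (Q.inv-r {π ↑ k} (Q.↑-≢0 k π≢0))) (Q.*-idˡ q))))) zq

 opaque
  unfolding Q._+_
  Z⇒CongP : ∀ m x y → Z ((x Q.- y) Q.* inv (ι (p ^ m))) → Defs.CongP p ν D b m x y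
  Z⇒CongP m x y = Z⇒InZp

  powZ-pos : ∀ n x → Defs.powZ p (ℤ.+ n) ℚ.* x ≡ ι (p ^ n) Q.* x
  powZ-pos n x = refl

  powZ-neg : ∀ n x → Defs.powZ p ℤ.-[1+ n ] ℚ.* x ≡ inv (ι (p ^ suc n)) Q.* x
  powZ-neg n x = refl

 M₀⇒InA : ∀ {f} → M₀ 0 f → Defs.InA p ν D b f
 M₀⇒InA {f} h = (λ t o → Z⇒InZp (Dv⇒Z (val h t o))) , go
  where
  go : ∀ m → 1 ≤ m → ∀ t₁ t₂ → Ω t₁ → Ω t₂ → ModEq (p ^ m) t₁ t₂ → Defs.CongP p ν D b m (f t₁) (f t₂)
  go (suc m) _ t₁ t₂ o₁ o₂ e = Z⇒CongP (suc m) (f t₁) (f t₂) (Dv⇒Z-quotient (dif h m t₁ t₂ o₁ o₂ e))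

 M₁⇒InA* : ∀ {f} → M₁ 0 f → Defs.InA* p ν D b f
 M₁⇒InA* {f} h = (λ t o → Z⇒InZp (Dv⇒Z (val h t o))) , go
  where
  go : ∀ m → 1 ≤ m → ∀ t₁ t₂ → Ω t₁ → Ω t₂ → ModEq (p ^ m) t₁ t₂ → Defs.CongP p ν D b (m ∸ 1) (f t₁) (f t₂)
  go (suc m) _ t₁ t₂ o₁ o₂ e = Z⇒CongP m (f t₁) (f t₂) (Dv⇒Z-quotient (dif h m t₁ t₂ o₁ o₂ e))

 M₀⇒InPowA : ∀ {E k f} → E ℤ.≤ ℤ.+ k → M₀ k f → Defs.InPowA p ν D b E f
 M₀⇒InPowA {E} {k} {f} E≤ h = M₀⇒InA (go (ℤ.- E) (subst (ℤ._≤ ℤ.+ k) (sym (ℤₚ.neg-involutive E)) E≤))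
  where
  go : ∀ z → ℤ.- z ℤ.≤ ℤ.+ k → M₀ 0 (λ t → Defs.powZ p z ℚ.* f t)
  go (ℤ.+ n) _ = M-resp (λ t _ → sym (powZ-pos n (f t))) (M-* {i = 0} {j = 0} (M-const (Dv-ι (p ^ n))) (M-weaken z≤n h))
  go ℤ.-[1+ n ] le′ = M-cancel (suc n) (M-resp (λ t _ → sym (eq t)) (M-weaken (≤-trans (≤-reflexive (+-identityʳ (suc n))) (ℤₚ.drop‿+≤+ le′)) h))
   where
   eq : ∀ t → π ↑ suc n Q.* (Defs.powZ p ℤ.-[1+ n ] ℚ.* f t) ≡ f t
   eq t = trans (cong (π ↑ suc n Q.*_) (trans (powZ-neg n (f t)) (cong (λ z → inv z Q.* f t) (Q.ι-^ p (suc n))))) (trans (sym (Q.*-assoc (π ↑ suc n) _ (f t)))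
    (trans (cong (Q._* f t) (Q.inv-r {π ↑ suc n} (Q.↑-≢0 (suc n) π≢0))) (Q.*-idˡ (f t))))

 M-divide-π : ∀ {lev k f} → M lev (suc k) f → M lev k (λ t → inv π Q.* f t)
 M-divide-π {lev} {k} {f} h = M-cancel 1 (M-resp (λ t _ → sym (trans (cong (Q._* (inv π Q.* f t)) (Q.*-idʳ π)) (trans (sym (Q.*-assoc π (inv π) (f t))) (trans (cong (Q._* f t) (Q.inv-r {π} π≢0)) (Q.*-idˡ (f t)))))) h)

 scaleD-any : ∀ x h d d' → scaleD (mkRaw x h) d ≡ scaleDec x d'
 scaleD-any x h (yes _) (yes _) = refl
 scaleD-any x h (no _) (no _) = refl
 scaleD-any x h (yes a) (no c) = ⊥-elim (c a)
 scaleD-any x h (no a) (yes c) = ⊥-elim (a c)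

 prodR-scale : ∀ l hs → prodR (raws l hs) scaleR ≡ prodScale l
 prodR-scale [] [] = refl
 prodR-scale (x ∷ l) (h ∷ hs) = cong₂ Q._*_ (scaleD-any x h (p∣?_ (↧ₙ x)) (p ∣? ↧ₙ x)) (prodR-scale l hs)

 isI-any : ∀ x h d (d' : Dec (p ∣ ↧ₙ x)) → isI (fromDec (mkRaw x h) d) ≡ bit (not (does d'))
 isI-any x h (yes _) (yes _) = refl
 isI-any x h (no _) (no _) = refl
 isI-any x h (yes a) (no c) = ⊥-elim (c a)
 isI-any x h (no a) (yes c) = ⊥-elim (a c)

 sumP-isI : ∀ l hs → sumP (raws l hs) isI ≡ integralCount l
 sumP-isI [] [] = refl
 sumP-isI (x ∷ l) (h ∷ hs) = trans (cong₂ _+_ (isI-any x h (p∣?_ (↧ₙ x)) (p ∣? ↧ₙ x)) (sumP-isI l hs)) (sym (integralCount-∷ x l))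

 sumL-length : ∀ l hs → sumL (raws l hs) (λ _ → 1) ≡ length l
 sumL-length [] [] = refl
 sumL-length (x ∷ l) (h ∷ hs) = cong suc (sumL-length l hs)

 κ-pow : ∀ b → κ 1 b ≡ (Q.- 1#) ↑ b2n b
 κ-pow true = sym (Q.*-idʳ _)
 κ-pow false = refl

 module _ (p2 : p ≡ 2) where
  private
   not4 : Param → ℕ
   not4 (int q) = 1
   not4 (non q) = b2n (not (does (4∣? NonP.N q)))

   κ-flag : ∀ g → κ 1 (flag g) ≡ (Q.- 1#) ↑ not4 g
   κ-flag (int q) = trans (cong (κ 1) (dec-true p≟2 p2)) (κ-pow true)
   κ-flag (non q) = trans (cong (λ z → κ 1 (z ∧ not (does (4∣? NonP.N q)))) (dec-true p≟2 p2)) (κ-pow (not (does (4∣? NonP.N q))))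

   not4-1 : ∀ x h d → not4 (fromDec (mkRaw x h) d) + b2n (does (4 ∣? ↧ₙ x)) ≡ 1
   not4-1 x h (no nd) = cong (λ z → 1 + b2n z) (dec-false (4 ∣? ↧ₙ x) (λ d4 → nd (subst (_∣ ↧ₙ x) (sym p2) (∣-trans (divides 2 refl) d4))))
   not4-1 x h (yes d) = two (4∣? (↧ₙ x)) (4 ∣? ↧ₙ x)
    where
    two : ∀ {A : Set} (a c : Dec A) → b2n (not (does a)) + b2n (does c) ≡ 1
    two (yes _) (yes _) = refl
    two (no _) (no _) = refl
    two (yes a) (no c) = ⊥-elim (c a)
    two (no a) (yes c) = ⊥-elim (a c)

   not4-count : ∀ l hs → sumP (raws l hs) not4 + length (filter (λ q → 4 ∣? ↧ₙ q) l) ≡ length l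
   not4-count [] [] = refl
   not4-count (x ∷ l) (h ∷ hs) = trans (cong (sumP (raws (x ∷ l) (h ∷ hs)) not4 +_) (length-filter-∷ (λ q → 4 ∣? ↧ₙ q) x l))
    (trans (solve 4 (λ a c e f → (a :+ c) :+ (e :+ f) := (a :+ e) :+ (c :+ f)) refl (not4 (toParam (mkRaw x h))) (sumP (raws l hs) not4) (b2n (does (4 ∣? ↧ₙ x))) (length (filter (λ q → 4 ∣? ↧ₙ q) l)))
     (cong₂ _+_ (not4-1 x h (p∣?_ (↧ₙ x))) (not4-count l hs)))

   neg1-even : ∀ k → (Q.- 1#) ↑ (k * 2) ≡ 1#
   neg1-even k = trans (Q.↑-* (Q.- 1#) k 2) (trans (cong (_↑ k) (Q.solve 1 (λ o → (Q.:- Q.:1) Q.:* ((Q.:- Q.:1) Q.:* Q.:1) Q.:= Q.:1) refl 1#)) (Q.1↑ k))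

   inv-neg1 : inv (Q.- 1#) ≡ Q.- 1#
   inv-neg1 = sym (Q.inv-unique (Q.- 1#) (Q.- 1#) (Q.solve 1 (λ o → (Q.:- Q.:1) Q.:* (Q.:- Q.:1) Q.:= Q.:1) refl 1#))

  -- Each parameter whose denominator is not divisible by 4 gives one sign -1. Of the 2r parameters,
  -- all but 𝔪 are of this kind, so the product depends on the parity of 𝔪 alone.
  κ-product-2 : ∀ lα lβ hα hβ → length lα ≡ length lβ → 2 ∣ length (filter (λ q → 4 ∣? ↧ₙ q) (lα ++ lβ)) → prodS (sg (raws lα hα) (raws lβ hβ)) (λ g → κ 1 (flag g)) ≡ 1#
  κ-product-2 lα lβ hα hβ same d2 = trans (prodS-ext (sg (raws lα hα) (raws lβ hβ)) κ-flag) (trans (prodS-sg (Q.- 1#) (raws lα hα) (raws lβ hβ) not4)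
    (trans (cong ((Q.- 1#) ↑ a Q.*_) (trans (Q.inv-↑ (Q.- 1#) c) (cong (_↑ c) inv-neg1))) (trans (sym (Q.↑-+ (Q.- 1#) a c)) (trans (cong ((Q.- 1#) ↑_) (_∣_.equality even)) (neg1-even (quotient even))))))
   where
   a = sumP (raws lα hα) not4
   c = sumP (raws lβ hβ) not4
   m₄ : List ℚ → ℕ
   m₄ l = length (filter (λ q → 4 ∣? ↧ₙ q) l)
   total : m₄ (lα ++ lβ) + (a + c) ≡ length lβ * 2
   total = trans (cong (_+ (a + c)) (trans (cong length (filter-++ (λ q → 4 ∣? ↧ₙ q) lα lβ)) (length-++ (filter (λ q → 4 ∣? ↧ₙ q) lα))))
    (trans (solve 4 (λ x y a c → (x :+ y) :+ (a :+ c) := (a :+ x) :+ (c :+ y)) refl (m₄ lα) (m₄ lβ) a c)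
     (trans (cong₂ _+_ (trans (not4-count lα hα) same) (not4-count lβ hβ)) (solve 1 (λ x → x :+ x := x :* con 2) refl (length lβ))))
   even : 2 ∣ a + c
   even = ∣m+n∣m⇒∣n (subst (2 ∣_) (sym total) (n∣m*n (length lβ))) d2

 κ-product : ∀ lα lβ hα hβ → length lα ≡ length lβ → (p ≡ 2 → 2 ∣ length (filter (λ q → 4 ∣? ↧ₙ q) (lα ++ lβ))) → prodS (sg (raws lα hα) (raws lβ hβ)) (λ g → κ 1 (flag g)) ≡ 1#
 κ-product lα lβ hα hβ same d2 = go (p ≟ 2)
  where
  go : Dec (p ≡ 2) → prodS (sg (raws lα hα) (raws lβ hβ)) (λ g → κ 1 (flag g)) ≡ 1#
  go (yes e) = κ-product-2 e lα lβ hα hβ same (d2 e)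
  go (no ne) = trans (prodS-ext (sg (raws lα hα) (raws lβ hβ)) (λ g → cong (κ 1) (odd g))) (prodS-1 (sg (raws lα hα) (raws lβ hβ)))
   where
   odd : ∀ g → flag g ≡ false
   odd (int q) = dec-false p≟2 ne
   odd (non q) = cong (_∧ not (does (4∣? NonP.N q))) (dec-false p≟2 ne)

 residue-eq : ∀ x h s s' → s ≤ s' → p ^ ν * D ∣ s' ∸ s → resR (mkRaw x h) s ≡ resR (mkRaw x h) s'
 residue-eq x h s s' le′ d = Res.res-cong N {{nzN}} (s * num x) (s' * num x) (quotient Nd * num x) 0 (begin
   s * num x + quotient Nd * num x * N  ≡⟨ solve 4 (λ s a q n → s :* a :+ q :* a :* n := (s :+ q :* n) :* a) refl s (num x) (quotient Nd) N ⟩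
   (s + quotient Nd * N) * num x        ≡⟨ cong (_* num x) (trans (cong (s +_) (sym (_∣_.equality Nd))) (m+[n∸m]≡n le′)) ⟩
   s' * num x                           ≡⟨ +-identityʳ _ ⟨
   s' * num x + 0 * N                   ∎)
  where
  open ≡-Reasoning
  N = ↧ₙ x
  nzN : NonZero N
  nzN = ℕ.>-nonZero (↧≥1 x)
  Nd : N ∣ s' ∸ s
  Nd = ∣-trans h d

 frac-congruent : ∀ s s' → 1 ≤ s → 1 ≤ s' → (s ≤ s' → p ^ ν * D ∣ s' ∸ s) → (s' ≤ s → p ^ ν * D ∣ s ∸ s') → ∀ l → All Div l → Defs.fracMul s l ≡ Defs.fracMul s' l
 frac-congruent s s' h h' d d' [] [] = refl
 frac-congruent s s' h h' d d' (x ∷ l) (dx ∷ ds) = cong₂ _∷_ (trans (frac-scale x dx s h) (trans (cong (_/ᵘ ↧ₙ x) same) (sym (frac-scale x dx s' h')))) (frac-congruent s s' h h' d d' l ds)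
  where
  same : resR (mkRaw x dx) s ≡ resR (mkRaw x dx) s'
  same with ≤-total s s'
  ... | inj₁ le′ = residue-eq x dx s s' le′ (d le′)
  ... | inj₂ le′ = sym (residue-eq x dx s' s le′ (d' le′))

 congruent⇒∣ : ∀ {n x y k k'} → x ≤ y → x + k * n ≡ y + k' * n → n ∣ y ∸ x
 congruent⇒∣ {n} {x} {y} {k} {k'} le′ e = ∣m+n∣m⇒∣n (subst (n ∣_) (sym (+-cancelˡ-≡ x _ _ (trans (solve 3 (λ x k d → x :+ (k :+ d) := (x :+ d) :+ k) refl x (k' * n) (y ∸ x)) (trans (cong (_+ k' * n) (m+[n∸m]≡n le′)) (sym e))))) (n∣m*n k)) (n∣m*n k')

 module _ {t t₁ : ℕ} (t∈ : Ω t) (shift : Defs.IsShift1 p ν D b t t₁) where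
  private
   u : ℕ
   u = multiplier 1 t
   k₀ = k₁
   mod-ν = ModEq⇒∣ {p ^ ν} {t₁} {t} (proj₁ (proj₂ (proj₂ shift)))
   mod-D = ModEq⇒∣ {D} {p * t₁} {t} (proj₂ (proj₂ (proj₂ shift)))
   u-ν : u ≡ t + t * k₀ * p ^ ν
   u-ν = trans (cong (t *_) (trans (*-identityʳ _) κ-ν)) (solve 3 (λ t q k → t :* (con 1 :+ q :* k) := t :+ t :* k :* q) refl t (p ^ ν) k₀)
   u-D : p * u ≡ t + t * k₂ * D
   u-D = trans (cong (λ z → p * (t * z)) (*-identityʳ _)) (trans (solve 3 (λ p t k → p :* (t :* k) := t :* (p :* k)) refl p t κ₀) (trans (cong (t *_) κ-D) (solve 3 (λ t k d → t :* (con 1 :+ k :* d) := t :+ t :* k :* d) refl t k₂ D)))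
   eq-ν : t₁ + (proj₁ mod-ν + t * k₀) * p ^ ν ≡ u + proj₁ (proj₂ mod-ν) * p ^ ν
   eq-ν = glue t₁ u t (p ^ ν) (proj₁ mod-ν) (proj₁ (proj₂ mod-ν)) (t * k₀) (proj₂ (proj₂ mod-ν)) u-ν
    where
    glue : ∀ x y t n k k' s → x + k * n ≡ t + k' * n → y ≡ t + s * n → x + (k + s) * n ≡ y + k' * n
    glue x y t n k k' s e e' = trans (solve 4 (λ x k s n → x :+ (k :+ s) :* n := (x :+ k :* n) :+ s :* n) refl x k s n) (trans (cong (_+ s * n) e) (trans (solve 4 (λ t k s n → (t :+ k :* n) :+ s :* n := (t :+ s :* n) :+ k :* n) refl t k' s n) (cong (_+ k' * n) (sym e'))))
   eq-D : p * t₁ + (proj₁ mod-D + t * k₂) * D ≡ p * u + proj₁ (proj₂ mod-D) * D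
   eq-D = glue (p * t₁) (p * u) t D (proj₁ mod-D) (proj₁ (proj₂ mod-D)) (t * k₂) (proj₂ (proj₂ mod-D)) u-D
    where
    glue : ∀ x y t n k k' s → x + k * n ≡ t + k' * n → y ≡ t + s * n → x + (k + s) * n ≡ y + k' * n
    glue x y t n k k' s e e' = trans (solve 4 (λ x k s n → x :+ (k :+ s) :* n := (x :+ k :* n) :+ s :* n) refl x k s n) (trans (cong (_+ s * n) e) (trans (solve 4 (λ t k s n → (t :+ k :* n) :+ s :* n := (t :+ s :* n) :+ k :* n) refl t k' s n) (cong (_+ k' * n) (sym e'))))
   both : ∀ {Δ} → p ^ ν ∣ Δ → D ∣ p * Δ → p ^ ν * D ∣ Δ
   both {Δ} dν dD = go (Cop.coprime-divisor D-p dD)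
    where
    go : D ∣ Δ → p ^ ν * D ∣ Δ
    go (divides v e) = subst (p ^ ν * D ∣_) (sym e) (*-monoˡ-∣ D (Cop.coprime-divisor (Cop.sym (PNc ν p∤D)) (subst (p ^ ν ∣_) (trans e (*-comm v D)) dν)))
     where
     open Counting p pp Ω using () renaming (Coprime-^ to PNc)

   kν kν′ kD kD′ : ℕ
   kν = proj₁ mod-ν + t * k₀
   kν′ = proj₁ (proj₂ mod-ν)
   kD = proj₁ mod-D + t * k₂
   kD′ = proj₁ (proj₂ mod-D)

  -- t₁ and t κ agree modulo p^ν, and p t₁ and p t κ agree modulo D; hence t₁ and t κ agree modulo
  -- d, on which alone the fractional parts depend.
  shift-frac : ∀ l → All Div l → Defs.fracMul t₁ l ≡ Defs.fracMul (multiplier 1 t) l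
  shift-frac = frac-congruent t₁ u (proj₁ shift) (multiplier≥1 1 t t∈)
   (λ le′ → both (congruent⇒∣ {p ^ ν} {t₁} {u} {kν} {kν′} le′ eq-ν) (subst (D ∣_) (sym (*-distribˡ-∸ p u t₁)) (congruent⇒∣ {D} {p * t₁} {p * u} {kD} {kD′} (*-monoʳ-≤ p le′) eq-D)))
   (λ le′ → both (congruent⇒∣ {p ^ ν} {u} {t₁} {kν′} {kν} le′ (sym eq-ν)) (subst (D ∣_) (sym (*-distribˡ-∸ p t₁ u)) (congruent⇒∣ {D} {p * u} {p * t₁} {kD′} {kD} (*-monoʳ-≤ p le′) (sym eq-D))))

-- The passage from C to C' and the distinction of cases.

module Assembly where

 open Q using (ι; ιz; inv; 0#; 1#; _↑_)
 import Defs
 open Parameters using (flag) renaming (κ to κ₁)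
 open SignedProducts using (prodS)
 open import Data.Nat.Base using (_+_; _*_; _∸_; _^_; _≤_; _<_)
 open import Data.Nat.Properties
 open import Data.Nat.Divisibility
 open import Data.Nat.LCM using (lcm; m∣lcm[m,n]; n∣lcm[m,n]; lcm-least)
 import Data.Integer.Divisibility as ℤDiv
 import Data.Integer.Divisibility.Signed as ZS
 import Data.Integer.Solver as ℤSolver
 open import Data.Rational.Base using (floor)
 open import Data.Bool.Base using (_∧_)
 open import Data.List.Base using (_++_; length; filter; map; foldr)
 open import Data.List.Properties using (map-cong; length-++; filter-++)
 open import Data.List.Relation.Unary.All as All using (All; []; _∷_; all?)
 import Data.List.Relation.Unary.All.Properties as Allₚ
 open import Data.Vec.Base as Vec using (Vec; toList)
 import Data.Vec.Properties as Vecₚ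
 open import Relation.Nullary using (¬?)
 open import Relation.Nullary.Decidable using (dec-true; dec-false)

 denominators∣lcm : ∀ l → All (λ x → ↧ₙ x ∣ foldr lcm 1 (map ↧ₙ_ l)) l
 denominators∣lcm [] = []
 denominators∣lcm (x ∷ l) = m∣lcm[m,n] (↧ₙ x) d ∷ All.map (λ h → ∣-trans h (n∣lcm[m,n] (↧ₙ x) d)) (denominators∣lcm l)
  where d = foldr lcm 1 (map ↧ₙ_ l)

 module _ (p : ℕ) (pp : Prime p) where
  open Counts p
  open Padic p pp using (p∤1)

  integralCount-≤ : ∀ l → integralCount l ≤ length l
  integralCount-≤ [] = z≤n
  integralCount-≤ (x ∷ l) = ≤-trans (≤-reflexive (integralCount-∷ x l)) (+-mono-≤ (bit≤1 (not (does (p ∣? ↧ₙ x)))) (integralCount-≤ l))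
   where
   bit≤1 : ∀ b → bit b ≤ 1
   bit≤1 true = ≤-refl
   bit≤1 false = z≤n

  integralCount-< : ∀ l → p ∣ foldr lcm 1 (map ↧ₙ_ l) → integralCount l < length l
  integralCount-< [] d = ⊥-elim (p∤1 d)
  integralCount-< (x ∷ l) d = go (euclidsLemma (↧ₙ x) e pp (∣-trans d (lcm-least (m∣m*n e) (n∣m*n (↧ₙ x)))))
   where
   e = foldr lcm 1 (map ↧ₙ_ l)
   step : ∀ d → does (p ∣? ↧ₙ x) ≡ d → integralCount (x ∷ l) ≡ bit (not d) + integralCount l
   step d eq = trans (integralCount-∷ x l) (cong (λ z → bit (not z) + integralCount l) eq)
   go : p ∣ ↧ₙ x ⊎ p ∣ e → integralCount (x ∷ l) < suc (length l)
   go (inj₁ h) = s≤s (≤-trans (≤-reflexive (step true (dec-true (p ∣? ↧ₙ x) h))) (integralCount-≤ l))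
   go (inj₂ h) = s≤s (≤-trans (≤-reflexive (integralCount-∷ x l)) (≤-trans (+-monoˡ-≤ (integralCount l) (bit≤1 (not (does (p ∣? ↧ₙ x))))) (integralCount-< l h)))
    where
    bit≤1 : ∀ b → bit b ≤ 1
    bit≤1 true = ≤-refl
    bit≤1 false = z≤n

  integralCount-All : ∀ l → All (λ x → ↧ₙ x ≡ 1) l → integralCount l ≡ length l
  integralCount-All [] [] = refl
  integralCount-All (x ∷ l) (h ∷ hs) = trans (integralCount-∷ x l) (cong₂ (λ a b → bit (not a) + b) (dec-false (p ∣? ↧ₙ x) (λ d → p∤1 (subst (p ∣_) h d))) (integralCount-All l hs))

  four-free : p ≡ 2 → ∀ l → ¬ p ∣ foldr lcm 1 (map ↧ₙ_ l) → length (filter (λ q → 4 ∣? ↧ₙ q) l) ≡ 0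
  four-free e [] nd = refl
  four-free e (x ∷ l) nd = trans (filter-∷ (λ q → 4 ∣? ↧ₙ q) (dec-false (4 ∣? ↧ₙ x) (λ h → nd (∣-trans (subst (_∣ ↧ₙ x) (sym e) (∣-trans (divides 2 refl) h)) (m∣lcm[m,n] (↧ₙ x) (foldr lcm 1 (map ↧ₙ_ l)))))))
    (four-free e l (λ h → nd (∣-trans h (n∣lcm[m,n] (↧ₙ x) (foldr lcm 1 (map ↧ₙ_ l))))))
   where
   filter-∷ : ∀ {P : ℚ → Set} (P? : ∀ q → Dec (P q)) → does (P? x) ≡ false → length (filter P? (x ∷ l)) ≡ length (filter P? l)
   filter-∷ P? eq with does (P? x)
   filter-∷ P? refl | false = refl

 -- From λ + (p-1)(e+1) = φ ≥ 0 follows λ/(p-1) ≥ -(e+1), and the floor respects an integer bound.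
 -- Here e + 1 will be the exponent of the constant, and e what remains after dividing the
 -- difference by p.
 floor-bound : ∀ lam P e φ → 1 ≤ P → lam ℤ.+ ℤ.+ (P * suc e) ≡ ℤ.+ φ →
  ℤ.-_ (ℤ.+ 1) ℤ.- floor (Defs.fromℤ lam ℚ.* Defs.inv (Defs.fromℕ P)) ℤ.≤ ℤ.+ e
 floor-bound lam P e φ P≥1 eq = go (fl ℤ.+ ℤ.+ suc e) refl
  where
  y : ℚ
  y = Defs.fromℤ lam ℚ.* Defs.inv (Defs.fromℕ P)
  fl = floor y
  fs : Σ ℕ λ rm → rm < ↧ₙ y × ↥ y ≡ ℤ.+ rm ℤ.+ fl ℤ.* ℤ.+ ↧ₙ y
  fs = floor-spec′ y
   where
   import Data.Integer.DivMod as ℤD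
   floor-spec′ : ∀ y → Σ ℕ λ rm → rm < ↧ₙ y × ↥ y ≡ ℤ.+ rm ℤ.+ floor y ℤ.* ℤ.+ ↧ₙ y
   floor-spec′ (ℚ.mkℚ n d c) = n ℤD.% (ℤ.+ suc d) , ℤD.n%d<d n (ℤ.+ suc d) , ℤD.a≡a%n+[a/n]*n n (ℤ.+ suc d)
  rm = proj₁ fs
  N = ↧ₙ y
  y≡ : y ≡ ιz lam Q.* inv (ι P)
  y≡ = sym (trans (Q.*≡ (ιz lam) (inv (ι P))) (cong₂ ℚ._*_ (Q.ιz≡ lam) (trans (Q.inv≡ (ι P)) (cong Defs.inv (Q.ιz≡ (ℤ.+ P))))))
  P≢0 : ι P ≢ 0#
  P≢0 = Q.ι≢0 (λ e → <⇒≱ P≥1 (≤-reflexive e))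
  cross : (ι rm Q.+ ιz fl Q.* ι N) Q.* ι P ≡ ιz lam Q.* ι N
  cross = begin
   (ι rm Q.+ ιz fl Q.* ι N) Q.* ι P     ≡⟨ cong (Q._* ι P) (trans (cong (ι rm Q.+_) (sym (Q.ιz-* fl (ℤ.+ N)))) (trans (sym (Q.ιz-+ (ℤ.+ rm) (fl ℤ.* ℤ.+ N))) (trans (cong ιz (sym (proj₂ (proj₂ fs)))) (sym (Q.↧-clear y))))) ⟩
   y Q.* ι N Q.* ι P                    ≡⟨ cong (λ z → z Q.* ι N Q.* ι P) y≡ ⟩
   ιz lam Q.* inv (ι P) Q.* ι N Q.* ι P ≡⟨ Q.solve 4 (λ l i n p → l Q.:* i Q.:* n Q.:* p Q.:= (i Q.:* p) Q.:* (l Q.:* n)) refl (ιz lam) (inv (ι P)) (ι N) (ι P) ⟩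
   (inv (ι P) Q.* ι P) Q.* (ιz lam Q.* ι N) ≡⟨ trans (cong (Q._* (ιz lam Q.* ι N)) (Q.inv-l {ι P} P≢0)) (Q.*-idˡ _) ⟩
   ιz lam Q.* ι N                       ∎
   where open ≡-Reasoning
  go : ∀ s → fl ℤ.+ ℤ.+ suc e ≡ s → ℤ.-_ (ℤ.+ 1) ℤ.- fl ℤ.≤ ℤ.+ e
  go (ℤ.+ k) h = subst (λ z → z ℤ.≤ ℤ.+ e) (trans (cong (λ z → ℤ.+ e ℤ.- z) (trans (sym h) (cong (λ w → fl ℤ.+ w) (ℤₚ.pos-+ 1 e))))
    (S.solve 2 (λ f e → e S.:- (f S.:+ (S.con (ℤ.+ 1) S.:+ e)) S.:= S.con (ℤ.- (ℤ.+ 1)) S.:- f) refl fl (ℤ.+ e))) (ℤₚ.i-j≤i (ℤ.+ e) (ℤ.+ k))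
   where module S = ℤSolver.+-*-Solver
  go ℤ.-[1+ j ] h = ⊥-elim (<⇒≱ (*-monoˡ-< P {{ℕ.>-nonZero P≥1}} (proj₁ (proj₂ fs))) (≤-trans (m≤m+n (N * P) _) (≤-trans (m≤n+m (suc j * (N * P)) (φ * N)) (≤-reflexive (sym nat)))))
   where
   hq : ιz fl Q.+ ι (suc e) ≡ Q.- ι (suc j)
   hq = trans (sym (Q.ιz-+ fl (ℤ.+ suc e))) (trans (cong ιz h) (Q.ιz-neg (ℤ.+ suc j)))
   lq : ιz lam Q.+ ι P Q.* ι (suc e) ≡ ι φ
   lq = trans (cong (ιz lam Q.+_) (sym (Q.ι-* P (suc e)))) (trans (sym (Q.ιz-+ lam (ℤ.+ (P * suc e)))) (cong ιz eq))
   nat : rm * P ≡ φ * N + suc j * (N * P)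
   nat = Q.ι-injective (begin
    ι (rm * P)                                                ≡⟨ Q.ι-* rm P ⟩
    ι rm Q.* ι P                                              ≡⟨ Q.solve 4 (λ r f n p → r Q.:* p Q.:= (r Q.:+ f Q.:* n) Q.:* p Q.:- f Q.:* (n Q.:* p)) refl (ι rm) (ιz fl) (ι N) (ι P) ⟩
    (ι rm Q.+ ιz fl Q.* ι N) Q.* ι P Q.- ιz fl Q.* (ι N Q.* ι P) ≡⟨ cong (Q._- ιz fl Q.* (ι N Q.* ι P)) cross ⟩
    ιz lam Q.* ι N Q.- ιz fl Q.* (ι N Q.* ι P)                ≡⟨ Q.solve 5 (λ l n f p e → l Q.:* n Q.:- f Q.:* (n Q.:* p) Q.:= (l Q.:+ p Q.:* e) Q.:* n Q.:- (f Q.:+ e) Q.:* (n Q.:* p)) refl (ιz lam) (ι N) (ιz fl) (ι P) (ι (suc e)) ⟩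
    (ιz lam Q.+ ι P Q.* ι (suc e)) Q.* ι N Q.- (ιz fl Q.+ ι (suc e)) Q.* (ι N Q.* ι P) ≡⟨ cong₂ (λ a b → a Q.* ι N Q.- b Q.* (ι N Q.* ι P)) lq hq ⟩
    ι φ Q.* ι N Q.- (Q.- ι (suc j)) Q.* (ι N Q.* ι P)         ≡⟨ Q.solve 3 (λ a j m → a Q.:- (Q.:- j) Q.:* m Q.:= a Q.:+ j Q.:* m) refl (ι φ Q.* ι N) (ι (suc j)) (ι N Q.* ι P) ⟩
    ι φ Q.* ι N Q.+ ι (suc j) Q.* (ι N Q.* ι P)               ≡⟨ cong₂ Q._+_ (sym (Q.ι-* φ N)) (trans (cong (ι (suc j) Q.*_) (sym (Q.ι-* N P))) (sym (Q.ι-* (suc j) (N * P)))) ⟩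
    ι (φ * N) Q.+ ι (suc j * (N * P))                         ≡⟨ Q.ι-+ (φ * N) _ ⟨
    ι (φ * N + suc j * (N * P))                               ∎)
    where open ≡-Reasoning

 opaque
  unfolding Q._+_
  fromℕ-* : ∀ n x → Defs.fromℕ n ℚ.* x ≡ ι n Q.* x
  fromℕ-* n x = refl

  scaleSer-↑ : ∀ c s n → Defs.scaleSer c s n ≡ c ↑ n Q.* s n
  scaleSer-↑ c s n = cong (λ z → z Q.* s n) (Q.powQ≡↑ c n)

  difference≡ : ∀ {x x′ y y′} n → x ≡ x′ → y ≡ y′ → x ℚ.- Defs.fromℕ n ℚ.* y ≡ x′ Q.- ι n Q.* y′
  difference≡ n refl refl = refl

  fromℕ-1 : ∀ x → Defs.fromℕ 1 ℚ.* x ≡ x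
  fromℕ-1 = ℚₚ.*-identityˡ

  fromℤ-1 : ∀ x → x ≡ Defs.fromℤ (ℤ.+ 1) ℚ.* x
  fromℤ-1 x = sym (ℚₚ.*-identityˡ x)

  positive⇒≢0 : ∀ {x} → ℚ.0ℚ ℚ.< x → x ≢ 0#
  positive⇒≢0 h e = ℚₚ.<-irrefl (sym e) h

 -- The effect of the factor 2 in C'. For odd p it is absorbed into the unit. For p = 2 it raises e₁
 -- by one and makes the slope inequality strict, so the doubled case falls under φ ≥ 1.
 record Adjusted (p : ℕ) (pp : Prime p) (x : ℚ) (e₂ Iα Iβ : ℕ) (doubled : Bool) : Set where
  open Padic p pp
  field
   e₁ : ℕ
   u : ℚ
   u-unit : UnitQ u
   decomposed : x ≡ π ↑ e₁ Q.* inv (π ↑ e₂) Q.* u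
   slope : (p ∸ 1) * e₂ + Iβ ≤ (p ∸ 1) * e₁ + Iα
   slack : doubled ≡ true → p ≡ 2 → suc ((p ∸ 1) * e₂ + Iβ) ≤ (p ∸ 1) * e₁ + Iα

 adjust : ∀ p pp C W e₁ e₂ u Iα Iβ → Padic.UnitQ p pp u → C Q.* W ≡ Padic.π p pp ↑ e₁ Q.* inv (Padic.π p pp ↑ e₂) Q.* u →
  (p ∸ 1) * e₂ + Iβ ≤ (p ∸ 1) * e₁ + Iα → ∀ doubled → Adjusted p pp ((if doubled then Defs.fromℕ 2 ℚ.* C else C) Q.* W) e₂ Iα Iβ doubled
 adjust p pp C W e₁ e₂ u Iα Iβ uu eq sl false = record { e₁ = e₁ ; u = u ; u-unit = uu ; decomposed = eq ; slope = sl ; slack = λ () }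
 adjust p pp C W e₁ e₂ u Iα Iβ uu eq sl true = go (p ≟ 2)
  where
  open Padic p pp
  twice : ∀ z → C Q.* W ≡ z → (Defs.fromℕ 2 ℚ.* C) Q.* W ≡ ι 2 Q.* z
  twice z h = trans (cong (Q._* W) (fromℕ-* 2 C)) (trans (Q.*-assoc (ι 2) C W) (cong (ι 2 Q.*_) h))
  go : Dec (p ≡ 2) → Adjusted p pp ((Defs.fromℕ 2 ℚ.* C) Q.* W) e₂ Iα Iβ true
  go (yes e) = record { e₁ = suc e₁ ; u = u ; u-unit = uu
   ; decomposed = trans (twice _ eq) (trans (cong (λ n → ι n Q.* (π ↑ e₁ Q.* inv (π ↑ e₂) Q.* u)) (sym e)) (Q.solve 4 (λ p a b u → p Q.:* ((a Q.:* b) Q.:* u) Q.:= ((p Q.:* a) Q.:* b) Q.:* u) refl π (π ↑ e₁) (inv (π ↑ e₂)) u))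
   ; slope = <⇒≤ lt ; slack = λ _ _ → lt }
   where
   lt : suc ((p ∸ 1) * e₂ + Iβ) ≤ (p ∸ 1) * suc e₁ + Iα
   lt = ≤-trans (s≤s sl) (≤-trans (+-monoˡ-≤ ((p ∸ 1) * e₁ + Iα) (m<n⇒0<n∸m 1<p)) (≤-reflexive (trans (sym (+-assoc (p ∸ 1) _ Iα)) (cong (_+ Iα) (sym (*-suc (p ∸ 1) e₁))))))
  go (no ne) = record { e₁ = e₁ ; u = u Q.* ι 2 ; u-unit = UnitQ-* uu (UnitQ-ι (λ d → ne (≤-antisym (∣⇒≤ d) 1<p)))
   ; decomposed = trans (twice _ eq) (Q.solve 4 (λ t a b u → t Q.:* ((a Q.:* b) Q.:* u) Q.:= (a Q.:* b) Q.:* (u Q.:* t)) refl (ι 2) (π ↑ e₁) (inv (π ↑ e₂)) u)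
   ; slope = sl ; slack = λ _ e → ⊥-elim (ne e) }

 module Final (r : ℕ) (α β : Vec ℚ r) (H : Defs.Hαβ α β) (p : ℕ) (pp : Prime p) (ν D : ℕ) (dEq : Defs.dαβ α β ≡ p ^ ν * D) (D-p : Cop.Coprime D p)
  (b : ℕ) (b≥1 : 1 ≤ b) (D≥1 : 1 ≤ D) (b-D : Cop.Coprime b D) (C : ℚ) (isC : Defs.IsCconst (toList (Vec.map Defs.frac α)) (toList (Vec.map Defs.frac β)) C) where

  open Counts p
  open Padic p pp
  open Filt (Reduced.Ω p pp ν D b D≥1 b≥1 D-p b-D)
  open Reduced p pp ν D b D≥1 b≥1 D-p b-D using (Ω; Raw)
  open Averaging p pp ν D b D≥1 b≥1 D-p b-D using (sumL)
  open Valuations p pp ν D b D≥1 b≥1 D-p b-D using (sumP)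
  open Fractional p pp ν D b D≥1 b≥1 D-p b-D using (raws; Div; ∈-raws; module FromH)
  open Coefficient p pp ν D b D≥1 b≥1 D-p b-D using (multiplier; module Coefficients)
  open Translation p pp ν D b D≥1 b≥1 D-p b-D
  open Numerator p pp ν D b D≥1 b≥1 D-p b-D using (module Membership)

  lα lβ : List ℚ
  lα = toList α
  lβ = toList β

  divisors : All Div (lα ++ lβ)
  divisors = subst (λ d → All (λ x → ↧ₙ x ∣ d) (lα ++ lβ)) dEq (denominators∣lcm (lα ++ lβ))
  hα : All Div lα
  hα = Allₚ.++⁻ˡ lα divisors
  hβ : All Div lβ
  hβ = Allₚ.++⁻ʳ lα divisors

  Iα Iβ : ℕ
  Iα = integralCount lα
  Iβ = integralCount lβ

  W : ℚ
  W = inv (prodScale lα Q.* inv (prodScale lβ))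

  C≢0 : C ≢ 0#
  C≢0 = positive⇒≢0 (proj₁ isC)

  module D₀ = Slope.Decomposition (Slope.decompose p pp ν D b D≥1 b≥1 D-p b-D (C Q.* W) (Q.*-≢0 C≢0 (Q.inv-≢0 {prodScale lα Q.* inv (prodScale lβ)} (Q.*-≢0 (prodScale≢0 lα) (Q.inv-≢0 {prodScale lβ} (prodScale≢0 lβ))))))

  -- The constant C concerns the parameters themselves, that is t = 1.
  private
   1-D : Cop.Coprime 1 D
   1-D = Cop.1-coprimeTo D
   module Z₁ = Fractional p pp ν D 1 D≥1 ≤-refl D-p 1-D
   module S₁ = Coefficient p pp ν D 1 D≥1 ≤-refl D-p 1-D
   module R₁ = Translation p pp ν D 1 D≥1 ≤-refl D-p 1-D
   module W₁ = Valuations.Valuation p pp ν D 1 D≥1 ≤-refl D-p 1-D (Z₁.raws lα hα) (Z₁.raws lβ hβ) D₀.e₁ D₀.e₂ D₀.unit D₀.isUnit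

   1∈Ω : Reduced.Ω p pp ν D 1 D≥1 ≤-refl D-p 1-D 1
   1∈Ω = ≤-refl , *-mono-≤ (m^n>0 p {{ℕ.>-nonZero (<⇒≤ 1<p)}} ν) D≥1 , Cop.1-coprimeTo (p ^ ν * D) , (D ∣0)

   module Co₁ = S₁.Coefficients lα lβ hα hβ C W₁.c (trans (sym D₀.decomposed) (cong (C Q.*_) (cong inv (cong₂ (λ x y → x Q.* inv y) (sym (R₁.prodR-scale lα hα)) (sym (R₁.prodR-scale lβ hβ))))))

   frac-list : ∀ {n} (v : Vec ℚ n) → toList (Vec.map Defs.frac v) ≡ Defs.fracMul (S₁.multiplier 0 1) (toList v)
   frac-list v = trans (Vecₚ.toList-map Defs.frac v) (map-cong (λ x → cong Defs.frac (sym (fromℕ-1 x))) (toList v))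

   integral₁ : ∀ n → Z (W₁.A 0 n 1)
   integral₁ n = subst Z (sym (Co₁.A-F 0 n 1 1∈Ω)) (subst Z (trans (scaleSer-↑ C (Defs.Fser (toList (Vec.map Defs.frac α)) (toList (Vec.map Defs.frac β))) n) (cong₂ (λ x y → C ↑ n Q.* Defs.Fser x y n) (frac-list α) (frac-list β)))
    (InZp⇒Z (λ d → p∤1 (subst (p ∣_) (proj₂ (proj₂ isC C) (ℤ.+ 1 , fromℤ-1 C) n) d))))

  slope₀ : (p ∸ 1) * D₀.e₂ + Iβ ≤ (p ∸ 1) * D₀.e₁ + Iα
  slope₀ = subst₂ _≤_ (cong ((p ∸ 1) * D₀.e₂ +_) (R₁.sumP-isI lβ hβ)) (cong ((p ∸ 1) * D₀.e₁ +_) (R₁.sumP-isI lα hα))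
   (Slope.slope-nonneg p pp ν D 1 D≥1 ≤-refl D-p 1-D (Z₁.raws lα hα) (Z₁.raws lβ hβ) D₀.e₁ D₀.e₂ D₀.unit D₀.isUnit 1 1∈Ω integral₁)

  doubled : Bool
  doubled = not (Defs.betaIntᵇ α β) ∧ does (¬? (2 ∣? Defs.𝔪 α β))

  C′ : ℚ
  C′ = Defs.C′ α β C

  module Ad = Adjusted (adjust p pp C W D₀.e₁ D₀.e₂ D₀.unit Iα Iβ D₀.isUnit D₀.decomposed slope₀ doubled)

  P e₁ e₂ φ : ℕ
  P = p ∸ 1
  e₁ = Ad.e₁
  e₂ = D₀.e₂
  φ = (P * e₁ + Iα) ∸ (P * e₂ + Iβ)

  balance : P * e₁ + Iα ≡ P * e₂ + Iβ + φ
  balance = sym (m+[n∸m]≡n Ad.slope)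

  αs βs : List Raw
  αs = raws lα hα
  βs = raws lβ hβ

  lengths : length lα ≡ length lβ
  lengths = trans (Vecₚ.length-toList α) (sym (Vecₚ.length-toList β))

  same-length : sumL αs (λ _ → 1) ≡ sumL βs (λ _ → 1)
  same-length = trans (sumL-length lα hα) (trans lengths (sym (sumL-length lβ hβ)))

  open Membership αs βs same-length (FromH.hnat α β dEq H hα hβ) e₁ e₂ φ
   (trans (cong (P * e₁ +_) (sumP-isI lα hα)) (trans balance (cong (λ z → P * e₂ + z + φ) (sym (sumP-isI lβ hβ))))) Ad.u Ad.u-unit

  module Co = Coefficients lα lβ hα hβ C′ (π ↑ e₁ Q.* inv (π ↑ e₂) Q.* Ad.u)
   (trans (sym Ad.decomposed) (cong (C′ Q.*_) (cong inv (cong₂ (λ x y → x Q.* inv y) (sym (prodR-scale lα hα)) (sym (prodR-scale lβ hβ))))))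

  open Quotients Co.quotient (λ r n t o → Co.quotient-conv r n t o)

  R : ℕ → ℕ → ℚ
  R k t = inv π Q.* difference k t

  equation : ∀ t → Ω t → ∀ t₁ → Defs.IsShift1 p ν D b t t₁ → ∀ k →
   Defs.subPowSer C′ p (Defs.SerDiv.quot (Defs.Fser (Defs.fracMul t₁ lα) (Defs.fracMul t₁ lβ)) (Defs.Gser (Defs.fracMul t₁ lα) (Defs.fracMul t₁ lβ))) k
    ℚ.- Defs.fromℕ p ℚ.* Defs.scaleSer C′ (Defs.SerDiv.quot (Defs.Fser (Defs.fracMul t lα) (Defs.fracMul t lβ)) (Defs.Gser (Defs.fracMul t lα) (Defs.fracMul t lβ))) k
    ≡ Defs.fromℕ p ℚ.* R k t
  equation t o t₁ sh k = trans (difference≡ p first second) (sym (trans (fromℕ-* p (R k t)) (trans (sym (Q.*-assoc π (inv π) (difference k t))) (trans (cong (Q._* difference k t) (Q.inv-r {π} π≢0)) (Q.*-idˡ _)))))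
   where
   quotFrac : List ℚ → List ℚ → ℕ → ℚ
   quotFrac γ δ = Defs.SerDiv.quot (Defs.Fser γ δ) (Defs.Gser γ δ)
   first : Defs.subPowSer C′ p (quotFrac (Defs.fracMul t₁ lα) (Defs.fracMul t₁ lβ)) k ≡ SeriesQuotient.sp p pp Ω (λ i → Co.quotient 1 i t) k
   first = trans (cong₂ (λ x y → Defs.subPowSer C′ p (quotFrac x y) k) (shift-frac {t} {t₁} o sh lα hα) (shift-frac {t} {t₁} o sh lβ hβ)) (SeriesQuotient.subPow-sp p pp Ω C′ (quotFrac (Defs.fracMul (multiplier 1 t) lα) (Defs.fracMul (multiplier 1 t) lβ)) k)
   second : Defs.scaleSer C′ (quotFrac (Defs.fracMul t lα) (Defs.fracMul t lβ)) k ≡ Co.quotient 0 k t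
   second = trans (cong (λ s → Defs.scaleSer C′ (quotFrac (Defs.fracMul s lα) (Defs.fracMul s lβ)) k) (sym (*-identityʳ t))) (scaleSer-↑ C′ (quotFrac (Defs.fracMul (multiplier 0 t) lα) (Defs.fracMul (multiplier 0 t) lβ)) k)

  Refined : Set
  Refined = p ∣ Defs.dαβ α β → ∀ k →
   (Defs.BetaInt α β → Defs.InPowA p ν D b (ℤ.-_ (ℤ.+ 1) ℤ.- floor (Defs.fromℤ (Defs.λp α β p) ℚ.* Defs.inv (Defs.fromℕ (p ∸ 1)))) (R k))
   × (¬ Defs.BetaInt α β → ¬ ((ℤ.+ (p ∸ 1)) ℤDiv.∣ Defs.λp α β p) → Defs.InA p ν D b (R k))
   × (¬ Defs.BetaInt α β → ¬ (2 ∣ Defs.𝔪 α β) → p ≡ 2 → Defs.InA p ν D b (R k))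

  Claim : Set
  Claim = (∀ k → Defs.InA* p ν D b (R k)) × Refined

  φ-cases : φ ≡ 0 ⊎ 1 ≤ φ
  φ-cases = go φ
   where
   go : ∀ n → n ≡ 0 ⊎ 1 ≤ n
   go zero = inj₁ refl
   go (suc n) = inj₂ (s≤s z≤n)

  private
   R-M₁ : ∀ {k} → M₁ 1 (difference k) → M₁ 0 (R k)
   R-M₁ h = M-divide-π h

   slack-InA : 1 ≤ φ → ∀ k → M₀ 0 (R k)
   slack-InA φ≥1 k = M-divide-π (difference-M (λ m → m) (λ a K _ → numerator-slack φ≥1 a K) k)

   strong-M₁ : φ ≡ 0 → (p ≡ 2 → 2 ∣ Defs.𝔪 α β) → ∀ k → M₁ 0 (R k)
   strong-M₁ φ0 even k = R-M₁ (difference-M M₀⇒M₁ (Tight.numerator-strong φ0 (κ-product lα lβ hα hβ lengths even)) k)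

   integral-numerators : Defs.BetaInt α β → ∀ g → g ∈ βs → Raw.N g ≡ 1
   integral-numerators bi g i = go (∈-raws lβ hβ i)
    where
    go : (Σ ℚ λ x → x ∈ lβ × Σ (Div x) λ h → g ≡ Fractional.mkRaw p pp ν D b D≥1 b≥1 D-p b-D x h) → Raw.N g ≡ 1
    go (x , ix , h , refl) = All.lookup bi ix

   -- p divides some denominator while all β are integers, so fewer α than β are p-integral; the
   -- slope inequality then forces e₁ > e₂.
   e-positive : Defs.BetaInt α β → p ∣ Defs.dαβ α β → e₂ < e₁
   e-positive bi pd = *-cancelˡ-< P e₂ e₁ (+-cancelʳ-< Iα (P * e₂) (P * e₁) (≤-trans (+-monoʳ-< (P * e₂) Iα<Iβ) Ad.slope))
    where
    Iβ-all : Iβ ≡ length lβ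
    Iβ-all = integralCount-All p pp lβ bi
    total : integralCount (lα ++ lβ) ≡ Iα + Iβ
    total = trans (cong length (filter-++ (λ q → ¬? (p ∣? ↧ₙ q)) lα lβ)) (length-++ (filter (λ q → ¬? (p ∣? ↧ₙ q)) lα))
    Iα<Iβ : Iα < Iβ
    Iα<Iβ = +-cancelʳ-< Iβ Iα Iβ (≤-trans (subst₂ _<_ total (length-++ lα) (integralCount-< p pp (lα ++ lβ) pd)) (≤-reflexive (cong₂ _+_ (trans lengths (sym Iβ-all)) (sym Iβ-all))))

   -- If 𝔪 were odd, C' would carry the factor 2 and φ would be positive.
   even-𝔪 : ¬ 1 ≤ φ → ¬ Defs.BetaInt α β → p ≡ 2 → 2 ∣ Defs.𝔪 α β
   even-𝔪 nφ nb p2 = go (2 ∣? Defs.𝔪 α β)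
    where
    go : Dec (2 ∣ Defs.𝔪 α β) → 2 ∣ Defs.𝔪 α β
    go (yes d) = d
    go (no nd) = ⊥-elim (nφ (m<n⇒0<n∸m (Ad.slack (cong₂ (λ x y → not x ∧ not y) (dec-false (all? (λ q → ↧ₙ q ≟ 1) lβ) nb) (dec-false (2 ∣? Defs.𝔪 α β) nd)) p2)))

   -- φ = 0 reads λ = (p-1)(e₂ - e₁).
   P∣λ : φ ≡ 0 → (ℤ.+ P) ℤDiv.∣ Defs.λp α β p
   P∣λ φ0 = ZS.∣⇒∣ᵤ (ZS.divides (ℤ.+ e₂ ℤ.- ℤ.+ e₁) (trans (S.solve 4 (λ a i c j → i S.:- j S.:= ((a S.:+ i) S.:- (c S.:+ j)) S.:+ (c S.:- a)) refl (ℤ.+ (P * e₁)) (ℤ.+ Iα) (ℤ.+ (P * e₂)) (ℤ.+ Iβ))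
     (trans (cong (λ z → z ℤ.+ (ℤ.+ (P * e₂) ℤ.- ℤ.+ (P * e₁))) (trans (cong₂ ℤ._-_ (sym (ℤₚ.pos-+ (P * e₁) Iα)) (sym (ℤₚ.pos-+ (P * e₂) Iβ))) (ℤₚ.i≡j⇒i-j≡0 (cong (λ z → ℤ.+ z) (trans balance (trans (cong (P * e₂ + Iβ +_) φ0) (+-identityʳ _)))))))
      (trans (ℤₚ.+-identityˡ _) (trans (cong₂ ℤ._-_ (ℤₚ.pos-* P e₂) (ℤₚ.pos-* P e₁)) (S.solve 3 (λ p a c → p S.:* a S.:- p S.:* c S.:= (a S.:- c) S.:* p) refl (ℤ.+ P) (ℤ.+ e₂) (ℤ.+ e₁)))))))
    where module S = ℤSolver.+-*-Solver

   InA : ∀ {k} → M₀ 0 (R k) → Defs.InA p ν D b (R k)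
   InA = M₀⇒InA

   slack-claim : 1 ≤ φ → ¬ Defs.BetaInt α β → Claim
   slack-claim φ≥1 nb = (λ k → M₁⇒InA* (M₀⇒M₁ (slack-InA φ≥1 k))) , λ _ k → (λ bi → ⊥-elim (nb bi)) , (λ _ _ → M₀⇒InA (slack-InA φ≥1 k)) , (λ _ _ _ → M₀⇒InA (slack-InA φ≥1 k))

   tight-claim : φ ≡ 0 → ¬ Defs.BetaInt α β → Claim
   tight-claim φ0 nb = (λ k → M₁⇒InA* (strong-M₁ φ0 even k)) , λ _ k → (λ bi → ⊥-elim (nb bi)) , (λ _ nd → ⊥-elim (nd (P∣λ φ0))) , (λ _ odd p2 → ⊥-elim (odd (even p2)))
    where
    even : p ≡ 2 → 2 ∣ Defs.𝔪 α β
    even = even-𝔪 (λ l → <⇒≱ l (≤-reflexive φ0)) nb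

   unramified-claim : ¬ p ∣ Defs.dαβ α β → Claim
   unramified-claim npd = (λ k → M₁⇒InA* (go φ-cases k)) , λ pd → ⊥-elim (npd pd)
    where
    go : φ ≡ 0 ⊎ 1 ≤ φ → ∀ k → M₁ 0 (R k)
    go (inj₁ φ0) k = strong-M₁ φ0 (λ p2 → subst (2 ∣_) (sym (four-free p pp p2 (lα ++ lβ) npd)) (2 ∣0)) k
    go (inj₂ φ≥1) k = M₀⇒M₁ (slack-InA φ≥1 k)

   β-claim : Defs.BetaInt α β → p ∣ Defs.dαβ α β → Claim
   β-claim bi pd = (λ k → M₁⇒InA* (M₀⇒M₁ (M-weaken z≤n (R-M k)))) , λ _ k → (λ _ → M₀⇒InPowA floor-≤ (R-M k)) , (λ nb → ⊥-elim (nb bi)) , (λ nb → ⊥-elim (nb bi))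
    where
    e : ℕ
    e = e₁ ∸ suc e₂
    e-eq : e₁ ≡ e₂ + suc e
    e-eq = trans (sym (m+[n∸m]≡n (e-positive bi pd))) (sym (+-suc e₂ e))
    member : φ ≡ 0 ⊎ 1 ≤ φ → ∀ a K → a < p → M₀ (suc e) (numerator a K)
    member (inj₁ φ0) a K l = Tight.numerator-weak φ0 (suc e) (s≤s z≤n) e-eq (integral-numerators bi) a K l
    member (inj₂ φ≥1) a K l = numerator-slack-β φ≥1 (suc e) (s≤s z≤n) e-eq (integral-numerators bi) a K
    R-M : ∀ k → M₀ e (R k)
    R-M k = M-divide-π (difference-M (λ m → m) (member φ-cases) k)
    nat : Iα + P * suc e ≡ Iβ + φ
    nat = +-cancelˡ-≡ (P * e₂) _ _ (trans (+-*-Solver.solve 4 (λ x i P e → x +-*-Solver.:+ (i +-*-Solver.:+ P +-*-Solver.:* e) +-*-Solver.:= (x +-*-Solver.:+ P +-*-Solver.:* e) +-*-Solver.:+ i) refl (P * e₂) Iα P (suc e))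
     (trans (cong (_+ Iα) (trans (sym (*-distribˡ-+ P e₂ (suc e))) (cong (P *_) (sym e-eq)))) (trans balance (+-assoc (P * e₂) Iβ φ))))
    int : Defs.λp α β p ℤ.+ ℤ.+ (P * suc e) ≡ ℤ.+ φ
    int = trans (S.solve 3 (λ i j x → (i S.:- j) S.:+ x S.:= (i S.:+ x) S.:- j) refl (ℤ.+ Iα) (ℤ.+ Iβ) (ℤ.+ (P * suc e)))
     (trans (cong (λ z → z ℤ.- ℤ.+ Iβ) (trans (sym (ℤₚ.pos-+ Iα (P * suc e))) (trans (cong (λ z → ℤ.+ z) nat) (ℤₚ.pos-+ Iβ φ)))) (S.solve 2 (λ j f → (j S.:+ f) S.:- j S.:= f) refl (ℤ.+ Iβ) (ℤ.+ φ)))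
     where module S = ℤSolver.+-*-Solver
    floor-≤ : ℤ.-_ (ℤ.+ 1) ℤ.- floor (Defs.fromℤ (Defs.λp α β p) ℚ.* Defs.inv (Defs.fromℕ (p ∸ 1))) ℤ.≤ ℤ.+ e
    floor-≤ = floor-bound (Defs.λp α β p) P e φ (m<n⇒0<n∸m 1<p) int

  -- When p does not divide d only 𝒜* is asserted. For integral β the exponent of the constant gives
  -- the bound in both cases of φ. For other β each refinement excludes φ = 0: p - 1 not dividing λ
  -- does so directly, and 𝔪 odd with p = 2 through the factor 2; for φ ≥ 1 the coefficients lie in
  -- 𝒜.
  claim : Claim
  claim = go (p ∣? Defs.dαβ α β) (all? (λ q → ↧ₙ q ≟ 1) lβ) φ-cases
   where
   go : Dec (p ∣ Defs.dαβ α β) → Dec (Defs.BetaInt α β) → φ ≡ 0 ⊎ 1 ≤ φ → Claim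
   go (no npd) _ _ = unramified-claim npd
   go (yes pd) (yes bi) _ = β-claim bi pd
   go (yes pd) (no nb) (inj₁ φ0) = tight-claim φ0 nb
   go (yes pd) (no nb) (inj₂ φ≥1) = slack-claim φ≥1 nb

open import Defs
open import Data.Nat as ℕ using (ℕ)
open import Data.Nat.Divisibility using (_∣_)
open import Data.Nat.Coprimality using (Coprime)
open import Data.Nat.Primality using (Prime)
open import Data.Integer as ℤ using (ℤ)
import Data.Integer.Divisibility as ℤDiv
open import Data.Rational as ℚ using (ℚ; 0ℚ; _-_; _*_; _≤_; floor)
open import Data.Vec using (Vec; lookup; toList; map)
open import Data.Fin using (Fin)
open import Data.Product using (Σ; _×_)
open import Relation.Nullary using (¬_)
open import Relation.Binary.PropositionalEquality using (_≡_)

theorem2 : (r : ℕ) (α β : Vec ℚ r) →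
    (∀ (i : Fin r) → ¬ (IsInt (lookup α i) × lookup α i ≤ 0ℚ)) →
    (∀ (j : Fin r) → ¬ (IsInt (lookup β j) × lookup β j ≤ 0ℚ)) →
    (∀ (i j : Fin r) → ¬ IsInt (lookup α i - lookup β j)) →
    Hαβ α β →
    (p : ℕ) → Prime p →
    (ν D : ℕ) → dαβ α β ≡ p ℕ.^ ν ℕ.* D → Coprime D p →
    (b : ℕ) → 1 ℕ.≤ b → b ℕ.≤ D → Coprime b D →
    (C : ℚ) → IsCconst (toList (map frac α)) (toList (map frac β)) C →
    Σ (ℕ → ℕ → ℚ) (λ R →
    (∀ (k : ℕ) → InA* p ν D b (R k))
    × (∀ (t : ℕ) → InΩ p ν D b t → ∀ (t₁ : ℕ) → IsShift1 p ν D b t t₁ → ∀ (k : ℕ) →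
    subPowSer (C′ α β C) p (Gser (fracMul t₁ (toList α)) (fracMul t₁ (toList β))
    /ₛ Fser (fracMul t₁ (toList α)) (fracMul t₁ (toList β))) k
    - fromℕ p * scaleSer (C′ α β C) (Gser (fracMul t (toList α)) (fracMul t (toList β))
    /ₛ Fser (fracMul t (toList α)) (fracMul t (toList β))) k
    ≡ fromℕ p * R k t)
    × (p ∣ dαβ α β → ∀ (k : ℕ) →
    (BetaInt α β →
    InPowA p ν D b (ℤ.-_ (ℤ.+ 1) ℤ.- floor (fromℤ (λp α β p) * inv (fromℕ (p ℕ.∸ 1)))) (R k))
    × (¬ BetaInt α β → ¬ ((ℤ.+ (p ℕ.∸ 1)) ℤDiv.∣ λp α β p) → InA p ν D b (R k))
    × (¬ BetaInt α β → ¬ (2 ∣ 𝔪 α β) → p ≡ 2 → InA p ν D b (R k))))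
theorem2 r α β α-admissible β-admissible disjoint H p pp ν D dEq D-p b b≥1 b≤D b-D C isC = F.R , proj₁ F.claim , F.equation , proj₂ F.claim
  where
  module F = Assembly.Final r α β H p pp ν D dEq D-p b b≥1 (Nat.≤-trans b≥1 b≤D) b-D C isC
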